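{- Let $k\in\{1,2,\dots\}$, let $\varepsilon>0$, and let $n:\mathbb{N}\to\mathbb{N}$ be any function with $1\le n(d)\le 2^d$ for all $d$ and $n(d)\ge k+1$ for all sufficiently large $d$. For each $d\in\mathbb{N}$, choose an $n(d)$-element subset $W$ of $\{0,1\}^d$ uniformly at random, and set $P:=\operatorname{conv} W\subset\mathbb{R}^d$. Let $\tau_k = 1-(1-2^{ -k})H_{k+1}$. Then the expected $k$-face density of $P$ satisfies, as $d\to\infty$, $$ \mathbb{E}[\varphi_k(P)] = \begin{cases} 1-o(1) & \text{if } n(d)\le 2^{(\tau_k-\varepsilon)d} \text{ for all } d,\\ o(1) & \text{if } n(d)\ge 2^{(\tau_k+\varepsilon)d}\text{ for all } d.\end{cases} $$
   Context: $\log$ denotes the binary logarithm. For $0<\xi<1$, $h(\xi):=\xi\log\frac1\xi+(1-\xi)\log\frac1{1-\xi}$ is the binary entropy function. For $r\ge 2$, $$H_r := \frac{1}{2^r-2}\sum_{i=1}^{r-1}\binom{r}{i}h\!\left(\tfrac{i}{r}\right).$$ For a polytope $Q$ with exactly $n$ vertices, $n\ge k+1$, the $k$-face density of $Q$ is $\varphi_k(Q):=f_k(Q)/\binom{n}{k+1}$, where $f_k(Q)$ is the number of $k$-dimensional faces of $Q$ (the polytope $Q$ itself counts as a face of $Q$; $f_k(Q)=0$ if $k>\dim Q$). Every point of $W\subseteq\{0,1\}^d$ is a vertex of $\operatorname{conv}W$, so $P$ has exactly $n(d)$ vertices. The $o(1)$ terms refer to $d\to\infty$ with $k$, $\varepsilon$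 and the function $n$ fixed. -}

module Defs where

open import Level using (0ℓ)
open import Data.Bool.Base using (Bool; true; false; _∨_)
open import Data.Nat.Base as ℕ using (ℕ; zero; suc; 2+; NonZero; NonTrivial; z≤n; s≤s; ⌊_/2⌋)
import Data.Nat.Properties as ℕ
open import Data.Nat.Combinatorics using (_C_)
open import Data.Nat.Induction using (<-rec)
open import Data.Nat.Logarithm using (⌊log₂_⌋; ⌊log₂⌋-mono-≤; ⌊log₂⌊n/2⌋⌋≡⌊log₂n⌋∸1; ⌊log₂[2^n]⌋≡n)
open import Data.Integer.Base as ℤ using (ℤ; +_; -[1+_])
import Data.Integer.Properties as ℤ
open import Data.Rational.Base as ℚ
  using (ℚ; mkℚ; 0ℚ; 1ℚ; ½; _+_; _*_; -_; _-_; _≤_; _<_; ∣_∣; _/_; 1/_; ↥_; ↧ₙ_; Positive)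
open import Data.Rational.Properties
import Data.Rational.Unnormalised.Base as ℚᵘ
import Data.Rational.Unnormalised.Properties as ℚᵘ
open import Data.Rational.Solver using (module +-*-Solver)
open import Data.Fin.Base using (Fin; zero; suc; toℕ; finToFun; funToFin; combine)
import Data.Fin.Properties as Fin
open import Data.Fin.Subset using (Subset; inside; outside; _∈_; _∉_; _⊆_) renaming (∣_∣ to card)
open import Data.Fin.Subset.Properties using (_∈?_; _⊆?_; anySubset?)
open import Data.Vec.Base using ([]; _∷_)
import Data.Vec.Functional as F
open import Data.List.Base
  using (List; []; _∷_; _++_; map; tabulate; foldr; length; filter; cartesianProductWith)
open import Data.List.Relation.Unary.All as All using (All; []; _∷_)
import Data.List.Relation.Unary.All.Properties as All
open import Data.List.Relation.Unary.Any using (here; there)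
import Data.List.Membership.Propositional as List
import Data.List.Membership.Propositional.Properties as List
open import Data.Product.Base using (∃; _×_; _,_; proj₁; proj₂)
open import Data.Sum.Base using (_⊎_; inj₁; inj₂)
open import Function.Base using (_∘_)
open import Function.Bundles using (_⇔_; mk⇔; Equivalence)
open import Relation.Nullary using (¬_; Dec; yes; no; contradiction; _×-dec_; ¬?)
open import Relation.Nullary.Decidable using (map′; decidable-stable)
open import Relation.Unary using (Pred; Decidable)
open import Relation.Binary.Definitions using (tri<; tri≈; tri>)
open import Relation.Binary.PropositionalEquality
  using (_≡_; _≢_; refl; sym; trans; cong; cong₂; subst; subst₂)
open import Algebra.Bundles using (CommutativeRing)
open import Algebra.Properties.CommutativeSemiring.Exp
  (CommutativeRing.commutativeSemiring +-*-commutativeRing)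
  using (_^_; ^-homo-*; ^-assocʳ; ^-distrib-*)
open import Algebra.Properties.Semiring.Sum (CommutativeRing.semiring +-*-commutativeRing)
  using (sum; sum-cong-≗; ∑-distrib-+; ∑-comm; *-distribˡ-sum; *-distribʳ-sum)
open +-*-Solver

fromℕℚ : ℕ → ℚ
fromℕℚ n = + n / 1

⊔ˡ : ∀ M N {i} → M ℕ.⊔ N ℕ.≤ i → M ℕ.≤ i
⊔ˡ M N = ℕ.m⊔n≤o⇒m≤o M N

⊔ʳ : ∀ M N {i} → M ℕ.⊔ N ℕ.≤ i → N ℕ.≤ i
⊔ʳ M N = ℕ.m⊔n≤o⇒n≤o M N

0≤½ : 0ℚ ≤ ½
0≤½ = nonNegative⁻¹ ½

≤-by : ∀ {p q r} → 0ℚ ≤ r → p + r ≡ q → p ≤ q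
≤-by {p} {q} {r} 0≤r eq = subst₂ _≤_ (+-identityʳ p) eq (+-monoʳ-≤ p 0≤r)

<-by : ∀ {p q r} → 0ℚ < r → p + r ≡ q → p < q
<-by {p} {q} {r} 0<r eq = subst₂ _<_ (+-identityʳ p) eq (+-monoʳ-< p 0<r)

≤⇒0≤- : ∀ {p q} → p ≤ q → 0ℚ ≤ q - p
≤⇒0≤- {p} {q} p≤q = subst (_≤ q - p) (+-inverseʳ p) (+-monoˡ-≤ (- p) p≤q)

<⇒0<- : ∀ {p q} → p < q → 0ℚ < q - p
<⇒0<- {p} {q} p<q = subst (_< q - p) (+-inverseʳ p) (+-monoˡ-< (- p) p<q)

*-nonNeg : ∀ {p q} → 0ℚ ≤ p → 0ℚ ≤ q → 0ℚ ≤ p * q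
*-nonNeg {p} {q} 0≤p 0≤q =
  subst (_≤ p * q) (*-zeroʳ p) (*-monoˡ-≤-nonNeg p {{ℚ.nonNegative 0≤p}} 0≤q)

*-pos : ∀ {p q} → 0ℚ < p → 0ℚ < q → 0ℚ < p * q
*-pos {p} {q} 0<p 0<q =
  subst (_< p * q) (*-zeroʳ p) (*-monoʳ-<-pos p {{ℚ.positive 0<p}} 0<q)

*-mono-≤ : ∀ {p q r s} → 0ℚ ≤ p → 0ℚ ≤ s → p ≤ q → r ≤ s → p * r ≤ q * s
*-mono-≤ {p} {q} {r} {s} 0≤p 0≤s p≤q r≤s = ≤-trans
  (*-monoˡ-≤-nonNeg p {{ℚ.nonNegative 0≤p}} r≤s)
  (*-monoʳ-≤-nonNeg s {{ℚ.nonNegative 0≤s}} p≤q)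

+-pos : ∀ {p q} → 0ℚ < p → 0ℚ < q → 0ℚ < p + q
+-pos {p} {q} 0<p 0<q = +-mono-< 0<p 0<q

0<½* : ∀ {ε} → 0ℚ < ε → 0ℚ < ½ * ε
0<½* = *-pos (positive⁻¹ ½)

half+half : ∀ ε → ½ * ε + ½ * ε ≡ ε
half+half = solve 1 (λ e → con ½ :* e :+ con ½ :* e := e) refl

p≤∣p∣ : ∀ p → p ≤ ∣ p ∣
p≤∣p∣ p with ≤-total 0ℚ p
... | inj₁ 0≤p = ≤-reflexive (sym (0≤p⇒∣p∣≡p 0≤p))
... | inj₂ p≤0 = ≤-trans p≤0 (0≤∣p∣ p)

∣-∣≤ : ∀ {p c} → p ≤ c → - p ≤ c → ∣ p ∣ ≤ c
∣-∣≤ {p} {c} p≤c -p≤c with ∣p∣≡p∨∣p∣≡-p p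
... | inj₁ eq = subst (_≤ c) (sym eq) p≤c
... | inj₂ eq = subst (_≤ c) (sym eq) -p≤c

-- The one-sided bound suffices: exchanging m and n gives |xₘ − xₙ| ≤ ε.
IsCauchy : (ℕ → ℚ) → Set
IsCauchy x = ∀ ε → 0ℚ < ε → ∃ λ N → ∀ m n → N ℕ.≤ m → N ℕ.≤ n → x m ≤ x n + ε

-- no-eta-equality keeps the type checker from unfolding Cauchy proofs when it compares reals.
record ℝ : Set where
  no-eta-equality
  constructor mkℝ
  field
    seq    : ℕ → ℚ
    cauchy : IsCauchy seq
open ℝ public

infix 4 _≤ℝ_ _<ℝ_ _≈ℝ_

record _≤ℝ_ (x y : ℝ) : Set where
  constructor mk≤ℝ
  field eventually : ∀ ε → 0ℚ < ε → ∃ λ N → ∀ n → N ℕ.≤ n → seq x n ≤ seq y n + ε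

_<ℝ_ : ℝ → ℝ → Set
x <ℝ y = ∃ λ ε → 0ℚ < ε × ∃ λ N → ∀ n → N ℕ.≤ n → seq x n + ε ≤ seq y n

_≈ℝ_ : ℝ → ℝ → Set
x ≈ℝ y = x ≤ℝ y × y ≤ℝ x

fromℚ : ℚ → ℝ
seq    (fromℚ q) _ = q
cauchy (fromℚ q) ε 0<ε = 0 , λ _ _ _ _ → ≤-by (<⇒≤ 0<ε) refl

fromℕ : ℕ → ℝ
fromℕ n = fromℚ (fromℕℚ n)

0ℝ 1ℝ : ℝ
0ℝ = fromℚ 0ℚ
1ℝ = fromℚ 1ℚ

infixl 6 _+ℝ_ _-ℝ_
infixl 7 _*ℝ_
infix 8 -ℝ_

_+ℝ_ : ℝ → ℝ → ℝ
seq    (x +ℝ y) n = seq x n + seq y n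
cauchy (x +ℝ y) ε 0<ε =
  let N₁ , p = cauchy x (½ * ε) (0<½* 0<ε)
      N₂ , q = cauchy y (½ * ε) (0<½* 0<ε)
  in N₁ ℕ.⊔ N₂ , λ m n N≤m N≤n → ≤-trans
       (+-mono-≤ (p m n (⊔ˡ N₁ N₂ N≤m) (⊔ˡ N₁ N₂ N≤n))
                 (q m n (⊔ʳ N₁ N₂ N≤m) (⊔ʳ N₁ N₂ N≤n)))
       (≤-reflexive (solve 3 (λ a b e →
         (a :+ con ½ :* e) :+ (b :+ con ½ :* e) := (a :+ b) :+ e) refl (seq x n) (seq y n) ε))

-ℝ_ : ℝ → ℝ
seq    (-ℝ x) n = - seq x n
cauchy (-ℝ x) ε 0<ε =
  let N , p = cauchy x ε 0<ε
  in N , λ m n N≤m N≤n → ≤-by (≤⇒0≤- (p n m N≤n N≤m))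
       (solve 3 (λ a b e → :- a :+ ((a :+ e) :- b) := :- b :+ e) refl (seq x m) (seq x n) ε)

_-ℝ_ : ℝ → ℝ → ℝ
x -ℝ y = x +ℝ -ℝ y

bounded : ∀ {x} → IsCauchy x → ∃ λ K → 0ℚ < K × ∃ λ N → ∀ n → N ℕ.≤ n → ∣ x n ∣ ≤ K
bounded {x} c = ∣ x N ∣ + 1ℚ , 0<K , N , λ n N≤n → ∣-∣≤
    (≤-trans (p n N N≤n ℕ.≤-refl) (+-monoˡ-≤ 1ℚ (p≤∣p∣ (x N))))
    (≤-trans (≤-by (≤⇒0≤- (p N n ℕ.≤-refl N≤n))
               (solve 2 (λ a b → :- a :+ ((a :+ con 1ℚ) :- b) := :- b :+ con 1ℚ) refl (x n) (x N)))
             (+-monoˡ-≤ 1ℚ (subst (- x N ≤_) (∣-p∣≡∣p∣ (x N)) (p≤∣p∣ (- x N)))))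
  where
  N = proj₁ (c 1ℚ (positive⁻¹ 1ℚ))
  p = proj₂ (c 1ℚ (positive⁻¹ 1ℚ))
  0<K : 0ℚ < ∣ x N ∣ + 1ℚ
  0<K = +-mono-≤-< (0≤∣p∣ (x N)) (positive⁻¹ 1ℚ)

inv : ∀ {p} → 0ℚ < p → ∃ λ q → 0ℚ < q × p * q ≡ 1ℚ
inv {p} 0<p = 1/ p , positive⁻¹ _ {{1/pos⇒pos p}} , *-inverseʳ p
  where
  instance
    _ = ℚ.positive 0<p
    _ = pos⇒nonZero p

prod-bound : ∀ {a d K δ} → ∣ a ∣ ≤ K → d ≤ δ → - d ≤ δ → a * d ≤ K * δ
prod-bound {a} {d} {K} {δ} a≤K d≤ -d≤ = ≤-trans (p≤∣p∣ (a * d))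
  (subst (_≤ K * δ) (sym (∣p*q∣≡∣p∣*∣q∣ a d))
    (*-mono-≤ (0≤∣p∣ a) (≤-trans (0≤∣p∣ d) ∣d∣≤) a≤K ∣d∣≤))
  where ∣d∣≤ = ∣-∣≤ d≤ -d≤

*-cauchy : ∀ {x y} → IsCauchy x → IsCauchy y → IsCauchy (λ n → x n * y n)
*-cauchy {x} {y} xc yc ε 0<ε = (N₁ ℕ.⊔ N₂) ℕ.⊔ (N₃ ℕ.⊔ N₄) , close
  where
  bx = bounded xc
  by = bounded yc
  K = proj₁ bx
  L = proj₁ by
  K⁻ = inv (proj₁ (proj₂ bx))
  L⁻ = inv (proj₁ (proj₂ by))
  δx = proj₁ L⁻ * (½ * ε)
  δy = proj₁ K⁻ * (½ * ε)
  cx = xc δx (*-pos (proj₁ (proj₂ L⁻)) (0<½* 0<ε))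
  cy = yc δy (*-pos (proj₁ (proj₂ K⁻)) (0<½* 0<ε))
  N₁ = proj₁ (proj₂ (proj₂ bx))
  N₂ = proj₁ (proj₂ (proj₂ by))
  N₃ = proj₁ cx
  N₄ = proj₁ cy
  diff : ∀ {a b δ} → a ≤ b + δ → a - b ≤ δ
  diff {a} {b} {δ} h = ≤-by (≤⇒0≤- h)
    (solve 3 (λ a b e → (a :- b) :+ ((b :+ e) :- a) := e) refl a b δ)
  diff′ : ∀ {a b δ} → b ≤ a + δ → - (a - b) ≤ δ
  diff′ {a} {b} {δ} h = ≤-by (≤⇒0≤- h)
    (solve 3 (λ a b e → (:- (a :- b)) :+ ((a :+ e) :- b) := e) refl a b δ)
  simp : ∀ k k⁻ → k * k⁻ ≡ 1ℚ → k * (k⁻ * (½ * ε)) ≡ ½ * ε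
  simp k k⁻ eq = trans (sym (*-assoc k k⁻ (½ * ε)))
    (trans (cong (_* (½ * ε)) eq) (*-identityˡ (½ * ε)))
  close : ∀ m n → (N₁ ℕ.⊔ N₂) ℕ.⊔ (N₃ ℕ.⊔ N₄) ℕ.≤ m → (N₁ ℕ.⊔ N₂) ℕ.⊔ (N₃ ℕ.⊔ N₄) ℕ.≤ n →
          x m * y m ≤ x n * y n + ε
  close m n N≤m N≤n = subst₂ _≤_
    (solve 4 (λ a b c d → c :* d :+ (a :* (b :- d) :+ d :* (a :- c)) := a :* b) refl a b c d)
    (cong (λ t → c * d + t) (half+half ε))
    (+-monoʳ-≤ (c * d)
      (+-mono-≤ (subst (a * (b - d) ≤_) (simp K (proj₁ K⁻) (proj₂ (proj₂ K⁻))) p₁)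
                (subst (d * (a - c) ≤_) (simp L (proj₁ L⁻) (proj₂ (proj₂ L⁻))) p₂)))
    where
    a = x m
    b = y m
    c = x n
    d = y n
    A : ∀ {i} → (N₁ ℕ.⊔ N₂) ℕ.⊔ (N₃ ℕ.⊔ N₄) ℕ.≤ i → N₁ ℕ.⊔ N₂ ℕ.≤ i
    A = ⊔ˡ (N₁ ℕ.⊔ N₂) (N₃ ℕ.⊔ N₄)
    B : ∀ {i} → (N₁ ℕ.⊔ N₂) ℕ.⊔ (N₃ ℕ.⊔ N₄) ℕ.≤ i → N₃ ℕ.⊔ N₄ ℕ.≤ i
    B = ⊔ʳ (N₁ ℕ.⊔ N₂) (N₃ ℕ.⊔ N₄)
    p₁ : a * (b - d) ≤ K * δy
    p₁ = prod-bound (proj₂ (proj₂ (proj₂ bx)) m (⊔ˡ N₁ N₂ (A N≤m)))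
      (diff {b} (proj₂ cy m n (⊔ʳ N₃ N₄ (B N≤m)) (⊔ʳ N₃ N₄ (B N≤n))))
      (diff′ {b} (proj₂ cy n m (⊔ʳ N₃ N₄ (B N≤n)) (⊔ʳ N₃ N₄ (B N≤m))))
    p₂ : d * (a - c) ≤ L * δx
    p₂ = prod-bound (proj₂ (proj₂ (proj₂ by)) n (⊔ʳ N₁ N₂ (A N≤n)))
      (diff {a} (proj₂ cx m n (⊔ˡ N₃ N₄ (B N≤m)) (⊔ˡ N₃ N₄ (B N≤n))))
      (diff′ {a} (proj₂ cx n m (⊔ˡ N₃ N₄ (B N≤n)) (⊔ˡ N₃ N₄ (B N≤m))))

_*ℝ_ : ℝ → ℝ → ℝ
seq    (x *ℝ y) n = seq x n * seq y n
cauchy (x *ℝ y) = *-cauchy (cauchy x) (cauchy y)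

fromℕℚ-+ : ∀ m n → fromℕℚ (m ℕ.+ n) ≡ fromℕℚ m + fromℕℚ n
fromℕℚ-+ m n = toℚᵘ-injective (ℚᵘ.≃-trans (toℚᵘ-fromℚᵘ (ℚᵘ.mkℚᵘ (+ (m ℕ.+ n)) 0))
  (ℚᵘ.≃-trans (ℚᵘ.≃-sym base)
  (ℚᵘ.≃-sym (ℚᵘ.≃-trans (toℚᵘ-homo-+ (fromℕℚ m) (fromℕℚ n))
    (ℚᵘ.+-cong (toℚᵘ-fromℚᵘ (ℚᵘ.mkℚᵘ (+ m) 0)) (toℚᵘ-fromℚᵘ (ℚᵘ.mkℚᵘ (+ n) 0)))))))
  where
  base : ℚᵘ.mkℚᵘ (+ m) 0 ℚᵘ.+ ℚᵘ.mkℚᵘ (+ n) 0 ℚᵘ.≃ ℚᵘ.mkℚᵘ (+ (m ℕ.+ n)) 0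
  base = ℚᵘ.*≡* (cong (ℤ._* + 1) (trans (cong₂ ℤ._+_ (ℤ.*-identityʳ (+ m)) (ℤ.*-identityʳ (+ n))) (sym (ℤ.pos-+ m n))))

fromℕℚ-* : ∀ m n → fromℕℚ (m ℕ.* n) ≡ fromℕℚ m * fromℕℚ n
fromℕℚ-* m n = toℚᵘ-injective (ℚᵘ.≃-trans (toℚᵘ-fromℚᵘ (ℚᵘ.mkℚᵘ (+ (m ℕ.* n)) 0))
  (ℚᵘ.≃-trans (ℚᵘ.*≡* (cong (ℤ._* + 1) (ℤ.pos-* m n)))
  (ℚᵘ.≃-sym (ℚᵘ.≃-trans (toℚᵘ-homo-* (fromℕℚ m) (fromℕℚ n))
    (ℚᵘ.*-cong (toℚᵘ-fromℚᵘ (ℚᵘ.mkℚᵘ (+ m) 0)) (toℚᵘ-fromℚᵘ (ℚᵘ.mkℚᵘ (+ n) 0)))))))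

fromℕℚ-mono-≤ : ∀ {m n} → m ℕ.≤ n → fromℕℚ m ≤ fromℕℚ n
fromℕℚ-mono-≤ {m} {n} m≤n = toℚᵘ-cancel-≤
  (ℚᵘ.≤-respʳ-≃ (ℚᵘ.≃-sym (toℚᵘ-fromℚᵘ (ℚᵘ.mkℚᵘ (+ n) 0)))
  (ℚᵘ.≤-respˡ-≃ (ℚᵘ.≃-sym (toℚᵘ-fromℚᵘ (ℚᵘ.mkℚᵘ (+ m) 0)))
  (ℚᵘ.*≤* (ℤ.*-monoʳ-≤-nonNeg (+ 1) (ℤ.+≤+ m≤n)))))

fromℕℚ-nonNeg : ∀ n → 0ℚ ≤ fromℕℚ n
fromℕℚ-nonNeg n = fromℕℚ-mono-≤ {0} {n} z≤n

1≤fromℕℚ : ∀ n .{{_ : NonZero n}} → 1ℚ ≤ fromℕℚ n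
1≤fromℕℚ (suc n) = fromℕℚ-mono-≤ {1} {suc n} (s≤s z≤n)

0<fromℕℚ : ∀ n .{{_ : NonZero n}} → 0ℚ < fromℕℚ n
0<fromℕℚ n = <-≤-trans (positive⁻¹ 1ℚ) (1≤fromℕℚ n)

fromℕℚ-cancel-≤ : ∀ {m n} → fromℕℚ m ≤ fromℕℚ n → m ℕ.≤ n
fromℕℚ-cancel-≤ {m} {n} h with m ℕ.≤? n
... | yes p = p
... | no ¬p = contradiction
  (<-≤-trans (<-by (positive⁻¹ 1ℚ) (trans (+-comm (fromℕℚ n) 1ℚ) (sym (fromℕℚ-+ 1 n)))) (fromℕℚ-mono-≤ (ℕ.≰⇒> ¬p)))
  (λ lt → <-irrefl refl (<-≤-trans lt h))

/-* : ∀ i n .{{_ : NonZero n}} → (i / n) * fromℕℚ n ≡ i / 1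
/-* i n@(suc n-1) = toℚᵘ-injective (ℚᵘ.≃-trans (toℚᵘ-homo-* (i / n) (fromℕℚ n))
  (ℚᵘ.≃-trans (ℚᵘ.*-cong (toℚᵘ-fromℚᵘ (ℚᵘ.mkℚᵘ i n-1)) (toℚᵘ-fromℚᵘ (ℚᵘ.mkℚᵘ (+ n) 0)))
  (ℚᵘ.≃-trans (ℚᵘ.*≡* (trans (ℤ.*-identityʳ (i ℤ.* + n)) (cong (λ t → i ℤ.* + t) (sym (ℕ.*-identityʳ n)))))
   (ℚᵘ.≃-sym (toℚᵘ-fromℚᵘ (ℚᵘ.mkℚᵘ i 0))))))

*-cancel-≤ : ∀ {p q r} → 0ℚ < r → p * r ≤ q * r → p ≤ q
*-cancel-≤ {r = r} 0<r = *-cancelʳ-≤-pos r {{ℚ.positive 0<r}}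

1/suc : ℕ → ℚ
1/suc n = + 1 / suc n

1/suc-* : ∀ n → 1/suc n * fromℕℚ (suc n) ≡ 1ℚ
1/suc-* n = /-* (+ 1) (suc n)

0<1/suc : ∀ n → 0ℚ < 1/suc n
0<1/suc n = positive⁻¹ _ {{normalize-pos 1 (suc n)}}

archimedean : ∀ ε → 0ℚ < ε → ∃ λ N → ∀ n → N ℕ.≤ n → 1/suc n ≤ ε
archimedean ε@(mkℚ (+ zero) _ _) 0<ε = contradiction 0<ε (λ lt → <-irrefl (sym (↥p≡0⇒p≡0 ε refl)) lt)
archimedean ε@(mkℚ -[1+ _ ] _ _) 0<ε = contradiction 0<ε λ { (ℚ.*<* ()) }
archimedean ε@(mkℚ (+ suc a) b c) 0<ε = ↧ₙ ε , λ n N≤n →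
  *-cancel-≤ (0<fromℕℚ (suc n)) (subst (_≤ ε * fromℕℚ (suc n)) (sym (1/suc-* n))
    (≤-trans (1≤ n) (*-monoˡ-≤-nonNeg ε {{ℚ.nonNegative (<⇒≤ 0<ε)}} (fromℕℚ-mono-≤ (ℕ.m≤n⇒m≤1+n N≤n)))))
  where
  eq : ε * fromℕℚ (↧ₙ ε) ≡ fromℕℚ (suc a)
  eq = trans (cong (_* fromℕℚ (↧ₙ ε)) (sym (↥p/↧p≡p ε))) (/-* (+ suc a) (suc b))
  1≤ : ∀ n → 1ℚ ≤ ε * fromℕℚ (↧ₙ ε)
  1≤ n = subst (1ℚ ≤_) (sym eq) (1≤fromℕℚ (suc a))

2^⌊log₂⌋≤ : ∀ n .{{_ : NonZero n}} → 2 ℕ.^ ⌊log₂ n ⌋ ℕ.≤ n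
2^⌊log₂⌋≤ = <-rec (λ n → .{{_ : NonZero n}} → 2 ℕ.^ ⌊log₂ n ⌋ ℕ.≤ n) go
  where
  go : ∀ n → (∀ {m} → m ℕ.< n → .{{_ : NonZero m}} → 2 ℕ.^ ⌊log₂ m ⌋ ℕ.≤ m) →
       .{{_ : NonZero n}} → 2 ℕ.^ ⌊log₂ n ⌋ ℕ.≤ n
  go 1 rec = ℕ.≤-refl
  go n@(suc (suc m)) rec = ℕ.≤-trans (ℕ.≤-reflexive (cong (2 ℕ.^_) (sym 1+)))
    (ℕ.≤-trans (ℕ.*-monoʳ-≤ 2 (rec (ℕ.⌊n/2⌋<n (suc m)))) 2*half≤)
    where
    1+ : suc ⌊log₂ ⌊ n /2⌋ ⌋ ≡ ⌊log₂ n ⌋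
    1+ = trans (cong suc (⌊log₂⌊n/2⌋⌋≡⌊log₂n⌋∸1 n)) (ℕ.m+[n∸m]≡n (⌊log₂⌋-mono-≤ {2} {n} (s≤s (s≤s z≤n))))
    2*half≤ : 2 ℕ.* ⌊ n /2⌋ ℕ.≤ n
    2*half≤ = ℕ.≤-trans (ℕ.+-monoʳ-≤ ⌊ n /2⌋ (ℕ.≤-trans (ℕ.≤-reflexive (ℕ.+-identityʳ ⌊ n /2⌋)) (ℕ.⌊n/2⌋≤⌈n/2⌉ n)))
               (ℕ.≤-reflexive (ℕ.⌊n/2⌋+⌈n/2⌉≡n n))

<2^1+⌊log₂⌋ : ∀ n → n ℕ.< 2 ℕ.^ suc ⌊log₂ n ⌋
<2^1+⌊log₂⌋ n = ℕ.≰⇒> λ h → ℕ.<-irrefl refl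
  (subst (ℕ._≤ ⌊log₂ n ⌋) (⌊log₂[2^n]⌋≡n (suc ⌊log₂ n ⌋)) (⌊log₂⌋-mono-≤ h))

2^-cancel-< : ∀ {m n} → 2 ℕ.^ m ℕ.< 2 ℕ.^ n → m ℕ.< n
2^-cancel-< {m} {n} h = ℕ.≰⇒> λ n≤m → ℕ.<⇒≱ h (ℕ.^-monoʳ-≤ 2 n≤m)

-- log a is the limit of ⌊log₂ aᵏ⌋ / k, since 2^⌊log₂ aᵏ⌋ ≤ aᵏ < 2^(⌊log₂ aᵏ⌋ + 1).
logℕ : (a : ℕ) → .{{NonZero a}} → ℝ
seq    (logℕ a) n = + ⌊log₂ a ℕ.^ suc n ⌋ / suc n
cauchy (logℕ a) ε 0<ε = proj₁ (archimedean ε 0<ε) , λ m n N≤m N≤n → ≤-trans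
    (close m n) (+-monoʳ-≤ (seq (logℕ a) n) (proj₂ (archimedean ε 0<ε) n N≤n))
  where
  L : ℕ → ℕ
  L n = ⌊log₂ a ℕ.^ suc n ⌋
  cross : ∀ m n → L m ℕ.* suc n ℕ.≤ suc (L n) ℕ.* suc m
  cross m n = ℕ.<⇒≤ (2^-cancel-< (begin-strict
    2 ℕ.^ (L m ℕ.* suc n)             ≡⟨ ℕ.^-*-assoc 2 (L m) (suc n) ⟨
    (2 ℕ.^ L m) ℕ.^ suc n             ≤⟨ ℕ.^-monoˡ-≤ (suc n) (2^⌊log₂⌋≤ (a ℕ.^ suc m) {{ℕ.m^n≢0 a (suc m)}}) ⟩
    (a ℕ.^ suc m) ℕ.^ suc n           ≡⟨ ℕ.^-*-assoc a (suc m) (suc n) ⟩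
    a ℕ.^ (suc m ℕ.* suc n)           ≡⟨ cong (a ℕ.^_) (ℕ.*-comm (suc m) (suc n)) ⟩
    a ℕ.^ (suc n ℕ.* suc m)           ≡⟨ ℕ.^-*-assoc a (suc n) (suc m) ⟨
    (a ℕ.^ suc n) ℕ.^ suc m           <⟨ ℕ.^-monoˡ-< (suc m) (<2^1+⌊log₂⌋ (a ℕ.^ suc n)) ⟩
    (2 ℕ.^ suc (L n)) ℕ.^ suc m       ≡⟨ ℕ.^-*-assoc 2 (suc (L n)) (suc m) ⟩
    2 ℕ.^ (suc (L n) ℕ.* suc m)       ∎))
    where open ℕ.≤-Reasoning
  close : ∀ m n → + L m / suc m ≤ + L n / suc n + 1/suc n
  close m n = *-cancel-≤ (0<fromℕℚ (suc m)) (*-cancel-≤ (0<fromℕℚ (suc n)) (subst₂ _≤_ lhs rhs (fromℕℚ-mono-≤ (cross m n))))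
    where
    M = fromℕℚ (suc m)
    N = fromℕℚ (suc n)
    lhs : fromℕℚ (L m ℕ.* suc n) ≡ (+ L m / suc m) * M * N
    lhs = trans (fromℕℚ-* (L m) (suc n)) (cong (_* N) (sym (/-* (+ L m) (suc m))))
    rhs : fromℕℚ (suc (L n) ℕ.* suc m) ≡ (+ L n / suc n + 1/suc n) * M * N
    rhs = trans (fromℕℚ-* (suc (L n)) (suc m)) (trans (cong (_* M) (trans (fromℕℚ-+ 1 (L n))
      (cong₂ _+_ (sym (1/suc-* n)) (sym (/-* (+ L n) (suc n))))))
      (solve 4 (λ i l M N → (i :* N :+ l :* N) :* M := (l :+ i) :* M :* N) refl (1/suc n) (+ L n / suc n) M N))

-- log (a/b) = log a − log b.
log : (x : ℚ) → .{{Positive x}} → ℝ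
log x@(mkℚ (+ suc a) b _) = logℕ (suc a) -ℝ logℕ (suc b)

^-nonNeg : ∀ {x} n → 0ℚ ≤ x → 0ℚ ≤ x ^ n
^-nonNeg zero    0≤x = <⇒≤ (positive⁻¹ 1ℚ)
^-nonNeg (suc n) 0≤x = *-nonNeg 0≤x (^-nonNeg n 0≤x)

^-pos : ∀ {x} n → 0ℚ < x → 0ℚ < x ^ n
^-pos zero    0<x = positive⁻¹ 1ℚ
^-pos (suc n) 0<x = *-pos 0<x (^-pos n 0<x)

^-mono-≤ : ∀ {x y} n → 0ℚ ≤ x → x ≤ y → x ^ n ≤ y ^ n
^-mono-≤ zero    0≤x x≤y = ≤-refl
^-mono-≤ (suc n) 0≤x x≤y = *-mono-≤ 0≤x (^-nonNeg n (≤-trans 0≤x x≤y)) x≤y (^-mono-≤ n 0≤x x≤y)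

^-cancel-≤ : ∀ {x y} n → 0ℚ ≤ y → x ^ n < y ^ n → x ≤ y
^-cancel-≤ {x} {y} n 0≤y h with ≤-total x y
... | inj₁ x≤y = x≤y
... | inj₂ y≤x = contradiction (<-≤-trans h (^-mono-≤ n 0≤y y≤x)) (<-irrefl refl)

1≤^ : ∀ {x} n → 1ℚ ≤ x → 1ℚ ≤ x ^ n
1≤^ zero    1≤x = ≤-refl
1≤^ {x} (suc n) 1≤x = *-mono-≤ (<⇒≤ (positive⁻¹ 1ℚ)) (^-nonNeg n (≤-trans (<⇒≤ (positive⁻¹ 1ℚ)) 1≤x)) 1≤x (1≤^ n 1≤x)

bernoulli : ∀ {x} n → 0ℚ ≤ x → 1ℚ + fromℕℚ n * x ≤ (1ℚ + x) ^ n
bernoulli {x} zero    0≤x = ≤-reflexive (solve 1 (λ x → con 1ℚ :+ con 0ℚ :* x := con 1ℚ) refl x)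
bernoulli {x} (suc n) 0≤x = ≤-trans
  (≤-by (*-nonNeg (fromℕℚ-nonNeg n) (*-nonNeg 0≤x 0≤x))
    (trans (cong (λ t → 1ℚ + t * x + fromℕℚ n * (x * x)) (fromℕℚ-+ 1 n))
      (solve 2 (λ n x → con 1ℚ :+ (con 1ℚ :+ n) :* x :+ n :* (x :* x) := (con 1ℚ :+ x) :* (con 1ℚ :+ n :* x)) refl (fromℕℚ n) x)))
  (*-monoˡ-≤-nonNeg (1ℚ + x) {{ℚ.nonNegative 0≤1+x}} (bernoulli n 0≤x))
  where
  0≤1+x : 0ℚ ≤ 1ℚ + x
  0≤1+x = +-mono-≤ (<⇒≤ (positive⁻¹ 1ℚ)) 0≤x

2ℚ : ℚ
2ℚ = + 2 / 1

0<2 : 0ℚ < 2ℚ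
0<2 = positive⁻¹ 2ℚ

2^-mono : ∀ {m n} → m ℕ.≤ n → 2ℚ ^ m ≤ 2ℚ ^ n
2^-mono {n = n} z≤n = 1≤^ n (fromℕℚ-mono-≤ {1} {2} (s≤s z≤n))
2^-mono (s≤s h) = *-monoˡ-≤-nonNeg 2ℚ (2^-mono h)

-- The greatest j < b with P j, if there is one, and 0 otherwise.
greatest : ∀ {p} {P : Pred ℕ p} → Decidable P → ℕ → ℕ
greatest P? zero = zero
greatest P? (suc b) with P? b
... | yes _ = b
... | no  _ = greatest P? b

greatest-satisfies : ∀ {p} {P : Pred ℕ p} (P? : Decidable P) → P 0 → ∀ b → P (greatest P? b)
greatest-satisfies P? P0 zero = P0
greatest-satisfies P? P0 (suc b) with P? b
... | yes Pb = Pb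
... | no  _  = greatest-satisfies P? P0 b

greatest-maximal : ∀ {p} {P : Pred ℕ p} (P? : Decidable P) → P 0 → ∀ b → ¬ P b → ¬ P (suc (greatest P? b))
greatest-maximal P? P0 zero ¬Pb = contradiction P0 ¬Pb
greatest-maximal P? P0 (suc b) ¬Pb with P? b
... | yes _   = ¬Pb
... | no  ¬Pb′ = greatest-maximal P? P0 b ¬Pb′

_⁺ _⁻ : ℤ → ℕ
(+ n) ⁺ = n
-[1+ _ ] ⁺ = 0
(+ _) ⁻ = 0
-[1+ n ] ⁻ = suc n

⁺-⁻ : ∀ i → i / 1 ≡ fromℕℚ (i ⁺) - fromℕℚ (i ⁻)
⁺-⁻ (+ n)    = sym (+-identityʳ (fromℕℚ n))
⁺-⁻ -[1+ n ] = sym (+-identityˡ (- fromℕℚ (suc n)))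

-- For e ≥ 0 this says e ≤ 2^q: writing q = (a − b)/c, it reads eᶜ · 2ᵇ ≤ 2ᵃ.
_≤2^_ : ℚ → ℚ → Set
e ≤2^ q = e ^ ↧ₙ q * 2ℚ ^ ((↥ q) ⁻) ≤ 2ℚ ^ ((↥ q) ⁺)

_≤2^?_ : ∀ e q → Relation.Nullary.Dec (e ≤2^ q)
e ≤2^? q = e ^ ↧ₙ q * 2ℚ ^ ((↥ q) ⁻) ≤? 2ℚ ^ ((↥ q) ⁺)

grid : ℕ → ℕ → ℚ
grid n j = fromℕℚ j * 1/suc n

exponents : ∀ q r t → q ≤ r + 1/suc t →
  (↥ q) ⁺ ℕ.* (↧ₙ r ℕ.* suc t) ℕ.+ (↥ r) ⁻ ℕ.* (↧ₙ q ℕ.* suc t) ℕ.≤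
  ((↥ r) ⁺ ℕ.* (↧ₙ q ℕ.* suc t) ℕ.+ ↧ₙ q ℕ.* ↧ₙ r) ℕ.+ (↥ q) ⁻ ℕ.* (↧ₙ r ℕ.* suc t)
exponents q r t h = fromℕℚ-cancel-≤ (subst₂ _≤_ (sym lhs) (sym rhs)
   (≤-by (*-nonNeg (*-nonNeg (*-nonNeg (≤⇒0≤- h) 0≤Q) 0≤R) 0≤T) eq))
  where
  a = fromℕℚ ((↥ q) ⁺)
  b = fromℕℚ ((↥ q) ⁻)
  c = fromℕℚ ((↥ r) ⁺)
  d = fromℕℚ ((↥ r) ⁻)
  Q = fromℕℚ (↧ₙ q)
  R = fromℕℚ (↧ₙ r)
  T = fromℕℚ (suc t)
  i = 1/suc t
  0≤Q = fromℕℚ-nonNeg (↧ₙ q)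
  0≤R = fromℕℚ-nonNeg (↧ₙ r)
  0≤T = fromℕℚ-nonNeg (suc t)
  num : ∀ q → q * fromℕℚ (↧ₙ q) ≡ fromℕℚ ((↥ q) ⁺) - fromℕℚ ((↥ q) ⁻)
  num q = trans (cong (_* fromℕℚ (↧ₙ q)) (sym (↥p/↧p≡p q))) (trans (/-* (↥ q) (↧ₙ q)) (⁺-⁻ (↥ q)))
  triple : ∀ x y z → fromℕℚ (x ℕ.* (y ℕ.* z)) ≡ fromℕℚ x * (fromℕℚ y * fromℕℚ z)
  triple x y z = trans (fromℕℚ-* x (y ℕ.* z)) (cong (fromℕℚ x *_) (fromℕℚ-* y z))
  lhs = trans (fromℕℚ-+ ((↥ q) ⁺ ℕ.* (↧ₙ r ℕ.* suc t)) ((↥ r) ⁻ ℕ.* (↧ₙ q ℕ.* suc t)))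
          (cong₂ _+_ (triple ((↥ q) ⁺) (↧ₙ r) (suc t)) (triple ((↥ r) ⁻) (↧ₙ q) (suc t)))
  rhs = trans (fromℕℚ-+ ((↥ r) ⁺ ℕ.* (↧ₙ q ℕ.* suc t) ℕ.+ ↧ₙ q ℕ.* ↧ₙ r) ((↥ q) ⁻ ℕ.* (↧ₙ r ℕ.* suc t)))
          (cong₂ _+_ (trans (fromℕℚ-+ ((↥ r) ⁺ ℕ.* (↧ₙ q ℕ.* suc t)) (↧ₙ q ℕ.* ↧ₙ r))
                       (cong₂ _+_ (triple ((↥ r) ⁺) (↧ₙ q) (suc t)) (fromℕℚ-* (↧ₙ q) (↧ₙ r))))
                     (triple ((↥ q) ⁻) (↧ₙ r) (suc t)))
  expand : (r + i - q) * Q * R * T ≡ (r * R) * (Q * T) + Q * R * (i * T) - (q * Q) * (R * T)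
  expand = solve 6 (λ q r i Q R T → (r :+ i :- q) :* Q :* R :* T :=
             (r :* R) :* (Q :* T) :+ Q :* R :* (i :* T) :- (q :* Q) :* (R :* T)) refl q r i Q R T
  eq : a * (R * T) + d * (Q * T) + (r + i - q) * Q * R * T ≡ c * (Q * T) + Q * R + b * (R * T)
  eq = trans (cong (λ z → a * (R * T) + d * (Q * T) + z) (trans expand
         (cong₂ (λ u v → u + v) (cong₂ (λ u v → u * (Q * T) + Q * R * v) (num r) (1/suc-* t)) (cong (λ u → - (u * (R * T))) (num q)))))
       (solve 7 (λ a b c d Q R T → a :* (R :* T) :+ d :* (Q :* T) :+
          ((c :- d) :* (Q :* T) :+ Q :* R :* con 1ℚ :- (a :- b) :* (R :* T)) :=
          c :* (Q :* T) :+ Q :* R :+ b :* (R :* T)) refl a b c d Q R T)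

2^-compare : ∀ q r t {e E} → 0ℚ ≤ e → 0ℚ ≤ E → e ≤2^ q → ¬ (E ≤2^ r) →
             q ≤ r + 1/suc t → e ≤ E * (1ℚ + 1/suc t)
2^-compare q r t {e} {E} 0≤e 0≤E e≤ E> q≤r = ^-cancel-≤ N (*-nonNeg 0≤E 0≤1+i)
    (*-cancelʳ-<-nonNeg Z {{ℚ.nonNegative (<⇒≤ 0<Z)}} main)
  where
  a = (↥ q) ⁺
  b = (↥ q) ⁻
  c = (↥ r) ⁺
  d = (↥ r) ⁻
  Q = ↧ₙ q
  R = ↧ₙ r
  T = suc t
  i = 1/suc t
  N = Q ℕ.* (R ℕ.* T)
  0≤1+i : 0ℚ ≤ 1ℚ + i
  0≤1+i = +-mono-≤ (<⇒≤ (positive⁻¹ 1ℚ)) (<⇒≤ (0<1/suc t))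
  A B′ : ℕ
  A = b ℕ.* (R ℕ.* T)
  B′ = d ℕ.* (Q ℕ.* T)
  Z = 2ℚ ^ A * 2ℚ ^ B′
  0<Z : 0ℚ < Z
  0<Z = *-pos (^-pos A 0<2) (^-pos B′ 0<2)
  pow : ∀ x y z n → (x ^ y * 2ℚ ^ z) ^ n ≡ x ^ (y ℕ.* n) * 2ℚ ^ (z ℕ.* n)
  pow x y z n = trans (^-distrib-* (x ^ y) (2ℚ ^ z) n) (cong₂ _*_ (^-assocʳ x y n) (^-assocʳ 2ℚ z n))
  lo : e ^ N * 2ℚ ^ A ≤ 2ℚ ^ (a ℕ.* (R ℕ.* T))
  lo = subst₂ _≤_ (pow e Q b (R ℕ.* T)) (^-assocʳ 2ℚ a (R ℕ.* T))
    (^-mono-≤ (R ℕ.* T) (*-nonNeg (^-nonNeg Q 0≤e) (<⇒≤ (^-pos b 0<2))) e≤)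
  RQT : R ℕ.* (Q ℕ.* T) ≡ N
  RQT = trans (sym (ℕ.*-assoc R Q T)) (trans (cong (ℕ._* T) (ℕ.*-comm R Q)) (ℕ.*-assoc Q R T))
  ^-mono-< : ∀ {x y} n .{{_ : NonZero n}} → 0ℚ ≤ x → x < y → x ^ n < y ^ n
  ^-mono-< {x} {y} (suc n) 0≤x x<y = ≤-<-trans
    (*-monoˡ-≤-nonNeg x {{ℚ.nonNegative 0≤x}} (^-mono-≤ n 0≤x (<⇒≤ x<y)))
    (*-monoˡ-<-pos (y ^ n) {{ℚ.positive (^-pos n (≤-<-trans 0≤x x<y))}} x<y)
  hi : 2ℚ ^ (c ℕ.* (Q ℕ.* T)) < E ^ N * 2ℚ ^ B′
  hi = subst₂ _<_ (^-assocʳ 2ℚ c (Q ℕ.* T))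
    (trans (pow E R d (Q ℕ.* T)) (cong (λ n → E ^ n * 2ℚ ^ B′) RQT))
    (^-mono-< (Q ℕ.* T) {{ℕ.m*n≢0 Q T}} (<⇒≤ (^-pos c 0<2)) (≰⇒> E>))
  2≤ : 2ℚ ≤ (1ℚ + i) ^ T
  2≤ = ≤-trans (≤-reflexive (cong (λ z → 1ℚ + z) (sym (trans (*-comm (fromℕℚ T) i) (1/suc-* t)))))
    (bernoulli T (<⇒≤ (0<1/suc t)))
  2^QR≤ : 2ℚ ^ (Q ℕ.* R) ≤ (1ℚ + i) ^ N
  2^QR≤ = ≤-trans (^-mono-≤ (Q ℕ.* R) (<⇒≤ 0<2) 2≤) (≤-reflexive
    (trans (^-assocʳ (1ℚ + i) T (Q ℕ.* R)) (cong ((1ℚ + i) ^_) (trans (ℕ.*-comm T (Q ℕ.* R)) (ℕ.*-assoc Q R T)))))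
  0<^N : 0ℚ < (1ℚ + i) ^ N
  0<^N = <-≤-trans (^-pos (Q ℕ.* R) 0<2) 2^QR≤
  main : e ^ N * Z < (E * (1ℚ + i)) ^ N * Z
  main = begin-strict
    e ^ N * (2ℚ ^ A * 2ℚ ^ B′)
      ≡⟨ *-assoc (e ^ N) (2ℚ ^ A) (2ℚ ^ B′) ⟨
    e ^ N * 2ℚ ^ A * 2ℚ ^ B′
      ≤⟨ *-monoʳ-≤-nonNeg (2ℚ ^ B′) {{ℚ.nonNegative (<⇒≤ (^-pos B′ 0<2))}} lo ⟩
    2ℚ ^ (a ℕ.* (R ℕ.* T)) * 2ℚ ^ B′
      ≡⟨ ^-homo-* 2ℚ (a ℕ.* (R ℕ.* T)) B′ ⟨
    2ℚ ^ (a ℕ.* (R ℕ.* T) ℕ.+ B′)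
      ≤⟨ 2^-mono (exponents q r t q≤r) ⟩
    2ℚ ^ ((c ℕ.* (Q ℕ.* T) ℕ.+ Q ℕ.* R) ℕ.+ A)
      ≡⟨ trans (^-homo-* 2ℚ (c ℕ.* (Q ℕ.* T) ℕ.+ Q ℕ.* R) A) (cong (_* 2ℚ ^ A) (^-homo-* 2ℚ (c ℕ.* (Q ℕ.* T)) (Q ℕ.* R))) ⟩
    2ℚ ^ (c ℕ.* (Q ℕ.* T)) * 2ℚ ^ (Q ℕ.* R) * 2ℚ ^ A
      ≤⟨ *-monoʳ-≤-nonNeg (2ℚ ^ A) {{ℚ.nonNegative (<⇒≤ (^-pos A 0<2))}}
           (*-monoˡ-≤-nonNeg (2ℚ ^ (c ℕ.* (Q ℕ.* T))) {{ℚ.nonNegative (<⇒≤ (^-pos (c ℕ.* (Q ℕ.* T)) 0<2))}} 2^QR≤) ⟩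
    2ℚ ^ (c ℕ.* (Q ℕ.* T)) * (1ℚ + i) ^ N * 2ℚ ^ A
      <⟨ *-monoˡ-<-pos (2ℚ ^ A) {{ℚ.positive (^-pos A 0<2)}} (*-monoˡ-<-pos ((1ℚ + i) ^ N) {{ℚ.positive 0<^N}} hi) ⟩
    E ^ N * 2ℚ ^ B′ * (1ℚ + i) ^ N * 2ℚ ^ A
      ≡⟨ solve 4 (λ x b y a → x :* b :* y :* a := x :* y :* (a :* b)) refl (E ^ N) (2ℚ ^ B′) ((1ℚ + i) ^ N) (2ℚ ^ A) ⟩
    E ^ N * (1ℚ + i) ^ N * Z
      ≡⟨ cong (_* Z) (^-distrib-* E (1ℚ + i) N) ⟨
    (E * (1ℚ + i)) ^ N * Z ∎
    where open ≤-Reasoning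

-- The largest e in (1/(n+1))·ℕ with e ≤ 2^q.
approx : ℚ → ℕ → ℚ
approx q n = grid n (greatest (λ j → grid n j ≤2^? q) (suc n ℕ.* 2 ℕ.^ ((↥ q) ⁺) ℕ.+ 1))

module _ (q : ℚ) (n : ℕ) where
  private
    P? = λ j → grid n j ≤2^? q
    a = (↥ q) ⁺
    b = (↥ q) ⁻
    bound = suc n ℕ.* 2 ℕ.^ a ℕ.+ 1

    fromℕℚ-2^ : ∀ m → fromℕℚ (2 ℕ.^ m) ≡ 2ℚ ^ m
    fromℕℚ-2^ zero    = refl
    fromℕℚ-2^ (suc m) = trans (fromℕℚ-* 2 (2 ℕ.^ m)) (cong (2ℚ *_) (fromℕℚ-2^ m))

    P0 : grid n 0 ≤2^ q
    P0 = ≤-trans (≤-reflexive (solve 3 (λ i x y → con 0ℚ :* i :* x :* y := con 0ℚ) refl (1/suc n) (grid n 0 ^ ℚ.ℚ.denominator-1 q) (2ℚ ^ b)))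
                 (<⇒≤ (^-pos a 0<2))

    x = grid n bound

    2^a<x : 2ℚ ^ a < x
    2^a<x = *-cancelʳ-<-nonNeg (fromℕℚ (suc n)) {{ℚ.nonNegative (fromℕℚ-nonNeg (suc n))}}
      (<-by (positive⁻¹ 1ℚ) (sym (trans (trans (*-assoc (fromℕℚ bound) (1/suc n) (fromℕℚ (suc n)))
        (trans (cong (fromℕℚ bound *_) (1/suc-* n)) (*-identityʳ (fromℕℚ bound))))
        (trans (fromℕℚ-+ (suc n ℕ.* 2 ℕ.^ a) 1)
          (cong (_+ 1ℚ) (trans (fromℕℚ-* (suc n) (2 ℕ.^ a)) (trans (cong (fromℕℚ (suc n) *_) (fromℕℚ-2^ a)) (*-comm (fromℕℚ (suc n)) (2ℚ ^ a)))))))))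

    1≤x : 1ℚ ≤ x
    1≤x = ≤-trans (2^-mono {0} {a} z≤n) (<⇒≤ 2^a<x)
    0≤x : 0ℚ ≤ x
    0≤x = ≤-trans (<⇒≤ (positive⁻¹ 1ℚ)) 1≤x

    ¬Pbound : ¬ (x ≤2^ q)
    ¬Pbound h = <-irrefl refl (<-≤-trans 2^a<x (≤-trans
      (≤-trans (≤-reflexive (sym (trans (*-identityʳ (x * 1ℚ)) (*-identityʳ x))))
        (*-mono-≤ (*-nonNeg 0≤x (<⇒≤ (positive⁻¹ 1ℚ))) (<⇒≤ (^-pos b 0<2))
          (*-monoˡ-≤-nonNeg x {{ℚ.nonNegative 0≤x}} (1≤^ (ℚ.ℚ.denominator-1 q) 1≤x)) (2^-mono {0} {b} z≤n))) h))

  approx≤ : approx q n ≤2^ q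
  approx≤ = greatest-satisfies P? P0 bound

  <approx : ¬ ((approx q n + 1/suc n) ≤2^ q)
  <approx h = greatest-maximal P? P0 bound ¬Pbound (subst (_≤2^ q) (sym eq) h)
    where
    g = greatest P? bound
    eq : grid n (suc g) ≡ grid n g + 1/suc n
    eq = trans (cong (_* 1/suc n) (fromℕℚ-+ 1 g))
      (solve 2 (λ g i → (con 1ℚ :+ g) :* i := g :* i :+ i) refl (fromℕℚ g) (1/suc n))

  0≤approx : 0ℚ ≤ approx q n
  0≤approx = *-nonNeg (fromℕℚ-nonNeg (greatest P? bound)) (<⇒≤ (0<1/suc n))

approx-compare : ∀ q r m n t → q ≤ r + 1/suc t →
                 approx q m ≤ (approx r n + 1/suc n) * (1ℚ + 1/suc t)
approx-compare q r m n t = 2^-compare q r t (0≤approx q m)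
  (+-mono-≤ (0≤approx r n) (<⇒≤ (0<1/suc n))) (approx≤ q m) (<approx r n)

2^-cauchy : ∀ {y} → IsCauchy y → IsCauchy (λ n → approx (y n) n)
2^-cauchy {y} yc ε 0<ε = (N₁ ℕ.⊔ N₂) ℕ.⊔ N₃ , close
  where
  first = yc (1/suc 0) (0<1/suc 0)
  N₁ = proj₁ first
  K = (approx (y N₁) N₁ + 1/suc N₁) * (1ℚ + 1/suc 0)
  bound : ∀ n → N₁ ℕ.≤ n → approx (y n) n ≤ K
  bound n N≤n = approx-compare (y n) (y N₁) n N₁ 0 (proj₂ first n N₁ N≤n ℕ.≤-refl)
  0<1+ : ∀ t → 0ℚ < 1ℚ + 1/suc t
  0<1+ t = +-pos (positive⁻¹ 1ℚ) (0<1/suc t)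
  0≤K : 0ℚ ≤ K
  0≤K = *-nonNeg (+-mono-≤ (0≤approx (y N₁) N₁) (<⇒≤ (0<1/suc N₁))) (<⇒≤ (0<1+ 0))
  0<L : 0ℚ < K + 1ℚ
  0<L = +-mono-≤-< 0≤K (positive⁻¹ 1ℚ)
  L⁻ = inv 0<L
  δ = ½ * (proj₁ L⁻ * ε)
  0<δ : 0ℚ < δ
  0<δ = 0<½* (*-pos (proj₁ (proj₂ L⁻)) 0<ε)
  arch = archimedean δ 0<δ
  t = proj₁ arch
  i = 1/suc t
  i≤δ : i ≤ δ
  i≤δ = proj₂ arch t ℕ.≤-refl
  second = yc i (0<1/suc t)
  N₂ = proj₁ second
  third = archimedean (½ * ε) (0<½* 0<ε)
  N₃ = proj₁ third
  j≤1 : ∀ n → 1/suc n ≤ 1ℚ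
  j≤1 n = *-cancel-≤ (0<fromℕℚ (suc n)) (subst₂ _≤_ (sym (1/suc-* n)) (sym (*-identityˡ (fromℕℚ (suc n)))) (1≤fromℕℚ (suc n)))
  close : ∀ m n → (N₁ ℕ.⊔ N₂) ℕ.⊔ N₃ ℕ.≤ m → (N₁ ℕ.⊔ N₂) ℕ.⊔ N₃ ℕ.≤ n →
          approx (y m) m ≤ approx (y n) n + ε
  close m n N≤m N≤n = ≤-trans
      (approx-compare (y m) (y n) m n t (proj₂ second m n (⊔ʳ N₁ N₂ (⊔ˡ (N₁ ℕ.⊔ N₂) N₃ N≤m)) (⊔ʳ N₁ N₂ (⊔ˡ (N₁ ℕ.⊔ N₂) N₃ N≤n))))
      (subst₂ _≤_ (solve 3 (λ e j i → e :+ (j :+ (e :+ j) :* i) := (e :+ j) :* (con 1ℚ :+ i)) refl e j i) refl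
        (+-monoʳ-≤ e (subst (j + (e + j) * i ≤_) (half+half ε)
          (+-mono-≤ (proj₂ third n (⊔ʳ (N₁ ℕ.⊔ N₂) N₃ N≤n))
            (subst ((e + j) * i ≤_) Lδ
              (*-mono-≤ 0≤e+j (<⇒≤ 0<δ) (+-mono-≤ (bound n (⊔ˡ N₁ N₂ (⊔ˡ (N₁ ℕ.⊔ N₂) N₃ N≤n))) (j≤1 n)) i≤δ))))))
    where
    e = approx (y n) n
    j = 1/suc n
    0≤e+j : 0ℚ ≤ e + j
    0≤e+j = +-mono-≤ (0≤approx (y n) n) (<⇒≤ (0<1/suc n))
    Lδ : (K + 1ℚ) * δ ≡ ½ * ε
    Lδ = trans (solve 3 (λ L l e → L :* (con ½ :* (l :* e)) := L :* l :* (con ½ :* e)) refl (K + 1ℚ) (proj₁ L⁻) ε)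
      (trans (cong (_* (½ * ε)) (proj₂ (proj₂ L⁻))) (*-identityˡ (½ * ε)))

-- 2^y is the limit of the lower grid approximations of 2^(yₙ), the grid being refined with n.
2^ℝ_ : ℝ → ℝ
seq    (2^ℝ y) n = approx (seq y n) n
cauchy (2^ℝ y) = 2^-cauchy (cauchy y)

Seq : Set
Seq = ℕ → ℚ

record NN (f : Seq) : Set where
  constructor mkNN
  field eventually : ∀ ε → 0ℚ < ε → ∃ λ N → ∀ n → N ℕ.≤ n → 0ℚ ≤ f n + ε
open NN

NN-resp : ∀ {f g} → (∀ n → f n ≡ g n) → NN f → NN g
NN-resp eq nn .eventually ε 0<ε = let N , h = nn .eventually ε 0<ε in
  N , λ n N≤n → subst (λ x → 0ℚ ≤ x + ε) (eq n) (h n N≤n)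

NN-+ : ∀ {f g} → NN f → NN g → NN (λ n → f n + g n)
NN-+ {f} {g} nf ng .eventually ε 0<ε = proj₁ F ℕ.⊔ proj₁ G , λ n N≤n → subst (0ℚ ≤_)
    (solve 3 (λ a b e → (a :+ con ½ :* e) :+ (b :+ con ½ :* e) := (a :+ b) :+ e) refl (f n) (g n) ε)
    (+-mono-≤ (proj₂ F n (⊔ˡ (proj₁ F) (proj₁ G) N≤n)) (proj₂ G n (⊔ʳ (proj₁ F) (proj₁ G) N≤n)))
  where
  F = nf .eventually (½ * ε) (0<½* 0<ε)
  G = ng .eventually (½ * ε) (0<½* 0<ε)

NN-const : ∀ {q} → 0ℚ ≤ q → NN (λ _ → q)
NN-const 0≤q .eventually ε 0<ε = 0 , λ _ _ → +-mono-≤ 0≤q (<⇒≤ 0<ε)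

NN-const⁻ : ∀ {q} → NN (λ _ → q) → 0ℚ ≤ q
NN-const⁻ {q} nn with ≤-total 0ℚ q
... | inj₁ 0≤q = 0≤q
... | inj₂ q≤0 with <-cmp q 0ℚ
...   | tri> _ _ 0<q = <⇒≤ 0<q
...   | tri≈ _ q≡0 _ = ≤-reflexive (sym q≡0)
...   | tri< q<0 _ _ = contradiction (≤-<-trans (proj₂ h (proj₁ h) ℕ.≤-refl) q+ε<0) (<-irrefl refl)
  where
  0<ε : 0ℚ < ½ * (- q)
  0<ε = 0<½* (neg-antimono-< q<0)
  h = nn .eventually (½ * (- q)) 0<ε
  q+ε<0 : q + ½ * (- q) < 0ℚ
  q+ε<0 = <-by 0<ε (solve 1 (λ q → q :+ con ½ :* (:- q) :+ con ½ :* (:- q) := con 0ℚ) refl q)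

NN-* : ∀ {f q} → 0ℚ ≤ q → NN f → NN (λ n → q * f n)
NN-* {f} {q} 0≤q nn with <-cmp 0ℚ q
... | tri> _ _ q<0 = contradiction (<-≤-trans q<0 0≤q) (<-irrefl refl)
... | tri≈ _ refl _ = NN-resp (λ n → sym (*-zeroˡ (f n))) (NN-const ≤-refl)
... | tri< 0<q _ _ = mkNN λ ε 0<ε →
    let q⁻ , 0<q⁻ , qq⁻ = inv 0<q
        N , h = nn .eventually (q⁻ * ε) (*-pos 0<q⁻ 0<ε)
    in N , λ n N≤n → subst (0ℚ ≤_)
         (trans (*-distribˡ-+ q (f n) (q⁻ * ε)) (cong (λ z → q * f n + z)
           (trans (sym (*-assoc q q⁻ ε)) (trans (cong (_* ε) qq⁻) (*-identityˡ ε)))))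
         (*-nonNeg 0≤q (h n N≤n))

Null : Seq → Set
Null f = NN f × NN (λ n → - f n)

Null-resp : ∀ {f g} → (∀ n → f n ≡ g n) → Null f → Null g
Null-resp eq (p , q) = NN-resp eq p , NN-resp (λ n → cong -_ (eq n)) q

Null-+ : ∀ {f g} → Null f → Null g → Null (λ n → f n + g n)
Null-+ {f} {g} (p , q) (p′ , q′) = NN-+ p p′ , NN-resp (λ n → sym (neg-distrib-+ (f n) (g n))) (NN-+ q q′)

Null-neg : ∀ {f} → Null f → Null (λ n → - f n)
Null-neg {f} (p , q) = q , NN-resp (λ n → solve 1 (λ x → x := :- (:- x)) refl (f n)) p

Null-0 : Null (λ _ → 0ℚ)
Null-0 = NN-const ≤-refl , NN-const ≤-refl

Null-* : ∀ {f} q → Null f → Null (λ n → q * f n)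
Null-* {f} q (a , b) with ≤-total 0ℚ q
... | inj₁ 0≤q = NN-* 0≤q a , NN-resp (λ n → sym (neg-distribʳ-* q (f n))) (NN-* 0≤q b)
... | inj₂ q≤0 = NN-resp (λ n → solve 2 (λ q x → (:- q) :* (:- x) := q :* x) refl q (f n)) (NN-* 0≤-q b)
               , NN-resp (λ n → sym (neg-distribˡ-* q (f n))) (NN-* 0≤-q a)
  where
  0≤-q : 0ℚ ≤ - q
  0≤-q = neg-antimono-≤ q≤0

NN-sum : ∀ {m} (f : Fin m → Seq) → (∀ i → NN (f i)) → NN (λ n → sum (λ i → f i n))
NN-sum {zero}  f h = NN-const ≤-refl
NN-sum {suc m} f h = NN-+ (h zero) (NN-sum (λ i → f (suc i)) (λ i → h (suc i)))

Null-sum : ∀ {m} (f : Fin m → Seq) → (∀ i → Null (f i)) → Null (λ n → sum (λ i → f i n))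
Null-sum {zero}  f h = Null-0
Null-sum {suc m} f h = Null-+ (h zero) (Null-sum (λ i → f (suc i)) (λ i → h (suc i)))

NN-sum-terms : ∀ {m} (f : Fin m → Seq) → (∀ i → NN (f i)) → NN (λ n → - sum (λ i → f i n)) →
               ∀ i → NN (λ n → - f i n)
NN-sum-terms {suc m} f h s zero = NN-resp
  (λ n → solve 2 (λ a b → :- (a :+ b) :+ b := :- a) refl (f zero n) (sum (λ i → f (suc i) n)))
  (NN-+ s (NN-sum (λ i → f (suc i)) (λ i → h (suc i))))
NN-sum-terms {suc m} f h s (suc i) = NN-sum-terms (λ i → f (suc i)) (λ i → h (suc i)) (NN-resp
  (λ n → solve 2 (λ a b → :- (a :+ b) :+ a := :- b) refl (f zero n) (sum (λ i → f (suc i) n)))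
  (NN-+ s (h zero))) i

≤⇒NN : ∀ x y → x ≤ℝ y → NN (λ n → seq y n - seq x n)
≤⇒NN x y (mk≤ℝ x≤y) .eventually ε 0<ε = proj₁ (x≤y ε 0<ε) , λ n N≤n → subst (0ℚ ≤_)
  (solve 3 (λ x y e → (y :+ e) :- x := (y :- x) :+ e) refl (seq x n) (seq y n) ε)
  (≤⇒0≤- (proj₂ (x≤y ε 0<ε) n N≤n))

NN⇒≤ : ∀ x y → NN (λ n → seq y n - seq x n) → x ≤ℝ y
NN⇒≤ x y nn = mk≤ℝ λ ε 0<ε → proj₁ (nn .eventually ε 0<ε) , λ n N≤n → ≤-by (proj₂ (nn .eventually ε 0<ε) n N≤n)
  (solve 3 (λ x y e → x :+ ((y :- x) :+ e) := y :+ e) refl (seq x n) (seq y n) ε)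

≈⇒Null : ∀ x y → x ≈ℝ y → Null (λ n → seq y n - seq x n)
≈⇒Null x y (x≤y , y≤x) = ≤⇒NN x y x≤y ,
  NN-resp (λ n → solve 2 (λ x y → x :- y := :- (y :- x)) refl (seq x n) (seq y n)) (≤⇒NN y x y≤x)

Null⇒≈ : ∀ x y → Null (λ n → seq y n - seq x n) → x ≈ℝ y
Null⇒≈ x y (p , q) = NN⇒≤ x y p ,
  NN⇒≤ y x (NN-resp (λ n → solve 2 (λ x y → :- (y :- x) := x :- y) refl (seq x n) (seq y n)) q)

≈0⇒Null : ∀ x → x ≈ℝ 0ℝ → Null (seq x)
≈0⇒Null x h = Null-resp (λ n → solve 1 (λ x → :- (con 0ℚ :- x) := x) refl (seq x n)) (Null-neg (≈⇒Null x 0ℝ h))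

Null⇒≈0 : ∀ x → Null (seq x) → x ≈ℝ 0ℝ
Null⇒≈0 x h = Null⇒≈ x 0ℝ (Null-resp (λ n → solve 1 (λ x → :- x := con 0ℚ :- x) refl (seq x n)) (Null-neg h))

-- A Cauchy sequence that is not positive in the limit is nonpositive in the limit.
≯0⇒≤0 : ∀ {x} → IsCauchy x → ¬ (NN x × ¬ NN (λ n → - x n)) → NN (λ n → - x n)
≯0⇒≤0 {x} c h .eventually ε 0<ε = decide (0ℚ ≤? - x N + ½ * ε)
  where
  N = proj₁ (c (½ * ε) (0<½* 0<ε))
  close = proj₂ (c (½ * ε) (0<½* 0<ε))
  lower : ∀ n → N ℕ.≤ n → x N - ½ * ε ≤ x n
  lower n N≤n = ≤-by (≤⇒0≤- (close N n ℕ.≤-refl N≤n))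
    (solve 3 (λ a b e → (b :- con ½ :* e) :+ ((a :+ con ½ :* e) :- b) := a) refl (x n) (x N) ε)
  decide : Dec (0ℚ ≤ - x N + ½ * ε) → ∃ λ M → ∀ n → M ℕ.≤ n → 0ℚ ≤ - x n + ε
  decide (yes p) = N , λ n N≤n → ≤-trans p (≤-by (≤⇒0≤- (close n N N≤n ℕ.≤-refl))
    (solve 3 (λ a b e → (:- b :+ con ½ :* e) :+ ((b :+ con ½ :* e) :- a) := :- a :+ e) refl (x n) (x N) ε))
  decide (no ¬p) = contradiction (nnx , λ nn → ¬p (bound nn)) h
    where
    nnx : NN x
    nnx = mkNN λ δ 0<δ → N , λ n N≤n → ≤-trans
      (≤-trans (≤-trans (<⇒≤ (neg-antimono-< (≰⇒> ¬p)))
        (≤-reflexive (solve 2 (λ b e → :- (:- b :+ con ½ :* e) := b :- con ½ :* e) refl (x N) ε)))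
        (lower n N≤n)) (≤-by (<⇒≤ 0<δ) refl)
    bound : NN (λ n → - x n) → 0ℚ ≤ - x N + ½ * ε
    bound nn = NN-const⁻ (mkNN λ δ 0<δ → 0 , λ _ _ →
      let M , g = nn .eventually δ 0<δ
          k = N ℕ.⊔ M
      in ≤-trans (g k (ℕ.m≤n⊔m N M)) (≤-by (≤⇒0≤- (close N k ℕ.≤-refl (ℕ.m≤m⊔n N M)))
           (solve 4 (λ a b e d → (:- b :+ d) :+ ((b :+ con ½ :* e) :- a) := (:- a :+ con ½ :* e) :+ d) refl
             (x N) (x k) ε δ)))

dot : ∀ {n} → (Fin n → ℚ) → (Fin n → ℚ) → ℚ
dot a x = sum λ i → a i * x i

Row : ℕ → Set
Row n = Bool × (Fin n → ℚ)

Holds : Bool → ℚ → Set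
Holds false v = 0ℚ ≤ v
Holds true  v = 0ℚ < v

-- The same constraints on the limit of a sequence, strict ones in a negative form.
Holdsˢ : Bool → Seq → Set
Holdsˢ false f = NN f
Holdsˢ true  f = NN f × ¬ NN (λ n → - f n)

Solution : ∀ {n} → (Fin n → ℚ) → List (Row n) → Set
Solution x = All λ (s , a) → Holds s (dot a x)

Solutionˢ : ∀ {n} → (Fin n → Seq) → List (Row n) → Set
Solutionˢ X = All λ (s , a) → Holdsˢ s (λ n → dot a (λ i → X i n))

Holds⇒≤ : ∀ s {v} → Holds s v → 0ℚ ≤ v
Holds⇒≤ false h = h
Holds⇒≤ true  h = <⇒≤ h

<⇒Holds : ∀ s {v} → 0ℚ < v → Holds s v
<⇒Holds false h = <⇒≤ h
<⇒Holds true  h = h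

Holds-* : ∀ s {q v} → 0ℚ < q → Holds s v → Holds s (q * v)
Holds-* false 0<q h = *-nonNeg (<⇒≤ 0<q) h
Holds-* true  0<q h = *-pos 0<q h

Holds-∨ˡ : ∀ s t {v} → Holds (s ∨ t) v → Holds s v
Holds-∨ˡ false t h = Holds⇒≤ t h
Holds-∨ˡ true  t h = h

Holds-∨ʳ : ∀ s t {v} → Holds (s ∨ t) v → Holds t v
Holds-∨ʳ false t h = h
Holds-∨ʳ true  t h = <⇒Holds t h

Holdsˢ⇒NN : ∀ s {f} → Holdsˢ s f → NN f
Holdsˢ⇒NN false h = h
Holdsˢ⇒NN true  h = proj₁ h

Holdsˢ-resp : ∀ s {f g} → (∀ n → f n ≡ g n) → Holdsˢ s f → Holdsˢ s g
Holdsˢ-resp false eq h = NN-resp eq h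
Holdsˢ-resp true  eq (h , k) = NN-resp eq h , λ nn → k (NN-resp (λ n → cong -_ (sym (eq n))) nn)

Holdsˢ-* : ∀ s {q f} → 0ℚ < q → Holdsˢ s f → Holdsˢ s (λ n → q * f n)
Holdsˢ-* false 0<q h = NN-* (<⇒≤ 0<q) h
Holdsˢ-* true {q} {f} 0<q (h , k) = NN-* (<⇒≤ 0<q) h , λ nn → k (NN-resp
  (λ n → trans (cong (q⁻ *_) (neg-distribʳ-* q (f n)))
    (trans (sym (*-assoc q⁻ q (- f n))) (trans (cong (_* - f n) (trans (*-comm q⁻ q) qq⁻)) (*-identityˡ (- f n)))))
  (NN-* (<⇒≤ (proj₁ (proj₂ (inv 0<q)))) nn))
  where
  q⁻ = proj₁ (inv 0<q)
  qq⁻ = proj₂ (proj₂ (inv 0<q))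

Holdsˢ-+ : ∀ s t {f g} → Holdsˢ s f → Holdsˢ t g → Holdsˢ (s ∨ t) (λ n → f n + g n)
Holdsˢ-+ false false hf hg = NN-+ hf hg
Holdsˢ-+ false true {f} {g} hf (hg , k) = NN-+ hf hg , λ nn → k (NN-resp
  (λ n → solve 2 (λ a b → :- (a :+ b) :+ a := :- b) refl (f n) (g n)) (NN-+ nn hf))
Holdsˢ-+ true t {f} {g} (hf , k) hg = NN-+ hf (Holdsˢ⇒NN t hg) , λ nn → k (NN-resp
  (λ n → solve 2 (λ a b → :- (a :+ b) :+ b := :- a) refl (f n) (g n)) (NN-+ nn (Holdsˢ⇒NN t hg)))

dot-+ : ∀ {n} (a b x : Fin n → ℚ) → dot (λ i → a i + b i) x ≡ dot a x + dot b x
dot-+ a b x = trans (sum-cong-≗ (λ i → *-distribʳ-+ (x i) (a i) (b i))) (∑-distrib-+ (λ i → a i * x i) (λ i → b i * x i))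

dot-* : ∀ {n} q (a x : Fin n → ℚ) → dot (λ i → q * a i) x ≡ q * dot a x
dot-* q a x = trans (sum-cong-≗ (λ i → *-assoc q (a i) (x i))) (sym (*-distribˡ-sum q (λ i → a i * x i)))

-- Rows with a positive, negative or zero coefficient at the first variable,
-- normalised so that this coefficient is 1, −1 or 0, and without it.
record Split {n} (rows : List (Row (suc n))) : Set where
  field
    pos neg zer : List (Row n)
    forward : ∀ X → Solutionˢ X rows →
      All (λ (s , a) → Holdsˢ s (λ k → X zero k + dot a (λ i → X (suc i) k))) pos ×
      All (λ (s , a) → Holdsˢ s (λ k → - X zero k + dot a (λ i → X (suc i) k))) neg ×
      Solutionˢ (λ i → X (suc i)) zer
    backward : ∀ x →
      All (λ (s , a) → Holds s (x zero + dot a (λ i → x (suc i)))) pos →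
      All (λ (s , a) → Holds s (- x zero + dot a (λ i → x (suc i)))) neg →
      Solution (λ i → x (suc i)) zer → Solution x rows

split : ∀ {n} (rows : List (Row (suc n))) → Split rows
split [] = record
  { pos = [] ; neg = [] ; zer = []
  ; forward = λ _ _ → [] , [] , [] ; backward = λ _ _ _ _ → [] }
split ((s , a) ∷ rows) with split rows | <-cmp (a zero) 0ℚ
... | S | tri≈ _ a₀≡0 _ = record
  { pos = pos ; neg = neg ; zer = (s , λ i → a (suc i)) ∷ zer
  ; forward = λ { X (h ∷ hs) → let p , q , r = forward X hs in
      p , q , Holdsˢ-resp s (λ k → drop (λ i → X i k)) h ∷ r }
  ; backward = λ { x p q (h ∷ r) → subst (Holds s) (sym (drop x)) h ∷ backward x p q r }
  }
  where
  open Split S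
  drop : ∀ x → dot a x ≡ dot (λ i → a (suc i)) (λ i → x (suc i))
  drop x = trans (cong (λ z → z * x zero + dot (λ i → a (suc i)) (λ i → x (suc i))) a₀≡0)
    (solve 2 (λ x y → con 0ℚ :* x :+ y := y) refl (x zero) (dot (λ i → a (suc i)) (λ i → x (suc i))))
... | S | tri> _ _ 0<a₀ = record
  { pos = (s , λ i → q * a (suc i)) ∷ pos ; neg = neg ; zer = zer
  ; forward = λ { X (h ∷ hs) → let p , n , z = forward X hs in
      Holdsˢ-resp s (λ k → down (λ i → X i k)) (Holdsˢ-* s 0<q h) ∷ p , n , z }
  ; backward = λ { x (h ∷ p) n z → subst (Holds s) (up x) (Holds-* s 0<a₀ h) ∷ backward x p n z }
  }
  where
  open Split S
  q = proj₁ (inv 0<a₀)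
  0<q = proj₁ (proj₂ (inv 0<a₀))
  a₀q = proj₂ (proj₂ (inv 0<a₀))
  down : ∀ x → q * dot a x ≡ x zero + dot (λ i → q * a (suc i)) (λ i → x (suc i))
  down x = trans (*-distribˡ-+ q (a zero * x zero) (dot (λ i → a (suc i)) (λ i → x (suc i)))) (cong₂ _+_
    (trans (sym (*-assoc q (a zero) (x zero))) (trans (cong (_* x zero) (trans (*-comm q (a zero)) a₀q)) (*-identityˡ (x zero))))
    (sym (dot-* q (λ i → a (suc i)) (λ i → x (suc i)))))
  up : ∀ x → a zero * (x zero + dot (λ i → q * a (suc i)) (λ i → x (suc i))) ≡ dot a x
  up x = trans (cong (a zero *_) (sym (down x))) (trans (sym (*-assoc (a zero) q (dot a x)))
    (trans (cong (_* dot a x) a₀q) (*-identityˡ (dot a x))))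
... | S | tri< a₀<0 _ _ = record
  { pos = pos ; neg = (s , λ i → q * a (suc i)) ∷ neg ; zer = zer
  ; forward = λ { X (h ∷ hs) → let p , n , z = forward X hs in
      p , Holdsˢ-resp s (λ k → down (λ i → X i k)) (Holdsˢ-* s 0<q h) ∷ n , z }
  ; backward = λ { x p (h ∷ n) z → subst (Holds s) (up x) (Holds-* s 0<-a₀ h) ∷ backward x p n z }
  }
  where
  open Split S
  0<-a₀ : 0ℚ < - a zero
  0<-a₀ = neg-antimono-< a₀<0
  q = proj₁ (inv 0<-a₀)
  0<q = proj₁ (proj₂ (inv 0<-a₀))
  a₀q = proj₂ (proj₂ (inv 0<-a₀))
  down : ∀ x → q * dot a x ≡ - x zero + dot (λ i → q * a (suc i)) (λ i → x (suc i))
  down x = trans (*-distribˡ-+ q (a zero * x zero) (dot (λ i → a (suc i)) (λ i → x (suc i)))) (cong₂ _+_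
    (trans (solve 3 (λ q a x → q :* (a :* x) := :- ((:- a :* q) :* x)) refl q (a zero) (x zero))
      (cong -_ (trans (cong (_* x zero) a₀q) (*-identityˡ (x zero)))))
    (sym (dot-* q (λ i → a (suc i)) (λ i → x (suc i)))))
  up : ∀ x → - a zero * (- x zero + dot (λ i → q * a (suc i)) (λ i → x (suc i))) ≡ dot a x
  up x = trans (cong (- a zero *_) (sym (down x))) (trans (sym (*-assoc (- a zero) q (dot a x)))
    (trans (cong (_* dot a x) a₀q) (*-identityˡ (dot a x))))

Implies : Bool × ℚ → Bool × ℚ → Set
Implies (s , v) (t , w) = ∀ x → Holds s (x + v) → Holds t (x + w)

Implies-total : ∀ b c → Implies b c ⊎ Implies c b
Implies-total (s , v) (t , w) with <-cmp v w
... | tri< v<w _ _ = inj₁ λ x h → <⇒Holds t (≤-<-trans (Holds⇒≤ s h) (+-monoʳ-< x v<w))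
... | tri> _ _ w<v = inj₂ λ x h → <⇒Holds s (≤-<-trans (Holds⇒≤ t h) (+-monoʳ-< x w<v))
Implies-total (true , v) (t , w)     | tri≈ _ refl _ = inj₁ λ x h → <⇒Holds t h
Implies-total (false , v) (t , w)    | tri≈ _ refl _ = inj₂ λ x h → Holds⇒≤ t h

tightest : (bs : List (Bool × ℚ)) → bs ≡ [] ⊎ ∃ λ b → b List.∈ bs × All (Implies b) bs
tightest [] = inj₁ refl
tightest (b ∷ bs) with tightest bs
... | inj₁ refl = inj₂ (b , here refl , (λ x h → h) ∷ [])
... | inj₂ (c , c∈ , cs) with Implies-total b c
...   | inj₁ b⇒c = inj₂ (b , here refl , (λ x h → h) ∷ All.map (λ {d} c⇒d x h → c⇒d x (b⇒c x h)) cs)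
...   | inj₂ c⇒b = inj₂ (c , there c∈ , c⇒b ∷ cs)

choose : (P Q : List (Bool × ℚ)) →
  (∀ {s v t w} → (s , v) List.∈ P → (t , w) List.∈ Q → Holds (s ∨ t) (v + w)) →
  ∃ λ x → All (λ (s , v) → Holds s (x + v)) P × All (λ (t , w) → Holds t (- x + w)) Q
choose P Q h with tightest P | tightest Q
... | inj₁ refl | inj₁ refl = 0ℚ , [] , []
... | inj₁ refl | inj₂ ((t , w) , _ , ts) = w - 1ℚ , [] , All.map (λ imp → imp (- (w - 1ℚ)) hw) ts
  where
  hw : Holds t (- (w - 1ℚ) + w)
  hw = <⇒Holds t (subst (0ℚ <_) (solve 1 (λ w → con 1ℚ := :- (w :- con 1ℚ) :+ w) refl w) (positive⁻¹ 1ℚ))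
... | inj₂ ((s , v) , _ , ss) | inj₁ refl = 1ℚ - v , All.map (λ imp → imp (1ℚ - v) hv) ss , []
  where
  hv : Holds s ((1ℚ - v) + v)
  hv = <⇒Holds s (subst (0ℚ <_) (solve 1 (λ w → con 1ℚ := (con 1ℚ :- w) :+ w) refl v) (positive⁻¹ 1ℚ))
... | inj₂ ((s , v) , v∈ , ss) | inj₂ ((t , w) , w∈ , ts) =
    x , All.map (λ imp → imp x hv) ss , All.map (λ imp → imp (- x) hw) ts
  where
  x = ½ * (w - v)
  hvw : Holds (s ∨ t) (½ * (v + w))
  hvw = Holds-* (s ∨ t) (positive⁻¹ ½) (h v∈ w∈)
  hv : Holds s (x + v)
  hv = subst (Holds s) (solve 2 (λ v w → con ½ :* (v :+ w) := con ½ :* (w :- v) :+ v) refl v w) (Holds-∨ˡ s t hvw)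
  hw : Holds t (- x + w)
  hw = subst (Holds t) (solve 2 (λ v w → con ½ :* (v :+ w) := :- (con ½ :* (w :- v)) :+ w) refl v w) (Holds-∨ʳ s t hvw)

addRows : ∀ {n} → Row n → Row n → Row n
addRows (s , a) (t , b) = s ∨ t , λ i → a i + b i

-- A homogeneous system with rational coefficients has a rational solution or no real one.
solvable? : ∀ {n} (rows : List (Row n)) → (∃ λ x → Solution x rows) ⊎ (∀ X → ¬ Solutionˢ X rows)
solvable? {zero} [] = inj₁ ((λ ()) , [])
solvable? {zero} ((true , a) ∷ rows) = inj₂ λ { X (h ∷ _) → proj₂ h (NN-const ≤-refl) }
solvable? {zero} ((false , a) ∷ rows) with solvable? rows
... | inj₁ (x , h) = inj₁ (x , ≤-refl ∷ h)
... | inj₂ ¬h      = inj₂ λ { X (_ ∷ h) → ¬h X h }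
solvable? {suc n} rows with solvable? (zer ++ cartesianProductWith addRows pos neg)
  where open Split (split rows)
... | inj₂ ¬h = inj₂ λ X h → ¬h (λ i → X (suc i))
      (let p , q , r = forward X h in All.++⁺ r (All.tabulate (λ {row} row∈ → pair X p q row∈)))
  where
  open Split (split rows)
  pair : ∀ X → All (λ (s , a) → Holdsˢ s (λ k → X zero k + dot a (λ i → X (suc i) k))) pos →
         All (λ (s , a) → Holdsˢ s (λ k → - X zero k + dot a (λ i → X (suc i) k))) neg →
         ∀ {row} → row List.∈ cartesianProductWith addRows pos neg →
         Holdsˢ (proj₁ row) (λ k → dot (proj₂ row) (λ i → X (suc i) k))
  pair X p q row∈ with List.∈-cartesianProductWith⁻ addRows pos neg row∈
  ... | (s , a) , (t , b) , a∈ , b∈ , refl = Holdsˢ-resp (s ∨ t)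
    (λ k → trans (solve 3 (λ x u v → (x :+ u) :+ (:- x :+ v) := u :+ v) refl (X zero k)
        (dot a (λ i → X (suc i) k)) (dot b (λ i → X (suc i) k)))
      (sym (dot-+ a b (λ i → X (suc i) k))))
    (Holdsˢ-+ s t (All.lookup p a∈) (All.lookup q b∈))
... | inj₁ (x , h) = inj₁ (x′ , backward x′
      (All.map⁻ {f = eval} (proj₁ (proj₂ chosen))) (All.map⁻ {f = eval} (proj₂ (proj₂ chosen))) (All.++⁻ˡ zer h))
  where
  open Split (split rows)
  eval : Row n → Bool × ℚ
  eval (s , a) = s , dot a x
  compatible : ∀ {s v t w} → (s , v) List.∈ map eval pos → (t , w) List.∈ map eval neg → Holds (s ∨ t) (v + w)
  compatible v∈ w∈ with List.∈-map⁻ eval v∈ | List.∈-map⁻ eval w∈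
  ... | (s , a) , a∈ , refl | (t , b) , b∈ , refl = subst (Holds (s ∨ t)) (dot-+ a b x)
    (All.lookup (All.++⁻ʳ zer h) (List.∈-cartesianProductWith⁺ addRows a∈ b∈))
  chosen = choose (map eval pos) (map eval neg) compatible
  x′ : Fin (suc n) → ℚ
  x′ zero    = proj₁ chosen
  x′ (suc i) = x i

sumℝ : ∀ {n} → (Fin n → ℝ) → ℝ
sumℝ = F.foldr _+ℝ_ 0ℝ

seq-sum : ∀ {n} (f : Fin n → ℝ) k → seq (sumℝ f) k ≡ sum (λ i → seq (f i) k)
seq-sum {zero}  f k = refl
seq-sum {suc n} f k = cong (λ z → seq (f zero) k + z) (seq-sum (f ∘ suc) k)

Point : ℕ → Set
Point d = Fin d → ℝ

⟨_,_⟩ : ∀ {d} → Point d → Point d → ℝ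
⟨ c , x ⟩ = sumℝ λ j → c j *ℝ x j

combination : ∀ {N d} → (Fin N → Point d) → (Fin N → ℝ) → Point d
combination p μ j = sumℝ λ i → μ i *ℝ p i j

-- The convex hull of the points p i with i ∈ W: weights vanish outside W.
Conv : ∀ {N d} → (Fin N → Point d) → Subset N → Pred (Point d) 0ℓ
Conv {N} p W x = ∃ λ (μ : Fin N → ℝ) →
  (∀ i → 0ℝ ≤ℝ μ i) × (∀ i → i ∉ W → μ i ≈ℝ 0ℝ) ×
  sumℝ μ ≈ℝ 1ℝ × (∀ j → x j ≈ℝ combination p μ j)

-- F = Q ∩ {x : ⟨c,x⟩ = b} for an inequality ⟨c,x⟩ ≤ b valid on Q. Taking c = 0 and b = 0
-- shows that Q is a face of itself.
IsFace : ∀ {d} → Pred (Point d) 0ℓ → Pred (Point d) 0ℓ → Set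
IsFace F Q = ∃ λ c → ∃ λ b →
  (∀ x → Q x → ⟨ c , x ⟩ ≤ℝ b) ×
  (∀ x → F x ⇔ (Q x × ⟨ c , x ⟩ ≈ℝ b))

AffinelyIndependent : ∀ {N d} → (Fin N → Point d) → Subset N → Set
AffinelyIndependent {N} p T = (μ : Fin N → ℝ) → (∀ i → i ∉ T → μ i ≈ℝ 0ℝ) →
  sumℝ μ ≈ℝ 0ℝ → (∀ j → combination p μ j ≈ℝ 0ℝ) → ∀ i → μ i ≈ℝ 0ℝ

-- The dimension of conv {p i : i ∈ S} is that of its affine hull, which is the affine hull of
-- {p i : i ∈ S}: one less than the largest size of an affinely independent subset.
HasDimension : ∀ {N d} → (Fin N → Point d) → Subset N → ℕ → Set
HasDimension p S k =
  (∃ λ T → T ⊆ S × AffinelyIndependent p T × card T ≡ suc k) ×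
  (∀ T → T ⊆ S → AffinelyIndependent p T → card T ℕ.≤ suc k)

basis : ∀ {n} → Fin n → Fin n → ℚ
basis zero    zero    = 1ℚ
basis zero    (suc _) = 0ℚ
basis (suc _) zero    = 0ℚ
basis (suc i) (suc k) = basis i k

dot-0 : ∀ {n} (x : Fin n → ℚ) → dot (λ _ → 0ℚ) x ≡ 0ℚ
dot-0 {zero}  x = refl
dot-0 {suc n} x = cong₂ _+_ (*-zeroˡ (x zero)) (dot-0 (x ∘ suc))

dot-basis : ∀ {n} (i : Fin n) x → dot (basis i) x ≡ x i
dot-basis zero    x = trans (cong₂ _+_ (*-identityˡ (x zero)) (dot-0 (x ∘ suc))) (+-identityʳ (x zero))
dot-basis (suc i) x = trans (cong₂ _+_ (*-zeroˡ (x zero)) (dot-basis i (x ∘ suc))) (+-identityˡ (x (suc i)))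

dot-neg : ∀ {n} (a x : Fin n → ℚ) → dot (λ i → - a i) x ≡ - dot a x
dot-neg {zero}  a x = refl
dot-neg {suc n} a x = trans (cong₂ _+_ (sym (neg-distribˡ-* (a zero) (x zero))) (dot-neg (a ∘ suc) (x ∘ suc)))
  (sym (neg-distrib-+ (a zero * x zero) (dot (a ∘ suc) (x ∘ suc))))

dot-comm : ∀ {n} (a x : Fin n → ℚ) → dot a x ≡ dot x a
dot-comm a x = sum-cong-≗ (λ i → *-comm (a i) (x i))

sum≡dot1 : ∀ {n} (x : Fin n → ℚ) → sum x ≡ dot (λ _ → 1ℚ) x
sum≡dot1 x = sum-cong-≗ (λ i → sym (*-identityˡ (x i)))

-- An equation is a pair of inequalities.
system : ∀ {n} → List (Fin n → ℚ) → List (Row n) → List (Row n)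
system E rows = map (false ,_) E ++ (map (λ a → false , λ i → - a i) E ++ rows)

EqSeq : ∀ {n} → (Fin n → Seq) → List (Fin n → ℚ) → Set
EqSeq X = All λ a → Null (λ k → dot a (λ i → X i k))

systemˢ : ∀ {n} {X : Fin n → Seq} {E rows} → EqSeq X E → Solutionˢ X rows → Solutionˢ X (system E rows)
systemˢ {X = X} eqs sol = All.++⁺ (All.map⁺ (All.map proj₁ eqs)) (All.++⁺
  (All.map⁺ (All.map (λ {a} h → NN-resp (λ k → sym (dot-neg a (λ i → X i k))) (proj₂ h)) eqs)) sol)

system⁻ : ∀ {n} {x : Fin n → ℚ} E {rows} → Solution x (system E rows) →
          All (λ a → dot a x ≡ 0ℚ) E × Solution x rows
system⁻ {x = x} E sol =
  All.zipWith (λ {a} (p , q) → ≤-antisym (subst₂ _≤_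
      (trans (cong -_ (dot-neg a x)) (solve 1 (λ x → :- (:- x) := x) refl (dot a x))) refl
      (neg-antimono-≤ q)) p)
    (All.map⁻ {f = false ,_} (All.++⁻ˡ (map (false ,_) E) sol)
    , All.map⁻ {f = λ a → false , λ i → - a i} (All.++⁻ˡ (map (λ a → false , λ i → - a i) E) rest))
  , All.++⁻ʳ (map (λ a → false , λ i → - a i) E) rest
  where rest = All.++⁻ʳ (map (false ,_) E) sol

any-or-all : ∀ {n} {A B : Fin n → Set} → (∀ i → A i ⊎ B i) → ∃ A ⊎ (∀ i → B i)
any-or-all {zero}  h = inj₂ λ ()
any-or-all {suc n} h with h zero | any-or-all (h ∘ suc)
... | inj₁ a | _            = inj₁ (zero , a)
... | inj₂ _ | inj₁ (i , a) = inj₁ (suc i , a)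
... | inj₂ b | inj₂ bs      = inj₂ λ { zero → b ; (suc i) → bs i }

≡⇒≈ : ∀ x y → (∀ k → seq x k ≡ seq y k) → x ≈ℝ y
≡⇒≈ x y eq = Null⇒≈ x y (Null-resp (λ k → sym (trans (cong (λ z → z - seq x k) (sym (eq k))) (+-inverseʳ (seq x k)))) Null-0)

≈1⇒Null : ∀ x → x ≈ℝ 1ℝ → Null (λ k → 1ℚ - seq x k)
≈1⇒Null x h = Null-resp {f = λ k → seq 1ℝ k - seq x k} {g = λ k → 1ℚ - seq x k}
  (λ k → cong (λ z → z - seq x k) {x = seq 1ℝ k} {y = 1ℚ} refl) (≈⇒Null x 1ℝ h)

fromℚ-≈0 : ∀ {q} → fromℚ q ≈ℝ 0ℝ → q ≡ 0ℚ
fromℚ-≈0 {q} h = let p , n = ≈0⇒Null (fromℚ q) h in ≤-antisym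
  (subst (_≤ 0ℚ) (solve 1 (λ q → :- (:- q) := q) refl q) (neg-antimono-≤ (NN-const⁻ n))) (NN-const⁻ p)

module _ {N d} (v : Fin N → Fin d → ℚ) where

  points : Fin N → Point d
  points i j = fromℚ (v i j)

  seq-combination : ∀ μ j k → seq (combination points μ j) k ≡ dot (λ i → v i j) (λ i → seq (μ i) k)
  seq-combination μ j k = trans (seq-sum (λ i → μ i *ℝ points i j) k) (sum-cong-≗ (λ i → *-comm (seq (μ i) k) (v i j)))

  module _ (T : Subset N) where

    supportRow : Fin N → Fin N → ℚ
    supportRow i with i ∈? T
    ... | yes _ = λ _ → 0ℚ
    ... | no  _ = basis i

    supportRow-∉ : ∀ i → i ∉ T → supportRow i ≡ basis i
    supportRow-∉ i i∉T with i ∈? T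
    ... | yes i∈T = contradiction i∈T i∉T
    ... | no  _   = refl

    relations : List (Fin N → ℚ)
    relations = tabulate supportRow ++ ((λ _ → 1ℚ) ∷ tabulate (λ j i → v i j))

    relationsˢ : (μ : Fin N → ℝ) → (∀ i → i ∉ T → μ i ≈ℝ 0ℝ) → sumℝ μ ≈ℝ 0ℝ →
                 (∀ j → combination points μ j ≈ℝ 0ℝ) → EqSeq (λ i → seq (μ i)) relations
    relationsˢ μ sup tot com = All.++⁺ (All.tabulate⁺ s)
      (Null-resp (λ k → trans (seq-sum μ k) (sum≡dot1 (λ i → seq (μ i) k))) (≈0⇒Null (sumℝ μ) tot) ∷
       All.tabulate⁺ (λ j → Null-resp (seq-combination μ j) (≈0⇒Null (combination points μ j) (com j))))
      where
      s : ∀ i → Null (λ k → dot (supportRow i) (λ i → seq (μ i) k))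
      s i with i ∈? T
      ... | yes _  = Null-resp (λ k → sym (dot-0 (λ i → seq (μ i) k))) Null-0
      ... | no i∉T = Null-resp (λ k → sym (dot-basis i (λ i → seq (μ i) k))) (≈0⇒Null (μ i) (sup i i∉T))

    dependence : Fin N → List (Row N)
    dependence i = system relations ((true , basis i) ∷ [])

    dependent : ∀ i x → Solution x (dependence i) → ¬ AffinelyIndependent points T
    dependent i x sol ind = <-irrefl (sym (fromℚ-≈0 {x i} (ind (λ i → fromℚ (x i)) sup tot com i))) 0<xᵢ
      where
      eqs : All (λ a → dot a x ≡ 0ℚ) relations
      eqs = proj₁ (system⁻ relations sol)
      0<xᵢ : 0ℚ < x i
      0<xᵢ = subst (0ℚ <_) (dot-basis i x) (All.head (proj₂ (system⁻ relations sol)))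
      sup : ∀ i → i ∉ T → fromℚ (x i) ≈ℝ 0ℝ
      sup i i∉T = ≡⇒≈ (fromℚ (x i)) 0ℝ λ _ → trans (sym (dot-basis i x))
        (trans (cong (λ a → dot a x) (sym (supportRow-∉ i i∉T)))
          (All.tabulate⁻ {f = supportRow} (All.++⁻ˡ (tabulate supportRow) eqs) i))
      rest : All (λ a → dot a x ≡ 0ℚ) ((λ _ → 1ℚ) ∷ tabulate (λ j i → v i j))
      rest = All.++⁻ʳ (tabulate supportRow) eqs
      tot : sumℝ (λ i → fromℚ (x i)) ≈ℝ 0ℝ
      tot = ≡⇒≈ (sumℝ (λ i → fromℚ (x i))) 0ℝ λ k →
        trans (seq-sum (λ i → fromℚ (x i)) k) (trans (sum≡dot1 x) (All.head rest))
      com : ∀ j → combination points (λ i → fromℚ (x i)) j ≈ℝ 0ℝ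
      com j = ≡⇒≈ (combination points (λ i → fromℚ (x i)) j) 0ℝ λ k →
        trans (seq-combination (λ i → fromℚ (x i)) j k)
          (All.tabulate⁻ {f = λ j i → v i j} (All.tail rest) j)

    independent : (∀ i X → ¬ Solutionˢ X (dependence i)) → AffinelyIndependent points T
    independent none μ sup tot com i = Null⇒≈0 (μ i)
      ( NN-resp (λ k → solve 1 (λ x → :- (:- x) := x) refl (seq (μ i) k))
          (nonPositive (λ k → -ℝ μ k)
            (All.map (λ {a} h → Null-resp (λ k → neg a k) (Null-neg h)) eqs))
      , nonPositive μ eqs)
      where
      eqs : EqSeq (λ i → seq (μ i)) relations
      eqs = relationsˢ μ sup tot com
      neg : ∀ a k → - dot a (λ i → seq (μ i) k) ≡ dot a (λ i → - seq (μ i) k)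
      neg a k = trans (cong -_ (dot-comm a (λ i → seq (μ i) k)))
        (trans (sym (dot-neg (λ i → seq (μ i) k) a)) (dot-comm (λ i → - seq (μ i) k) a))
      nonPositive : (ν : Fin N → ℝ) → EqSeq (λ i → seq (ν i)) relations → NN (λ k → - seq (ν i) k)
      nonPositive ν eqs = ≯0⇒≤0 (cauchy (ν i)) λ { (nn , pos) → none i (λ i → seq (ν i))
        (systemˢ eqs ((NN-resp (λ k → sym (dot-basis i (λ i → seq (ν i) k))) nn
          , λ h → pos (NN-resp (λ k → cong -_ (dot-basis i (λ i → seq (ν i) k))) h)) ∷ [])) }

    affinelyIndependent? : Dec (AffinelyIndependent points T)
    affinelyIndependent? = decide (any-or-all (λ i → solvable? (dependence i)))
      where
      decide : (∃ λ i → ∃ λ x → Solution x (dependence i)) ⊎ (∀ i X → ¬ Solutionˢ X (dependence i)) →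
               Dec (AffinelyIndependent points T)
      decide (inj₁ (i , x , sol)) = no (dependent i x sol)
      decide (inj₂ none)          = yes (independent none)

  slack : ℚ → (Fin d → ℚ) → Fin N → ℚ
  slack b c i = b - dot c (v i)

  sum-slack : ∀ b c (m : Fin N → ℚ) →
    sum (λ i → m i * slack b c i) ≡ b * sum m - dot c (λ j → dot (λ i → v i j) m)
  sum-slack b c m = trans
    (sum-cong-≗ (λ i → solve 3 (λ m b s → m :* (b :- s) := m :* b :+ (:- con 1ℚ) :* (m :* s)) refl (m i) b (dot c (v i))))
    (trans (∑-distrib-+ (λ i → m i * b) (λ i → - 1ℚ * (m i * dot c (v i))))
    (trans (cong₂ _+_ (trans (sym (*-distribʳ-sum b m)) (*-comm (sum m) b))
        (sym (*-distribˡ-sum (- 1ℚ) (λ i → m i * dot c (v i)))))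
      (trans (cong (λ z → b * sum m + - 1ℚ * z) swap)
        (solve 2 (λ x y → x :+ (:- con 1ℚ) :* y := x :- y) refl (b * sum m) (dot c (λ j → dot (λ i → v i j) m))))))
    where
    swap : sum (λ i → m i * dot c (v i)) ≡ dot c (λ j → dot (λ i → v i j) m)
    swap = trans (sum-cong-≗ (λ i → *-distribˡ-sum (m i) (λ j → c j * v i j)))
      (trans (∑-comm (λ i j → m i * (c j * v i j)))
      (sum-cong-≗ (λ j → trans
        (sum-cong-≗ (λ i → solve 3 (λ m c v → m :* (c :* v) := c :* (v :* m)) refl (m i) (c j) (v i j)))
        (sym (*-distribˡ-sum (c j) (λ i → v i j * m i))))))

  dot-minus : ∀ {n} (c x y : Fin n → ℚ) → dot c (λ j → x j - y j) ≡ dot c x - dot c y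
  dot-minus c x y = trans (dot-comm c (λ j → x j - y j)) (trans (dot-+ x (λ j → - y j) c)
    (cong₂ _+_ (dot-comm x c) (trans (dot-neg y c) (cong -_ (dot-comm y c)))))

  Null-deficit : ∀ b (c : Fin d → ℚ) (s : Seq) (X G : Fin d → Seq) →
    Null (λ k → 1ℚ - s k) → (∀ j → Null (λ k → G j k - X j k)) →
    Null (λ k → b * (1ℚ - s k) + dot c (λ j → G j k - X j k))
  Null-deficit b c s X G hs hG = Null-+ {f = λ k → b * (1ℚ - s k)} {g = λ k → dot c (λ j → G j k - X j k)}
    (Null-* {f = λ k → 1ℚ - s k} b hs)
    (Null-sum (λ j k → c j * (G j k - X j k)) (λ j → Null-* {f = λ k → G j k - X j k} (c j) (hG j)))

  deficit-slack : ∀ b c (m : Fin N → ℚ) (x : Fin d → ℚ) {s : ℚ} {g : Fin d → ℚ} → s ≡ sum m →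
    (∀ j → g j ≡ dot (λ i → v i j) m) →
    b * (1ℚ - s) + dot c (λ j → g j - x j) ≡ (b - dot c x) - sum (λ i → m i * slack b c i)
  deficit-slack b c m x {s} {g} s≡ g≡ = trans
    (cong₂ (λ u w → b * (1ℚ - u) + w) s≡ (trans (dot-minus c g x)
      (cong (λ z → z - dot c x) (sum-cong-≗ (λ j → cong (λ z → c j * z) (g≡ j))))))
    (trans (solve 4 (λ b s g y → b :* (con 1ℚ :- s) :+ (g :- y) := (b :- y) :- (b :* s :- g)) refl
        b (sum m) (dot c (λ j → dot (λ i → v i j) m)) (dot c x))
      (cong (λ z → (b - dot c x) - z) (sym (sum-slack b c m))))

  module _ (W : Subset N) (x : Point d) (x∈ : Conv points W x) (b : ℚ) (c : Fin d → ℚ) where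

    weight : Fin N → ℝ
    weight = proj₁ x∈

    gap : Seq
    gap k = b - dot c (λ j → seq (x j) k)

    weightedSlack : Seq
    weightedSlack k = sum (λ i → seq (weight i) k * slack b c i)

    gap≈weightedSlack : Null (λ k → gap k - weightedSlack k)
    gap≈weightedSlack = Null-resp total (Null-deficit b c (seq (sumℝ weight))
      (λ j → seq (x j)) (λ j → seq (combination points weight j))
      (≈1⇒Null (sumℝ weight) (proj₁ (proj₂ (proj₂ (proj₂ x∈)))))
      (λ j → ≈⇒Null (x j) (combination points weight j) (proj₂ (proj₂ (proj₂ (proj₂ x∈))) j)))
      where
      total : ∀ k → b * (1ℚ - seq (sumℝ weight) k) + dot c (λ j → seq (combination points weight j) k - seq (x j) k) ≡
                    gap k - weightedSlack k
      total k = deficit-slack b c (λ i → seq (weight i) k) (λ j → seq (x j) k)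
        (seq-sum weight k) (λ j → seq-combination weight j k)

    module _ (valid : ∀ i → i ∈ W → 0ℚ ≤ slack b c i) where

      term≥0 : ∀ i → NN (λ k → seq (weight i) k * slack b c i)
      term≥0 i with i ∈? W
      ... | yes i∈W = NN-resp (λ k → trans (*-comm (slack b c i) (seq (weight i) k - 0ℚ))
            (cong (_* slack b c i) (+-identityʳ (seq (weight i) k))))
          (NN-* (valid i i∈W) (≤⇒NN 0ℝ (weight i) (proj₁ (proj₂ x∈) i)))
      ... | no  i∉W = NN-resp (λ k → *-comm (slack b c i) (seq (weight i) k))
          (proj₁ (Null-* (slack b c i) (≈0⇒Null (weight i) (proj₁ (proj₂ (proj₂ x∈)) i i∉W))))

      gap≥0 : NN gap
      gap≥0 = NN-resp (λ k → solve 2 (λ g w → (g :- w) :+ w := g) refl (gap k) (weightedSlack k))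
        (NN-+ (proj₁ gap≈weightedSlack) (NN-sum (λ i k → seq (weight i) k * slack b c i) term≥0))

      gap≈0⇒weight≈0 : Null gap → ∀ i → 0ℚ < slack b c i → weight i ≈ℝ 0ℝ
      gap≈0⇒weight≈0 null i 0<s = Null⇒≈0 (weight i)
          ( NN-resp (λ k → cancel (seq (weight i) k)) (NN-* (<⇒≤ 0<s⁻) (term≥0 i))
          , NN-resp (λ k → trans (sym (neg-distribʳ-* s⁻ (seq (weight i) k * slack b c i))) (cong -_ (cancel (seq (weight i) k))))
              (NN-* (<⇒≤ 0<s⁻) (NN-sum-terms (λ i k → seq (weight i) k * slack b c i) term≥0 nonPos i)))
        where
        s⁻ = proj₁ (inv 0<s)
        0<s⁻ = proj₁ (proj₂ (inv 0<s))
        cancel : ∀ m → s⁻ * (m * slack b c i) ≡ m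
        cancel m = trans (solve 3 (λ t m s → t :* (m :* s) := m :* (s :* t)) refl s⁻ m (slack b c i))
          (trans (cong (m *_) (proj₂ (proj₂ (inv 0<s)))) (*-identityʳ m))
        nonPos : NN (λ k → - weightedSlack k)
        nonPos = NN-resp (λ k → solve 2 (λ g w → (g :- w) :+ :- g := :- w) refl (gap k) (weightedSlack k))
          (NN-+ (proj₁ gap≈weightedSlack) (proj₂ null))

    gap≈0 : (∀ i → i ∈ W → slack b c i ≡ 0ℚ) → Null gap
    gap≈0 tight = Null-resp (λ k → solve 2 (λ g w → (g :- w) :+ w := g) refl (gap k) (weightedSlack k))
        (Null-+ gap≈weightedSlack (Null-sum (λ i k → seq (weight i) k * slack b c i) term≈0))
      where
      term≈0 : ∀ i → Null (λ k → seq (weight i) k * slack b c i)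
      term≈0 i with i ∈? W
      ... | yes i∈W = Null-resp (λ k → sym (trans (cong (seq (weight i) k *_) (tight i i∈W)) (*-zeroʳ (seq (weight i) k)))) Null-0
      ... | no  i∉W = Null-resp (λ k → *-comm (slack b c i) (seq (weight i) k))
          (Null-* (slack b c i) (≈0⇒Null (weight i) (proj₁ (proj₂ (proj₂ x∈)) i i∉W)))

  basis-≢ : ∀ {n} (i k : Fin n) → i ≢ k → basis i k ≡ 0ℚ
  basis-≢ zero    zero    i≢k = contradiction refl i≢k
  basis-≢ zero    (suc k) i≢k = refl
  basis-≢ (suc i) zero    i≢k = refl
  basis-≢ (suc i) (suc k) i≢k = basis-≢ i k (i≢k ∘ cong suc)

  basis-nonNeg : ∀ {n} (i k : Fin n) → 0ℚ ≤ basis i k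
  basis-nonNeg zero    zero    = <⇒≤ (positive⁻¹ 1ℚ)
  basis-nonNeg zero    (suc k) = ≤-refl
  basis-nonNeg (suc i) zero    = ≤-refl
  basis-nonNeg (suc i) (suc k) = basis-nonNeg i k

  point∈Conv : ∀ W i → i ∈ W → Conv points W (points i)
  point∈Conv W i i∈W = μ
    , (λ k → NN⇒≤ 0ℝ (μ k) (NN-const (subst (0ℚ ≤_) (sym (+-identityʳ (basis i k))) (basis-nonNeg i k))))
    , (λ k k∉W → ≡⇒≈ (μ k) 0ℝ λ _ → basis-≢ i k λ { refl → k∉W i∈W })
    , ≡⇒≈ (sumℝ μ) 1ℝ (λ k → trans (seq-sum μ k) (trans (sum≡dot1 (basis i))
        (trans (dot-comm (λ _ → 1ℚ) (basis i)) (dot-basis i (λ _ → 1ℚ)))))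
    , λ j → ≡⇒≈ (points i j) (combination points μ j) λ k → sym (trans (seq-combination μ j k)
        (trans (dot-comm (λ i → v i j) (basis i)) (dot-basis i (λ i → v i j))))
    where
    μ : Fin N → ℝ
    μ k = fromℚ (basis i k)

  ConvexPosition : Set
  ConvexPosition = ∀ S i → Conv points S (points i) → i ∈ S

  module _ (convexPosition : ConvexPosition) (S W : Subset N) (S⊆W : S ⊆ W) where

    functionalRow : Fin N → Fin (suc d) → ℚ
    functionalRow i zero    = 1ℚ
    functionalRow i (suc j) = - v i j

    dot-functionalRow : ∀ i x → dot (functionalRow i) x ≡ slack (x zero) (x ∘ suc) i
    dot-functionalRow i x = cong₂ _+_ (*-identityˡ (x zero))
      (trans (dot-neg (v i) (x ∘ suc)) (cong -_ (dot-comm (v i) (x ∘ suc))))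

    onFace : Fin N → Fin (suc d) → ℚ
    onFace i with i ∈? S
    ... | yes _ = functionalRow i
    ... | no  _ = λ _ → 0ℚ

    onFace-∈ : ∀ i → i ∈ S → onFace i ≡ functionalRow i
    onFace-∈ i i∈S with i ∈? S
    ... | yes _  = refl
    ... | no i∉S = contradiction i∈S i∉S

    offFace : Fin N → Row (suc d)
    offFace i with i ∈? S | i ∈? W
    ... | no _ | yes _ = true , functionalRow i
    ... | _    | _     = false , λ _ → 0ℚ

    offFace-∉ : ∀ i → i ∉ S → i ∈ W → offFace i ≡ (true , functionalRow i)
    offFace-∉ i i∉S i∈W with i ∈? S | i ∈? W
    ... | yes i∈S | _     = contradiction i∈S i∉S
    ... | no _ | yes _    = refl
    ... | no _ | no i∉W   = contradiction i∈W i∉W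

    exposure : List (Row (suc d))
    exposure = system (tabulate onFace) (tabulate offFace)

    exposed : ∀ x → Solution x exposure → IsFace (Conv points S) (Conv points W)
    exposed x sol = (λ j → fromℚ (c j)) , fromℚ b
      , (λ y y∈ → NN⇒≤ ⟨ fromℚ ∘ c , y ⟩ (fromℚ b) (NN-resp (λ k → sym (gap-seq y k)) (gap≥0 W y y∈ b c valid)))
      , λ y → mk⇔
          (λ y∈S → widen y y∈S , Null⇒≈ ⟨ fromℚ ∘ c , y ⟩ (fromℚ b)
            (Null-resp (λ k → sym (gap-seq y k)) (gap≈0 S y y∈S b c tight)))
          (λ (y∈W , y≈b) → shrink y y∈W
            (gap≈0⇒weight≈0 W y y∈W b c valid (Null-resp (gap-seq y) (≈⇒Null ⟨ fromℚ ∘ c , y ⟩ (fromℚ b) y≈b))))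
      where
      b = x zero
      c = x ∘ suc
      both = system⁻ {x = x} (tabulate onFace) sol
      tight : ∀ i → i ∈ S → slack b c i ≡ 0ℚ
      tight i i∈S = trans (sym (dot-functionalRow i x)) (trans (cong (λ a → dot a x) (sym (onFace-∈ i i∈S)))
        (All.tabulate⁻ {f = onFace} (proj₁ both) i))
      strict : ∀ i → i ∉ S → i ∈ W → 0ℚ < slack b c i
      strict i i∉S i∈W = subst (0ℚ <_) (dot-functionalRow i x)
        (subst (λ r → Holds (proj₁ r) (dot (proj₂ r) x)) (offFace-∉ i i∉S i∈W)
          (All.tabulate⁻ {f = offFace} (proj₂ both) i))
      valid : ∀ i → i ∈ W → 0ℚ ≤ slack b c i
      valid i i∈W with i ∈? S
      ... | yes i∈S = ≤-reflexive (sym (tight i i∈S))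
      ... | no  i∉S = <⇒≤ (strict i i∉S i∈W)
      gap-seq : ∀ y k → b - seq ⟨ fromℚ ∘ c , y ⟩ k ≡ b - dot c (λ j → seq (y j) k)
      gap-seq y k = cong (λ z → b - z) (seq-sum (λ j → fromℚ (c j) *ℝ y j) k)
      widen : ∀ y → Conv points S y → Conv points W y
      widen y (μ , μ≥0 , sup , rest) = μ , μ≥0 , (λ i i∉W → sup i (i∉W ∘ S⊆W)) , rest
      shrink : ∀ y (y∈ : Conv points W y) → (∀ i → 0ℚ < slack b c i → proj₁ y∈ i ≈ℝ 0ℝ) → Conv points S y
      shrink y (μ , μ≥0 , sup , rest) small = μ , μ≥0 , sup′ , rest
        where
        sup′ : ∀ i → i ∉ S → μ i ≈ℝ 0ℝ
        sup′ i i∉S with i ∈? W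
        ... | yes i∈W = small i (strict i i∉S i∈W)
        ... | no  i∉W = sup i i∉W

    notExposed : (∀ X → ¬ Solutionˢ X exposure) → ¬ IsFace (Conv points S) (Conv points W)
    notExposed none (c , b , valid , face) = none X
        (systemˢ {X = X} (All.tabulate⁺ eqs) (All.tabulate⁺ ineqs))
      where
      X : Fin (suc d) → Seq
      X zero    = seq b
      X (suc j) = seq (c j)
      row : ∀ i k → seq b k - seq ⟨ c , points i ⟩ k ≡ dot (functionalRow i) (λ j → X j k)
      row i k = trans (cong (λ z → seq b k - z) (seq-sum (λ j → c j *ℝ points i j) k)) (sym (dot-functionalRow i (λ j → X j k)))
      eqs : ∀ i → Null (λ k → dot (onFace i) (λ j → X j k))
      eqs i with i ∈? S
      ... | no  _   = Null-resp (λ k → sym (dot-0 (λ j → X j k))) Null-0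
      ... | yes i∈S = Null-resp (row i) (≈⇒Null ⟨ c , points i ⟩ b
        (proj₂ (Equivalence.to (face (points i)) (point∈Conv S i i∈S))))
      ineqs : ∀ i → Holdsˢ (proj₁ (offFace i)) (λ k → dot (proj₂ (offFace i)) (λ j → X j k))
      ineqs i with i ∈? S | i ∈? W
      ... | yes _  | _      = NN-resp (λ k → sym (dot-0 (λ j → X j k))) (NN-const ≤-refl)
      ... | no _   | no _   = NN-resp (λ k → sym (dot-0 (λ j → X j k))) (NN-const ≤-refl)
      ... | no i∉S | yes i∈W = NN-resp (row i) ≤b , λ ≥b → i∉S (convexPosition S i
          (Equivalence.from (face (points i)) (point∈Conv W i i∈W , Null⇒≈ ⟨ c , points i ⟩ b
            (≤b , NN-resp (λ k → cong -_ (sym (row i k))) ≥b))))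
        where
        ≤b : NN (λ k → seq b k - seq ⟨ c , points i ⟩ k)
        ≤b = ≤⇒NN ⟨ c , points i ⟩ b (valid (points i) (point∈Conv W i i∈W))

    isFace? : Dec (IsFace (Conv points S) (Conv points W))
    isFace? = decide (solvable? exposure)
      where
      decide : (∃ λ x → Solution x exposure) ⊎ (∀ X → ¬ Solutionˢ X exposure) →
               Dec (IsFace (Conv points S) (Conv points W))
      decide (inj₁ (x , sol)) = yes (exposed x sol)
      decide (inj₂ none)      = no (notExposed none)

hasDimension? : ∀ {N d} (v : Fin N → Fin d → ℚ) S k → Dec (HasDimension (points v) S k)
hasDimension? {N} v S k = anySubset? (λ T → T ⊆? S ×-dec affinelyIndependent? v T ×-dec card T ℕ.≟ suc k) ×-dec
  map′ within exceeded (¬? (anySubset? λ T → T ⊆? S ×-dec affinelyIndependent? v T ×-dec ¬? (card T ℕ.≤? suc k)))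
  where
  TooLarge : Pred (Subset N) 0ℓ
  TooLarge T = T ⊆ S × AffinelyIndependent (points v) T × ¬ card T ℕ.≤ suc k
  within : ¬ ∃ TooLarge → ∀ T → T ⊆ S → AffinelyIndependent (points v) T → card T ℕ.≤ suc k
  within none T T⊆S ind = decidable-stable (card T ℕ.≤? suc k)
    λ large → none (T , (λ {i} → T⊆S {i}) , ind , large)
  exceeded : (∀ T → T ⊆ S → AffinelyIndependent (points v) T → card T ℕ.≤ suc k) → ¬ ∃ TooLarge
  exceeded all (T , T⊆S , ind , large) = large (all T (λ {i} → T⊆S {i}) ind)

cubeℚ : ∀ d → Fin (2 ℕ.^ d) → Fin d → ℚ
cubeℚ d i j = fromℕℚ (toℕ (finToFun {2} {d} i j))

-- The points of {0,1}^d, indexed by Fin (2 ^ d); a set W ⊆ {0,1}^d is a Subset (2 ^ d).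
cube : ∀ d → Fin (2 ℕ.^ d) → Point d
cube d i j = fromℕ (toℕ (finToFun {2} {d} i j))

funToFin-cong : ∀ {m n} {f g : Fin m → Fin n} → (∀ j → f j ≡ g j) → funToFin f ≡ funToFin g
funToFin-cong {zero}  eq = refl
funToFin-cong {suc m} eq = cong₂ combine (eq zero) (funToFin-cong (eq ∘ suc))

sum-nonNeg : ∀ {n} (f : Fin n → ℚ) → (∀ j → 0ℚ ≤ f j) → 0ℚ ≤ sum f
sum-nonNeg {zero}  f h = ≤-refl
sum-nonNeg {suc n} f h = +-mono-≤ (h zero) (sum-nonNeg (f ∘ suc) (h ∘ suc))

term≤sum : ∀ {n} (f : Fin n → ℚ) → (∀ j → 0ℚ ≤ f j) → ∀ j → f j ≤ sum f
term≤sum {suc n} f h zero    = ≤-by (sum-nonNeg (f ∘ suc) (h ∘ suc)) refl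
term≤sum {suc n} f h (suc j) = ≤-trans (term≤sum (f ∘ suc) (h ∘ suc) j)
  (≤-by (h zero) (+-comm (sum (f ∘ suc)) (f zero)))

cube-convexPosition : ∀ d → ConvexPosition (cubeℚ d)
cube-convexPosition d S i i∈Conv = decidable-stable (i ∈? S) λ i∉S → <-irrefl refl (<-≤-trans
    (subst (_< 0ℚ) (sym (solve 1 (λ x → (x :- con 1ℚ) :- x := :- con 1ℚ) refl (dot c (v i)))) (negative⁻¹ (- 1ℚ)))
    (NN-const⁻ (gap≥0 v S (points v i) i∈Conv b c (valid i∉S))))
  where
  v : Fin (2 ℕ.^ d) → Fin d → ℚ
  v = cubeℚ d
  bit : Fin (2 ℕ.^ d) → Fin d → Fin 2
  bit = finToFun {2} {d}
  value : Fin 2 → ℚ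
  value a = fromℕℚ (toℕ a)
  sign : Fin 2 → ℚ
  sign zero    = - 1ℚ
  sign (suc _) = 1ℚ
  c : Fin d → ℚ
  c j = sign (bit i j)
  b : ℚ
  b = dot c (v i) - 1ℚ
  sign-nonNeg : ∀ a a′ → 0ℚ ≤ sign a * (value a - value a′)
  sign-nonNeg zero       zero       = ≤-refl
  sign-nonNeg zero       (suc zero) = nonNegative⁻¹ 1ℚ
  sign-nonNeg (suc zero) zero       = nonNegative⁻¹ 1ℚ
  sign-nonNeg (suc zero) (suc zero) = ≤-refl
  sign-≢ : ∀ a a′ → a ≢ a′ → sign a * (value a - value a′) ≡ 1ℚ
  sign-≢ zero       zero       ≢ = contradiction refl ≢
  sign-≢ zero       (suc zero) ≢ = refl
  sign-≢ (suc zero) zero       ≢ = refl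
  sign-≢ (suc zero) (suc zero) ≢ = contradiction refl ≢
  differ : ∀ w → w ≢ i → ∃ λ j → bit i j ≢ bit w j
  differ w w≢i = decide (any-or-all λ j → toSum (bit i j Fin.≟ bit w j))
    where
    toSum : ∀ {j} → Dec (bit i j ≡ bit w j) → (bit i j ≢ bit w j) ⊎ (bit i j ≡ bit w j)
    toSum (yes p) = inj₂ p
    toSum (no ¬p) = inj₁ ¬p
    decide : (∃ λ j → bit i j ≢ bit w j) ⊎ (∀ j → bit i j ≡ bit w j) → ∃ λ j → bit i j ≢ bit w j
    decide (inj₁ e)  = e
    decide (inj₂ eq) = contradiction (trans (sym (Fin.funToFin-finToFin {d} {2} w))
      (trans (funToFin-cong {d} {2} (λ j → sym (eq j))) (Fin.funToFin-finToFin {d} {2} i))) w≢i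
  distance : ∀ w → w ≢ i → 1ℚ ≤ dot c (λ j → v i j - v w j)
  distance w w≢i = let j , bit≢ = differ w w≢i in
    subst (_≤ dot c (λ j → v i j - v w j)) (sign-≢ (bit i j) (bit w j) bit≢)
      (term≤sum (λ j → c j * (v i j - v w j)) (λ j → sign-nonNeg (bit i j) (bit w j)) j)
  valid : i ∉ S → ∀ w → w ∈ S → 0ℚ ≤ slack v b c w
  valid i∉S w w∈S = subst (0ℚ ≤_)
    (trans (cong (_- 1ℚ) (dot-minus v c (v i) (v w)))
      (solve 2 (λ x y → (x :- y) :- con 1ℚ := (x :- con 1ℚ) :- y) refl (dot c (v i)) (dot c (v w))))
    (≤⇒0≤- (distance w λ { refl → i∉S w∈S }))

-- conv S is a k-dimensional face of conv W. Every point of W is a vertex of conv W, so S ↦ conv S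
-- is injective and every face of conv W is conv S for exactly one S ⊆ W, its vertex set.
IsKFace : ∀ {d} → ℕ → Subset (2 ℕ.^ d) → Subset (2 ℕ.^ d) → Set
IsKFace {d} k W S =
  S ⊆ W × IsFace (Conv (cube d) S) (Conv (cube d) W) × HasDimension (cube d) S k

isKFace? : ∀ {d} k (W S : Subset (2 ℕ.^ d)) → Dec (IsKFace {d} k W S)
isKFace? {d} k W S = decide (S ⊆? W)
  where
  decide : Dec (S ⊆ W) → Dec (IsKFace {d} k W S)
  decide (no S⊈W)  = no λ h → S⊈W (proj₁ h)
  decide (yes S⊆W) = map′ (λ (f , h) → S⊆W , f , h) proj₂
    (isFace? (cubeℚ d) (cube-convexPosition d) S W S⊆W ×-dec hasDimension? (cubeℚ d) S k)

subsets : ∀ n → List (Subset n)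
subsets zero    = [] ∷ []
subsets (suc n) = map (inside ∷_) (subsets n) ++ map (outside ∷_) (subsets n)

-- f_k(conv W), the faces being counted through their vertex sets.
faceNumber : ∀ {d} → ℕ → Subset (2 ℕ.^ d) → ℕ
faceNumber {d} k W = length (filter (isKFace? {d} k W) (subsets (2 ℕ.^ d)))

-- m / n, with the junk value 0 at n = 0.
ratio : ℕ → ℕ → ℚ
ratio m zero      = 0ℚ
ratio m n@(suc _) = + m / n

-- The denominator is nonzero exactly when W has at least k + 1 points.
faceDensity : ∀ {d} → ℕ → Subset (2 ℕ.^ d) → ℚ
faceDensity {d} k W = ratio (faceNumber {d} k W) (card W C suc k)

-- The arithmetic mean, with the junk value 0 for the empty list.
mean : List ℚ → ℚ
mean []          = 0ℚ
mean qs@(_ ∷ _)  = foldr _+_ 0ℚ qs * (+ 1 / length qs)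

-- Expectation for W uniform among the n-element subsets of {0,1}^d; there are such W iff n ≤ 2^d.
expectedFaceDensity : (d n k : ℕ) → ℚ
expectedFaceDensity d n k =
  mean (map (faceDensity {d} k) (filter (λ W → card W ℕ.≟ n) (subsets (2 ℕ.^ d))))

TendsToZero : (ℕ → ℚ) → Set
TendsToZero f = ∀ δ → 0ℚ < δ → ∃ λ D → ∀ d → D ℕ.≤ d → ∣ f d ∣ ≤ δ

-- Binary entropy at rational arguments 0 < ξ < 1; only the values h (i/r) are ever needed.
h : (ξ : ℚ) → .{{Positive ξ}} → .{{Positive (1ℚ - ξ)}} → ℝ
h ξ {{pos}} {{pos′}} =
  fromℚ ξ *ℝ log ((1/ ξ) {{pos⇒nonZero ξ}}) {{1/pos⇒pos ξ}} +ℝ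
  fromℚ (1ℚ - ξ) *ℝ log ((1/ (1ℚ - ξ)) {{pos⇒nonZero (1ℚ - ξ)}}) {{1/pos⇒pos (1ℚ - ξ)}}

module _ {r} (i : Fin r) where

  -- (i + 1)/(r + 1) for 0 ≤ i < r; in H below, i/r for 1 ≤ i ≤ r − 1.
  fraction : ℚ
  fraction = + suc (toℕ i) / suc r

  fraction-pos : Positive fraction
  fraction-pos = normalize-pos (suc (toℕ i)) (suc r)

  fraction<1 : fraction < 1ℚ
  fraction<1 = *-cancelʳ-<-nonNeg (fromℕℚ (suc r)) {{ℚ.nonNegative (fromℕℚ-nonNeg (suc r))}} {fraction} {1ℚ}
    (subst₂ _<_ (sym (/-* (+ suc (toℕ i)) (suc r))) (sym (*-identityˡ (fromℕℚ (suc r))))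
      (≰⇒> λ le → ℕ.<⇒≱ (s≤s (Fin.toℕ<n i)) (fromℕℚ-cancel-≤ {suc r} {suc (toℕ i)} le)))

  1-fraction-pos : Positive (1ℚ - fraction)
  1-fraction-pos = ℚ.positive (<⇒0<- {fraction} {1ℚ} fraction<1)

2^r∸2-nonZero : ∀ r → NonZero (2 ℕ.^ 2+ r ℕ.∸ 2)
2^r∸2-nonZero r = ℕ.>-nonZero (ℕ.m<n⇒0<n∸m (ℕ.^-monoʳ-< 2 (s≤s (s≤s z≤n)) {1} {2+ r} (s≤s (s≤s z≤n))))

H : (r : ℕ) → .{{NonTrivial r}} → ℝ
H r@(2+ m) = fromℚ ((+ 1 / (2 ℕ.^ r ℕ.∸ 2)) {{2^r∸2-nonZero m}}) *ℝ
  sumℝ λ (i : Fin (suc m)) →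
    fromℕ (r C suc (toℕ i)) *ℝ h (fraction i) {{fraction-pos i}} {{1-fraction-pos i}}

τ : (k : ℕ) → .{{NonZero k}} → ℝ
τ k@(suc _) = 1ℝ -ℝ fromℚ (1ℚ - (+ 1 / (2 ℕ.^ k)) {{ℕ.m^n≢0 2 k}}) *ℝ H (suc k)

{-# OPTIONS --safe #-}
-- Write r = k + 1 and read r points of the cube as the rows of an r × d matrix with columns in {0,1}^r. By Chebyshev's
-- inequality almost every r-set T is typical: each column type occurs about d/2^r times. A typical T is affinely
-- independent and contains every point of the cube in its affine hull, so the only k-face it can span is conv T.
-- The likelihood of y ∈ {0,1}^d is ∏ⱼ #{rows of T agreeing with y in column j}; the likelihoods sum to r^d, and the rows
-- of T have likelihood about Λ^(d/2^r), where r^(2^r)/Λ = 2^(2^r (1 − τ)).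
--
-- Below the threshold: by Markov's inequality at most 2^((1 − τ) d + o(d)) points are as likely as the rows of T, so almost
-- surely W contains none of them outside T, and the logarithm of the likelihood, which is affine in y, exposes conv T.
--
-- Above the threshold: rotating each column of the matrix independently keeps the barycentre of its rows, so a closed
-- halfspace with T on its boundary contains a row of each of the r^d rotated matrices. A point is a row of at most as many
-- of these as its likelihood, so the halfspace contains 2^((1 − τ) d − o(d)) points of the cube. If conv T is a face of
-- conv W, then W avoids all of them but T. A halfspace is determined by its Chow parameters, for which there are
-- (2^d + 1)^(d + 1) possibilities, and a union bound over these finishes the proof.
module Submission where

module Logarithms where

  open import Data.Nat.Base as ℕ using (ℕ; zero; suc; NonZero; z≤n; s≤s)
  import Data.Nat.Properties as ℕ
  open import Data.Nat.Combinatorics using (_C_)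
  open import Data.Nat.Logarithm using (⌊log₂_⌋)
  open import Data.Nat.Tactic.RingSolver using (solve-∀)
  open import Data.Integer.Base using (+_)
  open import Data.Rational.Base as ℚ
    using (ℚ; mkℚ; 0ℚ; 1ℚ; ½; _+_; _*_; -_; _-_; _≤_; _<_; _/_; 1/_; ↥_; ↧ₙ_; Positive)
  open import Data.Rational.Properties
  open import Data.Rational.Solver using (module +-*-Solver)
  open +-*-Solver using (solve; con; _:+_; _:*_; _:-_; :-_; _:=_)
  open import Data.Fin.Base using (Fin; zero; suc; toℕ)
  import Data.Fin.Properties as Fin
  open import Data.Product.Base using (∃; _×_; _,_; proj₁; proj₂)
  open import Function.Base using (_∘_)
  open import Relation.Binary.PropositionalEquality
  open import Algebra.Bundles using (CommutativeRing)
  open import Algebra.Properties.CommutativeSemiring.Exp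
    (CommutativeRing.commutativeSemiring +-*-commutativeRing)
    using (_^_; ^-homo-*; ^-assocʳ; ^-distrib-*)
  open import Algebra.Properties.Semiring.Sum (CommutativeRing.semiring +-*-commutativeRing)
    using (sum; sum-cong-≗; ∑-distrib-+; *-distribˡ-sum)
  open import Defs renaming (h to entropy)

  ^-mono-< : ∀ {x y} n .{{_ : NonZero n}} → 0ℚ ≤ x → x < y → x ^ n < y ^ n
  ^-mono-< {x} {y} (suc n) 0≤x x<y = ≤-<-trans
    (*-monoˡ-≤-nonNeg x {{ℚ.nonNegative 0≤x}} (^-mono-≤ n 0≤x (<⇒≤ x<y)))
    (*-monoˡ-<-pos (y ^ n) {{ℚ.positive (^-pos n (≤-<-trans 0≤x x<y))}} x<y)

  root-≤ : ∀ {x y} n .{{_ : NonZero n}} → 0ℚ ≤ y → x ^ n ≤ y ^ n → x ≤ y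
  root-≤ n 0≤y h = ≮⇒≥ λ y<x → <-irrefl refl (<-≤-trans (^-mono-< n 0≤y y<x) h)

  -- x ⊑ q says x ≤ 2^q: writing q = (a − b)/c, it reads xᶜ · 2ᵇ ≤ 2ᵃ.
  infix 4 _⊑_
  record _⊑_ (x q : ℚ) : Set where
    constructor mk⊑
    field
      nonNeg : 0ℚ ≤ x
      c a b  : ℕ
      c≢0    : NonZero c
      rep    : fromℕℚ c * q ≡ fromℕℚ a - fromℕℚ b
      bound  : x ^ c * 2ℚ ^ b ≤ 2ℚ ^ a
  open _⊑_ using (nonNeg)

  private
    power : ∀ x c b n → (x ^ c * 2ℚ ^ b) ^ n ≡ x ^ (c ℕ.* n) * 2ℚ ^ (b ℕ.* n)
    power x c b n = trans (^-distrib-* (x ^ c) (2ℚ ^ b) n) (cong₂ _*_ (^-assocʳ x c n) (^-assocʳ 2ℚ b n))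

    raise : ∀ {x} c a b n → 0ℚ ≤ x → x ^ c * 2ℚ ^ b ≤ 2ℚ ^ a → x ^ (c ℕ.* n) * 2ℚ ^ (b ℕ.* n) ≤ 2ℚ ^ (a ℕ.* n)
    raise {x} c a b n 0≤x h = subst₂ _≤_ (power x c b n) (^-assocʳ 2ℚ a n)
      (^-mono-≤ n (*-nonNeg (^-nonNeg c 0≤x) (<⇒≤ (^-pos b 0<2))) h)

    compare : ∀ {x p q} (p⊑ : x ⊑ p) → p ≤ q → ∀ c′ a′ b′ → fromℕℚ c′ * q ≡ fromℕℚ a′ - fromℕℚ b′ →
      x ^ (_⊑_.c p⊑ ℕ.* c′) * 2ℚ ^ (b′ ℕ.* _⊑_.c p⊑) ≤ 2ℚ ^ (a′ ℕ.* _⊑_.c p⊑)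
    compare {x} {p} {q} (mk⊑ 0≤x c a b _ rep h) p≤q c′ a′ b′ rep′ =
        *-cancel-≤ (^-pos (b ℕ.* c′) 0<2) (begin
          x ^ (c ℕ.* c′) * 2ℚ ^ (b′ ℕ.* c) * 2ℚ ^ (b ℕ.* c′)
            ≡⟨ solve 3 (λ x y z → x :* y :* z := x :* z :* y) refl (x ^ (c ℕ.* c′)) (2ℚ ^ (b′ ℕ.* c)) (2ℚ ^ (b ℕ.* c′)) ⟩
          x ^ (c ℕ.* c′) * 2ℚ ^ (b ℕ.* c′) * 2ℚ ^ (b′ ℕ.* c)
            ≤⟨ *-monoʳ-≤-nonNeg (2ℚ ^ (b′ ℕ.* c)) {{ℚ.nonNegative (<⇒≤ (^-pos (b′ ℕ.* c) 0<2))}} (raise c a b c′ 0≤x h) ⟩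
          2ℚ ^ (a ℕ.* c′) * 2ℚ ^ (b′ ℕ.* c)
            ≡⟨ ^-homo-* 2ℚ (a ℕ.* c′) (b′ ℕ.* c) ⟨
          2ℚ ^ (a ℕ.* c′ ℕ.+ b′ ℕ.* c)
            ≤⟨ 2^-mono exponents≤ ⟩
          2ℚ ^ (a′ ℕ.* c ℕ.+ b ℕ.* c′)
            ≡⟨ ^-homo-* 2ℚ (a′ ℕ.* c) (b ℕ.* c′) ⟩
          2ℚ ^ (a′ ℕ.* c) * 2ℚ ^ (b ℕ.* c′) ∎)
      where
      open ≤-Reasoning
      sides : ∀ i j k l → fromℕℚ (i ℕ.* j ℕ.+ k ℕ.* l) ≡ fromℕℚ i * fromℕℚ j + fromℕℚ k * fromℕℚ l
      sides i j k l = trans (fromℕℚ-+ (i ℕ.* j) (k ℕ.* l)) (cong₂ _+_ (fromℕℚ-* i j) (fromℕℚ-* k l))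
      exponents≤ : a ℕ.* c′ ℕ.+ b′ ℕ.* c ℕ.≤ a′ ℕ.* c ℕ.+ b ℕ.* c′
      exponents≤ = fromℕℚ-cancel-≤ (subst₂ _≤_ (sym (sides a c′ b′ c)) (sym (sides a′ c b c′))
        (≤-by (*-nonNeg (*-nonNeg (fromℕℚ-nonNeg c) (fromℕℚ-nonNeg c′)) (≤⇒0≤- p≤q))
          (trans (solve 6 (λ A B′ C C′ p q → (A :* C′ :+ B′ :* C) :+ C :* C′ :* (q :- p) :=
              (A :* C′ :+ B′ :* C) :+ (C :* (C′ :* q) :- C′ :* (C :* p))) refl
              (fromℕℚ a) (fromℕℚ b′) (fromℕℚ c) (fromℕℚ c′) p q)
            (trans (cong₂ (λ u v → (fromℕℚ a * fromℕℚ c′ + fromℕℚ b′ * fromℕℚ c) + (fromℕℚ c * u - fromℕℚ c′ * v)) rep′ rep)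
              (solve 6 (λ A B A′ B′ C C′ → (A :* C′ :+ B′ :* C) :+ (C :* (A′ :- B′) :- C′ :* (A :- B)) := A′ :* C :+ B :* C′) refl
                (fromℕℚ a) (fromℕℚ b) (fromℕℚ a′) (fromℕℚ b′) (fromℕℚ c) (fromℕℚ c′))))))

    denominator-rep : ∀ q → fromℕℚ (↧ₙ q) * q ≡ fromℕℚ ((↥ q) ⁺) - fromℕℚ ((↥ q) ⁻)
    denominator-rep q = trans (*-comm (fromℕℚ (↧ₙ q)) q)
      (trans (cong (_* fromℕℚ (↧ₙ q)) (sym (↥p/↧p≡p q))) (trans (/-* (↥ q) (↧ₙ q)) (⁺-⁻ (↥ q))))

  ⊑-integral : ∀ {x p} → x ⊑ p → ∀ a b → p ≤ fromℕℚ a - fromℕℚ b → x * 2ℚ ^ b ≤ 2ℚ ^ a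
  ⊑-integral {x} {p} p⊑ a b p≤ = root-≤ c {{_⊑_.c≢0 p⊑}} (<⇒≤ (^-pos a 0<2)) (subst₂ _≤_
      (trans (cong (λ n → x ^ n * 2ℚ ^ (b ℕ.* c)) (ℕ.*-identityʳ c)) (sym (trans (^-distrib-* x (2ℚ ^ b) c) (cong (x ^ c *_) (^-assocʳ 2ℚ b c)))))
      (sym (^-assocʳ 2ℚ a c))
      (compare p⊑ p≤ 1 a b (*-identityˡ _)))
    where c = _⊑_.c p⊑

  ⊑-≤ : ∀ {x y p} → 0ℚ ≤ x → x ≤ y → y ⊑ p → x ⊑ p
  ⊑-≤ 0≤x x≤y (mk⊑ 0≤y c a b c≢0 rep h) = mk⊑ 0≤x c a b c≢0 rep
    (≤-trans (*-monoʳ-≤-nonNeg (2ℚ ^ b) {{ℚ.nonNegative (<⇒≤ (^-pos b 0<2))}} (^-mono-≤ c 0≤x x≤y)) h)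

  ⊑-* : ∀ {x y p q} → x ⊑ p → y ⊑ q → x * y ⊑ p + q
  ⊑-* {x} {y} {p} {q} (mk⊑ 0≤x c a b c≢0 rep h) (mk⊑ 0≤y c′ a′ b′ c′≢0 rep′ h′) =
    mk⊑ (*-nonNeg 0≤x 0≤y) (c ℕ.* c′) (a ℕ.* c′ ℕ.+ a′ ℕ.* c) (b ℕ.* c′ ℕ.+ b′ ℕ.* c) (ℕ.m*n≢0 c c′ {{c≢0}} {{c′≢0}})
      (trans (cong (_* (p + q)) (fromℕℚ-* c c′))
        (trans (solve 4 (λ c c′ p q → c :* c′ :* (p :+ q) := c′ :* (c :* p) :+ c :* (c′ :* q)) refl (fromℕℚ c) (fromℕℚ c′) p q)
          (trans (cong₂ (λ u v → fromℕℚ c′ * u + fromℕℚ c * v) rep rep′)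
            (trans (solve 6 (λ c c′ a b a′ b′ → c′ :* (a :- b) :+ c :* (a′ :- b′) := (a :* c′ :+ a′ :* c) :- (b :* c′ :+ b′ :* c)) refl
                (fromℕℚ c) (fromℕℚ c′) (fromℕℚ a) (fromℕℚ b) (fromℕℚ a′) (fromℕℚ b′))
              (sym (cong₂ _-_ (sides a a′) (sides b b′)))))))
      (subst₂ _≤_ (trans (solve 4 (λ x u y v → x :* u :* (y :* v) := x :* y :* (u :* v)) refl (x ^ (c ℕ.* c′)) (2ℚ ^ (b ℕ.* c′)) (y ^ (c′ ℕ.* c)) (2ℚ ^ (b′ ℕ.* c)))
          (cong₂ _*_ (trans (cong (λ n → x ^ (c ℕ.* c′) * y ^ n) (ℕ.*-comm c′ c)) (sym (^-distrib-* x y (c ℕ.* c′)))) (sym (^-homo-* 2ℚ (b ℕ.* c′) (b′ ℕ.* c)))))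
        (sym (^-homo-* 2ℚ (a ℕ.* c′) (a′ ℕ.* c)))
        (*-mono-≤ (*-nonNeg (^-nonNeg (c ℕ.* c′) 0≤x) (<⇒≤ (^-pos (b ℕ.* c′) 0<2))) (<⇒≤ (^-pos (a′ ℕ.* c) 0<2)) (raise c a b c′ 0≤x h) (raise c′ a′ b′ c 0≤y h′)))
    where
    sides : ∀ a a′ → fromℕℚ (a ℕ.* c′ ℕ.+ a′ ℕ.* c) ≡ fromℕℚ a * fromℕℚ c′ + fromℕℚ a′ * fromℕℚ c
    sides a a′ = trans (fromℕℚ-+ (a ℕ.* c′) (a′ ℕ.* c)) (cong₂ _+_ (fromℕℚ-* a c′) (fromℕℚ-* a′ c))

  1⊑0 : 1ℚ ⊑ 0ℚ
  1⊑0 = mk⊑ (<⇒≤ (positive⁻¹ 1ℚ)) 1 0 0 _ refl ≤-refl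

  ⊑-resp : ∀ {x y p q} → x ≡ y → p ≡ q → x ⊑ p → y ⊑ q
  ⊑-resp refl refl h = h

  ⊑-^ : ∀ {x p} n → x ⊑ p → x ^ n ⊑ fromℕℚ n * p
  ⊑-^ {x} {p} zero    h = ⊑-resp refl (sym (*-zeroˡ p)) 1⊑0
  ⊑-^ {x} {p} (suc n) h = ⊑-resp refl (trans (solve 2 (λ p n → p :+ n :* p := (con 1ℚ :+ n) :* p) refl p (fromℕℚ n)) (cong (_* p) (sym (fromℕℚ-+ 1 n)))) (⊑-* h (⊑-^ n h))

  prod : ∀ {n} → (Fin n → ℚ) → ℚ
  prod {zero}  f = 1ℚ
  prod {suc n} f = f zero * prod (f ∘ suc)

  ⊑-prod : ∀ {n} (x p : Fin n → ℚ) → (∀ i → x i ⊑ p i) → prod x ⊑ sum p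
  ⊑-prod {zero}  x p h = 1⊑0
  ⊑-prod {suc n} x p h = ⊑-* (h zero) (⊑-prod (x ∘ suc) (p ∘ suc) (h ∘ suc))

  ≤2^⇒⊑ : ∀ {e q} → 0ℚ ≤ e → e ≤2^ q → e ⊑ q
  ≤2^⇒⊑ {e} {q} 0≤e h = mk⊑ 0≤e (↧ₙ q) ((↥ q) ⁺) ((↥ q) ⁻) _ (denominator-rep q) h

  inverse-≤ : ∀ {u w s t} → 0ℚ ≤ w → w * s ≡ 1ℚ → u * t ≡ 1ℚ → 0ℚ ≤ u → t ≤ s → w ≤ u
  inverse-≤ {u} {w} {s} {t} 0≤w ws ut 0≤u t≤s = subst₂ _≤_
    (trans (solve 3 (λ u w t → u :* w :* t := w :* (u :* t)) refl u w t) (trans (cong (w *_) ut) (*-identityʳ w)))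
    (trans (solve 3 (λ u w s → u :* w :* s := u :* (w :* s)) refl u w s) (trans (cong (u *_) ws) (*-identityʳ u)))
    (*-monoˡ-≤-nonNeg (u * w) {{ℚ.nonNegative (*-nonNeg 0≤u 0≤w)}} t≤s)

  inverse-^ : ∀ {e e′} n → e * e′ ≡ 1ℚ → e ^ n * e′ ^ n ≡ 1ℚ
  inverse-^ {e} {e′} n eq = trans (sym (^-distrib-* e e′ n)) (trans (cong (_^ n) eq) (1^ n))
    where
    1^ : ∀ n → 1ℚ ^ n ≡ 1ℚ
    1^ zero    = refl
    1^ (suc n) = trans (*-identityˡ (1ℚ ^ n)) (1^ n)

  ≥2^⇒⊑ : ∀ {e e′ q} → 0ℚ ≤ e → 0ℚ ≤ e′ → e * e′ ≡ 1ℚ → ∀ c a b .{{_ : NonZero c}} →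
    fromℕℚ c * q ≡ fromℕℚ a - fromℕℚ b → 2ℚ ^ a ≤ e ^ c * 2ℚ ^ b → e′ ⊑ - q
  ≥2^⇒⊑ {e} {e′} {q} 0≤e 0≤e′ ee′ c a b rep h = mk⊑ 0≤e′ c b a (ℕ.≢-nonZero (ℕ.≢-nonZero⁻¹ c))
    (trans (solve 2 (λ c q → c :* (:- q) := :- (c :* q)) refl (fromℕℚ c) q)
      (trans (cong -_ rep) (solve 2 (λ a b → :- (a :- b) := b :- a) refl (fromℕℚ a) (fromℕℚ b))))
    (≤-trans (*-monoˡ-≤-nonNeg (e′ ^ c) {{ℚ.nonNegative (^-nonNeg c 0≤e′)}} h) (≤-reflexive
      (trans (sym (*-assoc (e′ ^ c) (e ^ c) (2ℚ ^ b))) (trans (cong (_* 2ℚ ^ b) (trans (*-comm (e′ ^ c) (e ^ c)) (inverse-^ c ee′))) (*-identityˡ (2ℚ ^ b))))))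

  fromℕℚ-^ : ∀ a n → fromℕℚ (a ℕ.^ n) ≡ fromℕℚ a ^ n
  fromℕℚ-^ a zero    = refl
  fromℕℚ-^ a (suc n) = trans (fromℕℚ-* a (a ℕ.^ n)) (cong (fromℕℚ a *_) (fromℕℚ-^ a n))

  logℕ-upper : ∀ a .{{_ : NonZero a}} j → fromℕℚ a ⊑ seq (logℕ a) j + 1/suc j
  logℕ-upper a j = mk⊑ (fromℕℚ-nonNeg a) (suc j) (suc L) 0 _
      (trans (*-comm (fromℕℚ (suc j)) _) (trans (*-distribʳ-+ (fromℕℚ (suc j)) (+ L / suc j) (1/suc j))
        (trans (cong₂ _+_ (/-* (+ L) (suc j)) (1/suc-* j)) (trans (+-comm (fromℕℚ L) 1ℚ) (trans (sym (fromℕℚ-+ 1 L)) (sym (+-identityʳ _)))))))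
      (subst₂ _≤_ (trans (fromℕℚ-^ a (suc j)) (sym (*-identityʳ _))) (fromℕℚ-^ 2 (suc L)) (fromℕℚ-mono-≤ (ℕ.<⇒≤ (<2^1+⌊log₂⌋ (a ℕ.^ suc j)))))
    where L = ⌊log₂ a ℕ.^ suc j ⌋

  logℕ-lower : ∀ a .{{_ : NonZero a}} {a′} → 0ℚ ≤ a′ → fromℕℚ a * a′ ≡ 1ℚ → ∀ j → a′ ⊑ - seq (logℕ a) j
  logℕ-lower a 0≤a′ aa′ j = ≥2^⇒⊑ (fromℕℚ-nonNeg a) 0≤a′ aa′ (suc j) L 0
      (trans (*-comm (fromℕℚ (suc j)) _) (trans (/-* (+ L) (suc j)) (sym (+-identityʳ _))))
      (subst₂ _≤_ (fromℕℚ-^ 2 L) (trans (fromℕℚ-^ a (suc j)) (sym (*-identityʳ _))) (fromℕℚ-mono-≤ (2^⌊log₂⌋≤ (a ℕ.^ suc j) {{ℕ.m^n≢0 a (suc j)}})))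
    where L = ⌊log₂ a ℕ.^ suc j ⌋

  log-upper : ∀ x .{{_ : Positive x}} j → x ⊑ seq (log x) j + 1/suc j
  log-upper x@(mkℚ (+ suc a) b _) j = ⊑-resp
    numerator
    (solve 3 (λ p q i → (p :+ i) :+ (:- q) := (p :- q) :+ i) refl (seq (logℕ (suc a)) j) (seq (logℕ (suc b)) j) (1/suc j))
    (⊑-* (logℕ-upper (suc a) j) (logℕ-lower (suc b) (<⇒≤ (0<1/suc b)) (trans (*-comm (fromℕℚ (suc b)) (1/suc b)) (1/suc-* b)) j))
    where
    numerator : fromℕℚ (suc a) * 1/suc b ≡ x
    numerator = trans (cong (_* 1/suc b) (sym (trans (cong (_* fromℕℚ (suc b)) (sym (↥p/↧p≡p x))) (/-* (+ suc a) (suc b)))))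
      (trans (*-assoc x (fromℕℚ (suc b)) (1/suc b)) (trans (cong (x *_) (trans (*-comm (fromℕℚ (suc b)) (1/suc b)) (1/suc-* b))) (*-identityʳ x)))

  log-lower : ∀ x .{{_ : Positive x}} {y} → x * y ≡ 1ℚ → ∀ j → y ⊑ - seq (log x) j + 1/suc j
  log-lower x@(mkℚ (+ suc a) b _) {y} xy j = ⊑-resp (unique y xy)
    (solve 3 (λ p q i → (q :+ i) :+ (:- p) := :- (p :- q) :+ i) refl (seq (logℕ (suc a)) j) (seq (logℕ (suc b)) j) (1/suc j))
    (⊑-* (logℕ-upper (suc b) j) (logℕ-lower (suc a) (<⇒≤ (0<1/suc a)) (trans (*-comm (fromℕℚ (suc a)) (1/suc a)) (1/suc-* a)) j))
    where
    unique : ∀ y → x * y ≡ 1ℚ → fromℕℚ (suc b) * 1/suc a ≡ y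
    unique y xy = trans (sym (*-identityʳ (fromℕℚ (suc b) * 1/suc a))) (trans (cong (fromℕℚ (suc b) * 1/suc a *_) (sym xy))
      (trans (solve 4 (λ b a x y → b :* a :* (x :* y) := x :* b :* a :* y) refl (fromℕℚ (suc b)) (1/suc a) x y)
        (trans (cong (λ z → z * 1/suc a * y) (trans (cong (_* fromℕℚ (suc b)) (sym (↥p/↧p≡p x))) (/-* (+ suc a) (suc b))))
          (trans (cong (_* y) (trans (*-comm (fromℕℚ (suc a)) (1/suc a)) (1/suc-* a))) (*-identityˡ y)))))

  prodℕ : ∀ {n} → (Fin n → ℕ) → ℕ
  prodℕ {zero}  f = 1
  prodℕ {suc n} f = f zero ℕ.* prodℕ (f ∘ suc)

  prod-cong : ∀ {n} {f g : Fin n → ℚ} → (∀ i → f i ≡ g i) → prod f ≡ prod g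
  prod-cong {zero}  h = refl
  prod-cong {suc n} h = cong₂ _*_ (h zero) (prod-cong (h ∘ suc))

  prod-* : ∀ {n} (f g : Fin n → ℚ) → prod (λ i → f i * g i) ≡ prod f * prod g
  prod-* {zero}  f g = refl
  prod-* {suc n} f g = trans (cong (f zero * g zero *_) (prod-* (f ∘ suc) (g ∘ suc)))
    (solve 4 (λ a b c d → a :* b :* (c :* d) := a :* c :* (b :* d)) refl (f zero) (g zero) (prod (f ∘ suc)) (prod (g ∘ suc)))

  prod-1 : ∀ n → prod {n} (λ _ → 1ℚ) ≡ 1ℚ
  prod-1 zero    = refl
  prod-1 (suc n) = trans (*-identityˡ _) (prod-1 n)

  fromℕℚ-prod : ∀ {n} (f : Fin n → ℕ) → fromℕℚ (prodℕ f) ≡ prod (λ i → fromℕℚ (f i))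
  fromℕℚ-prod {zero}  f = refl
  fromℕℚ-prod {suc n} f = trans (fromℕℚ-* (f zero) _) (cong (fromℕℚ (f zero) *_) (fromℕℚ-prod (f ∘ suc)))

  module Entropies (k′ : ℕ) where

    k r R : ℕ
    k = suc k′
    r = suc k
    R = 2 ℕ.^ r

    Cᵢ A B : Fin k → ℕ
    Cᵢ i = r C suc (toℕ i)
    A i = suc (toℕ i)
    B i = r ℕ.∸ A i

    A+B : ∀ i → fromℕℚ (A i) + fromℕℚ (B i) ≡ fromℕℚ r
    A+B i = trans (sym (fromℕℚ-+ (A i) (B i))) (cong fromℕℚ (ℕ.m+[n∸m]≡n (ℕ.≤-trans (Fin.toℕ<n i) (ℕ.n≤1+n k))))

    module _ (i : Fin k) where

      private
        ξ = fraction i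
        ρ = fromℕℚ r
        instance
          pos  = fraction-pos i
          pos′ = 1-fraction-pos i

      p q : ℚ
      p = (1/ ξ) {{pos⇒nonZero ξ}}
      q = (1/ (1ℚ - ξ)) {{pos⇒nonZero (1ℚ - ξ)}}

      hᵢ : ℕ → ℚ
      hᵢ j = seq (entropy ξ) j

      private
        pξ : p * ξ ≡ 1ℚ
        pξ = *-inverseˡ ξ {{pos⇒nonZero ξ}}
        qξ : q * (1ℚ - ξ) ≡ 1ℚ
        qξ = *-inverseˡ (1ℚ - ξ) {{pos⇒nonZero (1ℚ - ξ)}}
        ξρ : ξ * ρ ≡ fromℕℚ (A i)
        ξρ = /-* (+ A i) r
        ξρ′ : (1ℚ - ξ) * ρ ≡ fromℕℚ (B i)
        ξρ′ = trans (solve 2 (λ x p → (con 1ℚ :- x) :* p := p :- x :* p) refl ξ ρ) (trans (cong₂ _-_ (sym (A+B i)) ξρ)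
          (solve 2 (λ a b → (a :+ b) :- a := b) refl (fromℕℚ (A i)) (fromℕℚ (B i))))
        ℓ ℓ′ : ℕ → ℚ
        ℓ j  = seq (log p {{1/pos⇒pos ξ}}) j
        ℓ′ j = seq (log q {{1/pos⇒pos (1ℚ - ξ)}}) j

      X Y : ℚ
      X = p ^ A i * q ^ B i
      Y = ξ ^ A i * (1ℚ - ξ) ^ B i

      X⊑ : ∀ j → X ⊑ ρ * hᵢ j + ρ * 1/suc j
      X⊑ j = ⊑-resp refl (begin
          fromℕℚ (A i) * (ℓ j + 1/suc j) + fromℕℚ (B i) * (ℓ′ j + 1/suc j)
            ≡⟨ solve 5 (λ a b l l′ i → a :* (l :+ i) :+ b :* (l′ :+ i) := (a :* l :+ b :* l′) :+ (a :+ b) :* i) refl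
                 (fromℕℚ (A i)) (fromℕℚ (B i)) (ℓ j) (ℓ′ j) (1/suc j) ⟩
          (fromℕℚ (A i) * ℓ j + fromℕℚ (B i) * ℓ′ j) + (fromℕℚ (A i) + fromℕℚ (B i)) * 1/suc j
            ≡⟨ cong₂ (λ u v → u + v * 1/suc j) (trans (cong₂ (λ a b → a * ℓ j + b * ℓ′ j) (sym ξρ) (sym ξρ′))
                 (solve 5 (λ x y p l l′ → (x :* p) :* l :+ (y :* p) :* l′ := p :* (x :* l :+ y :* l′)) refl ξ (1ℚ - ξ) ρ (ℓ j) (ℓ′ j))) (A+B i) ⟩
          ρ * (ξ * ℓ j + (1ℚ - ξ) * ℓ′ j) + ρ * 1/suc j ∎)
        (⊑-* (⊑-^ (A i) (log-upper p {{1/pos⇒pos ξ}} j)) (⊑-^ (B i) (log-upper q {{1/pos⇒pos (1ℚ - ξ)}} j)))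
        where open ≡-Reasoning

      Y⊑ : ∀ j → Y ⊑ - (ρ * hᵢ j) + ρ * 1/suc j
      Y⊑ j = ⊑-resp refl (begin
          fromℕℚ (A i) * (- ℓ j + 1/suc j) + fromℕℚ (B i) * (- ℓ′ j + 1/suc j)
            ≡⟨ solve 5 (λ a b l l′ i → a :* (:- l :+ i) :+ b :* (:- l′ :+ i) := :- (a :* l :+ b :* l′) :+ (a :+ b) :* i) refl
                 (fromℕℚ (A i)) (fromℕℚ (B i)) (ℓ j) (ℓ′ j) (1/suc j) ⟩
          - (fromℕℚ (A i) * ℓ j + fromℕℚ (B i) * ℓ′ j) + (fromℕℚ (A i) + fromℕℚ (B i)) * 1/suc j
            ≡⟨ cong₂ (λ u v → - u + v * 1/suc j) (trans (cong₂ (λ a b → a * ℓ j + b * ℓ′ j) (sym ξρ) (sym ξρ′))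
                 (solve 5 (λ x y p l l′ → (x :* p) :* l :+ (y :* p) :* l′ := p :* (x :* l :+ y :* l′)) refl ξ (1ℚ - ξ) ρ (ℓ j) (ℓ′ j))) (A+B i) ⟩
          - (ρ * (ξ * ℓ j + (1ℚ - ξ) * ℓ′ j)) + ρ * 1/suc j ∎)
        (⊑-* (⊑-^ (A i) (log-lower p {{1/pos⇒pos ξ}} pξ j)) (⊑-^ (B i) (log-lower q {{1/pos⇒pos (1ℚ - ξ)}} qξ j)))
        where open ≡-Reasoning

      XY : X * Y ≡ 1ℚ
      XY = trans (solve 4 (λ a b c d → a :* b :* (c :* d) := (a :* c) :* (b :* d)) refl (p ^ A i) (q ^ B i) (ξ ^ A i) ((1ℚ - ξ) ^ B i))
        (cong₂ _*_ (inverse-^ {p} {ξ} (A i) pξ) (inverse-^ {q} {1ℚ - ξ} (B i) qξ))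

      X*counts : X * fromℕℚ (A i ℕ.^ A i ℕ.* B i ℕ.^ B i) ≡ fromℕℚ (r ℕ.^ r)
      X*counts = begin
        X * fromℕℚ (A i ℕ.^ A i ℕ.* B i ℕ.^ B i)
          ≡⟨ cong (X *_) (trans (fromℕℚ-* (A i ℕ.^ A i) (B i ℕ.^ B i)) (cong₂ _*_ (fromℕℚ-^ (A i) (A i)) (fromℕℚ-^ (B i) (B i)))) ⟩
        X * (fromℕℚ (A i) ^ A i * fromℕℚ (B i) ^ B i)
          ≡⟨ solve 4 (λ a b c d → a :* b :* (c :* d) := (a :* c) :* (b :* d)) refl (p ^ A i) (q ^ B i) (fromℕℚ (A i) ^ A i) (fromℕℚ (B i) ^ B i) ⟩
        (p ^ A i * fromℕℚ (A i) ^ A i) * (q ^ B i * fromℕℚ (B i) ^ B i)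
          ≡⟨ cong₂ _*_ (trans (sym (^-distrib-* p (fromℕℚ (A i)) (A i))) (cong (_^ A i) (scale p ξ pξ ξρ)))
               (trans (sym (^-distrib-* q (fromℕℚ (B i)) (B i))) (cong (_^ B i) (scale q (1ℚ - ξ) qξ ξρ′))) ⟩
        ρ ^ A i * ρ ^ B i
          ≡⟨ ^-homo-* ρ (A i) (B i) ⟨
        ρ ^ (A i ℕ.+ B i)
          ≡⟨ cong (ρ ^_) (ℕ.m+[n∸m]≡n (ℕ.≤-trans (Fin.toℕ<n i) (ℕ.n≤1+n k))) ⟩
        ρ ^ r
          ≡⟨ fromℕℚ-^ r r ⟨
        fromℕℚ (r ℕ.^ r) ∎
        where
        open ≡-Reasoning
        scale : ∀ p ξ {n} → p * ξ ≡ 1ℚ → ξ * ρ ≡ n → p * n ≡ ρ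
        scale p ξ pξ refl = trans (sym (*-assoc p ξ ρ)) (trans (cong (_* ρ) pξ) (*-identityˡ ρ))

    S : ℕ → ℚ
    S j = sum λ i → fromℕℚ (Cᵢ i) * hᵢ i j

    D : ℚ
    D = sum λ i → fromℕℚ (Cᵢ i) * fromℕℚ r

    P P⁻ : ℚ
    P  = prod λ i → X i ^ Cᵢ i
    P⁻ = prod λ i → Y i ^ Cᵢ i

    P⊑ : ∀ j → P ⊑ fromℕℚ r * S j + D * 1/suc j
    P⊑ j = ⊑-resp refl total (⊑-prod _ (λ i → fromℕℚ (Cᵢ i) * (fromℕℚ r * hᵢ i j + fromℕℚ r * 1/suc j)) (λ i → ⊑-^ (Cᵢ i) (X⊑ i j)))
      where
      total : sum (λ i → fromℕℚ (Cᵢ i) * (fromℕℚ r * hᵢ i j + fromℕℚ r * 1/suc j)) ≡ fromℕℚ r * S j + D * 1/suc j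
      total = trans (sum-cong-≗ (λ i → solve 4 (λ c p h e → c :* (p :* h :+ p :* e) := p :* (c :* h) :+ e :* (c :* p)) refl
          (fromℕℚ (Cᵢ i)) (fromℕℚ r) (hᵢ i j) (1/suc j)))
        (trans (∑-distrib-+ (λ i → fromℕℚ r * (fromℕℚ (Cᵢ i) * hᵢ i j)) (λ i → 1/suc j * (fromℕℚ (Cᵢ i) * fromℕℚ r)))
          (cong₂ _+_ (sym (*-distribˡ-sum (fromℕℚ r) (λ i → fromℕℚ (Cᵢ i) * hᵢ i j)))
            (trans (sym (*-distribˡ-sum (1/suc j) (λ i → fromℕℚ (Cᵢ i) * fromℕℚ r))) (*-comm (1/suc j) D))))

    P⁻⊑ : ∀ j → P⁻ ⊑ - (fromℕℚ r * S j) + D * 1/suc j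
    P⁻⊑ j = ⊑-resp refl total (⊑-prod _ (λ i → fromℕℚ (Cᵢ i) * (- (fromℕℚ r * hᵢ i j) + fromℕℚ r * 1/suc j)) (λ i → ⊑-^ (Cᵢ i) (Y⊑ i j)))
      where
      total : sum (λ i → fromℕℚ (Cᵢ i) * (- (fromℕℚ r * hᵢ i j) + fromℕℚ r * 1/suc j)) ≡ - (fromℕℚ r * S j) + D * 1/suc j
      total = trans (sum-cong-≗ (λ i → solve 4 (λ c p h e → c :* (:- (p :* h) :+ p :* e) := (:- p) :* (c :* h) :+ e :* (c :* p)) refl
          (fromℕℚ (Cᵢ i)) (fromℕℚ r) (hᵢ i j) (1/suc j)))
        (trans (∑-distrib-+ (λ i → - fromℕℚ r * (fromℕℚ (Cᵢ i) * hᵢ i j)) (λ i → 1/suc j * (fromℕℚ (Cᵢ i) * fromℕℚ r)))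
          (cong₂ _+_ (trans (sym (*-distribˡ-sum (- fromℕℚ r) (λ i → fromℕℚ (Cᵢ i) * hᵢ i j))) (sym (neg-distribˡ-* (fromℕℚ r) (S j))))
            (trans (sym (*-distribˡ-sum (1/suc j) (λ i → fromℕℚ (Cᵢ i) * fromℕℚ r))) (*-comm (1/suc j) D))))

    P*P⁻ : P * P⁻ ≡ 1ℚ
    P*P⁻ = trans (sym (prod-* (λ i → X i ^ Cᵢ i) (λ i → Y i ^ Cᵢ i)))
      (trans (prod-cong (λ i → inverse-^ {X i} {Y i} (Cᵢ i) (XY i))) (prod-1 k))

    -- The normalisation cancels because 2^r (1 − 2⁻ᵏ) = 2^r − 2.
    τ-sum : ∀ j → fromℕℚ R * (1ℚ - seq (τ k) j) ≡ S j
    τ-sum j = begin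
      fromℕℚ R * (1ℚ - (1ℚ + - ((1ℚ - u) * (c * seq (sumℝ summand) j))))
        ≡⟨ cong (λ s → fromℕℚ R * (1ℚ - (1ℚ + - ((1ℚ - u) * (c * s))))) (seq-sum summand j) ⟩
      fromℕℚ R * (1ℚ - (1ℚ + - ((1ℚ - u) * (c * S j))))
        ≡⟨ solve 4 (λ R u c s → R :* (con 1ℚ :- (con 1ℚ :+ :- ((con 1ℚ :- u) :* (c :* s)))) := (R :- R :* u) :* c :* s) refl (fromℕℚ R) u c (S j) ⟩
      (fromℕℚ R - fromℕℚ R * u) * c * S j
        ≡⟨ cong (λ z → z * c * S j) (cong (λ z → fromℕℚ R - z) R*u) ⟩
      (fromℕℚ R - 2ℚ) * c * S j
        ≡⟨ cong (_* S j) (trans (*-comm (fromℕℚ R - 2ℚ) c) (trans (cong (c *_) R-2) (/-* (+ 1) (R ℕ.∸ 2) {{2^r∸2-nonZero k′}}))) ⟩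
      1ℚ * S j
        ≡⟨ *-identityˡ (S j) ⟩
      S j ∎
      where
      open ≡-Reasoning
      summand : Fin k → ℝ
      summand i = fromℕ (Cᵢ i) *ℝ entropy (fraction i) {{fraction-pos i}} {{1-fraction-pos i}}
      u = (+ 1 / (2 ℕ.^ k)) {{ℕ.m^n≢0 2 k}}
      c = (+ 1 / (R ℕ.∸ 2)) {{2^r∸2-nonZero k′}}
      R*u : fromℕℚ R * u ≡ 2ℚ
      R*u = trans (cong (_* u) (fromℕℚ-* 2 (2 ℕ.^ k))) (trans (solve 2 (λ v u → con 2ℚ :* v :* u := con 2ℚ :* (u :* v)) refl (fromℕℚ (2 ℕ.^ k)) u)
        (cong (2ℚ *_) (/-* (+ 1) (2 ℕ.^ k) {{ℕ.m^n≢0 2 k}})))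
      R-2 : fromℕℚ R - 2ℚ ≡ fromℕℚ (R ℕ.∸ 2)
      R-2 = trans (cong (λ z → fromℕℚ z - 2ℚ) (sym (ℕ.m∸n+n≡m {R} {2} (ℕ.^-monoʳ-≤ 2 {1} {r} (s≤s z≤n)))))
        (trans (cong (_- 2ℚ) (fromℕℚ-+ (R ℕ.∸ 2) 2)) (solve 1 (λ x → (x :+ con 2ℚ) :- con 2ℚ := x) refl (fromℕℚ (R ℕ.∸ 2))))

    module _ (Λ : ℕ)
      (Λ^r : Λ ℕ.^ r ≡ r ℕ.^ r ℕ.* prodℕ (λ i → (A i ℕ.^ A i ℕ.* B i ℕ.^ B i) ℕ.^ Cᵢ i) ℕ.* r ℕ.^ r)
      (r^rR : (r ℕ.^ r) ℕ.^ R ≡ r ℕ.^ r ℕ.* prodℕ (λ i → (r ℕ.^ r) ℕ.^ Cᵢ i) ℕ.* r ℕ.^ r) where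

      P*Λ^r : P * fromℕℚ (Λ ℕ.^ r) ≡ fromℕℚ ((r ℕ.^ r) ℕ.^ R)
      P*Λ^r = begin
        P * fromℕℚ (Λ ℕ.^ r)
          ≡⟨ cong (λ n → P * fromℕℚ n) Λ^r ⟩
        P * fromℕℚ (r ℕ.^ r ℕ.* prodℕ cs ℕ.* r ℕ.^ r)
          ≡⟨ cong (P *_) (trans (fromℕℚ-* (r ℕ.^ r ℕ.* prodℕ cs) (r ℕ.^ r)) (cong (_* w) (trans (fromℕℚ-* (r ℕ.^ r) (prodℕ cs)) (cong (w *_) (fromℕℚ-prod cs))))) ⟩
        P * (w * prod (λ i → fromℕℚ (cs i)) * w)
          ≡⟨ solve 3 (λ P w c → P :* (w :* c :* w) := w :* (P :* c) :* w) refl P w (prod (λ i → fromℕℚ (cs i))) ⟩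
        w * (P * prod (λ i → fromℕℚ (cs i))) * w
          ≡⟨ cong (λ z → w * z * w) (trans (sym (prod-* (λ i → X i ^ Cᵢ i) (λ i → fromℕℚ (cs i)))) (prod-cong each)) ⟩
        w * prod (λ i → fromℕℚ ((r ℕ.^ r) ℕ.^ Cᵢ i)) * w
          ≡⟨ trans (fromℕℚ-* (r ℕ.^ r ℕ.* prodℕ ws) (r ℕ.^ r)) (cong (_* w) (trans (fromℕℚ-* (r ℕ.^ r) (prodℕ ws)) (cong (w *_) (fromℕℚ-prod ws)))) ⟨
        fromℕℚ (r ℕ.^ r ℕ.* prodℕ ws ℕ.* r ℕ.^ r)
          ≡⟨ cong fromℕℚ r^rR ⟨
        fromℕℚ ((r ℕ.^ r) ℕ.^ R) ∎
        where
        open ≡-Reasoning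
        cs ws : Fin k → ℕ
        cs i = (A i ℕ.^ A i ℕ.* B i ℕ.^ B i) ℕ.^ Cᵢ i
        ws i = (r ℕ.^ r) ℕ.^ Cᵢ i
        w = fromℕℚ (r ℕ.^ r)
        each : ∀ i → X i ^ Cᵢ i * fromℕℚ (cs i) ≡ fromℕℚ (ws i)
        each i = trans (cong (X i ^ Cᵢ i *_) (fromℕℚ-^ (A i ℕ.^ A i ℕ.* B i ℕ.^ B i) (Cᵢ i)))
          (trans (sym (^-distrib-* (X i) (fromℕℚ (A i ℕ.^ A i ℕ.* B i ℕ.^ B i)) (Cᵢ i)))
            (trans (cong (_^ Cᵢ i) (X*counts i)) (sym (fromℕℚ-^ (r ℕ.^ r) (Cᵢ i)))))

      private
        ρ Rᵠ Q : ℚ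
        ρ  = fromℕℚ r
        Rᵠ = fromℕℚ R
        Q  = ρ * Rᵠ

        0≤D : 0ℚ ≤ D
        0≤D = sum-nonNeg (λ i → fromℕℚ (Cᵢ i) * fromℕℚ r) (λ i → *-nonNeg (fromℕℚ-nonNeg (Cᵢ i)) (fromℕℚ-nonNeg r))

        0<Q : 0ℚ < Q
        0<Q = *-pos (0<fromℕℚ r) (0<fromℕℚ R {{ℕ.m^n≢0 2 r}})

      -- Half of Q ε absorbs the error D/(j + 1) of the approximate logarithms, the other half exceeds 1/(t + 1).
      margin : ∀ ε → 0ℝ <ℝ ε → ∃ λ t → ∃ λ N → ∀ j → N ℕ.≤ j → D * 1/suc j + 1/suc t ≤ Q * seq ε j
      margin ε (ε₀ , 0<ε₀ , N₀ , ε₀≤) = t , N₀ ℕ.⊔ N₁ , λ j N≤j → begin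
          D * 1/suc j + 1/suc t     ≤⟨ +-mono-≤ (error j (⊔ʳ N₀ N₁ N≤j)) (proj₂ (archimedean δ 0<δ) t ℕ.≤-refl) ⟩
          δ + δ                     ≡⟨ half+half (Q * ε₀) ⟩
          Q * ε₀                    ≡⟨ cong (Q *_) (+-identityˡ ε₀) ⟨
          Q * (0ℚ + ε₀)             ≤⟨ *-monoˡ-≤-nonNeg Q {{ℚ.nonNegative (<⇒≤ 0<Q)}} (ε₀≤ j (⊔ˡ N₀ N₁ N≤j)) ⟩
          Q * seq ε j               ∎
        where
        open ≤-Reasoning
        δ = ½ * (Q * ε₀)
        0<δ = 0<½* (*-pos 0<Q 0<ε₀)
        D⁻ = inv (+-mono-≤-< 0≤D (positive⁻¹ 1ℚ))
        δ′ = proj₁ D⁻ * δ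
        0<δ′ = *-pos (proj₁ (proj₂ D⁻)) 0<δ
        t = proj₁ (archimedean δ 0<δ)
        N₁ = proj₁ (archimedean δ′ 0<δ′)
        error : ∀ j → N₁ ℕ.≤ j → D * 1/suc j ≤ δ
        error j N≤j = begin
          D * 1/suc j                ≤⟨ *-mono-≤ 0≤D (<⇒≤ 0<δ′) (≤-by (<⇒≤ (positive⁻¹ 1ℚ)) refl) (proj₂ (archimedean δ′ 0<δ′) j N≤j) ⟩
          (D + 1ℚ) * (proj₁ D⁻ * δ)  ≡⟨ *-assoc (D + 1ℚ) (proj₁ D⁻) δ ⟨
          (D + 1ℚ) * proj₁ D⁻ * δ    ≡⟨ trans (cong (_* δ) (proj₂ (proj₂ D⁻))) (*-identityˡ δ) ⟩
          δ                          ∎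

      private
        fromℕℚ-Q*e*d : ∀ e d → fromℕℚ (r ℕ.* R ℕ.* e ℕ.* d) ≡ Q * fromℕℚ e * fromℕℚ d
        fromℕℚ-Q*e*d e d = trans (fromℕℚ-* (r ℕ.* R ℕ.* e) d) (cong (_* fromℕℚ d) (trans (fromℕℚ-* (r ℕ.* R) e) (cong (_* fromℕℚ e) (fromℕℚ-* r R))))

      upper-exponent : ∀ {ε x j d t} → x ⊑ (seq (τ k) j + - seq ε j) * fromℕℚ d → D * 1/suc j + 1/suc t ≤ Q * seq ε j →
        (x ^ (r ℕ.* R) * P ^ d) ^ suc t * 2ℚ ^ d ≤ 2ℚ ^ (r ℕ.* R ℕ.* suc t ℕ.* d)
      upper-exponent {ε} {x} {j} {d} {t} x⊑ m = ⊑-integral (⊑-^ (suc t) (⊑-* (⊑-^ (r ℕ.* R) x⊑) (⊑-^ d (P⊑ j)))) (r ℕ.* R ℕ.* suc t ℕ.* d) d (begin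
          T * (fromℕℚ (r ℕ.* R) * ((τⱼ + - εⱼ) * δ) + δ * (ρ * S j + err))
            ≡⟨ cong₂ (λ a b → T * (a * ((τⱼ + - εⱼ) * δ) + δ * (ρ * b + err))) (fromℕℚ-* r R) (sym (τ-sum j)) ⟩
          T * (Q * ((τⱼ + - εⱼ) * δ) + δ * (ρ * (Rᵠ * (1ℚ - τⱼ)) + err))
            ≡⟨ solve 7 (λ T p R τ e d i → T :* ((p :* R) :* ((τ :+ :- e) :* d) :+ d :* (p :* (R :* (con 1ℚ :- τ)) :+ i)) :=
                 (p :* R) :* T :* d :- T :* d :* ((p :* R) :* e :- i)) refl T ρ Rᵠ τⱼ εⱼ δ err ⟩
          Q * T * δ - T * δ * (Q * εⱼ - err)
            ≤⟨ +-monoʳ-≤ (Q * T * δ) (neg-antimono-≤ (*-monoˡ-≤-nonNeg (T * δ) {{ℚ.nonNegative (*-nonNeg (fromℕℚ-nonNeg (suc t)) (fromℕℚ-nonNeg d))}} surplus)) ⟩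
          Q * T * δ - T * δ * 1/suc t
            ≡⟨ cong₂ (λ a b → a - b) (sym (fromℕℚ-Q*e*d (suc t) d)) (trans (solve 3 (λ T d i → T :* d :* i := d :* (i :* T)) refl T δ (1/suc t))
                 (trans (cong (δ *_) (1/suc-* t)) (*-identityʳ δ))) ⟩
          fromℕℚ (r ℕ.* R ℕ.* suc t ℕ.* d) - fromℕℚ d ∎)
        where
        open ≤-Reasoning
        T = fromℕℚ (suc t)
        δ = fromℕℚ d
        τⱼ = seq (τ k) j
        εⱼ = seq ε j
        err = D * 1/suc j
        surplus : 1/suc t ≤ Q * εⱼ - err
        surplus = ≤-by (≤⇒0≤- m) (solve 3 (λ i s e → i :+ (s :- (e :+ i)) := s :- e) refl (1/suc t) (Q * εⱼ) err)

      lower-exponent : ∀ {ε x j d t} → x ⊑ - ((seq (τ k) j + seq ε j) * fromℕℚ d) → D * 1/suc j + 1/suc t ≤ Q * seq ε j →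
        (x ^ (r ℕ.* R) * P⁻ ^ d) ^ suc t * 2ℚ ^ (r ℕ.* R ℕ.* suc t ℕ.* d ℕ.+ d) ≤ 1ℚ
      lower-exponent {ε} {x} {j} {d} {t} x⊑ m = ⊑-integral (⊑-^ (suc t) (⊑-* (⊑-^ (r ℕ.* R) x⊑) (⊑-^ d (P⁻⊑ j)))) 0 (r ℕ.* R ℕ.* suc t ℕ.* d ℕ.+ d) (begin
          T * (fromℕℚ (r ℕ.* R) * (- ((τⱼ + εⱼ) * δ)) + δ * (- (ρ * S j) + err))
            ≡⟨ cong₂ (λ a b → T * (a * (- ((τⱼ + εⱼ) * δ)) + δ * (- (ρ * b) + err))) (fromℕℚ-* r R) (sym (τ-sum j)) ⟩
          T * (Q * (- ((τⱼ + εⱼ) * δ)) + δ * (- (ρ * (Rᵠ * (1ℚ - τⱼ))) + err))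
            ≡⟨ solve 7 (λ T p R τ e d i → T :* ((p :* R) :* (:- ((τ :+ e) :* d)) :+ d :* (:- (p :* (R :* (con 1ℚ :- τ))) :+ i)) :=
                 con 0ℚ :- ((p :* R) :* T :* d :+ T :* d :* ((p :* R) :* e :- i))) refl T ρ Rᵠ τⱼ εⱼ δ err ⟩
          0ℚ - (Q * T * δ + T * δ * (Q * εⱼ - err))
            ≤⟨ +-monoʳ-≤ 0ℚ (neg-antimono-≤ (+-monoʳ-≤ (Q * T * δ) (*-monoˡ-≤-nonNeg (T * δ) {{ℚ.nonNegative (*-nonNeg (fromℕℚ-nonNeg (suc t)) (fromℕℚ-nonNeg d))}} surplus))) ⟩
          0ℚ - (Q * T * δ + T * δ * 1/suc t)
            ≡⟨ cong (λ z → 0ℚ - z) (trans (cong₂ _+_ (sym (fromℕℚ-Q*e*d (suc t) d)) (trans (solve 3 (λ T d i → T :* d :* i := d :* (i :* T)) refl T δ (1/suc t))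
                 (trans (cong (δ *_) (1/suc-* t)) (*-identityʳ δ)))) (sym (fromℕℚ-+ (r ℕ.* R ℕ.* suc t ℕ.* d) d))) ⟩
          0ℚ - fromℕℚ (r ℕ.* R ℕ.* suc t ℕ.* d ℕ.+ d) ∎)
        where
        open ≤-Reasoning
        T = fromℕℚ (suc t)
        δ = fromℕℚ d
        τⱼ = seq (τ k) j
        εⱼ = seq ε j
        err = D * 1/suc j
        surplus : 1/suc t ≤ Q * εⱼ - err
        surplus = ≤-by (≤⇒0≤- m) (solve 3 (λ i s e → i :+ (s :- (e :+ i)) := s :- e) refl (1/suc t) (Q * εⱼ) err)

      -- The factor ½ absorbs the additive error in the order of ℝ.
      half⊑ : ∀ n → 1 ℕ.≤ n → ∀ y → fromℕ n ≤ℝ 2^ℝ y → ∃ λ N → ∀ j → N ℕ.≤ j → ½ * fromℕℚ n ⊑ seq y j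
      half⊑ n 1≤n y (mk≤ℝ n≤) = proj₁ ev , λ j N≤j → ⊑-≤ (*-nonNeg 0≤½ (fromℕℚ-nonNeg n))
          (≤-trans (≤-by (≤⇒0≤- (≤-trans (≤-trans (*-monoˡ-≤-nonNeg ½ (fromℕℚ-mono-≤ 1≤n)) ≤-refl) ≤-refl))
              (solve 1 (λ n → con ½ :* n :+ (con ½ :* n :- con ½ :* con 1ℚ) := n :- con ½) refl (fromℕℚ n)))
            (≤-by (≤⇒0≤- (proj₂ ev j N≤j)) (solve 2 (λ n a → (n :- con ½) :+ ((a :+ con ½) :- n) := a) refl (fromℕℚ n) (approx (seq y j) j))))
          (≤2^⇒⊑ (0≤approx (seq y j) j) (approx≤ (seq y j) j))
        where ev = n≤ ½ (positive⁻¹ ½)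

      double⊑ : ∀ n → 1 ℕ.≤ n → ∀ y {u} → 0ℚ ≤ u → u * (2ℚ * fromℕℚ n) ≡ 1ℚ → 2^ℝ y ≤ℝ fromℕ n →
        ∃ λ N → ∀ j → N ℕ.≤ j → u ⊑ - seq y j
      double⊑ n 1≤n y {u} 0≤u u2n (mk≤ℝ ≤n) = proj₁ ev ℕ.⊔ proj₁ small , λ j N≤j → main j (⊔ˡ (proj₁ ev) (proj₁ small) N≤j) (⊔ʳ (proj₁ ev) (proj₁ small) N≤j)
        where
        ev = ≤n ½ (positive⁻¹ ½)
        small = archimedean ½ (positive⁻¹ ½)
        main : ∀ j → proj₁ ev ℕ.≤ j → proj₁ small ℕ.≤ j → u ⊑ - seq y j
        main j N≤j M≤j = ⊑-≤ 0≤u (inverse-≤ {proj₁ z⁻} {u} {2ℚ * fromℕℚ n} {z} 0≤u u2n (trans (*-comm (proj₁ z⁻) z) (proj₂ (proj₂ z⁻))) (<⇒≤ (proj₁ (proj₂ z⁻))) z≤2n)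
            (≥2^⇒⊑ {z} {proj₁ z⁻} (<⇒≤ 0<z) (<⇒≤ (proj₁ (proj₂ z⁻))) (proj₂ (proj₂ z⁻)) (↧ₙ yⱼ) ((↥ yⱼ) ⁺) ((↥ yⱼ) ⁻)
              (trans (*-comm (fromℕℚ (↧ₙ yⱼ)) yⱼ) (trans (cong (_* fromℕℚ (↧ₙ yⱼ)) (sym (↥p/↧p≡p yⱼ))) (trans (/-* (↥ yⱼ) (↧ₙ yⱼ)) (⁺-⁻ (↥ yⱼ)))))
              (<⇒≤ (≰⇒> (<approx yⱼ j))))
          where
          yⱼ = seq y j
          z = approx yⱼ j + 1/suc j
          0<z : 0ℚ < z
          0<z = +-mono-≤-< (0≤approx yⱼ j) (0<1/suc j)
          z⁻ = inv 0<z
          z≤2n : z ≤ 2ℚ * fromℕℚ n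
          z≤2n = ≤-trans (+-mono-≤ (proj₂ ev j N≤j) (proj₂ small j M≤j)) (≤-by (≤⇒0≤- (fromℕℚ-mono-≤ 1≤n))
            (solve 1 (λ n → ((n :+ con ½) :+ con ½) :+ (n :- con 1ℚ) := con 2ℚ :* n) refl (fromℕℚ n)))

      private
        e-of : ℕ → ℕ
        e-of t = r ℕ.* suc t

        P*Λ-power : ∀ t d → (P ^ d) ^ suc t * fromℕℚ (Λ ℕ.^ (e-of t ℕ.* d)) ≡ fromℕℚ (r ℕ.^ (R ℕ.* e-of t ℕ.* d))
        P*Λ-power t d = begin
          (P ^ d) ^ suc t * fromℕℚ (Λ ℕ.^ (r ℕ.* suc t ℕ.* d))
            ≡⟨ cong₂ _*_ (^-assocʳ P d (suc t)) (trans (cong (λ n → fromℕℚ (Λ ℕ.^ n)) (lem r (suc t) d)) (trans (cong fromℕℚ (sym (ℕ.^-*-assoc Λ r (d ℕ.* suc t)))) (fromℕℚ-^ (Λ ℕ.^ r) (d ℕ.* suc t)))) ⟩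
          P ^ (d ℕ.* suc t) * fromℕℚ (Λ ℕ.^ r) ^ (d ℕ.* suc t)
            ≡⟨ ^-distrib-* P (fromℕℚ (Λ ℕ.^ r)) (d ℕ.* suc t) ⟨
          (P * fromℕℚ (Λ ℕ.^ r)) ^ (d ℕ.* suc t)
            ≡⟨ cong (_^ (d ℕ.* suc t)) P*Λ^r ⟩
          fromℕℚ ((r ℕ.^ r) ℕ.^ R) ^ (d ℕ.* suc t)
            ≡⟨ trans (sym (fromℕℚ-^ ((r ℕ.^ r) ℕ.^ R) (d ℕ.* suc t))) (cong fromℕℚ (trans (ℕ.^-*-assoc (r ℕ.^ r) R (d ℕ.* suc t))
                 (trans (ℕ.^-*-assoc r r (R ℕ.* (d ℕ.* suc t))) (cong (r ℕ.^_) (lem₂ r R (suc t) d))))) ⟩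
          fromℕℚ (r ℕ.^ (R ℕ.* (r ℕ.* suc t) ℕ.* d)) ∎
          where
          open ≡-Reasoning
          lem : ∀ r t d → r ℕ.* t ℕ.* d ≡ r ℕ.* (d ℕ.* t)
          lem = solve-∀
          lem₂ : ∀ r R t d → r ℕ.* (R ℕ.* (d ℕ.* t)) ≡ R ℕ.* (r ℕ.* t) ℕ.* d
          lem₂ = solve-∀

        2ℚ^ : ∀ n → 2ℚ ^ n ≡ fromℕℚ (2 ℕ.^ n)
        2ℚ^ n = sym (fromℕℚ-^ 2 n)

        rRe : ∀ r R t → r ℕ.* R ℕ.* t ≡ R ℕ.* (r ℕ.* t)
        rRe = solve-∀

      subcritical : ∀ ε → 0ℝ <ℝ ε → ∃ λ e → NonZero e × ∀ d n → 1 ℕ.≤ n → fromℕ n ≤ℝ 2^ℝ ((τ k -ℝ ε) *ℝ fromℕ d) →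
        n ℕ.^ (R ℕ.* e) ℕ.* r ℕ.^ (R ℕ.* e ℕ.* d) ℕ.* 2 ℕ.^ d ℕ.≤ 2 ℕ.^ (R ℕ.* e) ℕ.* 2 ℕ.^ (R ℕ.* e ℕ.* d) ℕ.* Λ ℕ.^ (e ℕ.* d)
      subcritical ε 0<ε = e , _ , λ d n 1≤n n≤ → fromℕℚ-cancel-≤ (main d n 1≤n n≤)
        where
        t = proj₁ (margin ε 0<ε)
        N = proj₁ (proj₂ (margin ε 0<ε))
        e = e-of t
        main : ∀ d n → 1 ℕ.≤ n → fromℕ n ≤ℝ 2^ℝ ((τ k -ℝ ε) *ℝ fromℕ d) →
          fromℕℚ (n ℕ.^ (R ℕ.* e) ℕ.* r ℕ.^ (R ℕ.* e ℕ.* d) ℕ.* 2 ℕ.^ d) ≤ fromℕℚ (2 ℕ.^ (R ℕ.* e) ℕ.* 2 ℕ.^ (R ℕ.* e ℕ.* d) ℕ.* Λ ℕ.^ (e ℕ.* d))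
        main d n 1≤n n≤ = begin
            fromℕℚ (n ℕ.^ (R ℕ.* e) ℕ.* r ℕ.^ (R ℕ.* e ℕ.* d) ℕ.* 2 ℕ.^ d)
              ≡⟨ trans (fromℕℚ-* (n ℕ.^ (R ℕ.* e) ℕ.* r ℕ.^ (R ℕ.* e ℕ.* d)) (2 ℕ.^ d))
                   (cong₂ _*_ (trans (fromℕℚ-* (n ℕ.^ (R ℕ.* e)) (r ℕ.^ (R ℕ.* e ℕ.* d))) (cong₂ _*_ n-power (sym (P*Λ-power t d)))) (sym (2ℚ^ d))) ⟩
            x ^ (R ℕ.* e) * a * (pw * l) * 2ℚ ^ d
              ≡⟨ solve 5 (λ x a pw l z → x :* a :* (pw :* l) :* z := x :* pw :* z :* (a :* l)) refl (x ^ (R ℕ.* e)) a pw l (2ℚ ^ d) ⟩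
            x ^ (R ℕ.* e) * pw * 2ℚ ^ d * (a * l)
              ≡⟨ cong (λ w → w * 2ℚ ^ d * (a * l)) (trans (cong (_* pw) (trans (cong (x ^_) (sym (rRe r R (suc t)))) (sym (^-assocʳ x (r ℕ.* R) (suc t)))))
                   (sym (^-distrib-* (x ^ (r ℕ.* R)) (P ^ d) (suc t)))) ⟩
            (x ^ (r ℕ.* R) * P ^ d) ^ suc t * 2ℚ ^ d * (a * l)
              ≤⟨ *-monoʳ-≤-nonNeg (a * l) {{ℚ.nonNegative (*-nonNeg (fromℕℚ-nonNeg (2 ℕ.^ (R ℕ.* e))) (fromℕℚ-nonNeg (Λ ℕ.^ (e ℕ.* d))))}}
                   (upper-exponent {ε} {x} {j} {d} {t} (proj₂ half j (⊔ʳ N (proj₁ half) ℕ.≤-refl)) (proj₂ (proj₂ (margin ε 0<ε)) j (⊔ˡ N (proj₁ half) ℕ.≤-refl))) ⟩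
            2ℚ ^ (r ℕ.* R ℕ.* suc t ℕ.* d) * (a * l)
              ≡⟨ trans (cong (_* (a * l)) (trans (2ℚ^ (r ℕ.* R ℕ.* suc t ℕ.* d)) (cong (λ m → fromℕℚ (2 ℕ.^ (m ℕ.* d))) (rRe r R (suc t)))))
                   (solve 3 (λ z a l → z :* (a :* l) := a :* z :* l) refl (fromℕℚ (2 ℕ.^ (R ℕ.* e ℕ.* d))) a l) ⟩
            a * fromℕℚ (2 ℕ.^ (R ℕ.* e ℕ.* d)) * l
              ≡⟨ trans (fromℕℚ-* (2 ℕ.^ (R ℕ.* e) ℕ.* 2 ℕ.^ (R ℕ.* e ℕ.* d)) (Λ ℕ.^ (e ℕ.* d))) (cong (_* l) (fromℕℚ-* (2 ℕ.^ (R ℕ.* e)) (2 ℕ.^ (R ℕ.* e ℕ.* d)))) ⟨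
            fromℕℚ (2 ℕ.^ (R ℕ.* e) ℕ.* 2 ℕ.^ (R ℕ.* e ℕ.* d) ℕ.* Λ ℕ.^ (e ℕ.* d)) ∎
          where
          open ≤-Reasoning
          y = (τ k -ℝ ε) *ℝ fromℕ d
          half = half⊑ n 1≤n y n≤
          j = N ℕ.⊔ proj₁ half
          x = ½ * fromℕℚ n
          a = fromℕℚ (2 ℕ.^ (R ℕ.* e))
          pw = (P ^ d) ^ suc t
          l = fromℕℚ (Λ ℕ.^ (e ℕ.* d))
          n-power : fromℕℚ (n ℕ.^ (R ℕ.* e)) ≡ x ^ (R ℕ.* e) * a
          n-power = trans (fromℕℚ-^ n (R ℕ.* e)) (trans (cong (_^ (R ℕ.* e)) (solve 1 (λ n → n := con ½ :* n :* con 2ℚ) refl (fromℕℚ n)))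
            (trans (^-distrib-* x 2ℚ (R ℕ.* e)) (cong (x ^ (R ℕ.* e) *_) (2ℚ^ (R ℕ.* e)))))

      supercritical : ∀ ε → 0ℝ <ℝ ε → ∃ λ e → NonZero e × ∀ d n → 1 ℕ.≤ n → 2^ℝ ((τ k +ℝ ε) *ℝ fromℕ d) ≤ℝ fromℕ n →
        2 ℕ.^ (R ℕ.* e ℕ.* d) ℕ.* Λ ℕ.^ (e ℕ.* d) ℕ.* 2 ℕ.^ d ℕ.≤ (2 ℕ.* n) ℕ.^ (R ℕ.* e) ℕ.* r ℕ.^ (R ℕ.* e ℕ.* d)
      supercritical ε 0<ε = e , _ , λ d n 1≤n ≤n → fromℕℚ-cancel-≤ (main d n 1≤n ≤n)
        where
        t = proj₁ (margin ε 0<ε)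
        N = proj₁ (proj₂ (margin ε 0<ε))
        e = e-of t
        main : ∀ d n → 1 ℕ.≤ n → 2^ℝ ((τ k +ℝ ε) *ℝ fromℕ d) ≤ℝ fromℕ n →
          fromℕℚ (2 ℕ.^ (R ℕ.* e ℕ.* d) ℕ.* Λ ℕ.^ (e ℕ.* d) ℕ.* 2 ℕ.^ d) ≤ fromℕℚ ((2 ℕ.* n) ℕ.^ (R ℕ.* e) ℕ.* r ℕ.^ (R ℕ.* e ℕ.* d))
        main d n 1≤n ≤n = begin
            fromℕℚ (2 ℕ.^ (R ℕ.* e ℕ.* d) ℕ.* Λ ℕ.^ (e ℕ.* d) ℕ.* 2 ℕ.^ d)
              ≡⟨ trans (fromℕℚ-* (2 ℕ.^ (R ℕ.* e ℕ.* d) ℕ.* Λ ℕ.^ (e ℕ.* d)) (2 ℕ.^ d)) (cong₂ _*_ (fromℕℚ-* (2 ℕ.^ (R ℕ.* e ℕ.* d)) (Λ ℕ.^ (e ℕ.* d))) (sym (2ℚ^ d))) ⟩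
            fromℕℚ (2 ℕ.^ (R ℕ.* e ℕ.* d)) * l * 2ℚ ^ d
              ≡⟨ trans (cong (λ w → w * l * 2ℚ ^ d) (trans (cong (λ m → fromℕℚ (2 ℕ.^ (m ℕ.* d))) (sym (rRe r R (suc t)))) (sym (2ℚ^ (r ℕ.* R ℕ.* suc t ℕ.* d)))))
                   (trans (solve 3 (λ u l v → u :* l :* v := (u :* v) :* l) refl (2ℚ ^ (r ℕ.* R ℕ.* suc t ℕ.* d)) l (2ℚ ^ d))
                     (cong (_* l) (sym (^-homo-* 2ℚ (r ℕ.* R ℕ.* suc t ℕ.* d) d)))) ⟩
            z * l
              ≡⟨ trans (cong (_* (z * l)) unit) (*-identityˡ (z * l)) ⟨
            (w * pw * (u ^ (R ℕ.* e) * p⁻)) * (z * l)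
              ≡⟨ solve 6 (λ w pw u q z l → (w :* pw :* (u :* q)) :* (z :* l) := w :* (pw :* l) :* (u :* q :* z)) refl w pw (u ^ (R ℕ.* e)) p⁻ z l ⟩
            w * (pw * l) * (u ^ (R ℕ.* e) * p⁻ * z)
              ≤⟨ *-monoˡ-≤-nonNeg (w * (pw * l)) {{ℚ.nonNegative (*-nonNeg (fromℕℚ-nonNeg ((2 ℕ.* n) ℕ.^ (R ℕ.* e))) (subst (0ℚ ≤_) (sym (P*Λ-power t d)) (fromℕℚ-nonNeg (r ℕ.^ (R ℕ.* e ℕ.* d)))))}} bound ⟩
            w * (pw * l) * 1ℚ
              ≡⟨ trans (*-identityʳ (w * (pw * l))) (cong (w *_) (P*Λ-power t d)) ⟩
            w * fromℕℚ (r ℕ.^ (R ℕ.* e ℕ.* d))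
              ≡⟨ fromℕℚ-* ((2 ℕ.* n) ℕ.^ (R ℕ.* e)) (r ℕ.^ (R ℕ.* e ℕ.* d)) ⟨
            fromℕℚ ((2 ℕ.* n) ℕ.^ (R ℕ.* e) ℕ.* r ℕ.^ (R ℕ.* e ℕ.* d)) ∎
          where
          open ≤-Reasoning
          y = (τ k +ℝ ε) *ℝ fromℕ d
          2n = fromℕℚ (2 ℕ.* n)
          u⁻ = inv (0<fromℕℚ (2 ℕ.* n) {{ℕ.m*n≢0 2 n {{_}} {{ℕ.>-nonZero 1≤n}}}})
          u = proj₁ u⁻
          2nu : 2n * u ≡ 1ℚ
          2nu = proj₂ (proj₂ u⁻)
          double = double⊑ n 1≤n y {u} (<⇒≤ (proj₁ (proj₂ u⁻))) (trans (*-comm u (2ℚ * fromℕℚ n)) (trans (cong (_* u) (sym (fromℕℚ-* 2 n))) 2nu)) ≤n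
          j = N ℕ.⊔ proj₁ double
          l = fromℕℚ (Λ ℕ.^ (e ℕ.* d))
          w = fromℕℚ ((2 ℕ.* n) ℕ.^ (R ℕ.* e))
          pw = (P ^ d) ^ suc t
          p⁻ = (P⁻ ^ d) ^ suc t
          z = 2ℚ ^ (r ℕ.* R ℕ.* suc t ℕ.* d ℕ.+ d)
          unit : w * pw * (u ^ (R ℕ.* e) * p⁻) ≡ 1ℚ
          unit = trans (solve 4 (λ w pw u q → w :* pw :* (u :* q) := (w :* u) :* (pw :* q)) refl w pw (u ^ (R ℕ.* e)) p⁻)
            (cong₂ _*_ (trans (cong (_* u ^ (R ℕ.* e)) (fromℕℚ-^ (2 ℕ.* n) (R ℕ.* e))) (inverse-^ {2n} {u} (R ℕ.* e) 2nu))
              (inverse-^ {P ^ d} {P⁻ ^ d} (suc t) (inverse-^ {P} {P⁻} d P*P⁻)))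
          bound : u ^ (R ℕ.* e) * p⁻ * z ≤ 1ℚ
          bound = subst (_≤ 1ℚ) (cong (_* z) (trans (^-distrib-* (u ^ (r ℕ.* R)) (P⁻ ^ d) (suc t)) (cong (_* p⁻) (trans (^-assocʳ u (r ℕ.* R) (suc t)) (cong (u ^_) (rRe r R (suc t)))))))
            (lower-exponent {ε} {u} {j} {d} {t} (proj₂ double j (⊔ʳ N (proj₁ double) ℕ.≤-refl)) (proj₂ (proj₂ (margin ε 0<ε)) j (⊔ˡ N (proj₁ double) ℕ.≤-refl)))

open import Defs
  using (ℝ; 0ℝ; _<ℝ_; _≤ℝ_; fromℚ; fromℕ; _+ℝ_; _-ℝ_; _*ℝ_; sumℝ; 2^ℝ_; seq-sum; ≡⇒≈; fromℚ-≈0; τ; TendsToZero;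
    fromℕℚ; fromℕℚ-+; fromℕℚ-*; fromℕℚ-mono-≤; fromℕℚ-cancel-≤; fromℕℚ-nonNeg; 0<fromℕℚ; /-*; 1/suc; 1/suc-*; 0<1/suc;
    *-cancel-≤; ≤-by; ≤⇒0≤-; <⇒0<-; ∣-∣≤; inv; archimedean; term≤sum; 2^⌊log₂⌋≤; <2^1+⌊log₂⌋; 2^-cancel-<;
    dot; dot-0; dot-neg; dot-comm; dot-basis; sum≡dot1; any-or-all; Holds; solvable?; system⁻;
    points; combination; seq-combination; Conv; IsFace; AffinelyIndependent; HasDimension; ConvexPosition; slack; sum-slack;
    supportRow; supportRow-∉; relations; dependence; independent; dot-functionalRow; onFace; onFace-∈; offFace; offFace-∉;
    exposure; exposed; notExposed; isFace?; cubeℚ; cube-convexPosition; funToFin-cong; isKFace?; subsets; faceNumber;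
    ratio; mean; faceDensity; expectedFaceDensity)
open import Data.Bool.Base using (_∧_)
open import Data.Bool.Properties using () renaming (_≟_ to _≟ᵇ_)
open import Data.Nat.Base
open import Data.Nat.Properties
open import Data.Nat.DivMod using (m/n*n≤m; m*n/n≡m; /-monoˡ-≤; m≡m%n+[m/n]*n; m%n<n)
open import Data.Nat.Combinatorics using (_C_; nCn≡1; nC1≡n; k>n⇒nCk≡0; nCk+nC[k+1]≡[n+1]C[k+1])
open import Data.Nat.Logarithm using (⌊log₂_⌋; ⌊log₂⌋-mono-≤)
open import Data.Nat.ListAction using (product)
open import Data.Nat.ListAction.Properties using (product-↭; product-++; product≢0)
open import Data.Nat.Tactic.RingSolver using (solve-∀)
import Data.Integer.Base as ℤ
import Data.Rational.Base as ℚ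
open import Data.Rational.Base using (ℚ; 0ℚ; 1ℚ; _-_)
import Data.Rational.Properties as ℚ
open import Data.Rational.Solver using (module +-*-Solver)
open +-*-Solver using (solve; con; _:+_; _:*_; _:-_; :-_; _:=_)
open import Algebra.Bundles using (CommutativeRing)
open import Algebra.Properties.Semiring.Sum (CommutativeRing.semiring ℚ.+-*-commutativeRing)
  using (sum-cong-≗; ∑-distrib-+; *-distribˡ-sum) renaming (sum to sumℚ; ∑-comm to sumℚ-comm)
open import Data.Fin.Base using (Fin; zero; suc; toℕ; fromℕ<; finToFun; funToFin)
open import Data.Fin.Properties
  using (toℕ-injective; toℕ-fromℕ<; toℕ<n; injective⇒≤; finToFun-funToFin; funToFin-finToFin) renaming (_≟_ to _≟ᶠ_)
open import Data.Fin.Subset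
  using (Subset; Side; inside; outside; _∈_; _∉_; _⊆_; ∁; ⊤; ⊥; ⁅_⁆; _∪_; _∩_) renaming (∣_∣ to card)
open import Data.Fin.Subset.Properties
open import Data.List.Base
  using (List; []; _∷_; _++_; map; foldr; filter; length; concat; replicate; tabulate; allFin; upTo; cartesianProductWith)
open import Data.List.Properties using (length-++; length-map; length-tabulate; length-upTo; map-++; map-∘; map-cong; map-tabulate)
open import Data.List.Membership.Propositional using (lose) renaming (_∈_ to _∈ˡ_)
open import Data.List.Membership.Propositional.Properties
  using (∈-∃++; ∈-++⁻; ∈-++⁺ˡ; ∈-++⁺ʳ; ∈-map⁺; ∈-map⁻; ∈-filter⁺; ∈-upTo⁺; ∈-allFin; ∈-cartesianProductWith⁺)
open import Data.List.Relation.Unary.All as All using (All; []; _∷_)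
import Data.List.Relation.Unary.All.Properties as All
open import Data.List.Relation.Unary.AllPairs using ([]; _∷_)
open import Data.List.Relation.Unary.Any as Any using (here; there)
open import Data.List.Relation.Unary.Unique.Propositional using (Unique)
import Data.List.Relation.Unary.Unique.Propositional.Properties as Unique
open import Data.List.Relation.Binary.Permutation.Propositional
  using (_↭_; ↭-refl; ↭-sym; ↭-trans; ↭-prep; ↭-reflexive)
import Data.List.Relation.Binary.Permutation.Propositional.Properties as Perm
open import Data.Product.Base using (∃; _×_; _,_; proj₁; proj₂; uncurry)
open import Data.Sum.Base using (_⊎_; inj₁; inj₂)
open import Data.Vec.Base as V using (Vec; []; _∷_; lookup; zipWith)
import Data.Vec.Properties as V
open import Function.Base using (_∘_; id; it)
open import Relation.Binary.Definitions using (DecidableEquality)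
open import Relation.Binary.PropositionalEquality
open import Relation.Nullary using (¬_; Dec; yes; no; contradiction; _×-dec_; _⊎-dec_; ¬?)
open import Relation.Nullary.Decidable using (does; map′; decidable-stable)
open Logarithms using (prodℕ; module Entropies)

private
  variable
    A B : Set
    Φ Ψ Χ : Set
    ν : ℕ

-- Sums and counts over finite lists

∑ : List A → (A → ℕ) → ℕ
∑ []       f = 0
∑ (x ∷ xs) f = f x + ∑ xs f

𝟙 : Dec Φ → ℕ
𝟙 (yes _) = 1
𝟙 (no _)  = 0

𝟙-yes : (d : Dec Φ) → Φ → 𝟙 d ≡ 1
𝟙-yes (yes _) p = refl
𝟙-yes (no ¬p) p = contradiction p ¬p

𝟙-no : (d : Dec Φ) → ¬ Φ → 𝟙 d ≡ 0
𝟙-no (yes p) ¬p = contradiction p ¬p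
𝟙-no (no _)  _  = refl

𝟙-mono : (d : Dec Φ) (e : Dec Ψ) → (Φ → Ψ) → 𝟙 d ≤ 𝟙 e
𝟙-mono (no _)  e f = z≤n
𝟙-mono (yes p) e f = ≤-reflexive (sym (𝟙-yes e (f p)))

𝟙-cong : (d : Dec Φ) (e : Dec Ψ) → (Φ → Ψ) → (Ψ → Φ) → 𝟙 d ≡ 𝟙 e
𝟙-cong d e f g = ≤-antisym (𝟙-mono d e f) (𝟙-mono e d g)

𝟙-⊎ : (d : Dec Φ) (e : Dec Ψ) (f : Dec Χ) → (Φ → Ψ ⊎ Χ) → 𝟙 d ≤ 𝟙 e + 𝟙 f
𝟙-⊎ (no _)  e f h = z≤n
𝟙-⊎ (yes p) e f h with h p
... | inj₁ q = ≤-trans (≤-reflexive (sym (𝟙-yes e q))) (m≤m+n _ _)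
... | inj₂ s = ≤-trans (≤-reflexive (sym (𝟙-yes f s))) (m≤n+m _ _)

𝟙-× : (p : Dec Φ) (q : Dec Ψ) → 𝟙 (p ×-dec q) ≡ 𝟙 p * 𝟙 q
𝟙-× (yes _) (yes _) = refl
𝟙-× (yes _) (no _)  = refl
𝟙-× (no _)  q       = refl

𝟙-*-≤ : (d : Dec Φ) {a b : ℕ} → (Φ → a ≤ b) → 𝟙 d * a ≤ 𝟙 d * b
𝟙-*-≤ (no _)  h = z≤n
𝟙-*-≤ (yes p) h = *-monoʳ-≤ 1 (h p)

∑-cong : (xs : List A) {f g : A → ℕ} → (∀ x → f x ≡ g x) → ∑ xs f ≡ ∑ xs g
∑-cong []       h = refl
∑-cong (x ∷ xs) h = cong₂ _+_ (h x) (∑-cong xs h)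

∑-mono-∈ : (xs : List A) {f g : A → ℕ} → (∀ x → x ∈ˡ xs → f x ≤ g x) → ∑ xs f ≤ ∑ xs g
∑-mono-∈ []       h = z≤n
∑-mono-∈ (x ∷ xs) h = +-mono-≤ (h x (here refl)) (∑-mono-∈ xs λ y y∈ → h y (there y∈))

∑-mono : (xs : List A) {f g : A → ℕ} → (∀ x → f x ≤ g x) → ∑ xs f ≤ ∑ xs g
∑-mono xs h = ∑-mono-∈ xs λ x _ → h x

∑-0 : (xs : List A) → ∑ xs (λ _ → 0) ≡ 0
∑-0 []       = refl
∑-0 (x ∷ xs) = ∑-0 xs

∑-const : (xs : List A) (c : ℕ) → ∑ xs (λ _ → c) ≡ length xs * c
∑-const []       c = refl
∑-const (x ∷ xs) c = cong (c +_) (∑-const xs c)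

∑-++ : (xs ys : List A) (f : A → ℕ) → ∑ (xs ++ ys) f ≡ ∑ xs f + ∑ ys f
∑-++ []       ys f = refl
∑-++ (x ∷ xs) ys f = trans (cong (f x +_) (∑-++ xs ys f)) (sym (+-assoc (f x) _ _))

∑-map : (g : B → A) (xs : List B) (f : A → ℕ) → ∑ (map g xs) f ≡ ∑ xs (f ∘ g)
∑-map g []       f = refl
∑-map g (x ∷ xs) f = cong (f (g x) +_) (∑-map g xs f)

∑-+ : (xs : List A) (f g : A → ℕ) → ∑ xs (λ x → f x + g x) ≡ ∑ xs f + ∑ xs g
∑-+ []       f g = refl
∑-+ (x ∷ xs) f g = trans (cong (f x + g x +_) (∑-+ xs f g)) (lemma (f x) (g x) (∑ xs f) (∑ xs g))
  where
  lemma : ∀ a b c d → a + b + (c + d) ≡ a + c + (b + d)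
  lemma = solve-∀

∑-*ˡ : (xs : List A) (c : ℕ) (f : A → ℕ) → ∑ xs (λ x → c * f x) ≡ c * ∑ xs f
∑-*ˡ []       c f = sym (*-zeroʳ c)
∑-*ˡ (x ∷ xs) c f = trans (cong (c * f x +_) (∑-*ˡ xs c f)) (sym (*-distribˡ-+ c (f x) _))

∑-*ʳ : (xs : List A) (c : ℕ) (f : A → ℕ) → ∑ xs (λ x → f x * c) ≡ ∑ xs f * c
∑-*ʳ xs c f = trans (∑-cong xs (λ x → *-comm (f x) c)) (trans (∑-*ˡ xs c f) (*-comm c _))

∑-comm : (xs : List A) (ys : List B) (f : A → B → ℕ) →
  ∑ xs (λ x → ∑ ys (f x)) ≡ ∑ ys (λ y → ∑ xs (λ x → f x y))
∑-comm []       ys f = sym (∑-0 ys)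
∑-comm (x ∷ xs) ys f = trans (cong (∑ ys (f x) +_) (∑-comm xs ys f)) (sym (∑-+ ys (f x) _))

∑-bound : (xs : List A) {f : A → ℕ} (c : ℕ) → (∀ x → x ∈ˡ xs → f x ≤ c) → ∑ xs f ≤ length xs * c
∑-bound xs c h = ≤-trans (∑-mono-∈ xs h) (≤-reflexive (∑-const xs c))

∑-term≤ : {xs : List A} (f : A → ℕ) {x : A} → x ∈ˡ xs → f x ≤ ∑ xs f
∑-term≤ f (here refl) = m≤m+n _ _
∑-term≤ f (there x∈)  = ≤-trans (∑-term≤ f x∈) (m≤n+m _ _)

count : {R : A → Set} → (∀ x → Dec (R x)) → List A → ℕ
count R? xs = ∑ xs λ x → 𝟙 (R? x)

length-filter-count : {R : A → Set} (R? : ∀ x → Dec (R x)) (xs : List A) → length (filter R? xs) ≡ count R? xs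
length-filter-count R? []       = refl
length-filter-count R? (x ∷ xs) with R? x in eq
... | yes r = cong suc (length-filter-count R? xs)
... | no ¬r = length-filter-count R? xs

∑-filter : {R : A → Set} (R? : ∀ x → Dec (R x)) (xs : List A) (f : A → ℕ) →
  ∑ (filter R? xs) f ≡ ∑ xs (λ x → 𝟙 (R? x) * f x)
∑-filter R? []       f = refl
∑-filter R? (x ∷ xs) f with R? x
... | yes r = cong₂ _+_ (sym (+-identityʳ (f x))) (∑-filter R? xs f)
... | no ¬r = ∑-filter R? xs f

count-mono : {R R′ : A → Set} (R? : ∀ x → Dec (R x)) (R′? : ∀ x → Dec (R′ x)) (xs : List A) →
  (∀ x → R x → R′ x) → count R? xs ≤ count R′? xs
count-mono R? R′? xs h = ∑-mono xs λ x → 𝟙-mono (R? x) (R′? x) (h x)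

count-none : {R : A → Set} (R? : ∀ x → Dec (R x)) (xs : List A) → (∀ x → ¬ R x) → count R? xs ≡ 0
count-none R? xs h = trans (∑-cong xs λ x → 𝟙-no (R? x) (h x)) (∑-0 xs)

count-unique : {R : A → Set} (R? : ∀ x → Dec (R x)) {xs : List A} {x : A} → Unique xs → x ∈ˡ xs →
  (∀ y → R y → y ≡ x) → R x → count R? xs ≡ 1
count-unique R? {x ∷ xs} {x} (x∉ ∷ u) (here refl) only r = cong₂ _+_ (𝟙-yes (R? x) r) (zeros xs x∉)
  where
  zeros : ∀ ys → All (x ≢_) ys → count R? ys ≡ 0
  zeros []       []         = refl
  zeros (y ∷ ys) (x≢y ∷ ps) = cong₂ _+_ (𝟙-no (R? y) (x≢y ∘ sym ∘ only y)) (zeros ys ps)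
count-unique R? {y ∷ xs} {x} (y∉ ∷ u) (there x∈) only r =
  cong₂ _+_ (𝟙-no (R? y) λ ry → All.lookup y∉ x∈ (only y ry)) (count-unique R? u x∈ only r)

Unique-⊆⇒length≤ : {xs ys : List A} → Unique xs → (∀ {x} → x ∈ˡ xs → x ∈ˡ ys) → length xs ≤ length ys
Unique-⊆⇒length≤ {xs = []}     u       h = z≤n
Unique-⊆⇒length≤ {xs = x ∷ xs} (x∉ ∷ u) h with ∈-∃++ (h (here refl))
... | as , bs , refl = ≤-trans (s≤s (Unique-⊆⇒length≤ u h′)) (≤-reflexive (begin
    suc (length (as ++ bs))        ≡⟨ cong suc (length-++ as) ⟩
    suc (length as + length bs)    ≡⟨ +-suc (length as) (length bs) ⟨
    length as + length (x ∷ bs)    ≡⟨ length-++ as ⟨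
    length (as ++ x ∷ bs)          ∎))
  where
  open ≡-Reasoning
  h′ : ∀ {y} → y ∈ˡ xs → y ∈ˡ as ++ bs
  h′ {y} y∈ with ∈-++⁻ as (h (there y∈))
  ... | inj₁ y∈as           = ∈-++⁺ˡ y∈as
  ... | inj₂ (here refl)    = contradiction refl (All.lookup x∉ y∈)
  ... | inj₂ (there y∈bs)   = ∈-++⁺ʳ as y∈bs

count≤count : {R : A → Set} {R′ : B → Set} (R? : ∀ x → Dec (R x)) (R′? : ∀ y → Dec (R′ y))
  (_~_ : A → B → Set) {xs : List A} {ys : List B} → Unique xs →
  (∀ x → x ∈ˡ xs → R x → ∃ λ y → y ∈ˡ ys × R′ y × x ~ y) →
  (∀ {x x′ y} → R x → R x′ → x ~ y → x′ ~ y → x ≡ x′) →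
  count R? xs ≤ count R′? ys
count≤count {A} {B} {R} {R′} R? R′? _~_ {xs} {ys} u h inj =
  let ws , uw , ws⊆ , _ , len = images xs u (λ _ x∈ → x∈) in
  ≤-trans (≤-reflexive (sym len)) (≤-trans (Unique-⊆⇒length≤ uw (λ w∈ → All.lookup ws⊆ w∈))
    (≤-reflexive (length-filter-count R′? ys)))
  where
  images : ∀ zs → Unique zs → (∀ z → z ∈ˡ zs → z ∈ˡ xs) →
    ∃ λ ws → Unique ws × All (_∈ˡ filter R′? ys) ws × All (λ w → ∃ λ z → z ∈ˡ zs × R z × z ~ w) ws ×
      length ws ≡ count R? zs
  images [] _ _ = [] , [] , [] , [] , refl
  images (z ∷ zs) (z∉ ∷ uz) sub with R? z | images zs uz (λ x x∈ → sub x (there x∈))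
  ... | no _  | ws , uw , ws⊆ , src , len =
    ws , uw , ws⊆ , All.map (λ (x , x∈ , p) → x , there x∈ , p) src , len
  ... | yes r | ws , uw , ws⊆ , src , len with h z (sub z (here refl)) r
  ...   | y , y∈ , r′ , z~y =
    y ∷ ws , All.map (λ { (x , x∈ , rx , x~w) refl → All.lookup z∉ x∈ (inj r rx z~y x~w) }) src ∷ uw
    , ∈-filter⁺ R′? y∈ r′ ∷ ws⊆
    , (z , here refl , r , z~y) ∷ All.map (λ (x , x∈ , p) → x , there x∈ , p) src
    , cong suc len

length≤keys*fibre : (key : A → ℕ) (K F : ℕ) {R : A → Set} (R? : ∀ x → Dec (R x)) (xs : List A) →
  (∀ x → R x → key x ≤ K) →
  (∀ v → count (λ x → R? x ×-dec (key x ≟ v)) xs ≤ F) → count R? xs ≤ suc K * F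
length≤keys*fibre key K F {R} R? xs key≤K fibre≤F = begin
  count R? xs                                                                    ≤⟨ ∑-mono xs split ⟩
  ∑ xs (λ x → count (λ v → R? x ×-dec (key x ≟ v)) (upTo (suc K)))                ≡⟨ ∑-comm xs (upTo (suc K)) _ ⟩
  ∑ (upTo (suc K)) (λ v → count (λ x → R? x ×-dec (key x ≟ v)) xs)                ≤⟨ ∑-bound (upTo (suc K)) F (λ v _ → fibre≤F v) ⟩
  length (upTo (suc K)) * F                                                      ≡⟨ cong (_* F) (length-upTo (suc K)) ⟩
  suc K * F                                                                      ∎
  where
  open ≤-Reasoning
  split : ∀ x → 𝟙 (R? x) ≤ count (λ v → R? x ×-dec (key x ≟ v)) (upTo (suc K))
  split x with R? x
  ... | no _  = z≤n
  ... | yes r = ≤-trans (≤-reflexive (sym (𝟙-yes (yes r ×-dec (key x ≟ key x)) (r , refl))))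
    (∑-term≤ (λ v → 𝟙 (yes r ×-dec (key x ≟ v))) (∈-upTo⁺ (s≤s (key≤K x r))))

-- Subsets of a finite set

subsets-complete : ∀ {n} (W : Subset n) → W ∈ˡ subsets n
subsets-complete []            = here refl
subsets-complete (inside ∷ W)  = ∈-++⁺ˡ (∈-map⁺ (inside ∷_) (subsets-complete W))
subsets-complete (outside ∷ W) = ∈-++⁺ʳ (map (inside ∷_) (subsets _)) (∈-map⁺ (outside ∷_) (subsets-complete W))

subsets-unique : ∀ n → Unique (subsets n)
subsets-unique zero    = [] ∷ []
subsets-unique (suc n) = Unique.++⁺
  (Unique.map⁺ V.∷-injectiveʳ (subsets-unique n)) (Unique.map⁺ V.∷-injectiveʳ (subsets-unique n))
  λ (i , o) → disjoint i o
  where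
  disjoint : ∀ {W : Subset (suc n)} → W ∈ˡ map (inside ∷_) (subsets n) → ¬ W ∈ˡ map (outside ∷_) (subsets n)
  disjoint i o with ∈-map⁻ (inside ∷_) i | ∈-map⁻ (outside ∷_) o
  ... | _ , _ , refl | _ , _ , ()

∑-subsets : ∀ n (f : Subset (suc n) → ℕ) →
  ∑ (subsets (suc n)) f ≡ ∑ (subsets n) (λ W → f (inside ∷ W)) + ∑ (subsets n) (λ W → f (outside ∷ W))
∑-subsets n f = trans (∑-++ (map (inside ∷_) (subsets n)) _ f) (cong₂ _+_ (∑-map _ (subsets n) f) (∑-map _ (subsets n) f))

length-subsets : ∀ n → length (subsets n) ≡ 2 ^ n
length-subsets zero    = refl
length-subsets (suc n) = trans (length-++ (map (inside ∷_) (subsets n)))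
  (cong₂ _+_ (trans (length-map _ (subsets n)) (length-subsets n))
    (trans (trans (length-map _ (subsets n)) (length-subsets n)) (sym (+-identityʳ (2 ^ n)))))

Between : ∀ {n} → Subset n → Subset n → ℕ → Subset n → Set
Between T U m W = T ⊆ W × W ⊆ U × card W ≡ card T + m

between? : ∀ {n} (T U : Subset n) m (W : Subset n) → Dec (Between T U m W)
between? T U m W = T ⊆? W ×-dec W ⊆? U ×-dec card W ≟ card T + m

count-between : ∀ {n} (T U : Subset n) (u m : ℕ) → T ⊆ U → card U ≡ card T + u → count (between? T U m) (subsets n) ≡ u C m
count-between [] [] u m T⊆U eq with u | m
... | zero  | zero  = refl
... | zero  | suc m = trans (+-identityʳ _) (𝟙-no (between? [] [] (suc m) []) λ { (_ , _ , ()) })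
count-between {suc n} (inside ∷ T) (outside ∷ U) u m T⊆U eq with () ← T⊆U V.here
count-between {suc n} (inside ∷ T) (inside ∷ U) u m T⊆U eq = trans (∑-subsets n _) (trans (cong₂ _+_
    (trans (∑-cong (subsets n) (λ W → 𝟙-cong (between? (inside ∷ T) (inside ∷ U) m (inside ∷ W)) (between? T U m W)
        (λ (a , b , c) → drop-∷-⊆ a , drop-∷-⊆ b , suc-injective c)
        (λ (a , b , c) → in⊆in a , in⊆in b , cong suc c)))
      (count-between T U u m (drop-∷-⊆ T⊆U) (suc-injective eq)))
    (trans (∑-cong (subsets n) (λ W → 𝟙-no (between? (inside ∷ T) (inside ∷ U) m (outside ∷ W))
        λ (a , _ , _) → case-in (a V.here))) (∑-0 (subsets n)))) (+-identityʳ _))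
  where
  case-in : ∀ {W : Subset n} → ¬ (zero ∈ (outside ∷ W))
  case-in ()
count-between {suc n} (outside ∷ T) (outside ∷ U) u m T⊆U eq = trans (∑-subsets n _) (cong₂ _+_
    (trans (∑-cong (subsets n) (λ W → 𝟙-no (between? (outside ∷ T) (outside ∷ U) m (inside ∷ W))
        λ (_ , b , _) → case-in (b V.here))) (∑-0 (subsets n)))
    (trans (∑-cong (subsets n) (λ W → 𝟙-cong (between? (outside ∷ T) (outside ∷ U) m (outside ∷ W)) (between? T U m W)
        (λ (a , b , c) → drop-∷-⊆ a , drop-∷-⊆ b , c)
        (λ (a , b , c) → out⊆ a , out⊆ b , c)))
      (count-between T U u m (drop-∷-⊆ T⊆U) eq)))
  where
  case-in : ∀ {W : Subset n} → ¬ (zero ∈ (outside ∷ W))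
  case-in ()
count-between {suc n} (outside ∷ T) (inside ∷ U) zero m T⊆U eq = contradiction
  (≤-trans (≤-reflexive (trans eq (+-identityʳ _))) (p⊆q⇒∣p∣≤∣q∣ (drop-∷-⊆ T⊆U))) (<-irrefl refl)
count-between {suc n} (outside ∷ T) (inside ∷ U) (suc u) m T⊆U eq = trans (∑-subsets n _) (cases m)
  where
  eq′ : card U ≡ card T + u
  eq′ = suc-injective (trans eq (+-suc (card T) u))
  out : ∀ m → ∑ (subsets n) (λ W → 𝟙 (between? (outside ∷ T) (inside ∷ U) m (outside ∷ W))) ≡ u C m
  out m = trans (∑-cong (subsets n) (λ W → 𝟙-cong (between? (outside ∷ T) (inside ∷ U) m (outside ∷ W)) (between? T U m W)
      (λ (a , b , c) → drop-∷-⊆ a , drop-∷-⊆ b , c)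
      (λ (a , b , c) → out⊆ a , out⊆ b , c)))
    (count-between T U u m (drop-∷-⊆ T⊆U) eq′)
  cases : ∀ m → ∑ (subsets n) (λ W → 𝟙 (between? (outside ∷ T) (inside ∷ U) m (inside ∷ W))) +
      ∑ (subsets n) (λ W → 𝟙 (between? (outside ∷ T) (inside ∷ U) m (outside ∷ W))) ≡ suc u C m
  cases zero = cong₂ _+_ (trans (∑-cong (subsets n) (λ W → 𝟙-no (between? (outside ∷ T) (inside ∷ U) 0 (inside ∷ W))
      λ (a , _ , c) → <-irrefl refl (≤-trans (≤-reflexive (trans c (+-identityʳ _))) (p⊆q⇒∣p∣≤∣q∣ (drop-∷-⊆ a)))))
      (∑-0 (subsets n))) (out 0)
  cases (suc m) = trans (cong₂ _+_
      (trans (∑-cong (subsets n) (λ W → 𝟙-cong (between? (outside ∷ T) (inside ∷ U) (suc m) (inside ∷ W)) (between? T U m W)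
          (λ (a , b , c) → drop-∷-⊆ a , drop-∷-⊆ b , suc-injective (trans c (+-suc (card T) m)))
          (λ (a , b , c) → out⊆ a , in⊆in b , trans (cong suc c) (sym (+-suc (card T) m)))))
        (count-between T U u m (drop-∷-⊆ T⊆U) eq′))
      (out (suc m))) (nCk+nC[k+1]≡[n+1]C[k+1] u m)

C-step : ∀ M m → suc m * (M C suc m) + m * (M C m) ≡ M * (M C m)
C-step zero zero = refl
C-step zero (suc m) = cong₂ _+_ (*-zeroʳ (suc (suc m))) (*-zeroʳ (suc m))
C-step (suc M) zero = trans (+-identityʳ _) (trans (*-identityˡ (suc M C 1)) (trans (nC1≡n (suc M)) (sym (*-identityʳ (suc M)))))
C-step (suc M) (suc m) = subst₂ (λ a b → suc (suc m) * a + suc m * b ≡ suc M * b)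
    (nCk+nC[k+1]≡[n+1]C[k+1] M (suc m)) (nCk+nC[k+1]≡[n+1]C[k+1] M m) (begin
  suc (suc m) * (y + z) + suc m * (x + y)                            ≡⟨ regroup m x y z ⟩
  (suc (suc m) * z + suc m * y) + (suc m * y + m * x) + (x + y)      ≡⟨ cong₂ (λ a b → a + b + (x + y)) (C-step M (suc m)) (C-step M m) ⟩
  M * y + M * x + (x + y)                                            ≡⟨ collect M x y ⟩
  suc M * (x + y)                                                    ∎)
  where
  open ≡-Reasoning
  x = M C m
  y = M C suc m
  z = M C suc (suc m)
  regroup : ∀ m x y z → suc (suc m) * (y + z) + suc m * (x + y) ≡ (suc (suc m) * z + suc m * y) + (suc m * y + m * x) + (x + y)
  regroup = solve-∀
  collect : ∀ M x y → M * y + M * x + (x + y) ≡ suc M * (x + y)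
  collect = solve-∀

C-absorption : ∀ M m → suc m * (suc M C suc m) ≡ suc M * (M C m)
C-absorption M m = begin
  suc m * (suc M C suc m)             ≡⟨ cong (suc m *_) (nCk+nC[k+1]≡[n+1]C[k+1] M m) ⟨
  suc m * (x + M C suc m)             ≡⟨ expand m x (M C suc m) ⟩
  x + (suc m * (M C suc m) + m * x)   ≡⟨ cong (x +_) (C-step M m) ⟩
  suc M * x                           ∎
  where
  open ≡-Reasoning
  x = M C m
  expand : ∀ m x y → suc m * (x + y) ≡ x + (suc m * y + m * x)
  expand = solve-∀

C-ratio : ∀ b a m → (b + a) ^ m * (b C m) ≤ b ^ m * ((b + a) C m)
C-ratio b a zero = ≤-refl
C-ratio b a (suc m) with b ≤? m
... | yes b≤m = ≤-trans (≤-reflexive (trans (cong ((b + a) ^ suc m *_) (k>n⇒nCk≡0 (s≤s b≤m))) (*-zeroʳ ((b + a) ^ suc m)))) z≤n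
... | no b≰m = *-cancelˡ-≤ (suc m) (begin
    suc m * (M ^ suc m * x′)          ≡⟨ rearr (suc m) (M ^ suc m) x′ ⟩
    M ^ suc m * (suc m * x′)          ≡⟨ cong (M ^ suc m *_) (step′ b b′ x x′ (C-step b m) b≡) ⟩
    M * M ^ m * (b′ * x)              ≡⟨ rearr₂ M (M ^ m) b′ x ⟩
    M * b′ * (M ^ m * x)              ≤⟨ *-mono-≤ Mb′≤ (C-ratio b a m) ⟩
    b * (b′ + a) * (b ^ m * y)        ≡⟨ rearr₃ b (b′ + a) (b ^ m) y ⟩
    b ^ suc m * ((b′ + a) * y)        ≡⟨ cong (b ^ suc m *_) (step′ M (b′ + a) y y′ (C-step M m) (trans (cong (_+ a) b≡) (+-assoc m b′ a))) ⟨
    b ^ suc m * (suc m * y′)          ≡⟨ rearr (suc m) (b ^ suc m) y′ ⟨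
    suc m * (b ^ suc m * y′)          ∎)
  where
  open ≤-Reasoning
  M = b + a
  b′ = b ∸ m
  b≡ : b ≡ m + b′
  b≡ = sym (m+[n∸m]≡n (<⇒≤ (≰⇒> b≰m)))
  x = b C m
  x′ = b C suc m
  y = M C m
  y′ = M C suc m
  rearr : ∀ k p z → k * (p * z) ≡ p * (k * z)
  rearr = solve-∀
  rearr₂ : ∀ M p b x → M * p * (b * x) ≡ M * b * (p * x)
  rearr₂ = solve-∀
  rearr₃ : ∀ b c p y → b * c * (p * y) ≡ b * p * (c * y)
  rearr₃ = solve-∀
  step′ : ∀ n c u v → suc m * v + m * u ≡ n * u → n ≡ m + c → suc m * v ≡ c * u
  step′ n c u v eq n≡ = +-cancelʳ-≡ (m * u) (suc m * v) (c * u) (trans eq (trans (cong (_* u) n≡)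
    (trans (*-distribʳ-+ u m c) (+-comm (m * u) (c * u)))))
  Mb′≤ : M * b′ ≤ b * (b′ + a)
  Mb′≤ = ≤-trans (m≤m+n (M * b′) (m * a)) (≤-reflexive (trans (cong (λ z → (z + a) * b′ + m * a) b≡)
    (trans (lem m b′ a) (cong (_* (b′ + a)) (sym b≡)))))
    where
    lem : ∀ m b a → (m + b + a) * b + m * a ≡ (m + b) * (b + a)
    lem = solve-∀

bernoulliℕ : ∀ b a q → b ^ q * (b + q * a) ≤ (b + a) ^ q * b
bernoulliℕ b a zero = ≤-reflexive (cong (_+ 0) (+-identityʳ b))
bernoulliℕ b a (suc q) = begin
  b * b ^ q * (b + suc q * a)                     ≤⟨ m≤m+n _ (b ^ q * (a * (q * a))) ⟩
  b * b ^ q * (b + suc q * a) + b ^ q * (a * (q * a))   ≡⟨ lem b (b ^ q) q a ⟩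
  (b + a) * (b ^ q * (b + q * a))                 ≤⟨ *-monoʳ-≤ (b + a) (bernoulliℕ b a q) ⟩
  (b + a) * ((b + a) ^ q * b)                     ≡⟨ *-assoc (b + a) ((b + a) ^ q) b ⟨
  (b + a) ^ suc q * b                             ∎
  where
  open ≤-Reasoning
  lem : ∀ b p q a → b * p * (b + suc q * a) + p * (a * (q * a)) ≡ (b + a) * (p * (b + q * a))
  lem = solve-∀

halving : ∀ b a q .{{_ : NonZero (b + a)}} → b + a ≤ q * a → 2 * b ^ q ≤ (b + a) ^ q
halving zero    a zero h = contradiction (≤-trans (>-nonZero⁻¹ a) h) λ ()
halving zero    a (suc q) h = z≤n
halving b@(suc _) a q h = *-cancelʳ-≤ (2 * b ^ q) ((b + a) ^ q) b (begin
  2 * b ^ q * b          ≡⟨ lem (b ^ q) b ⟩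
  b ^ q * (b + b)        ≤⟨ *-monoʳ-≤ (b ^ q) (+-monoʳ-≤ b (≤-trans (m≤m+n b a) h)) ⟩
  b ^ q * (b + q * a)    ≤⟨ bernoulliℕ b a q ⟩
  (b + a) ^ q * b        ∎)
  where
  open ≤-Reasoning
  lem : ∀ p b → 2 * p * b ≡ p * (b + b)
  lem = solve-∀

^-*-swap : ∀ m n k → (m * n) ^ k ≡ m ^ k * n ^ k
^-*-swap m n zero    = refl
^-*-swap m n (suc k) = trans (cong (m * n *_) (^-*-swap m n k)) (lem m n (m ^ k) (n ^ k))
  where
  lem : ∀ m n p q → m * n * (p * q) ≡ m * p * (n * q)
  lem = solve-∀

C-decay : ∀ b a q s m .{{_ : NonZero (b + a)}} → b + a ≤ q * a → s * q ≤ m → 2 ^ s * (b C m) ≤ (b + a) C m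
C-decay b a q s m h sq≤m = *-cancelˡ-≤ ((b + a) ^ m) {{m^n≢0 (b + a) m}} (begin
  (b + a) ^ m * (2 ^ s * (b C m))    ≡⟨ lem ((b + a) ^ m) (2 ^ s) (b C m) ⟩
  2 ^ s * ((b + a) ^ m * (b C m))    ≤⟨ *-monoʳ-≤ (2 ^ s) (C-ratio b a m) ⟩
  2 ^ s * (b ^ m * ((b + a) C m))    ≡⟨ *-assoc (2 ^ s) (b ^ m) _ ⟨
  2 ^ s * b ^ m * ((b + a) C m)      ≤⟨ *-monoˡ-≤ ((b + a) C m) pow ⟩
  (b + a) ^ m * ((b + a) C m)        ∎)
  where
  open ≤-Reasoning
  lem : ∀ x y z → x * (y * z) ≡ y * (x * z)
  lem = solve-∀
  m≡ : q * s + (m ∸ q * s) ≡ m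
  m≡ = m+[n∸m]≡n (≤-trans (≤-reflexive (*-comm q s)) sq≤m)
  split : ∀ x → x ^ m ≡ (x ^ q) ^ s * x ^ (m ∸ q * s)
  split x = trans (cong (x ^_) (sym m≡)) (trans (^-distribˡ-+-* x (q * s) _)
    (cong (_* x ^ (m ∸ q * s)) (sym (^-*-assoc x q s))))
  pow : 2 ^ s * b ^ m ≤ (b + a) ^ m
  pow = begin
    2 ^ s * b ^ m                                 ≡⟨ cong (2 ^ s *_) (split b) ⟩
    2 ^ s * ((b ^ q) ^ s * b ^ (m ∸ q * s))       ≡⟨ *-assoc (2 ^ s) _ _ ⟨
    2 ^ s * (b ^ q) ^ s * b ^ (m ∸ q * s)         ≡⟨ cong (_* b ^ (m ∸ q * s)) (^-*-swap 2 (b ^ q) s) ⟨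
    (2 * b ^ q) ^ s * b ^ (m ∸ q * s)             ≤⟨ *-mono-≤ (^-monoˡ-≤ s (halving b a q h)) (^-monoˡ-≤ (m ∸ q * s) (m≤m+n b a)) ⟩
    ((b + a) ^ q) ^ s * (b + a) ^ (m ∸ q * s)     ≡⟨ split (b + a) ⟨
    (b + a) ^ m                                   ∎

C-lower : ∀ r M → r ≤ M → M ^ r ≤ r ^ r * (M C r)
C-lower r M r≤M = subst (λ N → N ^ r ≤ r ^ r * (N C r)) (m+[n∸m]≡n r≤M)
  (≤-trans (≤-reflexive (sym (trans (cong ((r + (M ∸ r)) ^ r *_) (nCn≡1 r)) (*-identityʳ _)))) (C-ratio r (M ∸ r) r))

C-monoˡ : ∀ {a b} m → a ≤ b → a C m ≤ b C m
C-monoˡ {a} {b} m a≤b = subst (λ b → a C m ≤ b C m) (m+[n∸m]≡n a≤b) (go (b ∸ a))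
  where
  go : ∀ c → a C m ≤ (a + c) C m
  go zero    = ≤-reflexive (cong (_C m) (sym (+-identityʳ a)))
  go (suc c) = ≤-trans (go c) (≤-trans (step m) (≤-reflexive (cong (_C m) (sym (+-suc a c)))))
    where
    step : ∀ m → (a + c) C m ≤ suc (a + c) C m
    step zero    = ≤-refl
    step (suc m) = ≤-trans (m≤n+m _ ((a + c) C m)) (≤-reflexive (nCk+nC[k+1]≡[n+1]C[k+1] (a + c) m))

m<n+[m/n]*n : ∀ m n .{{_ : NonZero n}} → m < n + (m / n) * n
m<n+[m/n]*n m n = ≤-<-trans (≤-reflexive (m≡m%n+[m/n]*n m n)) (+-monoˡ-< ((m / n) * n) (m%n<n m n))

n<2^n : ∀ n → n < 2 ^ n
n<2^n zero    = s≤s z≤n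
n<2^n (suc n) = ≤-trans (s≤s (n<2^n n)) (≤-trans (+-monoˡ-≤ (2 ^ n) (>-nonZero⁻¹ (2 ^ n) {{m^n≢0 2 n}}))
  (≤-reflexive (cong (2 ^ n +_) (sym (+-identityʳ (2 ^ n))))))

-- With x = ⌊d/2p⌋: dᵖ ≤ x²ᵖ ≤ 2^(2px) ≤ 2ᵈ as soon as d < 2p(x + 1) ≤ x².
polynomial≤exponential : ∀ p → ∃ λ D → ∀ d → D ≤ d → d ^ p ≤ 2 ^ d
polynomial≤exponential zero = 0 , λ d _ → >-nonZero⁻¹ (2 ^ d) {{m^n≢0 2 d}}
polynomial≤exponential p@(suc p-1) = P * suc P , bound
  where
  P = 2 * p
  instance
    _ : NonZero P
    _ = m*n≢0 2 p
  bound : ∀ d → P * suc P ≤ d → d ^ p ≤ 2 ^ d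
  bound d D≤d = begin
    d ^ p              ≤⟨ ^-monoˡ-≤ p d≤x² ⟩
    (x * x) ^ p        ≡⟨ cong (λ z → (x * z) ^ p) (*-identityʳ x) ⟨
    (x ^ 2) ^ p        ≡⟨ ^-*-assoc x 2 p ⟩
    x ^ P              ≤⟨ ^-monoˡ-≤ P (<⇒≤ (n<2^n x)) ⟩
    (2 ^ x) ^ P        ≡⟨ ^-*-assoc 2 x P ⟩
    2 ^ (x * P)        ≤⟨ ^-monoʳ-≤ 2 (m/n*n≤m d P) ⟩
    2 ^ d              ∎
    where
    open ≤-Reasoning
    x = d / P
    x≥ : suc P ≤ x
    x≥ = ≤-trans (≤-reflexive (trans (sym (m*n/n≡m (suc P) P)) (cong (_/ P) (*-comm (suc P) P)))) (/-monoˡ-≤ P D≤d)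
    d≤x² : d ≤ x * x
    d≤x² = begin
      d               ≤⟨ <⇒≤ (m<n+[m/n]*n d P) ⟩
      P + x * P       ≤⟨ +-monoˡ-≤ (x * P) (≤-trans (n≤1+n P) x≥) ⟩
      x + x * P       ≡⟨ *-suc x P ⟨
      x * suc P       ≤⟨ *-monoʳ-≤ x x≥ ⟩
      x * x           ∎

-- Words and the second moment method

words : List A → (d : ℕ) → List (Vec A d)
words xs zero    = [] ∷ []
words xs (suc d) = cartesianProductWith _∷_ xs (words xs d)

∑-words : (xs : List A) (d : ℕ) (f : Vec A (suc d) → ℕ) →
  ∑ (words xs (suc d)) f ≡ ∑ xs (λ x → ∑ (words xs d) (λ w → f (x ∷ w)))
∑-words xs d f = go xs
  where
  go : ∀ ys → ∑ (cartesianProductWith _∷_ ys (words xs d)) f ≡ ∑ ys (λ x → ∑ (words xs d) (λ w → f (x ∷ w)))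
  go []       = refl
  go (y ∷ ys) = trans (∑-++ (map (y ∷_) (words xs d)) _ f) (cong₂ _+_ (∑-map (y ∷_) (words xs d) f) (go ys))

words-complete : {xs : List A} → (∀ x → x ∈ˡ xs) → ∀ {d} (w : Vec A d) → w ∈ˡ words xs d
words-complete c []      = here refl
words-complete c (x ∷ w) = ∈-cartesianProductWith⁺ _∷_ (c x) (words-complete c w)

words-unique : {xs : List A} → Unique xs → ∀ d → Unique (words xs d)
words-unique u zero    = [] ∷ []
words-unique u (suc d) = Unique.cartesianProductWith⁺ _∷_ V.∷-injective u (words-unique u d)

∑-words-const : (xs : List A) (d c : ℕ) → ∑ (words xs d) (λ _ → c) ≡ length xs ^ d * c
∑-words-const xs zero    c = refl
∑-words-const xs (suc d) c = trans (∑-words xs d _) (trans (∑-cong xs λ _ → ∑-words-const xs d c)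
  (trans (∑-const xs _) (sym (*-assoc (length xs) _ c))))

2xy≤x²+y² : ∀ x y z D → x ≡ y + z → x ≤ D * z → x * x + D * D * (2 * x * y) ≤ D * D * (x * x + y * y)
2xy≤x²+y² x y z D x≡ x≤ = ≤-trans (+-monoˡ-≤ (D * D * (2 * x * y)) (*-mono-≤ x≤ x≤))
  (≤-reflexive (trans (cong (λ x → D * z * (D * z) + D * D * (2 * x * y)) x≡)
    (trans (lem D y z) (cong (λ x → D * D * (x * x + y * y)) (sym x≡)))))
  where
  lem : ∀ D y z → D * z * (D * z) + D * D * (2 * (y + z) * y) ≡ D * D * ((y + z) * (y + z) + y * y)
  lem = solve-∀

2xy≤x²+y²′ : ∀ x y → 2 * x * y ≤ x * x + y * y
2xy≤x²+y²′ x y with ≤-total x y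
... | inj₁ x≤y = subst (λ y → 2 * x * y ≤ x * x + y * y) (m+[n∸m]≡n x≤y)
  (≤-trans (m≤m+n _ ((y ∸ x) * (y ∸ x))) (≤-reflexive (lem x (y ∸ x))))
  where
  lem : ∀ x z → 2 * x * (x + z) + z * z ≡ x * x + (x + z) * (x + z)
  lem = solve-∀
... | inj₂ y≤x = subst (λ x → 2 * x * y ≤ x * x + y * y) (m+[n∸m]≡n y≤x)
  (≤-trans (m≤m+n _ ((x ∸ y) * (x ∸ y))) (≤-reflexive (lem y (x ∸ y))))
  where
  lem : ∀ x z → 2 * (x + z) * x + z * z ≡ (x + z) * (x + z) + x * x
  lem = solve-∀

occurrences : DecidableEquality A → ∀ {d} → A → Vec A d → ℕ
occurrences _≟ᴬ_ c []      = 0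
occurrences _≟ᴬ_ c (x ∷ w) = 𝟙 (x ≟ᴬ c) + occurrences _≟ᴬ_ c w

module Alphabet (_≟ᴬ_ : DecidableEquality A) (xs : List A) (complete : ∀ x → x ∈ˡ xs) (unique : Unique xs)
  (R′ : ℕ) (length≡ : length xs ≡ suc R′) where

  private R = suc R′

  occ : ∀ {d} → A → Vec A d → ℕ
  occ = occurrences _≟ᴬ_

  -- One letter equals c and the other R − 1 do not.
  ∑-letters : ∀ c (g : ℕ → ℕ) → ∑ xs (λ x → g (𝟙 (x ≟ᴬ c))) + g 0 ≡ R * g 0 + g 1
  ∑-letters c g = +-cancelʳ-≡ (g 0) _ _ total
    where
    is : A → ℕ
    is x = 𝟙 (x ≟ᴬ c)
    each : ∀ x → g (is x) + is x * g 0 ≡ g 0 + is x * g 1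
    each x with x ≟ᴬ c
    ... | yes _ = trans (+-comm (g 1) (g 0 + 0)) (cong₂ _+_ (+-identityʳ (g 0)) (sym (+-identityʳ (g 1))))
    ... | no _  = refl
    one : ∑ xs is ≡ 1
    one = count-unique (_≟ᴬ c) unique (complete c) (λ _ eq → eq) refl
    total : ∑ xs (λ x → g (is x)) + g 0 + g 0 ≡ R * g 0 + g 1 + g 0
    total = cong (_+ g 0) (begin
      ∑ xs (λ x → g (is x)) + g 0                             ≡⟨ cong (λ z → ∑ xs (λ x → g (is x)) + z) (sym (trans (cong (_* g 0) one) (*-identityˡ (g 0)))) ⟩
      ∑ xs (λ x → g (is x)) + ∑ xs is * g 0                   ≡⟨ cong (∑ xs (λ x → g (is x)) +_) (∑-*ʳ xs (g 0) is) ⟨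
      ∑ xs (λ x → g (is x)) + ∑ xs (λ x → is x * g 0)         ≡⟨ ∑-+ xs _ _ ⟨
      ∑ xs (λ x → g (is x) + is x * g 0)                      ≡⟨ ∑-cong xs each ⟩
      ∑ xs (λ x → g 0 + is x * g 1)                           ≡⟨ ∑-+ xs _ _ ⟩
      ∑ xs (λ _ → g 0) + ∑ xs (λ x → is x * g 1)              ≡⟨ cong₂ _+_ (trans (∑-const xs (g 0)) (cong (_* g 0) length≡)) (∑-*ʳ xs (g 1) is) ⟩
      R * g 0 + ∑ xs is * g 1                                 ≡⟨ cong (R * g 0 +_) (trans (cong (_* g 1) one) (*-identityˡ (g 1))) ⟩
      R * g 0 + g 1                                           ∎)
      where open ≡-Reasoning

  ∑-occ : ∀ c d (g : ℕ → ℕ) → ∑ (words xs (suc d)) (λ w → g (occ c w)) ≡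
    R′ * ∑ (words xs d) (λ w → g (occ c w)) + ∑ (words xs d) (λ w → g (suc (occ c w)))
  ∑-occ c d g = trans (∑-words xs d _) (trans (∑-comm xs (words xs d) _)
    (trans (∑-cong (words xs d) λ w → +-cancelʳ-≡ (g (occ c w)) _ _ (trans (∑-letters c (λ i → g (i + occ c w)))
        (lem R′ (g (occ c w)) (g (suc (occ c w))))))
      (trans (∑-+ (words xs d) _ _) (cong (_+ ∑ (words xs d) (λ w → g (suc (occ c w)))) (∑-*ˡ (words xs d) R′ _)))))
    where
    lem : ∀ R′ a b → suc R′ * a + b ≡ R′ * a + b + a
    lem = solve-∀

  ∑1 : ∀ d → ∑ (words xs d) (λ _ → 1) ≡ R ^ d
  ∑1 d = trans (∑-words-const xs d 1) (trans (*-identityʳ _) (cong (_^ d) length≡))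

  first-moment : ∀ c d → R * ∑ (words xs d) (occ c) ≡ d * R ^ d
  first-moment c zero    = *-zeroʳ R
  first-moment c (suc d) = begin
    R * ∑ (words xs (suc d)) (occ c)                 ≡⟨ cong (R *_) (∑-occ c d id) ⟩
    R * (R′ * M + ∑ (words xs d) (λ w → suc (occ c w))) ≡⟨ cong (λ z → R * (R′ * M + z)) (trans (∑-+ (words xs d) (λ _ → 1) (occ c)) (cong (_+ M) (∑1 d))) ⟩
    R * (R′ * M + (R ^ d + M))                       ≡⟨ lem R′ M (R ^ d) ⟩
    R * (R * M) + R * R ^ d                          ≡⟨ cong (λ z → R * z + R * R ^ d) (first-moment c d) ⟩
    R * (d * R ^ d) + R * R ^ d                      ≡⟨ lem₂ R d (R ^ d) ⟩
    suc d * (R * R ^ d)                              ∎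
    where
    open ≡-Reasoning
    M = ∑ (words xs d) (occ c)
    lem : ∀ R′ M p → suc R′ * (R′ * M + (p + M)) ≡ suc R′ * (suc R′ * M) + suc R′ * p
    lem = solve-∀
    lem₂ : ∀ R d p → R * (d * p) + R * p ≡ suc d * (R * p)
    lem₂ = solve-∀

  second-moment : ∀ c d → R * R * ∑ (words xs d) (λ w → occ c w * occ c w) ≡ R ^ d * (d * d + d * R′)
  second-moment c zero    = trans (*-zeroʳ (R * R)) refl
  second-moment c (suc d) = begin
    R * R * ∑ (words xs (suc d)) (λ w → occ c w * occ c w)        ≡⟨ cong (R * R *_) (∑-occ c d (λ n → n * n)) ⟩
    R * R * (R′ * M₂ + ∑ (words xs d) (λ w → suc (occ c w) * suc (occ c w))) ≡⟨ cong (λ z → R * R * (R′ * M₂ + z)) square ⟩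
    R * R * (R′ * M₂ + (M₂ + (2 * M₁ + R ^ d)))                   ≡⟨ lem R′ M₁ M₂ (R ^ d) ⟩
    R * (R * R * M₂) + 2 * R * (R * M₁) + R * R * R ^ d           ≡⟨ cong₂ (λ u v → R * u + 2 * R * v + R * R * R ^ d) (second-moment c d) (first-moment c d) ⟩
    R * (R ^ d * (d * d + d * R′)) + 2 * R * (d * R ^ d) + R * R * R ^ d  ≡⟨ lem₂ R′ d (R ^ d) ⟩
    R * R ^ d * (suc d * suc d + suc d * R′)                      ∎
    where
    open ≡-Reasoning
    M₁ = ∑ (words xs d) (occ c)
    M₂ = ∑ (words xs d) (λ w → occ c w * occ c w)
    sq : ∀ n → suc n * suc n ≡ n * n + (2 * n + 1)
    sq = solve-∀
    square : ∑ (words xs d) (λ w → suc (occ c w) * suc (occ c w)) ≡ M₂ + (2 * M₁ + R ^ d)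
    square = trans (∑-cong (words xs d) (λ w → sq (occ c w))) (trans (∑-+ (words xs d) _ _)
      (cong (M₂ +_) (trans (∑-+ (words xs d) _ _) (cong₂ _+_ (∑-*ˡ (words xs d) 2 _) (∑1 d)))))
    lem : ∀ R′ a b p → suc R′ * suc R′ * (R′ * b + (b + (2 * a + p))) ≡
      suc R′ * (suc R′ * suc R′ * b) + 2 * suc R′ * (suc R′ * a) + suc R′ * suc R′ * p
    lem = solve-∀
    lem₂ : ∀ R′ d p → suc R′ * (p * (d * d + d * R′)) + 2 * suc R′ * (d * p) + suc R′ * suc R′ * p ≡
      suc R′ * p * (suc d * suc d + suc d * R′)
    lem₂ = solve-∀

  Typical : ∀ {d} → ℕ → Vec A d → Set
  Typical N w = ∀ c → N ≤ occ c w

  typical? : ∀ {d} N (w : Vec A d) → Dec (Typical N w)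
  typical? N w = map′ (λ all c → All.lookup all (complete c)) (λ h → All.tabulate λ {c} _ → h c)
    (All.all? (λ c → N ≤? occ c w) xs)

  module _ (N d D : ℕ) .{{_ : NonZero D}} (small : R * N * D + d ≤ d * D) where

    chebyshev-pointwise : ∀ n → 𝟙 (n <? N) * (d * d) + D * D * (2 * d * (R * n)) ≤ D * D * (d * d + R * n * (R * n))
    chebyshev-pointwise n with n <? N
    ... | no _    = *-monoʳ-≤ (D * D) (2xy≤x²+y²′ d (R * n))
    ... | yes n<N = ≤-trans (≤-reflexive (cong (_+ D * D * (2 * d * (R * n))) (+-identityʳ (d * d))))
        (2xy≤x²+y² d (R * n) (d ∸ R * n) D (sym (m+[n∸m]≡n Rn≤d)) d≤)
      where
      RnD+d≤ : R * n * D + d ≤ d * D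
      RnD+d≤ = ≤-trans (+-monoˡ-≤ d (*-monoˡ-≤ D (*-monoʳ-≤ R (<⇒≤ n<N)))) small
      Rn≤d : R * n ≤ d
      Rn≤d = *-cancelʳ-≤ (R * n) d D (≤-trans (m≤m+n _ d) RnD+d≤)
      d≤ : d ≤ D * (d ∸ R * n)
      d≤ = +-cancelˡ-≤ (R * n * D) _ _ (≤-trans RnD+d≤ (≤-reflexive (begin
        d * D                                 ≡⟨ cong (_* D) (m+[n∸m]≡n Rn≤d) ⟨
        (R * n + (d ∸ R * n)) * D             ≡⟨ lem (R * n) (d ∸ R * n) D ⟩
        R * n * D + D * (d ∸ R * n)           ∎)))
        where
        open ≡-Reasoning
        lem : ∀ a b D → (a + b) * D ≡ a * D + D * b
        lem = solve-∀

    chebyshev : ∀ c → count (λ w → occ c w <? N) (words xs d) * (d * d) ≤ D * D * (d * R′) * R ^ d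
    chebyshev c = +-cancelʳ-≤ (D * D * (2 * d * (d * R ^ d))) _ _ (begin
      count (λ w → occ c w <? N) ws * (d * d) + D * D * (2 * d * (d * R ^ d))
        ≡⟨ cong₂ _+_ (sym (∑-*ʳ ws (d * d) _)) (cong (λ z → D * D * (2 * d * z)) (sym (first-moment c d))) ⟩
      ∑ ws (λ w → 𝟙 (occ c w <? N) * (d * d)) + D * D * (2 * d * (R * ∑ ws (occ c)))
        ≡⟨ cong (∑ ws (λ w → 𝟙 (occ c w <? N) * (d * d)) +_) pull ⟩
      ∑ ws (λ w → 𝟙 (occ c w <? N) * (d * d)) + ∑ ws (λ w → D * D * (2 * d * (R * occ c w)))
        ≡⟨ ∑-+ ws _ _ ⟨
      ∑ ws (λ w → 𝟙 (occ c w <? N) * (d * d) + D * D * (2 * d * (R * occ c w)))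
        ≤⟨ ∑-mono ws (λ w → chebyshev-pointwise (occ c w)) ⟩
      ∑ ws (λ w → D * D * (d * d + R * occ c w * (R * occ c w)))
        ≡⟨ trans (∑-*ˡ ws (D * D) _) (cong (D * D *_) (trans (∑-+ ws _ _) (cong₂ _+_
             (trans (∑-words-const xs d (d * d)) (cong (λ z → z ^ d * (d * d)) length≡))
             (trans (∑-cong ws (λ w → sq R (occ c w))) (trans (∑-*ˡ ws (R * R) _) (second-moment c d)))))) ⟩
      D * D * (R ^ d * (d * d) + R ^ d * (d * d + d * R′))
        ≡⟨ lem (D * D) (R ^ d) d R′ ⟩
      D * D * (d * R′) * R ^ d + D * D * (2 * d * (d * R ^ d)) ∎)
      where
      open ≤-Reasoning
      ws = words xs d
      sq : ∀ R n → R * n * (R * n) ≡ R * R * (n * n)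
      sq = solve-∀
      lem : ∀ D p d R′ → D * (p * (d * d) + p * (d * d + d * R′)) ≡ D * (d * R′) * p + D * (2 * d * (d * p))
      lem = solve-∀
      pull : D * D * (2 * d * (R * ∑ ws (occ c))) ≡ ∑ ws (λ w → D * D * (2 * d * (R * occ c w)))
      pull = sym (trans (∑-*ˡ ws (D * D) _) (cong (D * D *_) (trans (∑-*ˡ ws (2 * d) _) (cong (2 * d *_) (∑-*ˡ ws R _)))))

    atypical-rare : .{{_ : NonZero d}} →
      count (λ w → ¬? (typical? N w)) (words xs d) * d ≤ R * (D * D * R′) * R ^ d
    atypical-rare = *-cancelʳ-≤ _ _ d (begin
      count (λ w → ¬? (typical? N w)) ws * d * d              ≡⟨ *-assoc (count (λ w → ¬? (typical? N w)) ws) d d ⟩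
      count (λ w → ¬? (typical? N w)) ws * (d * d)            ≤⟨ *-monoˡ-≤ (d * d) (∑-mono ws some) ⟩
      ∑ ws (λ w → ∑ xs (λ c → 𝟙 (occ c w <? N))) * (d * d)    ≡⟨ cong (_* (d * d)) (∑-comm ws xs _) ⟩
      ∑ xs (λ c → count (λ w → occ c w <? N) ws) * (d * d)    ≡⟨ ∑-*ʳ xs (d * d) _ ⟨
      ∑ xs (λ c → count (λ w → occ c w <? N) ws * (d * d))    ≤⟨ ∑-bound xs _ (λ c _ → chebyshev c) ⟩
      length xs * (D * D * (d * R′) * R ^ d)                  ≡⟨ cong (_* (D * D * (d * R′) * R ^ d)) length≡ ⟩
      R * (D * D * (d * R′) * R ^ d)                          ≡⟨ lem R (D * D) d R′ (R ^ d) ⟩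
      R * (D * D * R′) * R ^ d * d                            ∎)
      where
      open ≤-Reasoning
      ws = words xs d
      lem : ∀ R D d R′ p → R * (D * (d * R′) * p) ≡ R * (D * R′) * p * d
      lem = solve-∀
      some : ∀ w → 𝟙 (¬? (typical? N w)) ≤ ∑ xs (λ c → 𝟙 (occ c w <? N))
      some w with All.all? (λ c → N ≤? occ c w) xs in eq
      ... | yes _ = z≤n
      ... | no ¬all with Any.satisfied (All.¬All⇒Any¬ (λ c → N ≤? occ c w) xs ¬all)
      ...   | c , N≰ = ≤-trans (≤-reflexive (sym (𝟙-yes (occ c w <? N) (≰⇒> N≰)))) (∑-term≤ (λ c → 𝟙 (occ c w <? N)) (complete c))

_≟ˢ_ : ∀ {n} → DecidableEquality (Subset n)
_≟ˢ_ = V.≡-dec _≟ᵇ_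

∑-allFin-suc : ∀ n (f : Fin (suc n) → ℕ) → ∑ (allFin (suc n)) f ≡ f zero + ∑ (allFin n) (f ∘ suc)
∑-allFin-suc n f = cong (f zero +_) (trans (cong (λ xs → ∑ xs f) (sym (map-tabulate id suc))) (∑-map suc (allFin n) f))

length-allFin : ∀ n → length (allFin n) ≡ n
length-allFin n = length-tabulate id

mult : ℕ → Side → ℕ → ℕ
mult r inside  i = i
mult r outside i = r ∸ i

count-lookup : ∀ {n} (t : Subset n) b → count (λ a → lookup t a ≟ᵇ b) (allFin n) ≡ mult n b (card t)
count-lookup t inside = go t
  where
  go : ∀ {n} (t : Subset n) → count (λ a → lookup t a ≟ᵇ inside) (allFin n) ≡ card t
  go []            = refl
  go (inside ∷ t)  = trans (∑-allFin-suc _ (λ a → 𝟙 (lookup (inside ∷ t) a ≟ᵇ inside))) (cong suc (go t))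
  go (outside ∷ t) = trans (∑-allFin-suc _ (λ a → 𝟙 (lookup (outside ∷ t) a ≟ᵇ inside))) (go t)
count-lookup t outside = trans (go t) (∣∁p∣≡n∸∣p∣ t)
  where
  go : ∀ {n} (t : Subset n) → count (λ a → lookup t a ≟ᵇ outside) (allFin n) ≡ card (∁ t)
  go []            = refl
  go (inside ∷ t)  = trans (∑-allFin-suc _ (λ a → 𝟙 (lookup (inside ∷ t) a ≟ᵇ outside))) (go t)
  go (outside ∷ t) = trans (∑-allFin-suc _ (λ a → 𝟙 (lookup (outside ∷ t) a ≟ᵇ outside))) (cong suc (go t))

mult-total : ∀ {n} (t : Subset n) → mult n inside (card t) + mult n outside (card t) ≡ n
mult-total t = m+[n∸m]≡n (∣p∣≤n t)

mult≤ : ∀ r b i → i ≤ r → mult r b i ≤ r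
mult≤ r inside  i h = h
mult≤ r outside i h = m∸n≤m r i

-- Cyclic rotation of the rows; as (a, s) ↦ a + s mod r it is a Latin square.
module _ {r : ℕ} where

  private
    rotated : (a s : ℕ) → a < r → s < r → ∃ λ v → v < r × (v ≡ a + s ⊎ v + r ≡ a + s)
    rotated a s a<r s<r with a + s <? r
    ... | yes <r = a + s , <r , inj₁ refl
    ... | no ≮r  = a + s ∸ r , +-cancelʳ-< r _ _ (≤-trans (s≤s (≤-reflexive (m∸n+n≡m (≮⇒≥ ≮r)))) (+-mono-<-≤ a<r (<⇒≤ s<r))) , inj₂ (m∸n+n≡m (≮⇒≥ ≮r))

  rotate : Fin r → Fin r → Fin r
  rotate a s = fromℕ< (proj₁ (proj₂ (rotated (toℕ a) (toℕ s) (toℕ<n a) (toℕ<n s))))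

  private
    rotate-spec : ∀ a s → toℕ (rotate a s) ≡ toℕ a + toℕ s ⊎ toℕ (rotate a s) + r ≡ toℕ a + toℕ s
    rotate-spec a s with rotated (toℕ a) (toℕ s) (toℕ<n a) (toℕ<n s)
    ... | v , v<r , inj₁ eq = inj₁ (trans (toℕ-fromℕ< v<r) eq)
    ... | v , v<r , inj₂ eq = inj₂ (trans (cong (_+ r) (toℕ-fromℕ< v<r)) eq)

    too-large : ∀ {v a a′ s} → a′ < r → v ≡ a + s → v + r ≡ a′ + s → a ≡ a′
    too-large {v} {a} {a′} {s} a′<r e e′ = contradiction
      (≤-trans a′<r (≤-trans (m≤n+m r a) (≤-reflexive (+-cancelʳ-≡ s (a + r) a′ (trans (lem a r s) (trans (cong (_+ r) (sym e)) e′))))))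
      (<-irrefl refl)
      where
      lem : ∀ a r s → a + r + s ≡ a + s + r
      lem = solve-∀

  rotate-injectiveˡ : ∀ s {a a′} → rotate a s ≡ rotate a′ s → a ≡ a′
  rotate-injectiveˡ s {a} {a′} eq with rotate-spec a s | rotate-spec a′ s
  ... | inj₁ e | inj₁ e′ = toℕ-injective (+-cancelʳ-≡ (toℕ s) _ _ (trans (sym e) (trans (cong toℕ eq) e′)))
  ... | inj₂ e | inj₂ e′ = toℕ-injective (+-cancelʳ-≡ (toℕ s) _ _ (trans (sym e) (trans (cong (λ z → toℕ z + r) eq) e′)))
  ... | inj₁ e | inj₂ e′ = toℕ-injective (too-large (toℕ<n a′) e (trans (cong (λ z → toℕ z + r) eq) e′))
  ... | inj₂ e | inj₁ e′ = sym (toℕ-injective (too-large (toℕ<n a) e′ (trans (cong (λ z → toℕ z + r) (sym eq)) e)))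

  rotate-comm : ∀ a s → rotate a s ≡ rotate s a
  rotate-comm a s with rotate-spec a s | rotate-spec s a
  ... | inj₁ e | inj₁ e′ = toℕ-injective (trans e (trans (+-comm (toℕ a) (toℕ s)) (sym e′)))
  ... | inj₂ e | inj₂ e′ = toℕ-injective (+-cancelʳ-≡ r _ _ (trans e (trans (+-comm (toℕ a) (toℕ s)) (sym e′))))
  ... | inj₁ e | inj₂ e′ = contradiction (≤-trans (m≤n+m r _) (≤-reflexive (trans e′ (trans (+-comm (toℕ s) (toℕ a)) (sym e))))) (<⇒≱ (toℕ<n (rotate a s)))
  ... | inj₂ e | inj₁ e′ = contradiction (≤-trans (m≤n+m r _) (≤-reflexive (trans e (trans (+-comm (toℕ a) (toℕ s)) (sym e′))))) (<⇒≱ (toℕ<n (rotate s a)))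

  rotate-injectiveʳ : ∀ a {s s′} → rotate a s ≡ rotate a s′ → s ≡ s′
  rotate-injectiveʳ a {s} {s′} eq = rotate-injectiveˡ a (trans (rotate-comm s a) (trans eq (rotate-comm a s′)))

count-reindex≤ : ∀ {n} {R : Fin n → Set} (R? : ∀ a → Dec (R a)) (π : Fin n → Fin n) →
  (∀ {a a′} → π a ≡ π a′ → a ≡ a′) → count (λ a → R? (π a)) (allFin n) ≤ count R? (allFin n)
count-reindex≤ {n} R? π inj = count≤count (λ a → R? (π a)) R? (λ a b → π a ≡ b) (Unique.allFin⁺ n)
  (λ a _ ra → π a , ∈-allFin (π a) , ra , refl) (λ { _ _ refl e → inj (sym e) })

shift : ∀ {r} → Fin r → Subset r → Subset r
shift s t = V.tabulate λ a → lookup t (rotate a s)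

lookup-shift : ∀ {r} (s : Fin r) t a → lookup (shift s t) a ≡ lookup t (rotate a s)
lookup-shift s t a = V.lookup∘tabulate _ a

count-shift≤ : ∀ {r} (s : Fin r) t b → mult r b (card (shift s t)) ≤ mult r b (card t)
count-shift≤ {r} s t b = begin
  mult r b (card (shift s t))                                       ≡⟨ count-lookup (shift s t) b ⟨
  count (λ a → lookup (shift s t) a ≟ᵇ b) (allFin r)                 ≡⟨ ∑-cong (allFin r) (λ a → 𝟙-cong (lookup (shift s t) a ≟ᵇ b) (lookup t (rotate a s) ≟ᵇ b)
                                                                        (trans (sym (lookup-shift s t a))) (trans (lookup-shift s t a))) ⟩
  count (λ a → lookup t (rotate a s) ≟ᵇ b) (allFin r)                ≤⟨ count-reindex≤ (λ a → lookup t a ≟ᵇ b) (λ a → rotate a s) (rotate-injectiveˡ s) ⟩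
  count (λ a → lookup t a ≟ᵇ b) (allFin r)                           ≡⟨ count-lookup t b ⟩
  mult r b (card t)                                                 ∎
  where open ≤-Reasoning

card-shift : ∀ {r} (s : Fin r) t → card (shift s t) ≡ card t
card-shift {r} s t = ≤-antisym (count-shift≤ s t inside)
  (+-cancelʳ-≤ (r ∸ card (shift s t)) _ _ (≤-trans (+-monoʳ-≤ (card t) (count-shift≤ s t outside))
    (≤-reflexive (trans (mult-total t) (sym (mult-total (shift s t)))))))

lookup-injective : ∀ {n} {t t′ : Vec A n} → (∀ a → lookup t a ≡ lookup t′ a) → t ≡ t′
lookup-injective {t = t} {t′} eq = trans (sym (V.tabulate∘lookup t)) (trans (V.tabulate-cong eq) (V.tabulate∘lookup t′))

-- A missed point b would extend π to an embedding of Fin (n + 1) into Fin n.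
injective⇒surjective : ∀ {n} (π : Fin n → Fin n) → (∀ {a a′} → π a ≡ π a′ → a ≡ a′) → ∀ b → ∃ λ a → π a ≡ b
injective⇒surjective {n} π inj b with Any.any? (λ a → π a ≟ᶠ b) (allFin n)
... | yes h = Any.satisfied h
... | no ¬h = contradiction (injective⇒≤ {f = extended} (λ {x} {y} → extended-injective x y)) (<⇒≱ (n<1+n n))
  where
  b∉ : ∀ a → π a ≢ b
  b∉ a eq = ¬h (lose (∈-allFin a) eq)
  extended : Fin (suc n) → Fin n
  extended zero    = b
  extended (suc a) = π a
  extended-injective : ∀ x y → extended x ≡ extended y → x ≡ y
  extended-injective zero    zero    _  = refl
  extended-injective zero    (suc y) eq = contradiction (sym eq) (b∉ y)
  extended-injective (suc x) zero    eq = contradiction eq (b∉ x)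
  extended-injective (suc x) (suc y) eq = cong suc (inj eq)

shift-injective : ∀ {r} (s : Fin r) {t t′} → shift s t ≡ shift s t′ → t ≡ t′
shift-injective s {t} {t′} eq = lookup-injective λ b →
  let a , πa≡b = injective⇒surjective (λ a → rotate a s) (rotate-injectiveˡ s) b in
  subst (λ b → lookup t b ≡ lookup t′ b) πa≡b
    (trans (sym (lookup-shift s t a)) (trans (cong (λ t → lookup t a) eq) (lookup-shift s t′ a)))

count-shift-entries : ∀ {r} t (a : Fin r) b → count (λ s → lookup (shift s t) a ≟ᵇ b) (allFin r) ≤ mult r b (card t)
count-shift-entries {r} t a b = begin
  count (λ s → lookup (shift s t) a ≟ᵇ b) (allFin r)     ≡⟨ ∑-cong (allFin r) (λ s → 𝟙-cong (lookup (shift s t) a ≟ᵇ b) (lookup t (rotate a s) ≟ᵇ b)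
                                                            (trans (sym (lookup-shift s t a))) (trans (lookup-shift s t a))) ⟩
  count (λ s → lookup t (rotate a s) ≟ᵇ b) (allFin r)    ≤⟨ count-reindex≤ (λ a → lookup t a ≟ᵇ b) (rotate a) (rotate-injectiveʳ a) ⟩
  count (λ a → lookup t a ≟ᵇ b) (allFin r)               ≡⟨ count-lookup t b ⟩
  mult r b (card t)                                     ∎
  where open ≤-Reasoning

count-by-witness : {R : A → Set} (R? : ∀ x → Dec (R x)) (xs : List A) (b : ℕ) →
  (∀ x → R x → count R? xs ≤ b) → count R? xs ≤ b
count-by-witness R? xs b h with Any.any? R? xs
... | yes p = let x , r = Any.satisfied p in h x r
... | no ¬p = ≤-trans (∑-bound xs 0 (λ x x∈ → ≤-reflexive (𝟙-no (R? x) λ r → ¬p (lose x∈ r)))) (≤-trans (≤-reflexive (*-zeroʳ (length xs))) z≤n)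

-- Matrices as words of columns, and the likelihood of a row

shiftM : ∀ {r d} → Vec (Fin r) d → Vec (Subset r) d → Vec (Subset r) d
shiftM = zipWith shift

row : ∀ {r d} → Fin r → Vec (Subset r) d → Vec Side d
row a = V.map (λ t → lookup t a)

-- The number of ways to choose a point of each column so that the row y results.
likelihood : ∀ {r d} → Vec (Subset r) d → Vec Side d → ℕ
likelihood         []      []      = 1
likelihood {r} (t ∷ X) (b ∷ y) = mult r b (card t) * likelihood X y

likelihood-shiftM : ∀ {r d} (s : Vec (Fin r) d) X y → likelihood (shiftM s X) y ≡ likelihood X y
likelihood-shiftM []      []      []      = refl
likelihood-shiftM {r} (s ∷ ss) (t ∷ X) (b ∷ y) = cong₂ _*_ (cong (mult r b) (card-shift s t)) (likelihood-shiftM ss X y)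

count-rows : ∀ {r d} (X : Vec (Subset r) d) a y →
  count (λ s → row a (shiftM s X) ≟ˢ y) (words (allFin r) d) ≤ likelihood X y
count-rows []      a []      = ≤-refl
count-rows {r} (t ∷ X) a (b ∷ y) = begin
  count (λ s → row a (shiftM s (t ∷ X)) ≟ˢ (b ∷ y)) (words (allFin r) (suc _))
    ≡⟨ ∑-words (allFin r) _ _ ⟩
  ∑ (allFin r) (λ s → ∑ (words (allFin r) _) (λ ss → 𝟙 (row a (shiftM (s ∷ ss) (t ∷ X)) ≟ˢ (b ∷ y))))
    ≤⟨ ∑-mono (allFin r) (λ s → ∑-mono (words (allFin r) _) (λ ss → both s ss)) ⟩
  ∑ (allFin r) (λ s → ∑ (words (allFin r) _) (λ ss → 𝟙 (lookup (shift s t) a ≟ᵇ b) * 𝟙 (row a (shiftM ss X) ≟ˢ y)))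
    ≡⟨ ∑-cong (allFin r) (λ s → ∑-*ˡ (words (allFin r) _) (𝟙 (lookup (shift s t) a ≟ᵇ b)) (λ ss → 𝟙 (row a (shiftM ss X) ≟ˢ y))) ⟩
  ∑ (allFin r) (λ s → 𝟙 (lookup (shift s t) a ≟ᵇ b) * count (λ ss → row a (shiftM ss X) ≟ˢ y) (words (allFin r) _))
    ≡⟨ ∑-*ʳ (allFin r) _ _ ⟩
  count (λ s → lookup (shift s t) a ≟ᵇ b) (allFin r) * count (λ ss → row a (shiftM ss X) ≟ˢ y) (words (allFin r) _)
    ≤⟨ *-mono-≤ (count-shift-entries t a b) (count-rows X a y) ⟩
  mult r b (card t) * likelihood X y ∎
  where
  open ≤-Reasoning
  both : ∀ s ss → 𝟙 (row a (shiftM (s ∷ ss) (t ∷ X)) ≟ˢ (b ∷ y)) ≤ 𝟙 (lookup (shift s t) a ≟ᵇ b) * 𝟙 (row a (shiftM ss X) ≟ˢ y)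
  both s ss = ≤-trans (𝟙-mono _ ((lookup (shift s t) a ≟ᵇ b) ×-dec (row a (shiftM ss X) ≟ˢ y)) V.∷-injective)
    (≤-reflexive (𝟙-× (lookup (shift s t) a ≟ᵇ b) (row a (shiftM ss X) ≟ˢ y)))

-- Masks: a set of columns

selected : ∀ {d} → Vec Side d → Vec A d → List A
selected []            []      = []
selected (inside ∷ m)  (x ∷ X) = x ∷ selected m X
selected (outside ∷ m) (x ∷ X) = selected m X

length-selected : ∀ {d} (m : Vec Side d) (X : Vec A d) → length (selected m X) ≡ card m
length-selected []            []      = refl
length-selected (inside ∷ m)  (x ∷ X) = cong suc (length-selected m X)
length-selected (outside ∷ m) (x ∷ X) = length-selected m X

selected-map : ∀ {d} (f : A → B) (m : Vec Side d) (X : Vec A d) → selected m (V.map f X) ≡ map f (selected m X)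
selected-map f []            []      = refl
selected-map f (inside ∷ m)  (x ∷ X) = cong (f x ∷_) (selected-map f m X)
selected-map f (outside ∷ m) (x ∷ X) = selected-map f m X

module Selection (_≟ᴬ_ : DecidableEquality A) where

  private
    #_∈_ : A → List A → ℕ
    # c ∈ L = count (_≟ᴬ c) L

  select : ∀ {d} (X : Vec A d) (L : List A) → (∀ c → # c ∈ L ≤ occurrences _≟ᴬ_ c X) → ∃ λ m → selected m X ↭ L
  select [] []      h = [] , ↭-refl
  select [] (x ∷ L) h = contradiction (≤-trans (≤-reflexive (cong (_+ count (_≟ᴬ x) L) (sym (𝟙-yes (x ≟ᴬ x) refl)))) (h x)) λ ()
  select (x ∷ X) L h with Any.any? (x ≟ᴬ_) L
  ... | no x∉ = let m , p = select X L h′ in outside ∷ m , p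
    where
    h′ : ∀ c → # c ∈ L ≤ occurrences _≟ᴬ_ c X
    h′ c with x ≟ᴬ c | h c
    ... | no _     | le = le
    ... | yes refl | _  = ≤-trans (∑-bound L 0 λ y y∈ → ≤-reflexive (𝟙-no (y ≟ᴬ x) λ { refl → x∉ (lose y∈ refl) }))
      (≤-trans (≤-reflexive (*-zeroʳ (length L))) z≤n)
  ... | yes x∈ with ∈-∃++ x∈
  ...   | as , bs , refl = let m , p = select X (as ++ bs) h′ in
      inside ∷ m , ↭-trans (↭-prep x p) (↭-sym (Perm.shift x as bs))
    where
    h′ : ∀ c → # c ∈ (as ++ bs) ≤ occurrences _≟ᴬ_ c X
    h′ c = +-cancelˡ-≤ (𝟙 (x ≟ᴬ c)) _ _ (≤-trans (≤-reflexive (begin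
      𝟙 (x ≟ᴬ c) + # c ∈ (as ++ bs)                ≡⟨ cong (𝟙 (x ≟ᴬ c) +_) (∑-++ as bs _) ⟩
      𝟙 (x ≟ᴬ c) + (# c ∈ as + # c ∈ bs)           ≡⟨ lem (𝟙 (x ≟ᴬ c)) (# c ∈ as) (# c ∈ bs) ⟩
      # c ∈ as + # c ∈ (x ∷ bs)                    ≡⟨ ∑-++ as (x ∷ bs) _ ⟨
      # c ∈ (as ++ x ∷ bs)                         ∎)) (h c))
      where
      open ≡-Reasoning
      lem : ∀ a b c → a + (b + c) ≡ b + (a + c)
      lem = solve-∀

profile : ∀ {r} → Fin r → Subset r → Side × ℕ
profile a t = lookup t a , card t

profiles : ℕ → List (Side × ℕ)
profiles r′ = map (λ t → inside , suc (card t)) (subsets r′) ++ map (λ t → outside , card t) (subsets r′)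

profiles-↭ : ∀ r′ (a : Fin (suc r′)) → map (profile a) (subsets (suc r′)) ↭ profiles r′
profiles-↭ r′ zero = ↭-reflexive (trans (map-++ (profile zero) (map (inside ∷_) (subsets r′)) _)
  (cong₂ _++_ (sym (map-∘ (subsets r′))) (sym (map-∘ (subsets r′)))))
profiles-↭ (suc r″) (suc a) = ↭-trans
    (↭-reflexive (trans (map-++ (profile (suc a)) (map (inside ∷_) (subsets (suc r″))) _)
      (cong₂ _++_ (trans (sym (map-∘ (subsets (suc r″)))) (map-∘ {g = up} {f = profile a} (subsets (suc r″)))) (sym (map-∘ (subsets (suc r″)))))))
    (↭-trans (Perm.++⁺ (Perm.map⁺ up (profiles-↭ r″ a)) (profiles-↭ r″ a)) (↭-trans (↭-reflexive expand) (↭-trans swap (↭-reflexive collapse))))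
  where
  up : Side × ℕ → Side × ℕ
  up (b , i) = b , suc i
  S = subsets r″
  II IO OI OO : List (Side × ℕ)
  II = map (λ t → inside , suc (suc (card t))) S
  IO = map (λ t → inside , suc (card t)) S
  OI = map (λ t → outside , suc (card t)) S
  OO = map (λ t → outside , card t) S
  expand : map up (profiles r″) ++ profiles r″ ≡ (II ++ OI) ++ (IO ++ OO)
  expand = cong (_++ (IO ++ OO)) (trans (map-++ up (map _ S) _) (cong₂ _++_ (sym (map-∘ S)) (sym (map-∘ S))))
  swap : (II ++ OI) ++ (IO ++ OO) ↭ (II ++ IO) ++ (OI ++ OO)
  swap = ↭-trans (Perm.++-assoc II OI (IO ++ OO)) (↭-trans (Perm.++⁺ˡ II (Perm.shifts OI IO)) (↭-sym (Perm.++-assoc II IO (OI ++ OO))))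
  collapse : (II ++ IO) ++ (OI ++ OO) ≡ profiles (suc r″)
  collapse = sym (cong₂ _++_
    (trans (map-++ (λ t → inside , suc (card t)) (map (inside ∷_) S) _) (cong₂ _++_ (sym (map-∘ S)) (sym (map-∘ S))))
    (trans (map-++ (λ t → outside , card t) (map (inside ∷_) S) _) (cong₂ _++_ (sym (map-∘ S)) (sym (map-∘ S)))))

copies : ℕ → List A → List A
copies N xs = concat (replicate N xs)

map-copies : ∀ N (f : A → B) xs → map f (copies N xs) ≡ copies N (map f xs)
map-copies zero    f xs = refl
map-copies (suc N) f xs = trans (map-++ f xs _) (cong (map f xs ++_) (map-copies N f xs))

copies-↭ : ∀ N {xs ys : List A} → xs ↭ ys → copies N xs ↭ copies N ys
copies-↭ zero    p = ↭-refl
copies-↭ (suc N) p = Perm.++⁺ p (copies-↭ N p)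

product-copies : ∀ N xs → product (copies N xs) ≡ product xs ^ N
product-copies zero    xs = refl
product-copies (suc N) xs = trans (product-++ xs _) (cong (product xs *_) (product-copies N xs))

length-copies : ∀ N (xs : List A) → length (copies N xs) ≡ N * length xs
length-copies zero    xs = refl
length-copies (suc N) xs = trans (length-++ xs) (cong (length xs +_) (length-copies N xs))

∑-copies : ∀ N (xs : List A) f → ∑ (copies N xs) f ≡ N * ∑ xs f
∑-copies zero    xs f = refl
∑-copies (suc N) xs f = trans (∑-++ xs _ f) (cong (∑ xs f +_) (∑-copies N xs f))

factors : ∀ {r d} → Vec Side d → Vec (Subset r) d → Vec Side d → List ℕ
factors {r} m X y = selected m (zipWith (λ t b → mult r b (card t)) X y)

factors≤ : ∀ {r d} (m : Vec Side d) (X : Vec (Subset r) d) y → All (_≤ r) (factors m X y)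
factors≤ [] [] [] = []
factors≤ {r} (inside ∷ m) (t ∷ X) (b ∷ y) = mult≤ r b (card t) (∣p∣≤n t) ∷ factors≤ m X y
factors≤ (outside ∷ m) (t ∷ X) (b ∷ y) = factors≤ m X y

likelihood≤ : ∀ {r d} (m : Vec Side d) (X : Vec (Subset r) d) y →
  likelihood X y ≤ product (factors m X y) * r ^ card (∁ m)
likelihood≤ [] [] [] = ≤-refl
likelihood≤ {r} (inside ∷ m) (t ∷ X) (b ∷ y) = ≤-trans (*-monoʳ-≤ (mult r b (card t)) (likelihood≤ m X y))
  (≤-reflexive (sym (*-assoc (mult r b (card t)) _ _)))
likelihood≤ {r} (outside ∷ m) (t ∷ X) (b ∷ y) = ≤-trans (*-mono-≤ (mult≤ r b (card t) (∣p∣≤n t)) (likelihood≤ m X y))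
  (≤-reflexive (lem r (product (factors m X y)) (r ^ card (∁ m))))
  where
  lem : ∀ r p q → r * (p * q) ≡ p * (r * q)
  lem = solve-∀

-- An unmasked column leaves the entry of y free, whence the factor 2.
∑-factors : ∀ {r d} (m : Vec Side d) (X : Vec (Subset r) d) →
  ∑ (subsets d) (λ y → product (factors m X y)) ≡ r ^ card m * 2 ^ card (∁ m)
∑-factors [] [] = refl
∑-factors {r} (inside ∷ m) (t ∷ X) = begin
  ∑ (subsets _) (λ y → product (factors (inside ∷ m) (t ∷ X) y))
    ≡⟨ ∑-subsets _ (λ y → product (factors (inside ∷ m) (t ∷ X) y)) ⟩
  ∑ (subsets _) (λ y → card t * product (factors m X y)) + ∑ (subsets _) (λ y → (r ∸ card t) * product (factors m X y))
    ≡⟨ cong₂ _+_ (∑-*ˡ (subsets _) (card t) (λ y → product (factors m X y))) (∑-*ˡ (subsets _) (r ∸ card t) (λ y → product (factors m X y))) ⟩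
  card t * total + (r ∸ card t) * total
    ≡⟨ *-distribʳ-+ total (card t) (r ∸ card t) ⟨
  (card t + (r ∸ card t)) * total
    ≡⟨ cong₂ _*_ (mult-total t) (∑-factors m X) ⟩
  r * (r ^ card m * 2 ^ card (∁ m))
    ≡⟨ *-assoc r (r ^ card m) _ ⟨
  r ^ card (inside ∷ m) * 2 ^ card (∁ (inside ∷ m)) ∎
  where
  open ≡-Reasoning
  total = ∑ (subsets _) (λ y → product (factors m X y))
∑-factors {r} (outside ∷ m) (t ∷ X) = trans (∑-subsets _ (λ y → product (factors (outside ∷ m) (t ∷ X) y))) (trans (cong₂ _+_ (∑-factors m X) (∑-factors m X))
  (lem (r ^ card m) (2 ^ card (∁ m))))
  where
  lem : ∀ p q → p * q + p * q ≡ p * (2 * q)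
  lem = solve-∀

card-∁ : ∀ {d} (m : Subset d) → card m + card (∁ m) ≡ d
card-∁ []            = refl
card-∁ (inside ∷ m)  = cong suc (card-∁ m)
card-∁ (outside ∷ m) = trans (+-suc (card m) _) (cong suc (card-∁ m))

module Columns (r′ : ℕ) where

  r R′ : ℕ
  r  = suc r′
  R′ = 2 ^ r ∸ 1

  R≡ : suc R′ ≡ 2 ^ r
  R≡ = m+[n∸m]≡n (>-nonZero⁻¹ (2 ^ r) {{m^n≢0 2 r}})

  open Alphabet _≟ˢ_ (subsets r) subsets-complete (subsets-unique r) R′ (trans (length-subsets r) (sym R≡)) public

  entry : Side × ℕ → ℕ
  entry = uncurry (mult r)

  Λ : ℕ
  Λ = product (map entry (profiles r′))

  mask : ∀ {N d} (X : Vec (Subset r) d) → Typical N X → ∃ λ m → selected m X ↭ copies N (subsets r)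
  mask {N} X typ = Selection.select _≟ˢ_ X (copies N (subsets r)) λ c → ≤-trans
    (≤-reflexive (trans (∑-copies N (subsets r) _) (trans (cong (N *_)
      (count-unique (_≟ˢ c) (subsets-unique r) (subsets-complete c) (λ _ e → e) refl)) (*-identityʳ N)))) (typ c)

  module _ {N d} (X : Vec (Subset r) d) (m : Vec Side d) (m↭ : selected m X ↭ copies N (subsets r)) where

    card-mask : card m ≡ N * 2 ^ r
    card-mask = trans (sym (length-selected m X)) (trans (Perm.↭-length m↭)
      (trans (length-copies N (subsets r)) (cong (N *_) (length-subsets r))))

    card-∁-mask : card (∁ m) ≡ d ∸ N * 2 ^ r
    card-∁-mask = trans (∣∁p∣≡n∸∣p∣ m) (cong (d ∸_) card-mask)

    factors-row : ∀ a → factors m X (row a X) ↭ map entry (copies N (profiles r′))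
    factors-row a = ↭-trans (↭-reflexive (begin
      selected m (zipWith (λ t b → mult r b (card t)) X (row a X))  ≡⟨ cong (selected m) (zip-row X) ⟩
      selected m (V.map (entry ∘ profile a) X)                      ≡⟨ selected-map (entry ∘ profile a) m X ⟩
      map (entry ∘ profile a) (selected m X)                        ≡⟨ map-∘ (selected m X) ⟩
      map entry (map (profile a) (selected m X))                    ∎))
      (Perm.map⁺ entry (↭-trans (Perm.map⁺ (profile a) m↭)
        (↭-trans (↭-reflexive (map-copies N (profile a) (subsets r))) (copies-↭ N (profiles-↭ r′ a)))))
      where
      open ≡-Reasoning
      zip-row : ∀ {d} (X : Vec (Subset r) d) → zipWith (λ t b → mult r b (card t)) X (row a X) ≡ V.map (entry ∘ profile a) X
      zip-row []      = refl
      zip-row (t ∷ X) = cong (entry (profile a t) ∷_) (zip-row X)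

    product-factors-row : ∀ a → product (factors m X (row a X)) ≡ Λ ^ N
    product-factors-row a = trans (product-↭ (factors-row a))
      (trans (cong product (map-copies N entry (profiles r′))) (product-copies N (map entry (profiles r′))))

    likelihood-row≤ : ∀ a → likelihood X (row a X) ≤ Λ ^ N * r ^ (d ∸ N * 2 ^ r)
    likelihood-row≤ a = ≤-trans (likelihood≤ m X (row a X))
      (≤-reflexive (cong₂ (λ p e → p * r ^ e) (product-factors-row a) card-∁-mask))

    Heavy : Vec Side d → Set
    Heavy y = Λ ^ N ≤ product (factors m X y)

    heavy? : ∀ y → Dec (Heavy y)
    heavy? y = Λ ^ N ≤? product (factors m X y)

    count-heavy : count heavy? (subsets d) * Λ ^ N ≤ r ^ (N * 2 ^ r) * 2 ^ (d ∸ N * 2 ^ r)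
    count-heavy = begin
      count heavy? (subsets d) * Λ ^ N                   ≡⟨ ∑-*ʳ (subsets d) (Λ ^ N) _ ⟨
      ∑ (subsets d) (λ y → 𝟙 (heavy? y) * Λ ^ N)         ≤⟨ ∑-mono (subsets d) markov ⟩
      ∑ (subsets d) (λ y → product (factors m X y))      ≡⟨ ∑-factors m X ⟩
      r ^ card m * 2 ^ card (∁ m)                        ≡⟨ cong₂ (λ a b → r ^ a * 2 ^ b) card-mask card-∁-mask ⟩
      r ^ (N * 2 ^ r) * 2 ^ (d ∸ N * 2 ^ r)              ∎
      where
      open ≤-Reasoning
      markov : ∀ y → 𝟙 (heavy? y) * Λ ^ N ≤ product (factors m X y)
      markov y with heavy? y
      ... | yes h = ≤-trans (≤-reflexive (+-identityʳ _)) h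
      ... | no _  = z≤n

  module _ (N d : ℕ) where

    shifts : List (Vec (Fin r) d)
    shifts = words (allFin r) d

    matrices : List (Vec (Subset r) d)
    matrices = words (subsets r) d

    Good : Vec (Subset r) d → Set
    Good X = Typical N X × r ^ d ≤ 2 * count (λ s → typical? N (shiftM s X)) shifts

    good? : ∀ X → Dec (Good X)
    good? X = typical? N X ×-dec (r ^ d ≤? 2 * count (λ s → typical? N (shiftM s X)) shifts)

    private
      atypical = count (λ X → ¬? (typical? N X)) matrices

      length-shifts : ∑ shifts (λ _ → 1) ≡ r ^ d
      length-shifts = trans (∑-words-const (allFin r) d 1) (trans (*-identityʳ _) (cong (_^ d) (length-allFin r)))

      atypicalShifts : Vec (Subset r) d → ℕ
      atypicalShifts X = count (λ s → ¬? (typical? N (shiftM s X))) shifts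

      𝟙-complement : ∀ {P : Set} (p : Dec P) → 𝟙 p + 𝟙 (¬? p) ≡ 1
      𝟙-complement (yes _) = refl
      𝟙-complement (no _)  = refl

      complement : ∀ X → count (λ s → typical? N (shiftM s X)) shifts + atypicalShifts X ≡ r ^ d
      complement X = trans (sym (∑-+ shifts _ _)) (trans (∑-cong shifts λ s → 𝟙-complement (typical? N (shiftM s X))) length-shifts)

      bad : ∀ X → 𝟙 (¬? (good? X)) * r ^ d ≤ 𝟙 (¬? (typical? N X)) * r ^ d + 2 * atypicalShifts X
      bad X with typical? N X | r ^ d ≤? 2 * count (λ s → typical? N (shiftM s X)) shifts
      ... | no _  | _     = m≤m+n _ _
      ... | yes _ | yes _ = z≤n
      ... | yes _ | no ≰  = ≤-trans (≤-reflexive (+-identityʳ _)) (+-cancelˡ-≤ (r ^ d) _ _ (begin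
        r ^ d + r ^ d        ≡⟨ cong (r ^ d +_) (+-identityʳ (r ^ d)) ⟨
        2 * r ^ d            ≡⟨ cong (2 *_) (complement X) ⟨
        2 * (c + b)          ≡⟨ *-distribˡ-+ 2 c b ⟩
        2 * c + 2 * b        ≤⟨ +-monoˡ-≤ (2 * b) (<⇒≤ (≰⇒> ≰)) ⟩
        r ^ d + 2 * b        ∎))
        where
        open ≤-Reasoning
        c = count (λ s → typical? N (shiftM s X)) shifts
        b = atypicalShifts X

      shiftM-injective : ∀ {d} (s : Vec (Fin r) d) {X X′} → shiftM s X ≡ shiftM s X′ → X ≡ X′
      shiftM-injective []       {[]}    {[]}      eq = refl
      shiftM-injective (s ∷ ss) {t ∷ X} {t′ ∷ X′} eq =
        cong₂ _∷_ (shift-injective s (V.∷-injectiveˡ eq)) (shiftM-injective ss (V.∷-injectiveʳ eq))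

    bad-rare : count (λ X → ¬? (good? X)) matrices ≤ 3 * atypical
    bad-rare = *-cancelʳ-≤ _ _ (r ^ d) {{m^n≢0 r d}} (begin
      count (λ X → ¬? (good? X)) matrices * r ^ d
        ≡⟨ ∑-*ʳ matrices (r ^ d) _ ⟨
      ∑ matrices (λ X → 𝟙 (¬? (good? X)) * r ^ d)
        ≤⟨ ∑-mono matrices bad ⟩
      ∑ matrices (λ X → 𝟙 (¬? (typical? N X)) * r ^ d + 2 * atypicalShifts X)
        ≡⟨ ∑-+ matrices _ _ ⟩
      ∑ matrices (λ X → 𝟙 (¬? (typical? N X)) * r ^ d) + ∑ matrices (λ X → 2 * atypicalShifts X)
        ≡⟨ cong₂ _+_ (∑-*ʳ matrices (r ^ d) _) (∑-*ˡ matrices 2 atypicalShifts) ⟩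
      atypical * r ^ d + 2 * ∑ matrices atypicalShifts
        ≡⟨ cong (λ z → atypical * r ^ d + 2 * z) (∑-comm matrices shifts _) ⟩
      atypical * r ^ d + 2 * ∑ shifts (λ s → count (λ X → ¬? (typical? N (shiftM s X))) matrices)
        ≤⟨ +-monoʳ-≤ (atypical * r ^ d) (*-monoʳ-≤ 2 (∑-mono shifts reindex)) ⟩
      atypical * r ^ d + 2 * ∑ shifts (λ _ → atypical)
        ≡⟨ cong (λ z → atypical * r ^ d + 2 * z) (trans (∑-words-const (allFin r) d atypical) (cong (λ n → n ^ d * atypical) (length-allFin r))) ⟩
      atypical * r ^ d + 2 * (r ^ d * atypical)
        ≡⟨ lem atypical (r ^ d) ⟩
      3 * atypical * r ^ d ∎)
      where
      open ≤-Reasoning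
      lem : ∀ a p → a * p + 2 * (p * a) ≡ 3 * a * p
      lem = solve-∀
      reindex : ∀ s → count (λ X → ¬? (typical? N (shiftM s X))) matrices ≤ atypical
      reindex s = count≤count (λ X → ¬? (typical? N (shiftM s X))) (λ X → ¬? (typical? N X)) (λ X Y → shiftM s X ≡ Y)
        (words-unique (subsets-unique r) d)
        (λ X _ h → shiftM s X , words-complete subsets-complete (shiftM s X) , h , refl)
        (λ { _ _ refl e → shiftM-injective s (sym e) })

    -- Every shift of X has a row in A, and a point of A is a row of at most Λᴺ r^(d − N 2^r) typical shifts.
    hit-all-shifts⇒large : ∀ X → Good X → {A : Vec Side d → Set} (A? : ∀ y → Dec (A y)) →
      (∀ s → ∃ λ a → A (row a (shiftM s X))) →
      r ^ d ≤ 2 * (r * (count A? (subsets d) * (Λ ^ N * r ^ (d ∸ N * 2 ^ r))))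
    hit-all-shifts⇒large X (_ , half) {A} A? hit = ≤-trans half (*-monoʳ-≤ 2 (begin
      count (λ s → typical? N (shiftM s X)) shifts
        ≤⟨ ∑-mono shifts spread ⟩
      ∑ shifts (λ s → ∑ (allFin r) (λ a → ∑ (subsets d) (λ y → 𝟙 (T? a y s))))
        ≡⟨ ∑-comm shifts (allFin r) _ ⟩
      ∑ (allFin r) (λ a → ∑ shifts (λ s → ∑ (subsets d) (λ y → 𝟙 (T? a y s))))
        ≡⟨ ∑-cong (allFin r) (λ a → ∑-comm shifts (subsets d) _) ⟩
      ∑ (allFin r) (λ a → ∑ (subsets d) (λ y → count (T? a y) shifts))
        ≤⟨ ∑-mono (allFin r) (λ a → ∑-mono (subsets d) (fibre a)) ⟩
      ∑ (allFin r) (λ a → ∑ (subsets d) (λ y → 𝟙 (A? y) * F))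
        ≡⟨ trans (∑-const (allFin r) _) (cong₂ _*_ (length-allFin r) (∑-*ʳ (subsets d) F _)) ⟩
      r * (count A? (subsets d) * F) ∎))
      where
      open ≤-Reasoning
      F = Λ ^ N * r ^ (d ∸ N * 2 ^ r)
      T? : ∀ a y s → Dec (A y × Typical N (shiftM s X) × row a (shiftM s X) ≡ y)
      T? a y s = A? y ×-dec typical? N (shiftM s X) ×-dec row a (shiftM s X) ≟ˢ y
      spread : ∀ s → 𝟙 (typical? N (shiftM s X)) ≤ ∑ (allFin r) (λ a → ∑ (subsets d) (λ y → 𝟙 (T? a y s)))
      spread s = ≤-trans (𝟙-mono (typical? N (shiftM s X)) (T? a (row a (shiftM s X)) s) (λ typ → h , typ , refl))
        (≤-trans (∑-term≤ (λ y → 𝟙 (T? a y s)) (subsets-complete (row a (shiftM s X))))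
          (∑-term≤ (λ a → ∑ (subsets d) (λ y → 𝟙 (T? a y s))) (∈-allFin a)))
        where
        a = proj₁ (hit s)
        h = proj₂ (hit s)
      fibre : ∀ a y → count (T? a y) shifts ≤ 𝟙 (A? y) * F
      fibre a y = count-by-witness (T? a y) shifts _ λ { s (h , typ , refl) →
        ≤-trans (count-mono (T? a y) (λ s → row a (shiftM s X) ≟ˢ y) shifts (λ _ (_ , _ , e) → e))
        (≤-trans (count-rows X a y)
        (≤-trans (≤-reflexive (sym (likelihood-shiftM s X y)))
        (≤-trans (let m , m↭ = mask (shiftM s X) typ in likelihood-row≤ {N} (shiftM s X) m m↭ a)
          (≤-reflexive (sym (trans (cong (_* F) (𝟙-yes (A? y) h)) (*-identityˡ F))))))) }

∏ : List A → (A → ℕ) → ℕ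
∏ xs f = product (map f xs)

∏-const : (xs : List A) (c : ℕ) → ∏ xs (λ _ → c) ≡ c ^ length xs
∏-const []       c = refl
∏-const (x ∷ xs) c = cong (c *_) (∏-const xs c)

∏-* : (xs : List A) (f g : A → ℕ) → ∏ xs (λ x → f x * g x) ≡ ∏ xs f * ∏ xs g
∏-* []       f g = refl
∏-* (x ∷ xs) f g = trans (cong (f x * g x *_) (∏-* xs f g)) (lem (f x) (g x) (∏ xs f) (∏ xs g))
  where
  lem : ∀ a b c d → a * b * (c * d) ≡ a * c * (b * d)
  lem = solve-∀

∏-comm : (xs : List A) (ys : List B) (f : A → B → ℕ) → ∏ xs (λ x → ∏ ys (f x)) ≡ ∏ ys (λ y → ∏ xs (λ x → f x y))
∏-comm []       ys f = sym (trans (∏-const ys 1) (^-zeroˡ (length ys)))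
∏-comm (x ∷ xs) ys f = trans (cong (∏ ys (f x) *_) (∏-comm xs ys f)) (sym (∏-* ys (f x) (λ y → ∏ xs (λ x → f x y))))

∏-cong : (xs : List A) {f g : A → ℕ} → (∀ x → f x ≡ g x) → ∏ xs f ≡ ∏ xs g
∏-cong xs h = cong product (map-cong h xs)

∏-lookup : ∀ {n} (t : Subset n) (g : Side → ℕ) → ∏ (allFin n) (λ a → g (lookup t a)) ≡ g inside ^ card t * g outside ^ (n ∸ card t)
∏-lookup t g = trans (go t) (cong (λ m → g inside ^ card t * g outside ^ m) (∣∁p∣≡n∸∣p∣ t))
  where
  step : ∀ {n} s (t : Subset n) → ∏ (allFin (suc n)) (λ a → g (lookup (s ∷ t) a)) ≡ g s * ∏ (allFin n) (λ a → g (lookup t a))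
  step s t = cong (λ xs → g s * product xs) (trans (map-tabulate suc (λ a → g (lookup (s ∷ t) a))) (sym (map-tabulate id (λ a → g (lookup t a)))))
  go : ∀ {n} (t : Subset n) → ∏ (allFin n) (λ a → g (lookup t a)) ≡ g inside ^ card t * g outside ^ card (∁ t)
  go []            = refl
  go (inside ∷ t)  = trans (step inside t) (trans (cong (g inside *_) (go t)) (sym (*-assoc (g inside) _ _)))
  go (outside ∷ t) = trans (step outside t) (trans (cong (g outside *_) (go t)) (lem (g outside) (g inside ^ card t) (g outside ^ card (∁ t))))
    where
    lem : ∀ a b c → a * (b * c) ≡ b * (a * c)
    lem = solve-∀

upTo-∏ : ℕ → (ℕ → ℕ) → ℕ
upTo-∏ zero    f = 1
upTo-∏ (suc n) f = f 0 * upTo-∏ n (f ∘ suc)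

upTo-∏-cong : ∀ n {f g : ℕ → ℕ} → (∀ i → f i ≡ g i) → upTo-∏ n f ≡ upTo-∏ n g
upTo-∏-cong zero    h = refl
upTo-∏-cong (suc n) h = cong₂ _*_ (h 0) (upTo-∏-cong n (h ∘ suc))

upTo-∏-* : ∀ n (f g : ℕ → ℕ) → upTo-∏ n (λ i → f i * g i) ≡ upTo-∏ n f * upTo-∏ n g
upTo-∏-* zero    f g = refl
upTo-∏-* (suc n) f g = trans (cong (f 0 * g 0 *_) (upTo-∏-* n (f ∘ suc) (g ∘ suc))) (lem (f 0) (g 0) _ _)
  where
  lem : ∀ a b c d → a * b * (c * d) ≡ a * c * (b * d)
  lem = solve-∀

upTo-∏-last : ∀ n (f : ℕ → ℕ) → upTo-∏ (suc n) f ≡ upTo-∏ n f * f n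
upTo-∏-last zero    f = trans (*-identityʳ (f 0)) (sym (+-identityʳ (f 0)))
upTo-∏-last (suc n) f = trans (cong (f 0 *_) (upTo-∏-last n (f ∘ suc))) (sym (*-assoc (f 0) _ _))

upTo-∏≡prodℕ : ∀ n (f : ℕ → ℕ) → upTo-∏ n f ≡ prodℕ {n} (λ i → f (toℕ i))
upTo-∏≡prodℕ zero    f = refl
upTo-∏≡prodℕ (suc n) f = cong (f 0 *_) (upTo-∏≡prodℕ n (f ∘ suc))

∏-by-card : ∀ n (F : ℕ → ℕ) → ∏ (subsets n) (F ∘ card) ≡ upTo-∏ (suc n) (λ i → F i ^ (n C i))
∏-by-card zero    F = trans (*-identityʳ (F 0)) (sym (trans (*-identityʳ _) (*-identityʳ (F 0))))
∏-by-card (suc n) F = begin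
  ∏ (subsets (suc n)) (F ∘ card)
    ≡⟨ trans (cong product (map-++ (F ∘ card) (map (inside ∷_) (subsets n)) _)) (trans (product-++ (map (F ∘ card) (map (inside ∷_) (subsets n))) _)
         (cong₂ _*_ (cong product (sym (map-∘ (subsets n)))) (cong product (sym (map-∘ (subsets n)))))) ⟩
  ∏ (subsets n) (F ∘ suc ∘ card) * ∏ (subsets n) (F ∘ card)
    ≡⟨ cong₂ _*_ (∏-by-card n (F ∘ suc)) (trans (∏-by-card n F) (sym extra)) ⟩
  upTo-∏ (suc n) (λ i → F (suc i) ^ (n C i)) * (F 0 ^ 1 * upTo-∏ (suc n) (λ i → F (suc i) ^ (n C suc i)))
    ≡⟨ lem (upTo-∏ (suc n) (λ i → F (suc i) ^ (n C i))) (F 0 ^ 1) _ ⟩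
  F 0 ^ 1 * (upTo-∏ (suc n) (λ i → F (suc i) ^ (n C i)) * upTo-∏ (suc n) (λ i → F (suc i) ^ (n C suc i)))
    ≡⟨ cong (F 0 ^ 1 *_) (upTo-∏-* (suc n) (λ i → F (suc i) ^ (n C i)) (λ i → F (suc i) ^ (n C suc i))) ⟨
  F 0 ^ 1 * upTo-∏ (suc n) (λ i → F (suc i) ^ (n C i) * F (suc i) ^ (n C suc i))
    ≡⟨ cong (F 0 ^ 1 *_) (upTo-∏-cong (suc n) (λ i → trans (sym (^-distribˡ-+-* (F (suc i)) (n C i) (n C suc i))) (cong (F (suc i) ^_) (nCk+nC[k+1]≡[n+1]C[k+1] n i)))) ⟩
  upTo-∏ (suc (suc n)) (λ i → F i ^ (suc n C i)) ∎
  where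
  open ≡-Reasoning
  lem : ∀ a b c → a * (b * c) ≡ b * (a * c)
  lem = solve-∀
  extra : upTo-∏ (suc (suc n)) (λ i → F i ^ (n C i)) ≡ upTo-∏ (suc n) (λ i → F i ^ (n C i))
  extra = trans (upTo-∏-last (suc n) (λ i → F i ^ (n C i))) (trans (cong (λ z → upTo-∏ (suc n) (λ i → F i ^ (n C i)) * F (suc n) ^ z) (k>n⇒nCk≡0 (n<1+n n)))
    (*-identityʳ _))

module _ (k′ : ℕ) where

  open Entropies k′ using (k; Cᵢ) renaming (A to Aᵢ; B to Bᵢ)
  open Columns k using (r; Λ; entry)

  ends : ∀ F → ∏ (subsets r) (F ∘ card) ≡ F 0 * prodℕ (λ i → F (Aᵢ i) ^ Cᵢ i) * F r
  ends F = trans (∏-by-card r F) (trans (upTo-∏-last r (λ i → F i ^ (r C i))) (cong₂ _*_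
    (cong₂ _*_ (*-identityʳ (F 0)) (upTo-∏≡prodℕ k (λ i → F (suc i) ^ (r C suc i))))
    (trans (cong (F r ^_) (nCn≡1 r)) (*-identityʳ (F r)))))

  r^rR : (r ^ r) ^ (2 ^ r) ≡ r ^ r * prodℕ (λ i → (r ^ r) ^ Cᵢ i) * r ^ r
  r^rR = trans (sym (trans (∏-const (subsets r) (r ^ r)) (cong ((r ^ r) ^_) (length-subsets r)))) (ends (λ _ → r ^ r))

  Λ^r : Λ ^ r ≡ r ^ r * prodℕ (λ i → (Aᵢ i ^ Aᵢ i * Bᵢ i ^ Bᵢ i) ^ Cᵢ i) * r ^ r
  Λ^r = begin
    Λ ^ r
      ≡⟨ trans (cong (Λ ^_) (sym (length-allFin r))) (sym (∏-const (allFin r) Λ)) ⟩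
    ∏ (allFin r) (λ _ → Λ)
      ≡⟨ ∏-cong (allFin r) (λ a → trans (sym (product-↭ (Perm.map⁺ entry (profiles-↭ k a)))) (cong product (sym (map-∘ (subsets r))))) ⟩
    ∏ (allFin r) (λ a → ∏ (subsets r) (λ t → mult r (lookup t a) (card t)))
      ≡⟨ ∏-comm (allFin r) (subsets r) (λ a t → mult r (lookup t a) (card t)) ⟩
    ∏ (subsets r) (λ t → ∏ (allFin r) (λ a → mult r (lookup t a) (card t)))
      ≡⟨ ∏-cong (subsets r) (λ t → ∏-lookup t (λ s → mult r s (card t))) ⟩
    ∏ (subsets r) (F ∘ card)
      ≡⟨ ends F ⟩
    F 0 * prodℕ (λ i → F (Aᵢ i) ^ Cᵢ i) * F r
      ≡⟨ cong₂ (λ x y → x * prodℕ (λ i → F (Aᵢ i) ^ Cᵢ i) * y) (*-identityˡ (r ^ r)) (trans (cong (λ z → r ^ r * z ^ z) (n∸n≡0 r)) (*-identityʳ (r ^ r))) ⟩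
    r ^ r * prodℕ (λ i → F (Aᵢ i) ^ Cᵢ i) * r ^ r ∎
    where
    open ≡-Reasoning
    F : ℕ → ℕ
    F i = i ^ i * (r ∸ i) ^ (r ∸ i)

insert : Fin ν → Subset ν → Subset ν
insert i T = T V.[ i ]≔ inside

insert⁻ : ∀ i (T : Subset ν) {j} → j ∈ insert i T → j ∈ T ⊎ j ≡ i
insert⁻ zero    (s ∷ T) V.here       = inj₂ refl
insert⁻ zero    (s ∷ T) (V.there j∈) = inj₁ (V.there j∈)
insert⁻ (suc i) (s ∷ T) V.here       = inj₁ V.here
insert⁻ (suc i) (s ∷ T) (V.there j∈) with insert⁻ i T j∈
... | inj₁ j∈T = inj₁ (V.there j∈T)
... | inj₂ eq  = inj₂ (cong suc eq)

insert-⊆ : ∀ {i} {T W : Subset ν} → i ∈ W → T ⊆ W → insert i T ⊆ W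
insert-⊆ {i = i} {T} i∈W T⊆W j∈ with insert⁻ i T j∈
... | inj₁ j∈T  = T⊆W j∈T
... | inj₂ refl = i∈W

card-insert : ∀ i (T : Subset ν) → i ∉ T → card (insert i T) ≡ suc (card T)
card-insert zero    (inside ∷ T)  i∉ = contradiction V.here i∉
card-insert zero    (outside ∷ T) i∉ = refl
card-insert (suc i) (inside ∷ T)  i∉ = cong suc (card-insert i T (i∉ ∘ V.there))
card-insert (suc i) (outside ∷ T) i∉ = card-insert i T (i∉ ∘ V.there)

card-∪-∁ : ∀ (T A : Subset ν) → T ⊆ A → card (T ∪ ∁ A) ≡ card T + card (∁ A)
card-∪-∁ []            []            _   = refl
card-∪-∁ (inside ∷ T)  (inside ∷ A)  T⊆A = cong suc (card-∪-∁ T A (drop-∷-⊆ T⊆A))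
card-∪-∁ (inside ∷ T)  (outside ∷ A) T⊆A = contradiction (T⊆A V.here) λ ()
card-∪-∁ (outside ∷ T) (inside ∷ A)  T⊆A = card-∪-∁ T A (drop-∷-⊆ T⊆A)
card-∪-∁ (outside ∷ T) (outside ∷ A) T⊆A = trans (cong suc (card-∪-∁ T A (drop-∷-⊆ T⊆A))) (sym (+-suc (card T) _))

∉⇒lookup : ∀ {i} {T : Subset ν} → i ∉ T → lookup T i ≡ outside
∉⇒lookup {i = i} {T} i∉ with lookup T i in eq
... | inside  = contradiction (V.lookup⇒[]= i T eq) i∉
... | outside = refl

subsetOf : {R : Fin ν → Set} → (∀ i → Dec (R i)) → Subset ν
subsetOf R? = V.tabulate λ i → does (R? i)

∈-subsetOf⁺ : {R : Fin ν → Set} (R? : ∀ i → Dec (R i)) → ∀ {i} → R i → i ∈ subsetOf R?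
∈-subsetOf⁺ R? {i} r = V.lookup⇒[]= i _ (trans (V.lookup∘tabulate _ i) (eq (R? i)))
  where
  eq : (d : Dec _) → does d ≡ inside
  eq (yes _) = refl
  eq (no ¬r) = contradiction r ¬r

∈-subsetOf⁻ : {R : Fin ν → Set} (R? : ∀ i → Dec (R i)) → ∀ {i} → i ∈ subsetOf R? → R i
∈-subsetOf⁻ R? {i} i∈ with R? i | trans (sym (V.lookup∘tabulate (λ i → does (R? i)) i)) (V.[]=⇒lookup i∈)
... | yes r | _ = r

card≡count : (A : Subset ν) → card A ≡ count (_∈? A) (allFin ν)
card≡count {ν} A = trans (sym (count-lookup A inside)) (∑-cong (allFin ν) λ i →
  𝟙-cong (lookup A i ≟ᵇ inside) (i ∈? A) (V.lookup⇒[]= i A) V.[]=⇒lookup)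

elements : (T : Subset ν) → Vec (Fin ν) (card T)
elements []            = []
elements (inside ∷ T)  = zero ∷ V.map suc (elements T)
elements (outside ∷ T) = V.map suc (elements T)

enum : ∀ {r} (T : Subset ν) → card T ≡ r → Fin r → Fin ν
enum T refl = lookup (elements T)

enum-∈ : ∀ {r} (T : Subset ν) (eq : card T ≡ r) a → enum T eq a ∈ T
enum-∈ T refl = go T
  where
  go : ∀ {ν} (T : Subset ν) a → lookup (elements T) a ∈ T
  go (inside ∷ T)  zero    = V.here
  go (inside ∷ T)  (suc a) = subst (_∈ inside ∷ T) (sym (V.lookup-map a suc (elements T))) (V.there (go T a))
  go (outside ∷ T) a       = subst (_∈ outside ∷ T) (sym (V.lookup-map a suc (elements T))) (V.there (go T a))

enum-surjective : ∀ {r} (T : Subset ν) (eq : card T ≡ r) {i} → i ∈ T → ∃ λ a → enum T eq a ≡ i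
enum-surjective T refl = go T
  where
  go : ∀ {ν} (T : Subset ν) {i} → i ∈ T → ∃ λ a → lookup (elements T) a ≡ i
  go (inside ∷ T)  V.here       = zero , refl
  go (inside ∷ T)  (V.there i∈) = let a , e = go T i∈ in suc a , trans (V.lookup-map a suc (elements T)) (cong suc e)
  go (outside ∷ T) (V.there i∈) = let a , e = go T i∈ in a , trans (V.lookup-map a suc (elements T)) (cong suc e)

-- Points of the cube as bit vectors

side : Fin 2 → Side
side zero    = outside
side (suc _) = inside

digit : Side → Fin 2
digit outside = zero
digit inside  = suc zero

digit-side : ∀ i → digit (side i) ≡ i
digit-side zero       = refl
digit-side (suc zero) = refl

side-digit : ∀ s → side (digit s) ≡ s
side-digit outside = refl
side-digit inside  = refl

module _ {d : ℕ} where

  bits : Fin (2 ^ d) → Vec Side d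
  bits i = V.tabulate λ j → side (finToFun {2} {d} i j)

  point : Vec Side d → Fin (2 ^ d)
  point y = funToFin {d} {2} λ j → digit (lookup y j)

  lookup-bits : ∀ i j → lookup (bits i) j ≡ side (finToFun {2} {d} i j)
  lookup-bits i j = V.lookup∘tabulate _ j

  bits-point : ∀ y → bits (point y) ≡ y
  bits-point y = lookup-injective λ j → trans (lookup-bits (point y) j)
    (trans (cong side (finToFun-funToFin {d} {2} (λ j → digit (lookup y j)) j)) (side-digit (lookup y j)))

  point-bits : ∀ i → point (bits i) ≡ i
  point-bits i = trans (funToFin-cong {d} {2} (λ j → trans (cong digit (lookup-bits i j)) (digit-side _))) (funToFin-finToFin {d} {2} i)

  bits-injective : ∀ {i i′} → bits i ≡ bits i′ → i ≡ i′
  bits-injective {i} {i′} eq = trans (sym (point-bits i)) (trans (cong point eq) (point-bits i′))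

  matrix : ∀ {r} → (Fin r → Fin (2 ^ d)) → Vec (Subset r) d
  matrix x = V.tabulate λ j → V.tabulate λ a → lookup (bits (x a)) j

  lookup-matrix : ∀ {r} (x : Fin r → Fin (2 ^ d)) a j → lookup (lookup (matrix x) j) a ≡ lookup (bits (x a)) j
  lookup-matrix x a j = trans (cong (λ t → lookup t a) (V.lookup∘tabulate _ j)) (V.lookup∘tabulate _ a)

  row-matrix : ∀ {r} (x : Fin r → Fin (2 ^ d)) a → row a (matrix x) ≡ bits (x a)
  row-matrix x a = lookup-injective λ j → trans (V.lookup-map j _ (matrix x)) (lookup-matrix x a j)

  matrix-injective : ∀ {r} {x x′ : Fin r → Fin (2 ^ d)} → matrix x ≡ matrix x′ → ∀ a → x a ≡ x′ a
  matrix-injective {x = x} {x′} eq a = bits-injective (trans (sym (row-matrix x a)) (trans (cong (row a) eq) (row-matrix x′ a)))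

  enum-matrix-injective : ∀ {r} {T T′ : Subset (2 ^ d)} (eq : card T ≡ r) (eq′ : card T′ ≡ r) →
    matrix (enum T eq) ≡ matrix (enum T′ eq′) → T ≡ T′
  enum-matrix-injective {T = T} {T′} eq eq′ m≡ = ⊆-antisym
      (λ i∈ → half eq eq′ m≡ i∈) (λ i∈ → half eq′ eq (sym m≡) i∈)
    where
    half : ∀ {r} {T T′ : Subset (2 ^ d)} (eq : card T ≡ r) (eq′ : card T′ ≡ r) →
      matrix (enum T eq) ≡ matrix (enum T′ eq′) → T ⊆ T′
    half {T = T} {T′} eq eq′ m≡ {i} i∈ = let a , e = enum-surjective T eq i∈ in
      subst (_∈ T′) (trans (sym (matrix-injective m≡ a)) e) (enum-∈ T′ eq′ a)

  count-points≤ : {R : Vec Side d → Set} (R? : ∀ y → Dec (R y)) (A : Subset (2 ^ d)) →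
    (∀ y → R y → point y ∈ A) → count R? (subsets d) ≤ card A
  count-points≤ R? A h = ≤-trans (count≤count R? (_∈? A) (λ y i → point y ≡ i) (subsets-unique d)
      (λ y _ r → point y , ∈-allFin (point y) , h y r , refl)
      (λ { {y} {y′} _ _ refl e → trans (sym (bits-point y)) (trans (cong bits (sym e)) (bits-point y′)) }))
    (≤-reflexive (sym (card≡count A)))

  count-bits≤ : {R : Vec Side d → Set} (R? : ∀ y → Dec (R y)) →
    count (λ i → R? (bits i)) (allFin (2 ^ d)) ≤ count R? (subsets d)
  count-bits≤ R? = count≤count (λ i → R? (bits i)) R? (λ i y → bits i ≡ y) (Unique.allFin⁺ (2 ^ d))
    (λ i _ r → bits i , subsets-complete (bits i) , r , refl)
    (λ { _ _ refl e → bits-injective (sym e) })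

sumℚ-zero : ∀ {n} (f : Fin n → ℚ) → (∀ i → f i ≡ 0ℚ) → sumℚ f ≡ 0ℚ
sumℚ-zero {zero}  f h = refl
sumℚ-zero {suc n} f h = cong₂ ℚ._+_ (h zero) (sumℚ-zero (f ∘ suc) (h ∘ suc))

without : ∀ {n} → Fin n → (Fin n → ℚ) → Fin n → ℚ
without p f i with i ≟ᶠ p
... | yes _ = 0ℚ
... | no _  = f i

without-≢ : ∀ {n} {p} (f : Fin n → ℚ) {i} → i ≢ p → without p f i ≡ f i
without-≢ {p = p} f {i} i≢p with i ≟ᶠ p
... | yes eq = contradiction eq i≢p
... | no _   = refl

without-≡ : ∀ {n} p (f : Fin n → ℚ) → without p f p ≡ 0ℚ
without-≡ p f with p ≟ᶠ p
... | yes _ = refl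
... | no ≢  = contradiction refl ≢

sumℚ-without : ∀ {n} p (f : Fin n → ℚ) → sumℚ f ≡ f p ℚ.+ sumℚ (without p f)
sumℚ-without zero f = cong (f zero ℚ.+_) (sym (trans (ℚ.+-identityˡ (sumℚ (without zero f ∘ suc))) (sum-cong-≗ {x = without zero f ∘ suc} {y = f ∘ suc} rest)))
  where
  rest : ∀ i → without zero f (suc i) ≡ f (suc i)
  rest i = without-≢ {p = zero} f λ ()
sumℚ-without (suc p) f = trans (cong (f zero ℚ.+_) (sumℚ-without p (f ∘ suc))) (trans
  (solve 3 (λ a b c → a :+ (b :+ c) := b :+ (a :+ c)) refl (f zero) (f (suc p)) (sumℚ (without p (f ∘ suc))))
  (cong (λ z → f (suc p) ℚ.+ (f zero ℚ.+ z)) (sum-cong-≗ same)))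
  where
  same : ∀ i → without p (f ∘ suc) i ≡ without (suc p) f (suc i)
  same i = by-cases i (i ≟ᶠ p)
    where
    by-cases : ∀ i → Dec (i ≡ p) → without p (f ∘ suc) i ≡ without (suc p) f (suc i)
    by-cases i (yes refl) = trans (without-≡ p (f ∘ suc)) (sym (without-≡ (suc p) f))
    by-cases i (no ≢)     = trans (without-≢ {p = p} (f ∘ suc) ≢) (sym (without-≢ {p = suc p} f λ { refl → ≢ refl }))

sumℚ-except : ∀ {n} (ps : List (Fin n)) → Unique ps → (f : Fin n → ℚ) → (∀ i → ¬ i ∈ˡ ps → f i ≡ 0ℚ) →
  sumℚ f ≡ foldr (λ p s → f p ℚ.+ s) 0ℚ ps
sumℚ-except []       _        f h = sumℚ-zero f λ i → h i λ ()
sumℚ-except (p ∷ ps) (p∉ ∷ u) f h = trans (sumℚ-without p f) (cong (f p ℚ.+_)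
    (trans (sumℚ-except ps u (without p f) zeros) (tail ps p∉)))
  where
  zeros : ∀ i → ¬ i ∈ˡ ps → without p f i ≡ 0ℚ
  zeros i i∉ with i ≟ᶠ p
  ... | yes _ = refl
  ... | no ≢  = h i λ { (here eq) → ≢ eq ; (there i∈) → i∉ i∈ }
  tail : ∀ qs → All (p ≢_) qs →
    foldr (λ q s → without p f q ℚ.+ s) 0ℚ qs ≡ foldr (λ q s → f q ℚ.+ s) 0ℚ qs
  tail []       []         = refl
  tail (q ∷ qs) (p≢q ∷ ps) = cong₂ ℚ._+_ (without-≢ {p = p} f (p≢q ∘ sym)) (tail qs ps)

module _ {N d : ℕ} (v : Fin N → Fin d → ℚ) where

  -- Faces and rational supporting hyperplanes

  record Exposing (S W : Subset N) : Set where
    field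
      b      : ℚ
      c      : Fin d → ℚ
      tight  : ∀ i → i ∈ S → slack v b c i ≡ 0ℚ
      strict : ∀ i → i ∉ S → i ∈ W → 0ℚ ℚ.< slack v b c i

  module _ (convex : ConvexPosition v) {S W : Subset N} (S⊆W : S ⊆ W) where

    isFace⇒exposing : IsFace (Conv (points v) S) (Conv (points v) W) → Exposing S W
    isFace⇒exposing face with solvable? (exposure v convex S W S⊆W)
    ... | inj₂ none = contradiction face (notExposed v convex S W S⊆W none)
    ... | inj₁ (x , sol) = record
      { b = x zero ; c = x ∘ suc
      ; tight = λ i i∈S → trans (sym (dot-functionalRow v convex S W S⊆W i x))
          (trans (cong (λ a → dot a x) (sym (onFace-∈ v convex S W S⊆W i i∈S)))
            (All.tabulate⁻ {f = onFace v convex S W S⊆W} (proj₁ both) i))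
      ; strict = λ i i∉S i∈W → subst (0ℚ ℚ.<_) (dot-functionalRow v convex S W S⊆W i x)
          (subst (λ r → Holds (proj₁ r) (dot (proj₂ r) x)) (offFace-∉ v convex S W S⊆W i i∉S i∈W)
            (All.tabulate⁻ {f = offFace v convex S W S⊆W} (proj₂ both) i))
      }
      where
      both = system⁻ {x = x} (tabulate (onFace v convex S W S⊆W)) sol

    exposing⇒isFace : Exposing S W → IsFace (Conv (points v) S) (Conv (points v) W)
    exposing⇒isFace e = exposed v convex S W S⊆W x
        (All.++⁺ (All.map⁺ (All.tabulate⁺ λ i → ℚ.≤-reflexive (sym (eq i))))
        (All.++⁺ (All.map⁺ (All.tabulate⁺ λ i → ℚ.≤-reflexive (sym (trans (dot-neg (onF i) x) (cong ℚ.-_ (eq i))))))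
          (All.tabulate⁺ ineq)))
      where
      open Exposing e
      onF = onFace v convex S W S⊆W
      x : Fin (suc d) → ℚ
      x zero    = b
      x (suc j) = c j
      eq : ∀ i → dot (onF i) x ≡ 0ℚ
      eq i with i ∈? S
      ... | yes i∈S = trans (dot-functionalRow v convex S W S⊆W i x) (tight i i∈S)
      ... | no _    = dot-0 x
      ineq : ∀ i → Holds (proj₁ (offFace v convex S W S⊆W i)) (dot (proj₂ (offFace v convex S W S⊆W i)) x)
      ineq i with i ∈? S | i ∈? W
      ... | yes _  | _       = ℚ.≤-reflexive (sym (dot-0 x))
      ... | no _   | no _    = ℚ.≤-reflexive (sym (dot-0 x))
      ... | no i∉S | yes i∈W = subst (0ℚ ℚ.<_) (sym (dot-functionalRow v convex S W S⊆W i x)) (strict i i∉S i∈W)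

  -- Affine relations

  record Relation (T : Subset N) (x : Fin N → ℚ) : Set where
    field
      support : ∀ i → i ∉ T → x i ≡ 0ℚ
      total   : sumℚ x ≡ 0ℚ
      coords  : ∀ j → dot (λ i → v i j) x ≡ 0ℚ
  open Relation

  relation-trivial⇒independent : ∀ {T} → (∀ x → Relation T x → ∀ i → x i ≡ 0ℚ) → AffinelyIndependent (points v) T
  relation-trivial⇒independent {T} trivial with any-or-all (λ i → solvable? (dependence v T i))
  ... | inj₂ none = independent v T none
  ... | inj₁ (i , x , sol) = contradiction (trivial x rel i) λ xᵢ≡0 → ℚ.<-irrefl (sym xᵢ≡0)
      (subst (0ℚ ℚ.<_) (dot-basis i x) (All.head (proj₂ both)))
    where
    both = system⁻ (relations v T) sol
    eqs = proj₁ both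
    rest : All (λ a → dot a x ≡ 0ℚ) ((λ _ → 1ℚ) ∷ tabulate (λ j i → v i j))
    rest = All.++⁻ʳ (tabulate (supportRow v T)) eqs
    rel : Relation T x
    rel .support i i∉T = trans (sym (dot-basis i x)) (trans (cong (λ a → dot a x) (sym (supportRow-∉ v T i i∉T)))
      (All.tabulate⁻ {f = supportRow v T} (All.++⁻ˡ (tabulate (supportRow v T)) eqs) i))
    rel .total = trans (sum≡dot1 x) (All.head rest)
    rel .coords j = All.tabulate⁻ {f = λ j i → v i j} (All.tail rest) j

  independent⇒relation-trivial : ∀ {T} → AffinelyIndependent (points v) T → ∀ x → Relation T x → ∀ i → x i ≡ 0ℚ
  independent⇒relation-trivial ind x rel i = fromℚ-≈0 {x i} (ind (λ i → fromℚ (x i))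
    (λ i i∉T → ≡⇒≈ (fromℚ (x i)) 0ℝ λ _ → rel .support i i∉T)
    (≡⇒≈ (sumℝ (λ i → fromℚ (x i))) 0ℝ λ k → trans (seq-sum (λ i → fromℚ (x i)) k) (rel .total))
    (λ j → ≡⇒≈ (combination (points v) (λ i → fromℚ (x i)) j) 0ℝ λ k →
      trans (seq-combination v (λ i → fromℚ (x i)) j k) (rel .coords j)) i)

  -- If no relation involves i, every relation on T ∪ {i} is one on T.
  extend-independent : ∀ {T i} → AffinelyIndependent (points v) T →
    (∀ x → Relation (insert i T) x → x i ≡ 0ℚ) → AffinelyIndependent (points v) (insert i T)
  extend-independent {T} {i} ind zeroᵢ = relation-trivial⇒independent λ x rel → independent⇒relation-trivial ind x record
    { support = λ m m∉T → by-cases x rel m m∉T (m ≟ᶠ i)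
    ; total   = rel .total
    ; coords  = rel .coords }
    where
    by-cases : ∀ x → Relation (insert i T) x → ∀ m → m ∉ T → Dec (m ≡ i) → x m ≡ 0ℚ
    by-cases x rel m m∉T (yes refl) = zeroᵢ x rel
    by-cases x rel m m∉T (no m≢i)   = rel .support m λ m∈ → outside-both (insert⁻ i T m∈)
      where
      outside-both : ¬ (m ∈ T ⊎ m ≡ i)
      outside-both (inj₁ m∈T) = m∉T m∈T
      outside-both (inj₂ m≡i) = m≢i m≡i

  slack-relation : ∀ {T} b c x → Relation T x → sumℚ (λ i → x i ℚ.* slack v b c i) ≡ 0ℚ
  slack-relation b c x rel = trans (sum-slack v b c x) (trans
    (cong₂ (λ s t → b ℚ.* s ℚ.- t) (rel .total) (trans (sum-cong-≗ (λ j → cong (c j ℚ.*_) (rel .coords j)))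
      (trans (dot-comm c (λ _ → 0ℚ)) (dot-0 c))))
    (solve 1 (λ b → b :* con 0ℚ :- con 0ℚ := con 0ℚ) refl b))

  spanned-face⊆ : ConvexPosition v → ∀ {W S S′ T k} → S ⊆ W → S′ ⊆ W → IsFace (Conv (points v) S) (Conv (points v) W) →
    T ⊆ S → T ⊆ S′ → AffinelyIndependent (points v) T → card T ≡ suc k → HasDimension (points v) S′ k → S′ ⊆ S
  spanned-face⊆ convex {W} {S} {S′} {T} {k} S⊆W S′⊆W face T⊆S T⊆S′ ind card≡ dim {i} i∈S′ = decide (i ∈? S)
    where
    open Exposing (isFace⇒exposing convex S⊆W face)
    decide : Dec (i ∈ S) → i ∈ S
    decide (yes i∈S) = i∈S
    decide (no i∉S) = contradiction (proj₂ dim (insert i T) (insert-⊆ i∈S′ T⊆S′) (extend-independent ind zeroᵢ))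
        (<⇒≱ (≤-reflexive (sym (trans (card-insert i T i∉T) (cong suc card≡)))))
      where
      i∉T : i ∉ T
      i∉T = i∉S ∘ T⊆S
      zeroᵢ : ∀ x → Relation (insert i T) x → x i ≡ 0ℚ
      zeroᵢ x rel = cancel (trans (sym (trans (sumℚ-except (i ∷ []) ([] ∷ []) (λ m → x m ℚ.* slack v b c m) others)
          (ℚ.+-identityʳ _))) (slack-relation b c x rel))
        where
        others : ∀ m → ¬ m ∈ˡ (i ∷ []) → x m ℚ.* slack v b c m ≡ 0ℚ
        others m m≢i with m ∈? T
        ... | yes m∈T = trans (cong (x m ℚ.*_) (tight m (T⊆S m∈T))) (ℚ.*-zeroʳ (x m))
        ... | no m∉T  = trans (cong (ℚ._* slack v b c m) (rel .support m λ m∈ → outside-both (insert⁻ i T m∈))) (ℚ.*-zeroˡ (slack v b c m))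
          where
          outside-both : ¬ (m ∈ T ⊎ m ≡ i)
          outside-both (inj₁ m∈T) = m∉T m∈T
          outside-both (inj₂ m≡i) = m≢i (here m≡i)
        cancel : x i ℚ.* slack v b c i ≡ 0ℚ → x i ≡ 0ℚ
        cancel eq = let s⁻ , _ , ss⁻ = inv (strict i i∉S (S′⊆W i∈S′)) in
          trans (sym (ℚ.*-identityʳ (x i))) (trans (cong (x i ℚ.*_) (sym ss⁻)) (trans (sym (ℚ.*-assoc (x i) (slack v b c i) s⁻))
            (trans (cong (ℚ._* s⁻) eq) (ℚ.*-zeroˡ s⁻))))

bitℚ : Side → ℚ
bitℚ inside  = 1ℚ
bitℚ outside = 0ℚ

cubeℚ-bits : ∀ d i j → cubeℚ d i j ≡ bitℚ (lookup (bits {d} i) j)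
cubeℚ-bits d i j = trans (value (finToFun {2} {d} i j)) (cong bitℚ (sym (lookup-bits {d} i j)))
  where
  value : ∀ a → fromℕℚ (toℕ a) ≡ bitℚ (side a)
  value zero       = refl
  value (suc zero) = refl

module _ {d : ℕ} (v : Fin (2 ^ d) → Fin d → ℚ) (v≡bit : ∀ i j → v i j ≡ bitℚ (lookup (bits {d} i) j)) where

  open Relation

  -- A set in whose matrix every column occurs is affinely independent, and its affine hull contains no further
  -- point of the cube: if x is a relation on T ∪ {i} and β the row of i, the columns with ones at a, or at a and b,
  -- give x_a = − x_i β_a and x_a + x_b = − x_i β_ab.
  module _ {r : ℕ} (T : Subset (2 ^ d)) (card≡ : card T ≡ r)
    (columns : ∀ t → ∃ λ j → lookup (matrix {d} (enum T card≡)) j ≡ t) where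

    private
      e = enum T card≡

      v-entry : ∀ t a → v (e a) (proj₁ (columns t)) ≡ bitℚ (lookup t a)
      v-entry t a = trans (v≡bit (e a) _) (cong bitℚ (trans (sym (lookup-matrix {d} e a _)) (cong (λ t → lookup t a) (proj₂ (columns t)))))

      term-0 : ∀ {x y} → y ≡ 0ℚ → y ℚ.* x ≡ 0ℚ
      term-0 {x} refl = ℚ.*-zeroˡ x

      ∉⁅⁆ : ∀ {a a′ : Fin r} → a′ ≢ a → bitℚ (lookup ⁅ a ⁆ a′) ≡ 0ℚ
      ∉⁅⁆ a′≢a = cong bitℚ (∉⇒lookup λ a′∈ → a′≢a (x∈⁅y⁆⇒x≡y _ a′∈))

      ∈⁅⁆ : ∀ (a : Fin r) → bitℚ (lookup ⁅ a ⁆ a) ≡ 1ℚ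
      ∈⁅⁆ a = cong bitℚ (V.[]=⇒lookup (x∈⁅x⁆ a))

    full⇒independent : AffinelyIndependent (points v) T
    full⇒independent = relation-trivial⇒independent v λ x rel i → by-cases x rel i (i ∈? T)
      where
      by-cases : ∀ x → Relation v T x → ∀ i → Dec (i ∈ T) → x i ≡ 0ℚ
      by-cases x rel i (no i∉T) = rel .support i i∉T
      by-cases x rel i (yes i∈T) with a , refl ← enum-surjective T card≡ i∈T = trans (sym (trans (sumℚ-except (e a ∷ []) ([] ∷ [])
          (λ m → v m j ℚ.* x m) others) (trans (ℚ.+-identityʳ _) (trans (cong (ℚ._* x (e a)) (trans (v-entry ⁅ a ⁆ a) (∈⁅⁆ a))) (ℚ.*-identityˡ _)))))
          (rel .coords j)
        where
        j = proj₁ (columns ⁅ a ⁆)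
        others : ∀ m → ¬ m ∈ˡ (e a ∷ []) → v m j ℚ.* x m ≡ 0ℚ
        others m m≢ with m ∈? T
        ... | no m∉T = trans (cong (v m j ℚ.*_) (rel .support m m∉T)) (ℚ.*-zeroʳ (v m j))
        ... | yes m∈T with a′ , refl ← enum-surjective T card≡ m∈T =
          term-0 (trans (v-entry ⁅ a ⁆ a′) (∉⁅⁆ {a} {a′} λ { refl → m≢ (here refl) }))

    full⇒closed : ∀ {i} → i ∉ T → ∀ x → Relation v (insert i T) x → x i ≡ 0ℚ
    full⇒closed {i} i∉T x rel = ones (any-or-all λ a → entryᵢ (j¹ a))
      where
      ξ = x i
      j¹ : Fin r → Fin d
      j¹ a = proj₁ (columns ⁅ a ⁆)
      j² : Fin r → Fin r → Fin d
      j² a b = proj₁ (columns (⁅ a ⁆ ∪ ⁅ b ⁆))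
      entryᵢ : ∀ j → v i j ≡ 1ℚ ⊎ v i j ≡ 0ℚ
      entryᵢ j = cases (lookup (bits {d} i) j) (v≡bit i j)
        where
        cases : ∀ s → v i j ≡ bitℚ s → v i j ≡ 1ℚ ⊎ v i j ≡ 0ℚ
        cases inside  eq = inj₁ eq
        cases outside eq = inj₂ eq
      e≢i : ∀ a → e a ≢ i
      e≢i a refl = i∉T (enum-∈ T card≡ a)
      reduce : ∀ ps → Unique ps → i ∈ˡ ps → (f : Fin (2 ^ d) → ℚ) → (∀ m → x m ≡ 0ℚ → f m ≡ 0ℚ) →
        (∀ a → ¬ e a ∈ˡ ps → f (e a) ≡ 0ℚ) → sumℚ f ≡ foldr (λ p s → f p ℚ.+ s) 0ℚ ps
      reduce ps u i∈ f f0 fe = sumℚ-except ps u f λ m m∉ → by-cases m m∉ (m ∈? T)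
        where
        by-cases : ∀ m → ¬ m ∈ˡ ps → Dec (m ∈ T) → f m ≡ 0ℚ
        by-cases m m∉ (yes m∈T) with a , refl ← enum-surjective T card≡ m∈T = fe a m∉
        by-cases m m∉ (no m∉T) = f0 m (rel .support m λ m∈ → outside-both (insert⁻ i T m∈))
          where
          outside-both : ¬ (m ∈ T ⊎ m ≡ i)
          outside-both (inj₁ m∈T)  = m∉T m∈T
          outside-both (inj₂ refl) = m∉ i∈
      coord : ∀ j ps → Unique ps → i ∈ˡ ps → (∀ a → ¬ e a ∈ˡ ps → v (e a) j ℚ.* x (e a) ≡ 0ℚ) →
        foldr (λ p s → v p j ℚ.* x p ℚ.+ s) 0ℚ ps ≡ 0ℚ
      coord j ps u i∈ h = trans (sym (reduce ps u i∈ (λ m → v m j ℚ.* x m)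
        (λ m eq → trans (cong (v m j ℚ.*_) eq) (ℚ.*-zeroʳ (v m j))) h)) (rel .coords j)
      single : ∀ a → x (e a) ≡ ℚ.- (v i (j¹ a) ℚ.* ξ)
      single a = trans (solve 2 (λ p q → p := (con 1ℚ :* p :+ (q :+ con 0ℚ)) :- q) refl (x (e a)) (v i (j¹ a) ℚ.* ξ))
        (trans (cong (λ z → z ℚ.- v i (j¹ a) ℚ.* ξ) (trans (cong (λ u → u ℚ.* x (e a) ℚ.+ (v i (j¹ a) ℚ.* ξ ℚ.+ 0ℚ)) (sym one))
          (coord (j¹ a) (e a ∷ i ∷ []) ((e≢i a ∷ []) ∷ [] ∷ []) (there (here refl))
            λ a′ a′∉ → term-0 (trans (v-entry ⁅ a ⁆ a′) (∉⁅⁆ {a} {a′} λ { refl → a′∉ (here refl) })))))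
          (ℚ.+-identityˡ _))
        where
        one : v (e a) (j¹ a) ≡ 1ℚ
        one = trans (v-entry ⁅ a ⁆ a) (∈⁅⁆ a)
      pair : ∀ a b → e a ≢ e b → x (e a) ℚ.+ (x (e b) ℚ.+ v i (j² a b) ℚ.* ξ) ≡ 0ℚ
      pair a b a≢b = trans (cong₂ ℚ._+_ (sym (trans (cong (ℚ._* x (e a)) (one a (p⊆p∪q ⁅ b ⁆ (x∈⁅x⁆ a)))) (ℚ.*-identityˡ (x (e a)))))
          (cong₂ ℚ._+_ (sym (trans (cong (ℚ._* x (e b)) (one b (q⊆p∪q ⁅ a ⁆ ⁅ b ⁆ (x∈⁅x⁆ b)))) (ℚ.*-identityˡ (x (e b))))) (sym (ℚ.+-identityʳ (v i (j² a b) ℚ.* ξ)))))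
        (coord (j² a b) (e a ∷ e b ∷ i ∷ []) ((a≢b ∷ e≢i a ∷ []) ∷ (e≢i b ∷ []) ∷ [] ∷ []) (there (there (here refl)))
          λ a′ a′∉ → term-0 (trans (v-entry (⁅ a ⁆ ∪ ⁅ b ⁆) a′) (cong bitℚ (∉⇒lookup λ a′∈ → neither a′∉ (x∈p∪q⁻ ⁅ a ⁆ ⁅ b ⁆ a′∈)))))
        where
        one : ∀ c → c ∈ ⁅ a ⁆ ∪ ⁅ b ⁆ → v (e c) (j² a b) ≡ 1ℚ
        one c c∈ = trans (v-entry (⁅ a ⁆ ∪ ⁅ b ⁆) c) (cong bitℚ (V.[]=⇒lookup c∈))
        neither : ∀ {a′} → ¬ e a′ ∈ˡ (e a ∷ e b ∷ i ∷ []) → ¬ (a′ ∈ ⁅ a ⁆ ⊎ a′ ∈ ⁅ b ⁆)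
        neither a′∉ (inj₁ a′∈) = a′∉ (here (cong e (x∈⁅y⁆⇒x≡y a a′∈)))
        neither a′∉ (inj₂ a′∈) = a′∉ (there (here (cong e (x∈⁅y⁆⇒x≡y b a′∈))))
      halve : ∀ p → p ℚ.+ p ≡ 0ℚ → p ≡ 0ℚ
      halve p eq = trans (solve 1 (λ p → p := con ℚ.½ :* (p :+ p)) refl p) (trans (cong (ℚ.½ ℚ.*_) eq) (ℚ.*-zeroʳ ℚ.½))
      negate : ∀ p → ℚ.- p ≡ 0ℚ → p ≡ 0ℚ
      negate p eq = trans (solve 1 (λ p → p := :- (:- p)) refl p) (cong ℚ.-_ eq)
      one* : ∀ {u} → u ≡ 1ℚ → ℚ.- (u ℚ.* ξ) ≡ ℚ.- ξ
      one* refl = cong ℚ.-_ (ℚ.*-identityˡ ξ)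
      zero* : ∀ {u} → u ≡ 0ℚ → ℚ.- (u ℚ.* ξ) ≡ 0ℚ
      zero* refl = cong ℚ.-_ (ℚ.*-zeroˡ ξ)

      third : ∀ a → v i (j¹ a) ≡ 1ℚ → (∀ b → e b ≡ e a ⊎ v i (j¹ b) ≡ 0ℚ) → ξ ≡ 0ℚ
      third a βₐ others = differ (any-or-all agree)
        where
        two : ∀ j → v (e a) j ℚ.* x (e a) ℚ.+ (v i j ℚ.* ξ ℚ.+ 0ℚ) ≡ 0ℚ
        two j = coord j (e a ∷ i ∷ []) ((e≢i a ∷ []) ∷ [] ∷ []) (there (here refl)) λ b b∉ → zero-at b b∉ (others b)
          where
          zero-at : ∀ b → ¬ e b ∈ˡ (e a ∷ i ∷ []) → e b ≡ e a ⊎ v i (j¹ b) ≡ 0ℚ → v (e b) j ℚ.* x (e b) ≡ 0ℚ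
          zero-at b b∉ (inj₁ eq) = contradiction (here eq) b∉
          zero-at b b∉ (inj₂ β≡0) = trans (cong (v (e b) j ℚ.*_) (trans (single b) (zero* β≡0))) (ℚ.*-zeroʳ (v (e b) j))
        combined : ∀ j → (v i j ℚ.- v (e a) j) ℚ.* ξ ≡ 0ℚ
        combined j = trans (solve 3 (λ p q ξ → (p :- q) :* ξ := q :* (:- ξ) :+ (p :* ξ :+ con 0ℚ)) refl (v i j) (v (e a) j) ξ)
          (trans (cong (λ z → v (e a) j ℚ.* z ℚ.+ (v i j ℚ.* ξ ℚ.+ 0ℚ)) (sym (trans (single a) (one* βₐ)))) (two j))
        agree : ∀ j → ξ ≡ 0ℚ ⊎ lookup (bits {d} (e a)) j ≡ lookup (bits {d} i) j
        agree j = compareBits (lookup (bits {d} i) j) (lookup (bits {d} (e a)) j) (trans (cong₂ (λ p q → (p ℚ.- q) ℚ.* ξ) (sym (v≡bit i j)) (sym (v≡bit (e a) j))) (combined j))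
          where
          compareBits : ∀ s t → (bitℚ s ℚ.- bitℚ t) ℚ.* ξ ≡ 0ℚ → ξ ≡ 0ℚ ⊎ t ≡ s
          compareBits inside  inside  _  = inj₂ refl
          compareBits outside outside _  = inj₂ refl
          compareBits inside  outside eq = inj₁ (trans (solve 1 (λ ξ → ξ := (con 1ℚ :- con 0ℚ) :* ξ) refl ξ) eq)
          compareBits outside inside  eq = inj₁ (negate ξ (trans (solve 1 (λ ξ → :- ξ := (con 0ℚ :- con 1ℚ) :* ξ) refl ξ) eq))
        differ : (∃ λ j → ξ ≡ 0ℚ) ⊎ (∀ j → lookup (bits {d} (e a)) j ≡ lookup (bits {d} i) j) → ξ ≡ 0ℚ
        differ (inj₁ (_ , eq)) = eq
        differ (inj₂ same)     = contradiction (bits-injective {d} (lookup-injective same)) (e≢i a)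

      second : ∀ a → v i (j¹ a) ≡ 1ℚ → (∃ λ b → e b ≢ e a × v i (j¹ b) ≡ 1ℚ) ⊎ (∀ b → e b ≡ e a ⊎ v i (j¹ b) ≡ 0ℚ) → ξ ≡ 0ℚ
      second a βₐ (inj₂ others) = third a βₐ others
      second a βₐ (inj₁ (b , b≢a , β_b)) = β-ab (entryᵢ (j² a b))
        where
        sum≡ : ℚ.- ξ ℚ.+ (ℚ.- ξ ℚ.+ v i (j² a b) ℚ.* ξ) ≡ 0ℚ
        sum≡ = trans (cong₂ (λ p q → p ℚ.+ (q ℚ.+ v i (j² a b) ℚ.* ξ)) (sym (trans (single a) (one* βₐ))) (sym (trans (single b) (one* β_b))))
          (pair a b (b≢a ∘ sym))
        β-ab : v i (j² a b) ≡ 1ℚ ⊎ v i (j² a b) ≡ 0ℚ → ξ ≡ 0ℚ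
        β-ab (inj₁ eq) = negate ξ (trans (solve 1 (λ ξ → :- ξ := :- ξ :+ (:- ξ :+ con 1ℚ :* ξ)) refl ξ)
          (trans (cong (λ u → ℚ.- ξ ℚ.+ (ℚ.- ξ ℚ.+ u ℚ.* ξ)) (sym eq)) sum≡))
        β-ab (inj₂ eq) = negate ξ (halve (ℚ.- ξ) (trans (solve 1 (λ ξ → :- ξ :+ :- ξ := :- ξ :+ (:- ξ :+ con 0ℚ :* ξ)) refl ξ)
          (trans (cong (λ u → ℚ.- ξ ℚ.+ (ℚ.- ξ ℚ.+ u ℚ.* ξ)) (sym eq)) sum≡)))

      ones : (∃ λ a → v i (j¹ a) ≡ 1ℚ) ⊎ (∀ a → v i (j¹ a) ≡ 0ℚ) → ξ ≡ 0ℚ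
      ones (inj₂ zeros) = trans (sym (trans (reduce (i ∷ []) ([] ∷ []) (here refl) x (λ _ eq → eq)
        (λ a _ → trans (single a) (zero* (zeros a)))) (ℚ.+-identityʳ ξ))) (rel .total)
      ones (inj₁ (a , βₐ)) = second a βₐ (any-or-all other)
        where
        other : ∀ b → (e b ≢ e a × v i (j¹ b) ≡ 1ℚ) ⊎ (e b ≡ e a ⊎ v i (j¹ b) ≡ 0ℚ)
        other b with e b ≟ᶠ e a | entryᵢ (j¹ b)
        ... | yes eq | _       = inj₂ (inj₁ eq)
        ... | no ≢   | inj₁ β  = inj₁ (≢ , β)
        ... | no _   | inj₂ β  = inj₂ (inj₂ β)

m*n≡0⇒n≡0 : ∀ m {n} → suc m * n ≡ 0 → n ≡ 0
m*n≡0⇒n≡0 m {n} eq with m*n≡0⇒m≡0∨n≡0 (suc m) eq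
... | inj₂ n≡0 = n≡0

product≤^ : ∀ {r} xs → All (_≤ r) xs → product xs ≤ r ^ length xs
product≤^ []       []       = ≤-refl
product≤^ (x ∷ xs) (p ∷ ps) = *-mono-≤ p (product≤^ xs ps)

-- With M large, Σ ⌊log₂ vᵢ^M⌋ orders products of K bounded positive factors strictly; a factor 0 costs more than
-- all the other weights can make up for.
module Weights (K r : ℕ) where

  M emax big : ℕ
  M    = 2 ^ K * r ^ K

  e : ℕ → ℕ
  e v = ⌊log₂ v ^ M ⌋

  emax = e r
  big  = suc (K * emax)

  weight : ℕ → ℕ
  weight zero      = 0
  weight v@(suc _) = big + e v

  private
    e≤emax : ∀ {v} → v ≤ r → e v ≤ emax
    e≤emax v≤r = ⌊log₂⌋-mono-≤ (^-monoˡ-≤ M v≤r)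

    weight≤ : ∀ {v} → v ≤ r → weight v ≤ big + emax
    weight≤ {zero}  _   = z≤n
    weight≤ {suc v} v≤r = +-monoʳ-≤ big (e≤emax v≤r)

    ∑weight≤ : ∀ vs → All (_≤ r) vs → ∑ vs weight ≤ length vs * (big + emax)
    ∑weight≤ []       []       = z≤n
    ∑weight≤ (v ∷ vs) (p ∷ ps) = +-mono-≤ (weight≤ p) (∑weight≤ vs ps)

    zero-factor : ∀ vs → All (_≤ r) vs → product vs ≡ 0 → ∑ vs weight + (big + emax) ≤ length vs * (big + emax)
    zero-factor (zero ∷ vs)  (p ∷ ps) eq = ≤-trans (≤-reflexive (+-comm (∑ vs weight) _)) (+-monoʳ-≤ (big + emax) (∑weight≤ vs ps))
    zero-factor (suc v ∷ vs) (p ∷ ps) eq = ≤-trans (≤-reflexive (+-assoc (weight (suc v)) _ _))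
      (+-mono-≤ (weight≤ p) (zero-factor vs ps (m*n≡0⇒n≡0 v eq)))

    positive : ∀ vs → product vs ≢ 0 → ∑ vs weight ≡ length vs * big + ∑ vs e
    positive []           _  = refl
    positive (zero ∷ vs)  ≢0 = contradiction refl ≢0
    positive (suc v ∷ vs) ≢0 = trans (cong (weight (suc v) +_) (positive vs λ eq → ≢0 (trans (cong (suc v *_) eq) (*-zeroʳ (suc v)))))
      (lem big (e (suc v)) (length vs * big) (∑ vs e))
      where
      lem : ∀ a b c d → a + b + (c + d) ≡ a + c + (b + d)
      lem = solve-∀

    2^∑≤ : ∀ vs → product vs ≢ 0 → 2 ^ ∑ vs e ≤ product vs ^ M
    2^∑≤ []           _  = ≤-reflexive (sym (^-zeroˡ M))
    2^∑≤ (zero ∷ vs)  ≢0 = contradiction refl ≢0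
    2^∑≤ (suc v ∷ vs) ≢0 = ≤-trans (≤-reflexive (^-distribˡ-+-* 2 (e (suc v)) _))
      (≤-trans (*-mono-≤ (2^⌊log₂⌋≤ (suc v ^ M) {{m^n≢0 (suc v) M}}) (2^∑≤ vs λ eq → ≢0 (trans (cong (suc v *_) eq) (*-zeroʳ (suc v)))))
        (≤-reflexive (sym (^-*-swap (suc v) (product vs) M))))

    ≤2^∑ : ∀ vs → product vs ^ M ≤ 2 ^ (∑ vs e + length vs)
    ≤2^∑ []       = ≤-reflexive (^-zeroˡ M)
    ≤2^∑ (v ∷ vs) = ≤-trans (≤-reflexive (^-*-swap v (product vs) M))
      (≤-trans (*-mono-≤ (<⇒≤ (<2^1+⌊log₂⌋ (v ^ M))) (≤2^∑ vs))
        (≤-reflexive (trans (sym (^-distribˡ-+-* 2 (suc (e v)) (∑ vs e + length vs))) (cong (2 ^_) (lem (e v) (∑ vs e) (length vs))))))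
      where
      lem : ∀ a b c → suc a + (b + c) ≡ a + b + suc c
      lem = solve-∀

  weight-mono-< : ∀ us vs → All (_≤ r) us → All (_≤ r) vs → length us ≡ K → length vs ≡ K →
    product vs < product us → ∑ vs weight < ∑ us weight
  weight-mono-< us vs us≤ vs≤ refl lv v<u = cases (product vs ≟ 0)
    where
    us≢0 : product us ≢ 0
    us≢0 eq = contradiction (≤-trans v<u (≤-reflexive eq)) λ ()
    u≡ : ∑ us weight ≡ K * big + ∑ us e
    u≡ = positive us us≢0
    cases : Dec (product vs ≡ 0) → ∑ vs weight < ∑ us weight
    cases (yes v≡0) = +-cancelʳ-< (big + emax) _ _ (begin-strict
      ∑ vs weight + (big + emax)              ≤⟨ zero-factor vs vs≤ v≡0 ⟩
      length vs * (big + emax)                ≡⟨ cong (_* (big + emax)) lv ⟩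
      K * (big + emax)                        ≡⟨ *-distribˡ-+ K big emax ⟩
      K * big + K * emax                      <⟨ +-monoʳ-< (K * big) (n<1+n (K * emax)) ⟩
      K * big + big                           ≤⟨ +-mono-≤ (≤-trans (m≤m+n (K * big) (∑ us e)) (≤-reflexive (sym u≡))) (m≤m+n big emax) ⟩
      ∑ us weight + (big + emax)              ∎)
      where open ≤-Reasoning
    cases (no v≢0) = subst₂ _<_ (sym (trans (positive vs v≢0) (cong (λ l → l * big + ∑ vs e) lv))) (sym u≡)
        (+-monoʳ-< (K * big) (+-cancelʳ-< K _ _ (2^-cancel-< (begin-strict
      2 ^ (∑ vs e + K)               ≡⟨ ^-distribˡ-+-* 2 (∑ vs e) K ⟩
      2 ^ ∑ vs e * 2 ^ K             ≤⟨ *-monoˡ-≤ (2 ^ K) (2^∑≤ vs v≢0) ⟩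
      v* ^ M * 2 ^ K                  <⟨ *-cancelʳ-< v* _ _ gap ⟩
      suc v* ^ M                      ≤⟨ ^-monoˡ-≤ M v<u ⟩
      product us ^ M                 ≤⟨ ≤2^∑ us ⟩
      2 ^ (∑ us e + K)               ∎))))
      where
      open ≤-Reasoning
      v* = product vs
      instance
        _ : NonZero v*
        _ = ≢-nonZero v≢0
      v*≤ : v* ≤ r ^ K
      v*≤ = ≤-trans (product≤^ vs vs≤) (≤-reflexive (cong (r ^_) lv))
      gap : v* ^ M * 2 ^ K * v* < suc v* ^ M * v*
      gap = begin-strict
        v* ^ M * 2 ^ K * v*          ≡⟨ *-assoc (v* ^ M) (2 ^ K) v* ⟩
        v* ^ M * (2 ^ K * v*)        <⟨ *-monoʳ-< (v* ^ M) {{m^n≢0 v* M}} (≤-trans (s≤s (*-monoʳ-≤ (2 ^ K) v*≤)) (+-monoˡ-≤ M (>-nonZero⁻¹ v*))) ⟩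
        v* ^ M * (v* + M)            ≡⟨ cong (λ z → v* ^ M * (v* + z)) (*-identityʳ M) ⟨
        v* ^ M * (v* + M * 1)        ≤⟨ bernoulliℕ v* 1 M ⟩
        (v* + 1) ^ M * v*            ≡⟨ cong (λ z → z ^ M * v*) (+-comm v* 1) ⟩
        suc v* ^ M * v*              ∎

-- The supporting hyperplane of a set whose matrix is typical

module _ {r : ℕ} (E : ℕ → ℕ) where

  coefficient : Side → Subset r → ℚ
  coefficient inside  t = fromℕℚ (E (card t)) ℚ.- fromℕℚ (E (r ∸ card t))
  coefficient outside t = 0ℚ

  offset : ∀ {d} → Vec Side d → Vec (Subset r) d → ℚ
  offset []            []      = 0ℚ
  offset (inside ∷ m)  (t ∷ X) = fromℕℚ (E (r ∸ card t)) ℚ.+ offset m X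
  offset (outside ∷ m) (t ∷ X) = offset m X

  score-linear : ∀ {d} (m : Vec Side d) (X : Vec (Subset r) d) y → fromℕℚ (∑ (factors m X y) E) ≡
    offset m X ℚ.+ dot (λ j → coefficient (lookup m j) (lookup X j)) (λ j → bitℚ (lookup y j))
  score-linear []            []      []      = refl
  score-linear (outside ∷ m) (t ∷ X) (b ∷ y) = trans (score-linear m X y) (cong (offset m X ℚ.+_)
    (sym (trans (cong (ℚ._+ tail) (ℚ.*-zeroˡ (bitℚ b))) (ℚ.+-identityˡ tail))))
    where tail = dot (λ j → coefficient (lookup m j) (lookup X j)) (λ j → bitℚ (lookup y j))
  score-linear (inside ∷ m) (t ∷ X) (inside ∷ y) = trans (fromℕℚ-+ (E (card t)) _) (trans (cong (fromℕℚ (E (card t)) ℚ.+_) (score-linear m X y))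
    (solve 4 (λ p q o s → p :+ (o :+ s) := (q :+ o) :+ ((p :- q) :* con 1ℚ :+ s)) refl (fromℕℚ (E (card t))) (fromℕℚ (E (r ∸ card t))) (offset m X)
      (dot (λ j → coefficient (lookup m j) (lookup X j)) (λ j → bitℚ (lookup y j)))))
  score-linear (inside ∷ m) (t ∷ X) (outside ∷ y) = trans (fromℕℚ-+ (E (r ∸ card t)) _) (trans (cong (fromℕℚ (E (r ∸ card t)) ℚ.+_) (score-linear m X y))
    (solve 4 (λ p q o s → q :+ (o :+ s) := (q :+ o) :+ ((p :- q) :* con 0ℚ :+ s)) refl (fromℕℚ (E (card t))) (fromℕℚ (E (r ∸ card t))) (offset m X)
      (dot (λ j → coefficient (lookup m j) (lookup X j)) (λ j → bitℚ (lookup y j)))))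

fromℕℚ-mono-< : ∀ {m n} → m < n → fromℕℚ m ℚ.< fromℕℚ n
fromℕℚ-mono-< m<n = ℚ.≰⇒> λ le → <⇒≱ m<n (fromℕℚ-cancel-≤ le)

module _ {d : ℕ} (v : Fin (2 ^ d) → Fin d → ℚ) (v≡bit : ∀ i j → v i j ≡ bitℚ (lookup (bits {d} i) j)) (r′ : ℕ) where

  open Columns r′

  module _ {N : ℕ} (T : Subset (2 ^ d)) (card≡ : card T ≡ r) (m : Vec Side d)
    (m↭ : selected m (matrix {d} (enum T card≡)) ↭ copies N (subsets r)) where

    private
      x = enum T card≡
      X = matrix {d} x
      open Weights (card m) r

    light⇒exposing : ∀ W → (∀ i → i ∈ W → i ∉ T → ¬ Heavy {N} X m m↭ (bits {d} i)) → Exposing v T W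
    light⇒exposing W light = record
      { b      = fromℕℚ S ℚ.- offset weight m X
      ; c      = c
      ; tight  = λ i i∈T → trans (slack≡ i) (trans (cong (λ z → fromℕℚ S ℚ.- fromℕℚ z) (score-T i i∈T)) (ℚ.+-inverseʳ (fromℕℚ S)))
      ; strict = λ i i∉T i∈W → subst (0ℚ ℚ.<_) (sym (slack≡ i)) (<⇒0<- (fromℕℚ-mono-< (below i (light i i∈W i∉T))))
      }
      where
      c : Fin d → ℚ
      c j = coefficient weight (lookup m j) (lookup X j)
      score : Vec Side d → ℕ
      score y = ∑ (factors m X y) weight
      S = ∑ (map entry (copies N (profiles r′))) weight
      slack≡ : ∀ i → slack v (fromℕℚ S ℚ.- offset weight m X) c i ≡ fromℕℚ S ℚ.- fromℕℚ (score (bits {d} i))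
      slack≡ i = trans (cong (λ z → fromℕℚ S ℚ.- offset weight m X ℚ.- z) (sum-cong-≗ (λ j → cong (c j ℚ.*_) (v≡bit i j))))
        (trans (solve 3 (λ s o t → (s :- o) :- t := s :- (o :+ t)) refl (fromℕℚ S) (offset weight m X) _)
          (cong (λ z → fromℕℚ S ℚ.- z) (sym (score-linear weight m X (bits {d} i)))))
      ∑-↭ : ∀ {xs ys : List ℕ} → xs ↭ ys → ∑ xs weight ≡ ∑ ys weight
      ∑-↭ _↭_.refl          = refl
      ∑-↭ (_↭_.prep x p)    = cong (weight x +_) (∑-↭ p)
      ∑-↭ (_↭_.swap x y p)  = trans (cong (λ z → weight x + (weight y + z)) (∑-↭ p)) (lem (weight x) (weight y) _)
        where
        lem : ∀ a b c → a + (b + c) ≡ b + (a + c)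
        lem = solve-∀
      ∑-↭ (_↭_.trans p q)   = trans (∑-↭ p) (∑-↭ q)
      score-row : ∀ a → score (bits {d} (x a)) ≡ S
      score-row a = trans (cong score (sym (row-matrix {d} x a))) (∑-↭ (factors-row {N} X m m↭ a))
      score-T : ∀ i → i ∈ T → score (bits {d} i) ≡ S
      score-T i i∈T = let a , e = enum-surjective T card≡ i∈T in subst (λ i → score (bits {d} i) ≡ S) e (score-row a)
      length-factors : ∀ y → length (factors m X y) ≡ card m
      length-factors y = length-selected m (zipWith (λ t b → mult r b (card t)) X y)
      below : ∀ i → ¬ Heavy {N} X m m↭ (bits {d} i) → score (bits {d} i) < S
      below i ¬heavy = subst (score (bits {d} i) <_) (score-row zero)
        (weight-mono-< (factors m X (bits {d} (x zero))) (factors m X (bits {d} i)) (factors≤ m X _) (factors≤ m X _) (length-factors _) (length-factors _)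
          (subst (product (factors m X (bits {d} i)) <_) (sym (trans (cong (λ y → product (factors m X y)) (sym (row-matrix {d} x zero)))
            (product-factors-row {N} X m m↭ zero))) (≰⇒> ¬heavy)))

sum-bits : ∀ {n} (A : Subset n) → sumℚ (λ i → bitℚ (lookup A i)) ≡ fromℕℚ (card A)
sum-bits []            = refl
sum-bits (inside ∷ A)  = trans (cong (1ℚ ℚ.+_) (sum-bits A)) (sym (fromℕℚ-+ 1 (card A)))
sum-bits (outside ∷ A) = trans (ℚ.+-identityˡ _) (sum-bits A)

equal-sums : ∀ {n} (f g : Fin n → ℚ) → (∀ i → f i ℚ.≤ g i) → sumℚ f ≡ sumℚ g → ∀ i → g i ≡ f i
equal-sums f g f≤g eq i = ℚ.≤-antisym (subst (ℚ._≤ f i) (solve 2 (λ f g → f :+ (g :- f) := g) refl (f i) (g i))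
    (subst (f i ℚ.+ diff i ℚ.≤_) (ℚ.+-identityʳ (f i)) (ℚ.+-monoʳ-≤ (f i)
      (subst (diff i ℚ.≤_) total (term≤sum diff (λ i → ≤⇒0≤- (f≤g i)) i))))) (f≤g i)
  where
  diff : Fin _ → ℚ
  diff i = g i ℚ.- f i
  total : sumℚ diff ≡ 0ℚ
  total = trans (sum-cong-≗ (λ i → solve 2 (λ f g → g :- f := g :+ (:- con 1ℚ) :* f) refl (f i) (g i)))
    (trans (∑-distrib-+ g (λ i → ℚ.- 1ℚ ℚ.* f i)) (trans (cong (sumℚ g ℚ.+_) (sym (*-distribˡ-sum (ℚ.- 1ℚ) f)))
      (trans (cong (λ z → sumℚ g ℚ.+ ℚ.- 1ℚ ℚ.* z) eq) (solve 1 (λ g → g :+ (:- con 1ℚ) :* g := con 0ℚ) refl (sumℚ g)))))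

length≤keys*fibres : {A : Set} {m : ℕ} (key : A → Vec ℕ m) (K F : ℕ) {R : A → Set} (R? : ∀ x → Dec (R x)) (xs : List A) →
  (∀ x j → lookup (key x) j ≤ K) →
  (∀ v → count (λ x → R? x ×-dec V.≡-dec _≟_ (key x) v) xs ≤ F) → count R? xs ≤ suc K ^ m * F
length≤keys*fibres {m = zero} key K F R? xs _ h = ≤-trans (count-mono R? _ xs λ x r → r , nil (key x))
    (≤-trans (h []) (≤-reflexive (sym (*-identityˡ F))))
  where
  nil : (v : Vec ℕ 0) → v ≡ []
  nil [] = refl
length≤keys*fibres {A} {suc m} key K F {R} R? xs key≤ h = ≤-trans
    (length≤keys*fibre (λ x → V.head (key x)) K (suc K ^ m * F) R? xs
      (λ x _ → subst (_≤ K) (lookup-zero (key x)) (key≤ x zero))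
      (λ k → length≤keys*fibres (λ x → V.tail (key x)) K F (λ x → R? x ×-dec (V.head (key x) ≟ k)) xs
        (λ x j → subst (_≤ K) (lookup-suc (key x) j) (key≤ x (suc j)))
        (λ v → ≤-trans (count-mono _ (λ x → R? x ×-dec V.≡-dec _≟_ (key x) (k ∷ v)) xs (λ x ((r , hd) , tl) → r , join (key x) hd tl)) (h (k ∷ v)))))
    (≤-reflexive (sym (*-assoc (suc K) (suc K ^ m) F)))
  where
  lookup-zero : ∀ (v : Vec ℕ (suc m)) → lookup v zero ≡ V.head v
  lookup-zero (_ ∷ _) = refl
  lookup-suc : ∀ (v : Vec ℕ (suc m)) j → lookup v (suc j) ≡ lookup (V.tail v) j
  lookup-suc (_ ∷ _) j = refl
  join : ∀ (v : Vec ℕ (suc m)) {k w} → V.head v ≡ k → V.tail v ≡ w → v ≡ k ∷ w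
  join (_ ∷ _) refl refl = refl

module Cube {d : ℕ} (v : Fin (2 ^ d) → Fin d → ℚ) (v≡bit : ∀ i j → v i j ≡ bitℚ (lookup (bits {d} i) j)) where

  private
    slackᵇ : ℚ → (Fin d → ℚ) → Vec Side d → ℚ
    slackᵇ b c y = b ℚ.- dot c (λ j → bitℚ (lookup y j))

    slack≡slackᵇ : ∀ b c i → slack v b c i ≡ slackᵇ b c (bits {d} i)
    slack≡slackᵇ b c i = cong (λ z → b ℚ.- z) (sum-cong-≗ (λ j → cong (c j ℚ.*_) (v≡bit i j)))

    sum-slack-rows : ∀ {r} b c (X : Vec (Subset r) d) → sumℚ (λ a → slackᵇ b c (row a X)) ≡
      sumℚ {r} (λ _ → b) ℚ.- dot c (λ j → fromℕℚ (card (lookup X j)))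
    sum-slack-rows {r} b c X = trans
      (sum-cong-≗ (λ a → solve 2 (λ b s → b :- s := b :+ (:- con 1ℚ) :* s) refl b (dot c (λ j → bitℚ (lookup (row a X) j)))))
      (trans (∑-distrib-+ {r} (λ _ → b) (λ a → ℚ.- 1ℚ ℚ.* dot c (λ j → bitℚ (lookup (row a X) j))))
      (trans (cong (sumℚ {r} (λ _ → b) ℚ.+_) (trans (sym (*-distribˡ-sum (ℚ.- 1ℚ) (λ a → dot c (λ j → bitℚ (lookup (row a X) j)))))
        (cong (ℚ.- 1ℚ ℚ.*_) swap)))
        (solve 2 (λ x y → x :+ (:- con 1ℚ) :* y := x :- y) refl (sumℚ {r} (λ _ → b)) (dot c (λ j → fromℕℚ (card (lookup X j)))))))
      where
      swap : sumℚ (λ a → dot c (λ j → bitℚ (lookup (row a X) j))) ≡ dot c (λ j → fromℕℚ (card (lookup X j)))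
      swap = trans (sumℚ-comm (λ a j → c j ℚ.* bitℚ (lookup (row a X) j))) (sum-cong-≗ λ j →
        trans (sym (*-distribˡ-sum (c j) (λ a → bitℚ (lookup (row a X) j)))) (cong (c j ℚ.*_)
          (trans (sum-cong-≗ (λ a → cong bitℚ (V.lookup-map j (λ t → lookup t a) X))) (sum-bits (lookup X j)))))

  halfspace : ℚ → (Fin d → ℚ) → Subset (2 ^ d)
  halfspace b c = subsetOf λ i → slack v b c i ℚ.≤? 0ℚ

  module _ (r′ : ℕ) where

    open Columns r′

    -- The rows of every shift of the matrix have the same barycentre.
    halfspace-large : ∀ N (T : Subset (2 ^ d)) (card≡ : card T ≡ r) → Good N d (matrix {d} (enum T card≡)) →
      ∀ b c → (∀ i → i ∈ T → slack v b c i ≡ 0ℚ) →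
      r ^ d ≤ 2 * (r * (card (halfspace b c) * (Λ ^ N * r ^ (d ∸ N * 2 ^ r))))
    halfspace-large N T card≡ good b c tight = ≤-trans (hit-all-shifts⇒large N d X good inside? hit)
        (*-monoʳ-≤ 2 (*-monoʳ-≤ r (*-monoˡ-≤ (Λ ^ N * r ^ (d ∸ N * 2 ^ r)) (count-points≤ {d} inside? (halfspace b c)
          λ y le → ∈-subsetOf⁺ (λ i → slack v b c i ℚ.≤? 0ℚ) (subst (ℚ._≤ 0ℚ) (sym (trans (slack≡slackᵇ b c (point {d} y)) (cong (slackᵇ b c) (bits-point {d} y)))) le)))))
      where
      X = matrix {d} (enum T card≡)
      inside? : ∀ y → Dec (slackᵇ b c y ℚ.≤ 0ℚ)
      inside? y = slackᵇ b c y ℚ.≤? 0ℚ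
      sum-T : sumℚ (λ a → slackᵇ b c (row a X)) ≡ 0ℚ
      sum-T = sumℚ-zero _ λ a → trans (cong (slackᵇ b c) (row-matrix {d} (enum T card≡) a))
        (trans (sym (slack≡slackᵇ b c (enum T card≡ a))) (tight _ (enum-∈ T card≡ a)))
      lookup-shiftM : ∀ {d} (s : Vec (Fin r) d) (X : Vec (Subset r) d) j → lookup (shiftM s X) j ≡ shift (lookup s j) (lookup X j)
      lookup-shiftM s X j = V.lookup-zipWith shift j s X
      sum-shift : ∀ s → sumℚ (λ a → slackᵇ b c (row a (shiftM s X))) ≡ 0ℚ
      sum-shift s = trans (sum-slack-rows b c (shiftM s X)) (trans (cong (λ z → sumℚ {r} (λ _ → b) ℚ.- z)
        (sum-cong-≗ (λ j → cong (λ n → c j ℚ.* fromℕℚ n) (trans (cong card (lookup-shiftM s X j)) (card-shift (lookup s j) (lookup X j))))))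
        (trans (sym (sum-slack-rows b c X)) sum-T))
      hit : ∀ s → ∃ λ a → slackᵇ b c (row a (shiftM s X)) ℚ.≤ 0ℚ
      hit s = decide (any-or-all λ a → sign (slackᵇ b c (row a (shiftM s X))))
        where
        sign : ∀ q → (q ℚ.≤ 0ℚ) ⊎ (0ℚ ℚ.< q)
        sign q with q ℚ.≤? 0ℚ
        ... | yes le = inj₁ le
        ... | no ¬le = inj₂ (ℚ.≰⇒> ¬le)
        decide : (∃ λ a → slackᵇ b c (row a (shiftM s X)) ℚ.≤ 0ℚ) ⊎ (∀ a → 0ℚ ℚ.< slackᵇ b c (row a (shiftM s X))) →
          ∃ λ a → slackᵇ b c (row a (shiftM s X)) ℚ.≤ 0ℚ
        decide (inj₁ h)   = h
        decide (inj₂ all) = contradiction (ℚ.<-≤-trans (all zero) (subst (slackᵇ b c (row zero (shiftM s X)) ℚ.≤_) (sum-shift s)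
          (term≤sum (λ a → slackᵇ b c (row a (shiftM s X))) (λ a → ℚ.<⇒≤ (all a)) zero))) (ℚ.<-irrefl refl)

  -- The Chow parameters of A, which distinguish a halfspace from all other sets of points.
  coordinate : Fin d → Subset (2 ^ d)
  coordinate j = V.tabulate λ i → lookup (bits {d} i) j

  chow : Subset (2 ^ d) → Vec ℕ (suc d)
  chow A = card A ∷ V.tabulate λ j → card (A ∩ coordinate j)

  chow≤ : ∀ A j → lookup (chow A) j ≤ 2 ^ d
  chow≤ A zero    = ∣p∣≤n A
  chow≤ A (suc j) = ≤-trans (≤-reflexive (V.lookup∘tabulate _ j)) (∣p∣≤n (A ∩ coordinate j))

  private
    indicator : Subset (2 ^ d) → Fin (2 ^ d) → ℚ
    indicator A i = bitℚ (lookup A i)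

    coordinate-sum : ∀ A j → dot (λ i → v i j) (indicator A) ≡ fromℕℚ (card (A ∩ coordinate j))
    coordinate-sum A j = trans (sum-cong-≗ λ i → trans (cong (ℚ._* indicator A i) (v≡bit i j))
        (trans (∧-bit (lookup (bits {d} i) j) (lookup A i))
          (cong bitℚ (sym (trans (V.lookup-zipWith _∧_ i A (coordinate j)) (cong (lookup A i ∧_) (V.lookup∘tabulate _ i)))))))
      (sum-bits (A ∩ coordinate j))
      where
      ∧-bit : ∀ s t → bitℚ s ℚ.* bitℚ t ≡ bitℚ (t ∧ s)
      ∧-bit inside  inside  = refl
      ∧-bit inside  outside = refl
      ∧-bit outside inside  = refl
      ∧-bit outside outside = refl

    sum-indicator-slack : ∀ A b c → sumℚ (λ i → indicator A i ℚ.* slack v b c i) ≡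
      b ℚ.* fromℕℚ (V.head (chow A)) ℚ.- dot c (λ j → fromℕℚ (lookup (V.tail (chow A)) j))
    sum-indicator-slack A b c = trans (sum-slack v b c (indicator A)) (cong₂ (λ s t → b ℚ.* s ℚ.- t) (sum-bits A)
      (sum-cong-≗ λ j → cong (c j ℚ.*_) (trans (coordinate-sum A j) (cong fromℕℚ (sym (V.lookup∘tabulate _ j))))))

  chow-⊆ : ∀ b c A → chow A ≡ chow (halfspace b c) → A ⊆ halfspace b c
  chow-⊆ b c A eq {i} i∈A with i ∈? halfspace b c
  ... | yes i∈ = i∈
  ... | no i∉ = contradiction zero-slack λ s≡0 → ℚ.<-irrefl (sym s≡0) 0<s
    where
    H = halfspace b c
    s = slack v b c
    H? = λ i → s i ℚ.≤? 0ℚ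
    0<s : 0ℚ ℚ.< s i
    0<s = ℚ.≰⇒> λ le → i∉ (∈-subsetOf⁺ H? le)
    termwise : ∀ i → indicator H i ℚ.* s i ℚ.≤ indicator A i ℚ.* s i
    termwise i = cases (i ∈? H) (lookup A i)
      where
      cases : Dec (i ∈ H) → ∀ t → indicator H i ℚ.* s i ℚ.≤ bitℚ t ℚ.* s i
      cases (yes i∈) inside  = ℚ.≤-reflexive (cong (λ t → bitℚ t ℚ.* s i) (V.[]=⇒lookup i∈))
      cases (yes i∈) outside = subst₂ ℚ._≤_ (sym (trans (cong (λ t → bitℚ t ℚ.* s i) (V.[]=⇒lookup i∈)) (ℚ.*-identityˡ (s i)))) (sym (ℚ.*-zeroˡ (s i)))
        (∈-subsetOf⁻ H? i∈)
      cases (no i∉) t = subst (ℚ._≤ bitℚ t ℚ.* s i) (sym (trans (cong (λ t → bitℚ t ℚ.* s i) (∉⇒lookup i∉)) (ℚ.*-zeroˡ (s i)))) (nonNeg t)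
        where
        0≤s : 0ℚ ℚ.≤ s i
        0≤s = ℚ.<⇒≤ (ℚ.≰⇒> λ le → i∉ (∈-subsetOf⁺ H? le))
        nonNeg : ∀ t → 0ℚ ℚ.≤ bitℚ t ℚ.* s i
        nonNeg inside  = subst (0ℚ ℚ.≤_) (sym (ℚ.*-identityˡ (s i))) 0≤s
        nonNeg outside = ℚ.≤-reflexive (sym (ℚ.*-zeroˡ (s i)))
    sums : sumℚ (λ i → indicator H i ℚ.* s i) ≡ sumℚ (λ i → indicator A i ℚ.* s i)
    sums = trans (sum-indicator-slack H b c) (trans (cong (λ κ → b ℚ.* fromℕℚ (V.head κ) ℚ.- dot c (λ j → fromℕℚ (lookup (V.tail κ) j))) (sym eq))
      (sym (sum-indicator-slack A b c)))
    zero-slack : s i ≡ 0ℚ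
    zero-slack = trans (sym (trans (cong (λ t → bitℚ t ℚ.* s i) (V.[]=⇒lookup i∈A)) (ℚ.*-identityˡ (s i))))
      (trans (equal-sums _ _ termwise sums i) (trans (cong (λ t → bitℚ t ℚ.* s i) (∉⇒lookup i∉)) (ℚ.*-zeroˡ (s i))))

  Face : Subset (2 ^ d) → Subset (2 ^ d) → Set
  Face T W = T ⊆ W × IsFace (Conv (points v) T) (Conv (points v) W)

  module _ (convex : ConvexPosition v) where

    face? : ∀ T W → Dec (Face T W)
    face? T W = decide (T ⊆? W)
      where
      decide : Dec (T ⊆ W) → Dec (Face T W)
      decide (no ⊈)     = no (⊈ ∘ proj₁)
      decide (yes T⊆W) = go (isFace? v convex T W T⊆W)
        where
        go : Dec (IsFace (Conv (points v) T) (Conv (points v) W)) → Dec (Face T W)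
        go (yes f) = yes (T⊆W , f)
        go (no ¬f) = no (¬f ∘ proj₂)

    module _ (T : Subset (2 ^ d)) (m u : ℕ)
      (large : ∀ b c → (∀ i → i ∈ T → slack v b c i ≡ 0ℚ) → card (∁ (halfspace b c)) ≤ u) where

      private
        supporting : ∀ {W} → Dec (Face T W) → Subset (2 ^ d)
        supporting (yes (T⊆W , f)) = let open Exposing (isFace⇒exposing v convex T⊆W f) in halfspace b c
        supporting (no _)          = ⊥

        face-and-size? : ∀ W → Dec (Face T W × card W ≡ card T + m)
        face-and-size? W = face? T W ×-dec card W ≟ card T + m

        key : Subset (2 ^ d) → Vec ℕ (suc d)
        key W = chow (supporting (face? T W))

        -- Two halfspaces with the same Chow parameters are equal, so all these W meet one of them in T only.
        confined : ∀ {W W₀} (f : Dec (Face T W)) (f₀ : Dec (Face T W₀)) → Face T W → Face T W₀ →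
          chow (supporting f) ≡ chow (supporting f₀) → W ⊆ T ∪ ∁ (supporting f₀)
        confined (no ¬f) f₀ face _ _ = contradiction face ¬f
        confined f (no ¬f₀) _ face₀ _ = contradiction face₀ ¬f₀
        confined {W} {W₀} (yes (T⊆W , f)) (yes (T⊆W₀ , f₀)) _ _ eq {i} i∈W = decide (i ∈? T)
          where
          module E = Exposing (isFace⇒exposing v convex T⊆W f)
          module E₀ = Exposing (isFace⇒exposing v convex T⊆W₀ f₀)
          decide : Dec (i ∈ T) → i ∈ T ∪ ∁ (halfspace E₀.b E₀.c)
          decide (yes i∈T) = p⊆p∪q _ i∈T
          decide (no i∉T)  = q⊆p∪q T _ (x∉p⇒x∈∁p λ i∈H₀ → ℚ.<-irrefl refl (ℚ.<-≤-trans (E.strict i i∉T i∈W)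
            (∈-subsetOf⁻ (λ i → slack v E.b E.c i ℚ.≤? 0ℚ) (chow-⊆ E.b E.c (halfspace E₀.b E₀.c) (sym eq) i∈H₀))))

        bounded : ∀ {W₀} (f₀ : Dec (Face T W₀)) → Face T W₀ →
          T ⊆ supporting f₀ × card (∁ (supporting f₀)) ≤ u
        bounded (no ¬f₀) face₀ = contradiction face₀ ¬f₀
        bounded (yes (T⊆W₀ , f₀)) _ = (λ {i} i∈T → ∈-subsetOf⁺ (λ i → slack v b c i ℚ.≤? 0ℚ) (ℚ.≤-reflexive (tight i i∈T))) , large b c tight
          where open Exposing (isFace⇒exposing v convex T⊆W₀ f₀)

      count-faces≤ : count face-and-size? (subsets (2 ^ d)) ≤ suc (2 ^ d) ^ suc d * (u C m)
      count-faces≤ = length≤keys*fibres key (2 ^ d) (u C m) face-and-size? (subsets (2 ^ d))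
        (λ W → chow≤ (supporting (face? T W))) fibre
        where
        fibre : ∀ κ → count (λ W → face-and-size? W ×-dec V.≡-dec _≟_ (key W) κ) (subsets (2 ^ d)) ≤ u C m
        fibre κ = count-by-witness _ (subsets (2 ^ d)) (u C m) λ W₀ ((face₀ , _) , eq₀) →
          let H = supporting (face? T W₀)
              T⊆H , ∁H≤u = bounded (face? T W₀) face₀
          in ≤-trans (count-mono _ (between? T (T ∪ ∁ H) m) (subsets (2 ^ d)) (λ W ((face , size) , eq) →
               (λ {i} → proj₁ face {i}) , confined (face? T W) (face? T W₀) face face₀ (trans eq (sym eq₀)) , size))
             (≤-trans (≤-reflexive (count-between T (T ∪ ∁ H) (card (∁ H)) m (p⊆p∪q (∁ H)) (card-∪-∁ T H T⊆H)))
               (C-monoˡ m ∁H≤u))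

occurs⇒column : ∀ {r d} (t : Subset r) (X : Vec (Subset r) d) → 1 ≤ occurrences _≟ˢ_ t X → ∃ λ j → lookup X j ≡ t
occurs⇒column t (x ∷ X) h with x ≟ˢ t
... | yes eq = zero , eq
... | no _   = let j , eq = occurs⇒column t X h in suc j , eq

count-supersets : ∀ {n} (T : Subset n) M m → n ≡ card T + M →
  count (λ W → T ⊆? W ×-dec card W ≟ card T + m) (subsets n) ≡ M C m
count-supersets {n} T M m n≡ = trans (∑-cong (subsets n) λ W → 𝟙-cong _ (between? T ⊤ m W)
    (λ (a , b) → a , ⊆-max W , b) (λ (a , _ , b) → a , b))
  (count-between T ⊤ M m (⊆-max T) (trans (∣⊤∣≡n n) n≡))

count-subsets : ∀ {n} (W : Subset n) r → count (λ T → T ⊆? W ×-dec card T ≟ r) (subsets n) ≡ card W C r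
count-subsets {n} W r = trans (∑-cong (subsets n) λ T → 𝟙-cong _ (between? ⊥ W r T)
    (λ (a , b) → ⊆-min T , a , trans b (cong (_+ r) (sym (∣⊥∣≡0 n)))) (λ (_ , a , b) → a , trans b (cong (_+ r) (∣⊥∣≡0 n))))
  (count-between ⊥ W (card W) r (⊆-min W) (cong (_+ card W) (sym (∣⊥∣≡0 n))))

count-card : ∀ n r → count (λ T → card T ≟ r) (subsets n) ≡ n C r
count-card n r = trans (∑-cong (subsets n) λ T → 𝟙-cong (card T ≟ r) (T ⊆? ⊤ ×-dec card T ≟ r) (λ e → ⊆-max T , e) proj₂)
  (trans (count-subsets {n} ⊤ r) (cong (_C r) (∣⊤∣≡n n)))

KFace : ∀ {d} → (Fin (2 ^ d) → Fin d → ℚ) → ℕ → Subset (2 ^ d) → Subset (2 ^ d) → Set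
KFace v k W T = T ⊆ W × IsFace (Conv (points v) T) (Conv (points v) W) × HasDimension (points v) T k

module FixedDimension {d : ℕ} (v : Fin (2 ^ d) → Fin d → ℚ) (v≡bit : ∀ i j → v i j ≡ bitℚ (lookup (bits {d} i) j))
  (convex : ConvexPosition v) (k N : ℕ) .{{N≢0 : NonZero N}} where

  open Columns k
  open Cube {d} v v≡bit

  private
    S : List (Subset (2 ^ d))
    S = subsets (2 ^ d)

  GoodSet : Subset (2 ^ d) → Set
  GoodSet T = ∃ λ (eq : card T ≡ r) → Good N d (matrix {d} (enum T eq))

  goodSet? : ∀ T → Dec (GoodSet T)
  goodSet? T with card T ≟ r
  ... | no ≢   = no (≢ ∘ proj₁)
  ... | yes eq = map′ (eq ,_) (λ (eq′ , g) → subst (λ e → Good N d (matrix {d} (enum T e))) (≡-irrelevant eq′ eq) g) (good? N d _)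

  private
    columns : ∀ {T} (g : GoodSet T) t → ∃ λ j → lookup (matrix {d} (enum T (proj₁ g))) j ≡ t
    columns {T} (eq , typ , _) t = occurs⇒column t (matrix {d} (enum T eq)) (≤-trans (>-nonZero⁻¹ N) (typ t))

  badSets : ℕ
  badSets = count (λ T → card T ≟ r ×-dec ¬? (goodSet? T)) S

  badSets≤ : badSets ≤ count (λ X → ¬? (good? N d X)) (matrices N d)
  badSets≤ = count≤count _ (λ X → ¬? (good? N d X)) (λ T X → ∃ λ (eq : card T ≡ r) → matrix {d} (enum T eq) ≡ X) (subsets-unique (2 ^ d))
    (λ T _ (eq , ¬g) → matrix {d} (enum T eq) , words-complete subsets-complete _ , (λ g → ¬g (eq , g)) , eq , refl)
    (λ { _ _ (eq , refl) (eq′ , e) → enum-matrix-injective {d} eq eq′ (sym e) })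

  module _ (F? : ∀ W T → Dec (KFace v k W T)) where

    Spanning? : ∀ (W T : Subset (2 ^ d)) → Dec (T ⊆ W × card T ≡ r × (¬ GoodSet T ⊎ Face T W))
    Spanning? W T = T ⊆? W ×-dec card T ≟ r ×-dec (¬? (goodSet? T) ⊎-dec face? convex T W)

    kfaces≤spanning : ∀ W → count (F? W) S ≤ count (Spanning? W) S
    kfaces≤spanning W = count≤count (F? W) (Spanning? W)
        (λ F T → T ⊆ F × AffinelyIndependent (points v) T × card T ≡ r) (subsets-unique (2 ^ d))
        spanning determined
      where
      spanning : ∀ F → F ∈ˡ S → KFace v k W F → ∃ λ T → T ∈ˡ S × (T ⊆ W × card T ≡ r × (¬ GoodSet T ⊎ Face T W)) ×
        T ⊆ F × AffinelyIndependent (points v) T × card T ≡ r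
      spanning F _ (F⊆W , face , (T , T⊆F , ind , card≡) , maximal) =
        T , subsets-complete T , (F⊆W ∘ T⊆F , card≡ , decide (goodSet? T)) , (λ {i} → T⊆F {i}) , ind , card≡
        where
        decide : Dec (GoodSet T) → ¬ GoodSet T ⊎ Face T W
        decide (no ¬g) = inj₁ ¬g
        decide (yes g) = inj₂ (subst (λ F → Face F W) (⊆-antisym F⊆T T⊆F) ((λ {i} → F⊆W {i}) , face))
          where
          F⊆T : F ⊆ T
          F⊆T {i} i∈F = decidable-stable (i ∈? T) λ i∉T → <⇒≱ (≤-reflexive (sym (trans (card-insert i T i∉T) (cong suc card≡))))
            (maximal (insert i T) (insert-⊆ i∈F T⊆F)
              (extend-independent v ind (full⇒closed {d} v v≡bit T (proj₁ g) (columns g) i∉T)))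
      determined : ∀ {F F′ T} → KFace v k W F → KFace v k W F′ → T ⊆ F × AffinelyIndependent (points v) T × card T ≡ r →
        T ⊆ F′ × AffinelyIndependent (points v) T × card T ≡ r → F ≡ F′
      determined (F⊆W , face , dim) (F′⊆W , face′ , dim′) (T⊆F , ind , card≡) (T⊆F′ , _ , _) = ⊆-antisym
        (spanned-face⊆ v convex F′⊆W F⊆W face′ T⊆F′ T⊆F ind card≡ dim)
        (spanned-face⊆ v convex F⊆W F′⊆W face T⊆F T⊆F′ ind card≡ dim′)

    kfaces≤C : ∀ W → count (F? W) S ≤ card W C r
    kfaces≤C W = ≤-trans (kfaces≤spanning W) (≤-trans (count-mono (Spanning? W) (λ T → T ⊆? W ×-dec card T ≟ r) S λ T (a , b , _) → (λ {i} → a {i}) , b)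
      (≤-reflexive (count-subsets W r)))

    good⇒kface : ∀ {W T} → GoodSet T → Face T W → KFace v k W T
    good⇒kface {W} {T} g (T⊆W , face) = T⊆W , face , (T , (λ i∈ → i∈) , full⇒independent {d} v v≡bit T (proj₁ g) (columns g) , proj₁ g)
      , λ T′ T′⊆T _ → ≤-trans (p⊆q⇒∣p∣≤∣q∣ T′⊆T) (≤-reflexive (proj₁ g))

    module _ (m M : ℕ) (2^d≡ : 2 ^ d ≡ r + M) where

      private
        n = r + m
        f : Subset (2 ^ d) → ℕ
        f W = count (F? W) S

        over? : ∀ (T W : Subset (2 ^ d)) → Dec (T ⊆ W × card W ≡ n)
        over? T W = T ⊆? W ×-dec card W ≟ n

        bad? : ∀ (T : Subset (2 ^ d)) → Dec (card T ≡ r × ¬ GoodSet T)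
        bad? T = card T ≟ r ×-dec ¬? (goodSet? T)

        count-over : ∀ T → card T ≡ r → count (over? T) S ≡ M C m
        count-over T eq = subst (λ c → count (λ W → T ⊆? W ×-dec card W ≟ c + m) S ≡ M C m) eq
          (count-supersets T M m (trans 2^d≡ (cong (_+ M) (sym eq))))

        weighted : (g : Subset (2 ^ d) → ℕ) → (∀ T → card T ≡ r → g T ≤ M C m) →
          (Y : ℕ) → (∀ T → GoodSet T → g T ≤ Y) → ∑ S (λ T → 𝟙 (card T ≟ r) * g T) ≤ badSets * (M C m) + ((2 ^ d) C r) * Y
        weighted g g≤ Y good≤ = begin
          ∑ S (λ T → 𝟙 (card T ≟ r) * g T)                                             ≤⟨ ∑-mono S split ⟩
          ∑ S (λ T → 𝟙 (bad? T) * (M C m) + 𝟙 (card T ≟ r) * Y)                          ≡⟨ ∑-+ S _ _ ⟩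
          ∑ S (λ T → 𝟙 (bad? T) * (M C m)) + ∑ S (λ T → 𝟙 (card T ≟ r) * Y)              ≡⟨ cong₂ _+_ (∑-*ʳ S (M C m) (λ T → 𝟙 (bad? T))) (trans (∑-*ʳ S Y (λ T → 𝟙 (card T ≟ r))) (cong (_* Y) (count-card (2 ^ d) r))) ⟩
          badSets * (M C m) + ((2 ^ d) C r) * Y                                        ∎
          where
          open ≤-Reasoning
          split : ∀ T → 𝟙 (card T ≟ r) * g T ≤ 𝟙 (bad? T) * (M C m) + 𝟙 (card T ≟ r) * Y
          split T with card T ≟ r | goodSet? T
          ... | no _   | _      = z≤n
          ... | yes eq | yes go = ≤-trans (*-monoʳ-≤ 1 (good≤ T go)) ≤-refl
          ... | yes eq | no _   = ≤-trans (*-monoʳ-≤ 1 (g≤ T eq)) (m≤m+n _ _)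

      Ws : List (Subset (2 ^ d))
      Ws = filter (λ W → card W ≟ n) S

      pairs : ((2 ^ d) C n) * (n C r) ≡ ((2 ^ d) C r) * (M C m)
      pairs = begin
        ((2 ^ d) C n) * (n C r)                                        ≡⟨ cong (_* (n C r)) (count-card (2 ^ d) n) ⟨
        count (λ W → card W ≟ n) S * (n C r)                           ≡⟨ ∑-*ʳ S (n C r) _ ⟨
        ∑ S (λ W → 𝟙 (card W ≟ n) * (n C r))                           ≡⟨ ∑-cong S (λ W → by-size W (card W ≟ n)) ⟩
        ∑ S (λ W → ∑ S (λ T → 𝟙 (card T ≟ r) * 𝟙 (over? T W)))         ≡⟨ ∑-comm S S _ ⟩
        ∑ S (λ T → ∑ S (λ W → 𝟙 (card T ≟ r) * 𝟙 (over? T W)))         ≡⟨ ∑-cong S (λ T → trans (∑-*ˡ S (𝟙 (card T ≟ r)) _) (of-size T (card T ≟ r))) ⟩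
        ∑ S (λ T → 𝟙 (card T ≟ r) * (M C m))                           ≡⟨ ∑-*ʳ S (M C m) _ ⟩
        count (λ T → card T ≟ r) S * (M C m)                           ≡⟨ cong (_* (M C m)) (count-card (2 ^ d) r) ⟩
        ((2 ^ d) C r) * (M C m)                                        ∎
        where
        open ≡-Reasoning
        of-size : ∀ T (e : Dec (card T ≡ r)) → 𝟙 e * count (over? T) S ≡ 𝟙 e * (M C m)
        of-size T (no _)   = refl
        of-size T (yes eq) = cong (1 *_) (count-over T eq)
        by-size : ∀ W (e : Dec (card W ≡ n)) → 𝟙 e * (n C r) ≡ ∑ S (λ T → 𝟙 (card T ≟ r) * 𝟙 (over? T W))
        by-size W (yes eq) = trans (+-identityʳ (n C r)) (trans (cong (_C r) (sym eq)) (trans (sym (count-subsets W r))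
          (∑-cong S λ T → trans (𝟙-cong (T ⊆? W ×-dec card T ≟ r) (card T ≟ r ×-dec over? T W) (λ (a , b) → b , a , eq) (λ (a , b , _) → b , a)) (𝟙-× (card T ≟ r) (over? T W)))))
        by-size W (no ≢) = sym (trans (∑-cong S λ T → trans (cong (𝟙 (card T ≟ r) *_) (𝟙-no (over? T W) (≢ ∘ proj₂))) (*-zeroʳ (𝟙 (card T ≟ r)))) (∑-0 S))

      ∑-kfaces≤C : ∑ Ws f ≤ ((2 ^ d) C n) * (n C r)
      ∑-kfaces≤C = begin
        ∑ Ws f                                    ≡⟨ ∑-filter (λ W → card W ≟ n) S f ⟩
        ∑ S (λ W → 𝟙 (card W ≟ n) * f W)          ≤⟨ ∑-mono S (λ W → 𝟙-*-≤ (card W ≟ n) (λ eq → ≤-trans (kfaces≤C W) (≤-reflexive (cong (_C r) eq)))) ⟩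
        ∑ S (λ W → 𝟙 (card W ≟ n) * (n C r))      ≡⟨ ∑-*ʳ S (n C r) _ ⟩
        count (λ W → card W ≟ n) S * (n C r)      ≡⟨ cong (_* (n C r)) (count-card (2 ^ d) n) ⟩
        ((2 ^ d) C n) * (n C r)                   ∎
        where open ≤-Reasoning

      ∑-kfaces≤ : ∀ Y → (∀ T → GoodSet T → count (λ W → face? convex T W ×-dec card W ≟ card T + m) S ≤ Y) →
        ∑ Ws f ≤ badSets * (M C m) + ((2 ^ d) C r) * Y
      ∑-kfaces≤ Y good≤ = begin
        ∑ Ws f                                                           ≡⟨ ∑-filter (λ W → card W ≟ n) S f ⟩
        ∑ S (λ W → 𝟙 (card W ≟ n) * f W)                                 ≤⟨ ∑-mono S (λ W → *-monoʳ-≤ (𝟙 (card W ≟ n)) (kfaces≤spanning W)) ⟩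
        ∑ S (λ W → 𝟙 (card W ≟ n) * count (Spanning? W) S)               ≡⟨ ∑-cong S (λ W → sym (∑-*ˡ S (𝟙 (card W ≟ n)) (λ T → 𝟙 (Spanning? W T)))) ⟩
        ∑ S (λ W → ∑ S (λ T → 𝟙 (card W ≟ n) * 𝟙 (Spanning? W T)))       ≤⟨ ∑-mono S (λ W → ∑-mono S (regroup W)) ⟩
        ∑ S (λ W → ∑ S (λ T → 𝟙 (card T ≟ r) * 𝟙 (relevant? T W)))       ≡⟨ ∑-comm S S _ ⟩
        ∑ S (λ T → ∑ S (λ W → 𝟙 (card T ≟ r) * 𝟙 (relevant? T W)))       ≡⟨ ∑-cong S (λ T → ∑-*ˡ S (𝟙 (card T ≟ r)) (λ W → 𝟙 (relevant? T W))) ⟩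
        ∑ S (λ T → 𝟙 (card T ≟ r) * count (relevant? T) S)               ≤⟨ weighted (λ T → count (relevant? T) S) all≤ Y good≤′ ⟩
        badSets * (M C m) + ((2 ^ d) C r) * Y                            ∎
        where
        open ≤-Reasoning
        relevant? : ∀ (T W : Subset (2 ^ d)) → Dec ((T ⊆ W × card W ≡ n) × (¬ GoodSet T ⊎ Face T W))
        relevant? T W = over? T W ×-dec (¬? (goodSet? T) ⊎-dec face? convex T W)
        regroup : ∀ W T → 𝟙 (card W ≟ n) * 𝟙 (Spanning? W T) ≤ 𝟙 (card T ≟ r) * 𝟙 (relevant? T W)
        regroup W T = subst₂ _≤_ (𝟙-× (card W ≟ n) (Spanning? W T)) (𝟙-× (card T ≟ r) (relevant? T W))
          (𝟙-mono (card W ≟ n ×-dec Spanning? W T) (card T ≟ r ×-dec relevant? T W) λ (w , a , t , s) → t , ((λ {i} → a {i}) , w) , s)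
        all≤ : ∀ T → card T ≡ r → count (relevant? T) S ≤ M C m
        all≤ T eq = ≤-trans (count-mono (relevant? T) (over? T) S λ _ → proj₁) (≤-reflexive (count-over T eq))
        good≤′ : ∀ T → GoodSet T → count (relevant? T) S ≤ Y
        good≤′ T g = ≤-trans (count-mono (relevant? T) _ S select-face) (good≤ T g)
          where
          select-face : ∀ W → (T ⊆ W × card W ≡ n) × (¬ GoodSet T ⊎ Face T W) → Face T W × card W ≡ card T + m
          select-face W ((_ , w) , inj₁ ¬g) = contradiction g ¬g
          select-face W ((_ , w) , inj₂ fa) = fa , trans w (cong (_+ m) (sym (proj₁ g)))

      ∑-kfaces≥ : ∀ Y → (∀ T → GoodSet T → count (λ W → over? T W ×-dec ¬? (face? convex T W)) S ≤ Y) →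
        ((2 ^ d) C r) * (M C m) ≤ ∑ Ws f + (badSets * (M C m) + ((2 ^ d) C r) * Y)
      ∑-kfaces≥ Y good≤ = begin
        ((2 ^ d) C r) * (M C m)
          ≡⟨ trans (∑-*ʳ S (M C m) _) (cong (_* (M C m)) (count-card (2 ^ d) r)) ⟨
        ∑ S (λ T → 𝟙 (card T ≟ r) * (M C m))
          ≡⟨ ∑-cong S (λ T → of-size T (card T ≟ r)) ⟩
        ∑ S (λ T → ∑ S (λ W → 𝟙 (card T ≟ r) * 𝟙 (over? T W)))
          ≤⟨ ∑-mono S (λ T → ∑-mono S (λ W → split T W)) ⟩
        ∑ S (λ T → ∑ S (λ W → 𝟙 (card W ≟ n) * 𝟙 (F? W T) + 𝟙 (card T ≟ r) * 𝟙 (missed? T W)))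
          ≡⟨ trans (∑-cong S λ T → ∑-+ S _ _) (∑-+ S _ _) ⟩
        ∑ S (λ T → ∑ S (λ W → 𝟙 (card W ≟ n) * 𝟙 (F? W T))) + ∑ S (λ T → ∑ S (λ W → 𝟙 (card T ≟ r) * 𝟙 (missed? T W)))
          ≡⟨ cong₂ _+_ (trans (∑-comm S S _) (trans (∑-cong S λ W → ∑-*ˡ S (𝟙 (card W ≟ n)) (λ T → 𝟙 (F? W T))) (sym (∑-filter (λ W → card W ≟ n) S f))))
               (∑-cong S λ T → ∑-*ˡ S (𝟙 (card T ≟ r)) (λ W → 𝟙 (missed? T W))) ⟩
        ∑ Ws f + ∑ S (λ T → 𝟙 (card T ≟ r) * count (missed? T) S)
          ≤⟨ +-monoʳ-≤ (∑ Ws f) (weighted (λ T → count (missed? T) S) all≤ Y good≤′) ⟩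
        ∑ Ws f + (badSets * (M C m) + ((2 ^ d) C r) * Y) ∎
        where
        open ≤-Reasoning
        missed? : ∀ (T W : Subset (2 ^ d)) → Dec ((T ⊆ W × card W ≡ n) × ¬ (GoodSet T × Face T W))
        missed? T W = over? T W ×-dec ¬? (goodSet? T ×-dec face? convex T W)
        of-size : ∀ T (e : Dec (card T ≡ r)) → 𝟙 e * (M C m) ≡ ∑ S (λ W → 𝟙 e * 𝟙 (over? T W))
        of-size T (no _)   = sym (∑-0 S)
        of-size T (yes eq) = trans (cong (1 *_) (sym (count-over T eq))) (sym (∑-*ˡ S 1 (λ W → 𝟙 (over? T W))))
        split : ∀ T W → 𝟙 (card T ≟ r) * 𝟙 (over? T W) ≤ 𝟙 (card W ≟ n) * 𝟙 (F? W T) + 𝟙 (card T ≟ r) * 𝟙 (missed? T W)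
        split T W = subst₂ _≤_ (𝟙-× (card T ≟ r) (over? T W)) (cong₂ _+_ (𝟙-× (card W ≟ n) (F? W T)) (𝟙-× (card T ≟ r) (missed? T W)))
          (𝟙-⊎ (card T ≟ r ×-dec over? T W) (card W ≟ n ×-dec F? W T) (card T ≟ r ×-dec missed? T W) λ (t , o) → cases t o (goodSet? T ×-dec face? convex T W))
          where
          cases : card T ≡ r → T ⊆ W × card W ≡ n → Dec (GoodSet T × Face T W) →
            (card W ≡ n × KFace v k W T) ⊎ (card T ≡ r × (T ⊆ W × card W ≡ n) × ¬ (GoodSet T × Face T W))
          cases t (a , w) (yes (g , fa)) = inj₁ (w , good⇒kface g fa)
          cases t o       (no ¬gf)       = inj₂ (t , o , ¬gf)
        all≤ : ∀ T → card T ≡ r → count (missed? T) S ≤ M C m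
        all≤ T eq = ≤-trans (count-mono (missed? T) (over? T) S λ _ → proj₁) (≤-reflexive (count-over T eq))
        good≤′ : ∀ T → GoodSet T → count (missed? T) S ≤ Y
        good≤′ T g = ≤-trans (count-mono (missed? T) _ S λ W (o , ¬gf) → o , λ fa → ¬gf (g , fa)) (good≤ T g)

      count-nonfaces≤ : ∀ T → GoodSet T → ∃ λ heavy → heavy * Λ ^ N ≤ r ^ (N * 2 ^ r) * 2 ^ (d ∸ N * 2 ^ r) ×
        M * count (λ W → over? T W ×-dec ¬? (face? convex T W)) S ≤ heavy * (m * (M C m))
      count-nonfaces≤ T g@(card≡ , typ , _) = h
          , ≤-trans (*-monoˡ-≤ (Λ ^ N) (count-bits≤ {d} H?)) (count-heavy {N} X (proj₁ mk) (proj₂ mk))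
          , (begin
            M * count (λ W → over? T W ×-dec ¬? (face? convex T W)) S      ≤⟨ *-monoʳ-≤ M (∑-mono S spread) ⟩
            M * ∑ S (λ W → ∑ is (λ i → 𝟙 (H? (bits {d} i)) * 𝟙 (with? i W)))   ≡⟨ cong (M *_) (∑-comm S is _) ⟩
            M * ∑ is (λ i → ∑ S (λ W → 𝟙 (H? (bits {d} i)) * 𝟙 (with? i W)))   ≡⟨ cong (M *_) (∑-cong is λ i → ∑-*ˡ S (𝟙 (H? (bits {d} i))) (λ W → 𝟙 (with? i W))) ⟩
            M * ∑ is (λ i → 𝟙 (H? (bits {d} i)) * count (with? i) S)           ≡⟨ ∑-*ˡ is M _ ⟨
            ∑ is (λ i → M * (𝟙 (H? (bits {d} i)) * count (with? i) S))         ≤⟨ ∑-mono is (λ i → ≤-trans (≤-reflexive (lem M (𝟙 (H? (bits {d} i))) _)) (*-monoʳ-≤ (𝟙 (H? (bits {d} i))) (each i))) ⟩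
            ∑ is (λ i → 𝟙 (H? (bits {d} i)) * (m * (M C m)))                   ≡⟨ ∑-*ʳ is (m * (M C m)) _ ⟩
            h * (m * (M C m))                                              ∎)
        where
        open ≤-Reasoning
        lem : ∀ a b c → a * (b * c) ≡ b * (a * c)
        lem = solve-∀
        X = matrix {d} (enum T card≡)
        mk = mask {N} X typ
        H? = heavy? {N} X (proj₁ mk) (proj₂ mk)
        is = allFin (2 ^ d)
        h = count (λ i → H? (bits {d} i)) is
        with? : ∀ i (W : Subset (2 ^ d)) → Dec (i ∉ T × insert i T ⊆ W × card W ≡ n)
        with? i W = ¬? (i ∈? T) ×-dec insert i T ⊆? W ×-dec card W ≟ n
        spread : ∀ W → 𝟙 (over? T W ×-dec ¬? (face? convex T W)) ≤ ∑ is (λ i → 𝟙 (H? (bits {d} i)) * 𝟙 (with? i W))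
        spread W = go (over? T W ×-dec ¬? (face? convex T W))
          where
          go : (e : Dec ((T ⊆ W × card W ≡ n) × ¬ Face T W)) → 𝟙 e ≤ ∑ is (λ i → 𝟙 (H? (bits {d} i)) * 𝟙 (with? i W))
          go (no _) = z≤n
          go (yes ((T⊆W , w) , ¬face)) = decide (any-or-all λ i → classify i (i ∈? W) (i ∈? T) (H? (bits {d} i)))
            where
            Blocking Harmless : Fin (2 ^ d) → Set
            Blocking i = i ∈ W × i ∉ T × Heavy {N} X (proj₁ mk) (proj₂ mk) (bits {d} i)
            Harmless i = i ∈ W → i ∉ T → ¬ Heavy {N} X (proj₁ mk) (proj₂ mk) (bits {d} i)
            classify : ∀ i → Dec (i ∈ W) → Dec (i ∈ T) → Dec (Heavy {N} X (proj₁ mk) (proj₂ mk) (bits {d} i)) → Blocking i ⊎ Harmless i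
            classify i (no i∉W)  _         _       = inj₂ λ i∈W → contradiction i∈W i∉W
            classify i (yes i∈W) (yes i∈T) _       = inj₂ λ _ i∉T → contradiction i∈T i∉T
            classify i (yes i∈W) (no i∉T)  (yes h) = inj₁ (i∈W , i∉T , h)
            classify i (yes i∈W) (no i∉T)  (no ¬h) = inj₂ λ _ _ → ¬h
            decide : (∃ Blocking) ⊎ (∀ i → Harmless i) → 1 ≤ ∑ is (λ i → 𝟙 (H? (bits {d} i)) * 𝟙 (with? i W))
            decide (inj₁ (i , i∈W , i∉T , h)) = ≤-trans (≤-reflexive (sym (cong₂ _*_ (𝟙-yes (H? (bits {d} i)) h) (𝟙-yes (with? i W) (i∉T , insert-⊆ i∈W T⊆W , w)))))
              (∑-term≤ (λ i → 𝟙 (H? (bits {d} i)) * 𝟙 (with? i W)) (∈-allFin i))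
            decide (inj₂ harmless) = contradiction ((λ {i} → T⊆W {i}) , exposing⇒isFace v convex T⊆W
              (light⇒exposing {d} v v≡bit k {N} T card≡ (proj₁ mk) (proj₂ mk) W harmless)) ¬face
        each : ∀ i → M * count (with? i) S ≤ m * (M C m)
        each i = decide (i ∈? T)
          where
          decide : Dec (i ∈ T) → M * count (with? i) S ≤ m * (M C m)
          decide (yes i∈T) = ≤-trans (≤-reflexive (trans (cong (M *_) (count-none (with? i) S λ _ (i∉T , _) → i∉T i∈T)) (*-zeroʳ M))) z≤n
          decide (no i∉T) = by-size m M 2^d≡ (λ W → card W ≡ n) (λ W → card W ≟ n) (λ W e → e)
            where
            card-i : card (insert i T) ≡ suc r
            card-i = trans (card-insert i T i∉T) (cong suc card≡)
            by-size : ∀ m M → 2 ^ d ≡ r + M → (R : Subset (2 ^ d) → Set) (R? : ∀ W → Dec (R W)) → (∀ W → R W → card W ≡ r + m) →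
              M * count (λ W → ¬? (i ∈? T) ×-dec insert i T ⊆? W ×-dec R? W) S ≤ m * (M C m)
            by-size m zero _ R R? _ = z≤n
            by-size zero (suc M) 2^d≡ R R? R⇒ = ≤-trans (*-monoʳ-≤ (suc M) (≤-reflexive (count-none _ S
              λ W (_ , sub , rW) → contradiction (≤-trans (≤-reflexive (sym card-i)) (≤-trans (p⊆q⇒∣p∣≤∣q∣ sub) (≤-reflexive (trans (R⇒ W rW) (+-identityʳ r))))) 1+n≰n))) (≤-reflexive (*-zeroʳ (suc M)))
            by-size (suc m) (suc M) 2^d≡ R R? R⇒ = ≤-trans (*-monoʳ-≤ (suc M) (≤-trans (count-mono _ (λ W → insert i T ⊆? W ×-dec card W ≟ card (insert i T) + m) S
                λ W (_ , sub , rW) → (λ {j} → sub {j}) , trans (R⇒ W rW) (trans (+-suc r m) (cong (_+ m) (sym card-i))))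
                (≤-reflexive (count-supersets (insert i T) M m (trans 2^d≡ (trans (+-suc r M) (cong (_+ M) (sym card-i))))))))
              (≤-reflexive (sym (C-absorption M m)))

^-cancelˡ-≤ : ∀ E .{{_ : NonZero E}} {x y} → x ^ E ≤ y ^ E → x ≤ y
^-cancelˡ-≤ E {x} {y} h with x ≤? y
... | yes le = le
... | no ≰   = contradiction (^-monoˡ-< E (≰⇒> ≰)) (≤⇒≯ h)

-- N copies of each of the R column types leave L = d − N R columns, a small fraction of d.
module Parameters (r R E : ℕ) .{{_ : NonZero r}} .{{_ : NonZero R}} .{{_ : NonZero E}} where

  D : ℕ
  D = 4 * r * E

  instance
    D≢0 : NonZero D
    D≢0 = m*n≢0 (4 * r) E {{m*n≢0 4 r}}

    RD≢0 : NonZero (R * D)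
    RD≢0 = m*n≢0 R D

  N : ℕ → ℕ
  N d = (d * pred D) / (R * D)

  L : ℕ → ℕ
  L d = d ∸ N d * R

  N-small : ∀ d → R * N d * D + d ≤ d * D
  N-small d = begin
    R * N d * D + d               ≡⟨ cong (_+ d) (lem R (N d) D) ⟩
    N d * (R * D) + d             ≤⟨ +-monoˡ-≤ d (m/n*n≤m (d * pred D) (R * D)) ⟩
    d * pred D + d                ≡⟨ lem₂ d (pred D) ⟩
    d * suc (pred D)              ≡⟨ cong (d *_) (suc-pred D) ⟩
    d * D                         ∎
    where
    open ≤-Reasoning
    lem : ∀ R N D → R * N * D ≡ N * (R * D)
    lem = solve-∀
    lem₂ : ∀ d p → d * p + d ≡ d * suc p
    lem₂ = solve-∀

  NR≤d : ∀ d → N d * R ≤ d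
  NR≤d d = *-cancelʳ-≤ (N d * R) d D (≤-trans (≤-reflexive (cong (_* D) (*-comm (N d) R))) (≤-trans (m≤m+n _ d) (N-small d)))

  split : ∀ d → d ≡ N d * R + L d
  split d = sym (m+[n∸m]≡n (NR≤d d))

  L-small : ∀ d → L d * D ≤ R * D + d
  L-small d = +-cancelˡ-≤ (N d * R * D) _ _ (begin
    N d * R * D + L d * D             ≡⟨ *-distribʳ-+ D (N d * R) (L d) ⟨
    (N d * R + L d) * D               ≡⟨ cong (_* D) (sym (split d)) ⟩
    d * D                             ≡⟨ cong (d *_) (sym (suc-pred D)) ⟩
    d * suc (pred D)                  ≡⟨ trans (*-suc d (pred D)) (+-comm d (d * pred D)) ⟩
    d * pred D + d                    ≤⟨ +-monoˡ-≤ d (<⇒≤ (m<n+[m/n]*n (d * pred D) (R * D))) ⟩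
    R * D + N d * (R * D) + d         ≡⟨ lem R D (N d) d ⟩
    N d * R * D + (R * D + d)         ∎)
    where
    open ≤-Reasoning
    lem : ∀ R D N d → R * D + N * (R * D) + d ≡ N * R * D + (R * D + d)
    lem = solve-∀

  N≥1 : ∀ d → 2 * R ≤ d → NonZero (N d)
  N≥1 d h = >-nonZero (≤-trans (≤-reflexive (sym (trans (cong (_/ (R * D)) (sym (*-identityˡ (R * D)))) (m*n/n≡m 1 (R * D))))) (/-monoˡ-≤ (R * D) (begin
    R * D                  ≡⟨ cong (R *_) (suc-pred D) ⟨
    R * suc (pred D)       ≤⟨ *-monoʳ-≤ R 1+p≤2p ⟩
    R * (2 * pred D)       ≡⟨ lem R (pred D) ⟩
    2 * R * pred D         ≤⟨ *-monoˡ-≤ (pred D) h ⟩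
    d * pred D             ∎)))
    where
    open ≤-Reasoning
    lem : ∀ R p → R * (2 * p) ≡ 2 * R * p
    lem = solve-∀
    4≤D : 4 ≤ D
    4≤D = ≤-trans (m≤m*n 4 r) (m≤m*n (4 * r) E)
    1+p≤2p : suc (pred D) ≤ 2 * pred D
    1+p≤2p = +-mono-≤ {1} {pred D} {pred D} {pred D + 0} (pred-mono-≤ (≤-trans (s≤s (s≤s z≤n)) 4≤D)) (≤-reflexive (sym (+-identityʳ _)))

  subcritical-room : ∀ g d → 16 * r * g * E + 4 * r * E * R ≤ d → E * (4 * g + L d) ≤ d
  subcritical-room g d h = *-cancelˡ-≤ (4 * r) {{m*n≢0 4 r}} (begin
    4 * r * (E * (4 * g + L d))                ≡⟨ lem r E g (L d) ⟩
    16 * r * g * E + L d * D                   ≤⟨ +-monoʳ-≤ (16 * r * g * E) (L-small d) ⟩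
    16 * r * g * E + (R * D + d)               ≡⟨ lem₂ (16 * r * g * E) r E R d ⟩
    16 * r * g * E + 4 * r * E * R + d         ≤⟨ +-monoˡ-≤ d h ⟩
    d + d                                      ≤⟨ ≤-trans (≤-trans (m≤m+n (d + d) (2 * d)) (≤-reflexive (lem₃ d))) (*-monoˡ-≤ d (m≤m*n 4 r)) ⟩
    4 * r * d                                  ∎)
    where
    open ≤-Reasoning
    lem : ∀ r E g L → 4 * r * (E * (4 * g + L)) ≡ 16 * r * g * E + L * (4 * r * E)
    lem = solve-∀
    lem₂ : ∀ x r E R d → x + (R * (4 * r * E) + d) ≡ x + 4 * r * E * R + d
    lem₂ = solve-∀
    lem₃ : ∀ d → d + d + 2 * d ≡ 4 * d
    lem₃ = solve-∀

  supercritical-room : ∀ d → 4 * r * E * R ≤ d → 2 * (r * (L d * E)) ≤ d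
  supercritical-room d h = *-cancelˡ-≤ 2 (begin
    2 * (2 * (r * (L d * E)))       ≡⟨ lem r (L d) E ⟩
    L d * D                         ≤⟨ L-small d ⟩
    R * D + d                       ≤⟨ +-monoˡ-≤ d (≤-trans (≤-reflexive (*-comm R D)) h) ⟩
    d + d                           ≡⟨ cong (d +_) (+-identityʳ d) ⟨
    2 * d                           ∎)
    where
    open ≤-Reasoning
    lem : ∀ r L E → 2 * (2 * (r * (L * E))) ≡ L * (4 * r * E)
    lem = solve-∀

n≤2^n : ∀ n → n ≤ 2 ^ n
n≤2^n n = <⇒≤ (n<2^n n)

module Estimates (r R e Λ : ℕ) .{{_ : NonZero r}} .{{_ : NonZero R}} .{{_ : NonZero e}} .{{_ : NonZero Λ}} where

  E : ℕ
  E = R * e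

  instance
    E≢0 : NonZero E
    E≢0 = m*n≢0 R e

  private
    Λ-split : ∀ d N L → d ≡ N * R + L → Λ ^ (e * d) ≡ (Λ ^ N) ^ E * Λ ^ (e * L)
    Λ-split d N L d≡ = trans (cong (λ d → Λ ^ (e * d)) d≡) (trans (cong (Λ ^_) (lem e N R L)) (trans (^-distribˡ-+-* Λ (N * (R * e)) (e * L))
      (cong (_* Λ ^ (e * L)) (sym (^-*-assoc Λ N E)))))
      where
      lem : ∀ e N R L → e * (N * R + L) ≡ N * (R * e) + e * L
      lem = solve-∀

    r-split : ∀ d N L → d ≡ N * R + L → r ^ (E * d) ≡ (r ^ (N * R)) ^ E * r ^ (E * L)
    r-split d N L d≡ = trans (cong (λ d → r ^ (E * d)) d≡) (trans (cong (r ^_) (lem E (N * R) L)) (trans (^-distribˡ-+-* r (N * R * E) (E * L))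
      (cong (_* r ^ (E * L)) (sym (^-*-assoc r (N * R) E)))))
      where
      lem : ∀ E x L → E * (x + L) ≡ x * E + E * L
      lem = solve-∀

    swap-exponent : ∀ x m n → x ^ (m * n) ≡ (x ^ n) ^ m
    swap-exponent x m n = trans (cong (x ^_) (*-comm m n)) (sym (^-*-assoc x n m))

  few-blocking : ∀ d N L n g h → d ≡ N * R + L → h * Λ ^ N ≤ r ^ (N * R) * 2 ^ L → Λ ≤ r ^ R → E * (4 * g + L) ≤ d →
    n ^ E * r ^ (E * d) * 2 ^ d ≤ 2 ^ E * 2 ^ (E * d) * Λ ^ (e * d) → 2 * g * h * n ≤ 2 ^ d
  few-blocking d N L n g h d≡ hΛ Λ≤ room key = ^-cancelˡ-≤ E (≤-trans
      (*-cancelʳ-≤ _ _ (λN * rL * 2 ^ d) {{m*n≢0 (λN * rL) (2 ^ d) {{m*n≢0 λN rL {{m^n≢0 (Λ ^ N) E {{m^n≢0 Λ N}}}} {{m^n≢0 r (E * L)}}}} {{m^n≢0 2 d}}}} (begin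
    (2 * g * h * n) ^ E * (λN * rL * 2 ^ d)
      ≡⟨ cong (_* (λN * rL * 2 ^ d)) (trans (^-*-swap (2 * g * h) n E) (cong (_* n ^ E) (^-*-swap (2 * g) h E))) ⟩
    (2 * g) ^ E * h ^ E * n ^ E * (λN * rL * 2 ^ d)
      ≡⟨ lem₁ ((2 * g) ^ E) (h ^ E) (n ^ E) λN rL (2 ^ d) ⟩
    (2 * g) ^ E * (h ^ E * λN) * (n ^ E * rL * 2 ^ d)
      ≡⟨ cong (λ z → (2 * g) ^ E * z * (n ^ E * rL * 2 ^ d)) (^-*-swap h (Λ ^ N) E) ⟨
    (2 * g) ^ E * (h * Λ ^ N) ^ E * (n ^ E * rL * 2 ^ d)
      ≤⟨ *-monoˡ-≤ (n ^ E * rL * 2 ^ d) (*-monoʳ-≤ ((2 * g) ^ E) (^-monoˡ-≤ E hΛ)) ⟩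
    (2 * g) ^ E * (r ^ (N * R) * 2 ^ L) ^ E * (n ^ E * rL * 2 ^ d)
      ≡⟨ cong (λ z → (2 * g) ^ E * z * (n ^ E * rL * 2 ^ d)) (^-*-swap (r ^ (N * R)) (2 ^ L) E) ⟩
    (2 * g) ^ E * ((r ^ (N * R)) ^ E * (2 ^ L) ^ E) * (n ^ E * rL * 2 ^ d)
      ≡⟨ lem₂ ((2 * g) ^ E) ((r ^ (N * R)) ^ E) ((2 ^ L) ^ E) (n ^ E) rL (2 ^ d) ⟩
    (2 * g) ^ E * (2 ^ L) ^ E * (n ^ E * ((r ^ (N * R)) ^ E * rL) * 2 ^ d)
      ≡⟨ cong (λ z → (2 * g) ^ E * (2 ^ L) ^ E * (n ^ E * z * 2 ^ d)) (r-split d N L d≡) ⟨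
    (2 * g) ^ E * (2 ^ L) ^ E * (n ^ E * r ^ (E * d) * 2 ^ d)
      ≤⟨ *-monoʳ-≤ ((2 * g) ^ E * (2 ^ L) ^ E) key ⟩
    (2 * g) ^ E * (2 ^ L) ^ E * (2 ^ E * 2 ^ (E * d) * Λ ^ (e * d))
      ≤⟨ *-monoʳ-≤ ((2 * g) ^ E * (2 ^ L) ^ E) (*-monoʳ-≤ (2 ^ E * 2 ^ (E * d)) (≤-trans (≤-reflexive (Λ-split d N L d≡)) (*-monoʳ-≤ λN Λ≤rL))) ⟩
    (2 * g) ^ E * (2 ^ L) ^ E * (2 ^ E * 2 ^ (E * d) * (λN * rL))
      ≡⟨ lem₃ ((2 * g) ^ E) ((2 ^ L) ^ E) (2 ^ E) (2 ^ (E * d)) (λN * rL) ⟩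
    (2 * g) ^ E * (2 ^ L) ^ E * 2 ^ E * (2 ^ (E * d) * (λN * rL))
      ≤⟨ *-monoˡ-≤ (2 ^ (E * d) * (λN * rL)) constants ⟩
    2 ^ d * (2 ^ (E * d) * (λN * rL))
      ≡⟨ lem₄ (2 ^ d) (2 ^ (E * d)) (λN * rL) ⟩
    2 ^ (E * d) * (λN * rL * 2 ^ d) ∎)) (≤-reflexive (swap-exponent 2 E d)))
    where
    open ≤-Reasoning
    λN = (Λ ^ N) ^ E
    rL = r ^ (E * L)
    lem₁ : ∀ g h n l r z → g * h * n * (l * r * z) ≡ g * (h * l) * (n * r * z)
    lem₁ = solve-∀
    lem₂ : ∀ g x y n r z → g * (x * y) * (n * r * z) ≡ g * y * (n * (x * r) * z)
    lem₂ = solve-∀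
    lem₃ : ∀ g y w z l → g * y * (w * z * l) ≡ g * y * w * (z * l)
    lem₃ = solve-∀
    lem₄ : ∀ x y z → x * (y * z) ≡ y * (z * x)
    lem₄ = solve-∀
    Λ≤rL : Λ ^ (e * L) ≤ rL
    Λ≤rL = ≤-trans (^-monoˡ-≤ (e * L) Λ≤) (≤-reflexive (trans (^-*-assoc r R (e * L)) (cong (r ^_) (sym (*-assoc R e L)))))
    constants : (2 * g) ^ E * (2 ^ L) ^ E * 2 ^ E ≤ 2 ^ d
    constants = begin
      (2 * g) ^ E * (2 ^ L) ^ E * 2 ^ E      ≡⟨ trans (^-*-swap (2 * g * 2 ^ L) 2 E) (cong (_* 2 ^ E) (^-*-swap (2 * g) (2 ^ L) E)) ⟨
      (2 * g * 2 ^ L * 2) ^ E                ≤⟨ ^-monoˡ-≤ E (≤-trans (≤-reflexive (lem₅ g (2 ^ L))) (≤-trans (*-monoˡ-≤ (2 ^ L) (n≤2^n (4 * g))) (≤-reflexive (sym (^-distribˡ-+-* 2 (4 * g) L))))) ⟩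
      (2 ^ (4 * g + L)) ^ E                  ≡⟨ swap-exponent 2 E (4 * g + L) ⟨
      2 ^ (E * (4 * g + L))                  ≤⟨ ^-monoʳ-≤ 2 room ⟩
      2 ^ d                                  ∎
      where
      lem₅ : ∀ g y → 2 * g * y * 2 ≡ 4 * g * y
      lem₅ = solve-∀

  many-in-halfspace : ∀ d N L n Z → d ≡ N * R + L → (4 * r * Z) ^ (2 * E) ≤ 2 ^ d → 2 * (r * (L * E)) ≤ d →
    2 ^ (E * d) * Λ ^ (e * d) * 2 ^ d ≤ (2 * n) ^ E * r ^ (E * d) → Z * 2 ^ d * (2 * r * (Λ ^ N * r ^ L)) ≤ n * r ^ d
  many-in-halfspace d N L n Z d≡ Z≤ room key = begin
      Z * 2 ^ d * (2 * r * (Λ ^ N * r ^ L))     ≡⟨ lem₀ Z (2 ^ d) r (Λ ^ N) (r ^ L) ⟩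
      (Z * 2 ^ d * (2 * r) * Λ ^ N) * r ^ L     ≤⟨ *-monoˡ-≤ (r ^ L) (^-cancelˡ-≤ E powers) ⟩
      n * r ^ (N * R) * r ^ L                   ≡⟨ trans (*-assoc n (r ^ (N * R)) (r ^ L)) (cong (n *_) (trans (sym (^-distribˡ-+-* r (N * R) L)) (cong (r ^_) (sym d≡)))) ⟩
      n * r ^ d                                 ∎
    where
    open ≤-Reasoning
    lem₀ : ∀ Z p r l q → Z * p * (2 * r * (l * q)) ≡ (Z * p * (2 * r) * l) * q
    lem₀ = solve-∀
    rL = r ^ (E * L)
    λN = (Λ ^ N) ^ E
    constants : (4 * r * Z) ^ E * rL ≤ 2 ^ d
    constants = ^-cancelˡ-≤ 2 (begin
      ((4 * r * Z) ^ E * rL) ^ 2              ≡⟨ ^-*-swap ((4 * r * Z) ^ E) rL 2 ⟩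
      ((4 * r * Z) ^ E) ^ 2 * rL ^ 2          ≡⟨ cong₂ _*_ (sym (swap-exponent (4 * r * Z) 2 E)) (^-*-assoc r (E * L) 2) ⟩
      (4 * r * Z) ^ (2 * E) * r ^ (E * L * 2) ≤⟨ *-mono-≤ Z≤ (≤-trans (^-monoˡ-≤ (E * L * 2) (n≤2^n r)) (≤-trans (≤-reflexive (trans (^-*-assoc 2 r (E * L * 2)) (cong (2 ^_) (lem r E L)))) (^-monoʳ-≤ 2 room))) ⟩
      2 ^ d * 2 ^ d                           ≡⟨ cong (2 ^ d *_) (*-identityʳ (2 ^ d)) ⟨
      (2 ^ d) ^ 2                             ∎)
      where
      lem : ∀ r E L → r * (E * L * 2) ≡ 2 * (r * (L * E))
      lem = solve-∀
    powers : (Z * 2 ^ d * (2 * r) * Λ ^ N) ^ E ≤ (n * r ^ (N * R)) ^ E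
    powers = *-cancelʳ-≤ _ _ (2 ^ E * rL) {{m*n≢0 (2 ^ E) rL {{m^n≢0 2 E}} {{m^n≢0 r (E * L)}}}} (begin
      (Z * 2 ^ d * (2 * r) * Λ ^ N) ^ E * (2 ^ E * rL)
        ≡⟨ cong (_* (2 ^ E * rL)) (trans (^-*-swap (Z * 2 ^ d * (2 * r)) (Λ ^ N) E) (cong (_* λN) (trans (^-*-swap (Z * 2 ^ d) (2 * r) E) (cong (_* (2 * r) ^ E) (^-*-swap Z (2 ^ d) E))))) ⟩
      Z ^ E * (2 ^ d) ^ E * (2 * r) ^ E * λN * (2 ^ E * rL)
        ≡⟨ lem₁ (Z ^ E) ((2 ^ d) ^ E) ((2 * r) ^ E) λN (2 ^ E) rL ⟩
      (2 ^ E * (2 * r) ^ E * Z ^ E) * rL * ((2 ^ d) ^ E * λN)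
        ≡⟨ cong (λ z → z * rL * ((2 ^ d) ^ E * λN)) (trans (cong (_^ E) (lem₂ r Z)) (trans (^-*-swap (2 * (2 * r)) Z E) (cong (_* Z ^ E) (^-*-swap 2 (2 * r) E)))) ⟨
      (4 * r * Z) ^ E * rL * ((2 ^ d) ^ E * λN)
        ≤⟨ *-monoˡ-≤ ((2 ^ d) ^ E * λN) constants ⟩
      2 ^ d * ((2 ^ d) ^ E * λN)
        ≤⟨ *-monoʳ-≤ (2 ^ d) (*-mono-≤ (≤-reflexive (sym (swap-exponent 2 E d))) (≤-trans (≤-trans (≤-reflexive (sym (*-identityʳ λN))) (*-monoʳ-≤ λN (>-nonZero⁻¹ (Λ ^ (e * L)) {{m^n≢0 Λ (e * L)}}))) (≤-reflexive (sym (Λ-split d N L d≡))))) ⟩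
      2 ^ d * (2 ^ (E * d) * Λ ^ (e * d))
        ≡⟨ *-comm (2 ^ d) _ ⟩
      2 ^ (E * d) * Λ ^ (e * d) * 2 ^ d
        ≤⟨ key ⟩
      (2 * n) ^ E * r ^ (E * d)
        ≡⟨ cong₂ _*_ (^-*-swap 2 n E) (r-split d N L d≡) ⟩
      2 ^ E * n ^ E * ((r ^ (N * R)) ^ E * rL)
        ≡⟨ lem₃ (2 ^ E) (n ^ E) ((r ^ (N * R)) ^ E) rL ⟩
      n ^ E * (r ^ (N * R)) ^ E * (2 ^ E * rL)
        ≡⟨ cong (_* (2 ^ E * rL)) (^-*-swap n (r ^ (N * R)) E) ⟨
      (n * r ^ (N * R)) ^ E * (2 ^ E * rL) ∎)
      where
      lem₁ : ∀ z p q l t u → z * p * q * l * (t * u) ≡ (t * q * z) * u * (p * l)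
      lem₁ = solve-∀
      lem₂ : ∀ r Z → 4 * r * Z ≡ 2 * (2 * r) * Z
      lem₂ = solve-∀
      lem₃ : ∀ a b c d → a * b * (c * d) ≡ b * c * (a * d)
      lem₃ = solve-∀

-- An m-subset of an M-set almost surely meets a fixed set of a₀ − r points, even summed over all halfspaces.
module Avoidance (r d m M g V W : ℕ) .{{_ : NonZero V}} .{{_ : NonZero r}} (2^d≡ : 2 ^ d ≡ r + M) .{{_ : NonZero M}} where

  s Z a₀ : ℕ
  s  = suc d * suc d + 2 * g
  Z  = 16 * s + 2 * r
  a₀ = W / V

  private
    instance
      s≢0 : NonZero s
      s≢0 = _

  avoidance : r + m ≤ 2 ^ d → W ≤ V * 2 ^ d → Z * 2 ^ d * V ≤ (r + m) * W →
    2 * g * (suc (2 ^ d) ^ suc d * ((2 ^ d ∸ a₀) C m)) ≤ M C m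
  avoidance n≤ W≤ large = begin
      2 * g * (suc (2 ^ d) ^ suc d * (b C m))     ≡⟨ *-assoc (2 * g) (suc (2 ^ d) ^ suc d) (b C m) ⟨
      2 * g * suc (2 ^ d) ^ suc d * (b C m)       ≤⟨ *-monoˡ-≤ (b C m) keys≤ ⟩
      2 ^ s * (b C m)                             ≤⟨ C-decay b a q s m {{subst NonZero (sym b+a≡) it}} (≤-trans (≤-reflexive b+a≡) (≤-trans (≤-trans (m≤n+m M r) (≤-reflexive (sym 2^d≡))) 2^d≤qa)) (≤-trans (≤-reflexive (*-comm s q)) (m/n*n≤m m s)) ⟩
      (b + a) C m                                 ≡⟨ cong (_C m) b+a≡ ⟩
      M C m                                       ∎
    where
    open ≤-Reasoning
    n = r + m
    b = 2 ^ d ∸ a₀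
    a = a₀ ∸ r
    q = m / s
    Z≤n : Z ≤ n
    Z≤n = *-cancelʳ-≤ Z n (V * 2 ^ d) {{m*n≢0 V (2 ^ d) {{it}} {{m^n≢0 2 d}}}} (≤-trans (≤-reflexive (lem Z (2 ^ d) V)) (≤-trans large (*-monoʳ-≤ n W≤)))
      where
      lem : ∀ Z p V → Z * (V * p) ≡ Z * p * V
      lem = solve-∀
    Z≤a₀ : Z ≤ a₀
    Z≤a₀ = ≤-trans (≤-reflexive (sym (m*n/n≡m Z V))) (/-monoˡ-≤ V (*-cancelˡ-≤ (2 ^ d) {{m^n≢0 2 d}}
      (≤-trans (≤-reflexive (lem Z (2 ^ d) V)) (≤-trans large (*-monoˡ-≤ W n≤)))))
      where
      lem : ∀ Z p V → p * (Z * V) ≡ Z * p * V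
      lem = solve-∀
    a₀≤2^d : a₀ ≤ 2 ^ d
    a₀≤2^d = ≤-trans (/-monoˡ-≤ V W≤) (≤-reflexive (trans (cong (_/ V) (*-comm V (2 ^ d))) (m*n/n≡m (2 ^ d) V)))
    2r≤Z : 2 * r ≤ Z
    2r≤Z = m≤n+m (2 * r) (16 * s)
    r≤a₀ : r ≤ a₀
    r≤a₀ = ≤-trans (m≤n*m r 2) (≤-trans 2r≤Z Z≤a₀)
    b+a≡ : b + a ≡ M
    b+a≡ = +-cancelˡ-≡ r (b + a) M (trans (lem r b a) (trans (cong (b +_) (m+[n∸m]≡n r≤a₀)) (trans (m∸n+n≡m a₀≤2^d) 2^d≡)))
      where
      lem : ∀ r b a → r + (b + a) ≡ b + (r + a)
      lem = solve-∀
    a₀≤2a : a₀ ≤ 2 * a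
    a₀≤2a = +-cancelˡ-≤ a₀ _ _ (begin
      a₀ + a₀                ≡⟨ cong₂ _+_ (sym (m+[n∸m]≡n r≤a₀)) (sym (m+[n∸m]≡n r≤a₀)) ⟩
      r + a + (r + a)        ≡⟨ lem r a ⟩
      2 * r + 2 * a          ≤⟨ +-monoˡ-≤ (2 * a) (≤-trans 2r≤Z Z≤a₀) ⟩
      a₀ + 2 * a             ∎)
      where
      lem : ∀ r a → r + a + (r + a) ≡ 2 * r + 2 * a
      lem = solve-∀
    n≤2m : n ≤ 2 * m
    n≤2m = +-cancelˡ-≤ n _ _ (begin
      n + n                  ≡⟨ lem r m ⟩
      2 * r + 2 * m          ≤⟨ +-monoˡ-≤ (2 * m) (≤-trans 2r≤Z Z≤n) ⟩
      n + 2 * m              ∎)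
      where
      lem : ∀ r m → r + m + (r + m) ≡ 2 * r + 2 * m
      lem = solve-∀
    2s≤m : 2 * s ≤ m
    2s≤m = *-cancelˡ-≤ 2 (≤-trans (≤-trans (m≤m+n (2 * (2 * s)) (12 * s + 2 * r)) (≤-reflexive (lem s r))) (≤-trans Z≤n n≤2m))
      where
      lem : ∀ s r → 2 * (2 * s) + (12 * s + 2 * r) ≡ 16 * s + 2 * r
      lem = solve-∀
    m≤2qs : m ≤ 2 * (q * s)
    m≤2qs = +-cancelˡ-≤ m _ _ (begin
      m + m                          ≡⟨ cong (m +_) (+-identityʳ m) ⟨
      2 * m                          ≤⟨ *-monoʳ-≤ 2 (<⇒≤ (m<n+[m/n]*n m s)) ⟩
      2 * (s + q * s)                ≡⟨ *-distribˡ-+ 2 s (q * s) ⟩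
      2 * s + 2 * (q * s)            ≤⟨ +-monoˡ-≤ (2 * (q * s)) 2s≤m ⟩
      m + 2 * (q * s)                ∎)
    W≤2a₀V : W ≤ 2 * a₀ * V
    W≤2a₀V = begin
      W                    ≤⟨ <⇒≤ (m<n+[m/n]*n W V) ⟩
      V + a₀ * V           ≤⟨ +-monoˡ-≤ (a₀ * V) (≤-trans (≤-reflexive (sym (*-identityˡ V))) (*-monoˡ-≤ V (≤-trans (>-nonZero⁻¹ r) r≤a₀))) ⟩
      a₀ * V + a₀ * V      ≡⟨ lem a₀ V ⟩
      2 * a₀ * V           ∎
      where
      lem : ∀ a V → a * V + a * V ≡ 2 * a * V
      lem = solve-∀
    2^d≤qa : 2 ^ d ≤ q * a
    2^d≤qa = *-cancelˡ-≤ (16 * s) {{m*n≢0 16 s}} (*-cancelʳ-≤ _ _ V (begin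
      16 * s * 2 ^ d * V                  ≤⟨ *-monoˡ-≤ V (*-monoˡ-≤ (2 ^ d) (m≤m+n (16 * s) (2 * r))) ⟩
      Z * 2 ^ d * V                       ≤⟨ large ⟩
      n * W                               ≤⟨ *-mono-≤ (≤-trans n≤2m (*-monoʳ-≤ 2 m≤2qs)) W≤2a₀V ⟩
      2 * (2 * (q * s)) * (2 * a₀ * V)    ≤⟨ *-monoʳ-≤ (2 * (2 * (q * s))) (*-monoˡ-≤ V (*-monoʳ-≤ 2 a₀≤2a)) ⟩
      2 * (2 * (q * s)) * (2 * (2 * a) * V)   ≡⟨ lem q s a V ⟩
      16 * s * (q * a) * V                ∎))
      where
      lem : ∀ q s a V → 2 * (2 * (q * s)) * (2 * (2 * a) * V) ≡ 16 * s * (q * a) * V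
      lem = solve-∀
    keys≤ : 2 * g * suc (2 ^ d) ^ suc d ≤ 2 ^ s
    keys≤ = begin
      2 * g * suc (2 ^ d) ^ suc d                ≤⟨ *-mono-≤ (n≤2^n (2 * g)) (^-monoˡ-≤ (suc d) (≤-trans (+-monoˡ-≤ (2 ^ d) (>-nonZero⁻¹ (2 ^ d) {{m^n≢0 2 d}})) (≤-reflexive (cong (2 ^ d +_) (sym (+-identityʳ (2 ^ d))))))) ⟩
      2 ^ (2 * g) * (2 ^ suc d) ^ suc d          ≡⟨ cong (2 ^ (2 * g) *_) (^-*-assoc 2 (suc d) (suc d)) ⟩
      2 ^ (2 * g) * 2 ^ (suc d * suc d)          ≡⟨ *-comm (2 ^ (2 * g)) _ ⟩
      2 ^ (suc d * suc d) * 2 ^ (2 * g)          ≡⟨ ^-distribˡ-+-* 2 (suc d * suc d) (2 * g) ⟨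
      2 ^ s                                      ∎

Z-polynomial : ∀ r g d → 256 * r + 128 * r * g + 8 * r * r ≤ d → 1 ≤ d → 4 * r * (16 * (suc d * suc d + 2 * g) + 2 * r) ≤ d ^ 3
Z-polynomial r g d h 1≤d = begin
  4 * r * (16 * (suc d * suc d + 2 * g) + 2 * r)          ≤⟨ *-monoʳ-≤ (4 * r) (+-monoˡ-≤ (2 * r) (*-monoʳ-≤ 16 (+-monoˡ-≤ (2 * g) (*-mono-≤ 1+d≤2d 1+d≤2d)))) ⟩
  4 * r * (16 * (2 * d * (2 * d) + 2 * g) + 2 * r)        ≡⟨ lem₁ r g d ⟩
  256 * r * (d * d) + (128 * r * g + 8 * r * r) * 1       ≤⟨ +-monoʳ-≤ (256 * r * (d * d)) (*-monoʳ-≤ (128 * r * g + 8 * r * r) (*-mono-≤ 1≤d 1≤d)) ⟩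
  256 * r * (d * d) + (128 * r * g + 8 * r * r) * (d * d) ≡⟨ lem₂ r g (d * d) ⟩
  (256 * r + 128 * r * g + 8 * r * r) * (d * d)           ≤⟨ *-monoˡ-≤ (d * d) h ⟩
  d * (d * d)                                             ≡⟨ cong (λ z → d * (d * z)) (*-identityʳ d) ⟨
  d ^ 3                                                   ∎
  where
  open ≤-Reasoning
  1+d≤2d : suc d ≤ 2 * d
  1+d≤2d = ≤-trans (+-monoˡ-≤ d 1≤d) (≤-reflexive (cong (d +_) (sym (+-identityʳ d))))
  lem₁ : ∀ r g d → 4 * r * (16 * (2 * d * (2 * d) + 2 * g) + 2 * r) ≡ 256 * r * (d * d) + (128 * r * g + 8 * r * r) * 1
  lem₁ = solve-∀
  lem₂ : ∀ r g x → 256 * r * x + (128 * r * g + 8 * r * r) * x ≡ (256 * r + 128 * r * g + 8 * r * r) * x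
  lem₂ = solve-∀

module Constants (k e : ℕ) .{{e≢0 : NonZero e}} where

  open Columns k public using (r; Λ; entry; R′; R≡)

  R : ℕ
  R = 2 ^ r

  instance
    R≢0 : NonZero R
    R≢0 = m^n≢0 2 r

    Λ≢0 : NonZero Λ
    Λ≢0 = product≢0 (All.map⁺ {f = entry} (All.++⁺ (All.map⁺ (All.universal (λ t → _) (subsets k)))
      (All.map⁺ (All.universal (λ t → >-nonZero (m<n⇒0<n∸m (s≤s (∣p∣≤n t)))) (subsets k)))))

  open Estimates r R e Λ public
  open Parameters r R E public

  Λ≤r^R : Λ ≤ r ^ R
  Λ≤r^R = ≤-trans (bounded (profiles k) (All.++⁺ (All.map⁺ (All.universal (λ t → s≤s (∣p∣≤n t)) (subsets k)))
      (All.map⁺ (All.universal (λ t → m∸n≤m r (card t)) (subsets k)))))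
    (≤-reflexive (cong (r ^_) (trans (length-++ (map (λ t → inside , suc (card t)) (subsets k)))
      (trans (cong₂ _+_ (trans (length-map _ (subsets k)) (length-subsets k)) (trans (length-map _ (subsets k)) (length-subsets k)))
        (cong (2 ^ k +_) (sym (+-identityʳ (2 ^ k))))))))
    where
    bounded : ∀ ps → All (λ p → entry p ≤ r) ps → product (map entry ps) ≤ r ^ length ps
    bounded []       []       = ≤-refl
    bounded (p ∷ ps) (h ∷ hs) = *-mono-≤ h (bounded ps hs)

  atypicality : ℕ
  atypicality = 3 * (R * (D * D * R′)) * r ^ r

  threshold : ℕ → ℕ
  threshold g = 2 * R ⊔ (suc r ⊔ ((16 * r * g * E + 4 * r * E * R) ⊔ ((256 * r + 128 * r * g + 8 * r * r) ⊔
    (2 * g * atypicality ⊔ proj₁ (polynomial≤exponential (3 * (2 * E)))))))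

  module Large (g d : ℕ) (t≤d : threshold g ≤ d) where

    private
      q₃ = 16 * r * g * E + 4 * r * E * R
      q₄ = 256 * r + 128 * r * g + 8 * r * r
      q₅ = 2 * g * atypicality
      q₆ = proj₁ (polynomial≤exponential (3 * (2 * E)))
      t₂ : suc r ⊔ (q₃ ⊔ (q₄ ⊔ (q₅ ⊔ q₆))) ≤ d
      t₂ = m⊔n≤o⇒n≤o (2 * R) (suc r ⊔ (q₃ ⊔ (q₄ ⊔ (q₅ ⊔ q₆)))) t≤d
      t₃ : q₃ ⊔ (q₄ ⊔ (q₅ ⊔ q₆)) ≤ d
      t₃ = m⊔n≤o⇒n≤o (suc r) (q₃ ⊔ (q₄ ⊔ (q₅ ⊔ q₆))) t₂
      t₄ : q₄ ⊔ (q₅ ⊔ q₆) ≤ d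
      t₄ = m⊔n≤o⇒n≤o q₃ (q₄ ⊔ (q₅ ⊔ q₆)) t₃
      t₅ : q₅ ⊔ q₆ ≤ d
      t₅ = m⊔n≤o⇒n≤o q₄ (q₅ ⊔ q₆) t₄

    N≢0 : NonZero (N d)
    N≢0 = N≥1 d (m⊔n≤o⇒m≤o (2 * R) (suc r ⊔ (q₃ ⊔ (q₄ ⊔ (q₅ ⊔ q₆)))) t≤d)

    r<d : r < d
    r<d = m⊔n≤o⇒m≤o (suc r) (q₃ ⊔ (q₄ ⊔ (q₅ ⊔ q₆))) t₂

    1≤d : 1 ≤ d
    1≤d = ≤-trans (s≤s z≤n) r<d

    room : 16 * r * g * E + 4 * r * E * R ≤ d
    room = m⊔n≤o⇒m≤o q₃ (q₄ ⊔ (q₅ ⊔ q₆)) t₃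

    rare : 2 * g * atypicality ≤ d
    rare = m⊔n≤o⇒m≤o q₅ q₆ t₅

    Z-bound : (4 * r * (16 * (suc d * suc d + 2 * g) + 2 * r)) ^ (2 * E) ≤ 2 ^ d
    Z-bound = ≤-trans (^-monoˡ-≤ (2 * E) (Z-polynomial r g d (m⊔n≤o⇒m≤o q₄ (q₅ ⊔ q₆) t₄) 1≤d))
      (≤-trans (≤-reflexive (^-*-assoc d 3 (2 * E))) (proj₂ (polynomial≤exponential (3 * (2 * E))) d (m⊔n≤o⇒n≤o q₅ q₆ t₅)))

module Bounds (k e g d : ℕ) .{{e≢0 : NonZero e}} (t≤d : Constants.threshold k e g ≤ d)
  (v : Fin (2 ^ d) → Fin d → ℚ) (v≡bit : ∀ i j → v i j ≡ bitℚ (lookup (bits {d} i) j)) (convex : ConvexPosition v) where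

  open Constants k e
  open Large g d t≤d
  open Columns k using (matrices; good?; Typical; typical?; bad-rare; atypical-rare)
  open FixedDimension {d} v v≡bit convex k (N d) {{N≢0}}
  open Cube {d} v v≡bit

  module _ (F? : ∀ W T → Dec (KFace {d} v k W T)) (m M : ℕ) (2^d≡ : 2 ^ d ≡ r + M) (n≤ : r + m ≤ 2 ^ d) where

    private
      n = r + m
      S = subsets (2 ^ d)
      f = λ W → count (F? W) S
      X = (2 ^ d) C r
      Π = X * (M C m)

      M≢0 : NonZero M
      M≢0 = ≢-nonZero λ { refl → <-irrefl refl (<-trans (≤-<-trans (≤-reflexive (trans 2^d≡ (+-identityʳ r))) r<d) (n<2^n d)) }

      few-bad : 2 * g * badSets ≤ X
      few-bad = *-cancelʳ-≤ _ _ d {{>-nonZero 1≤d}} (begin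
        2 * g * badSets * d                                    ≡⟨ *-assoc (2 * g) badSets d ⟩
        2 * g * (badSets * d)                                  ≤⟨ *-monoʳ-≤ (2 * g) (*-monoˡ-≤ d (≤-trans badSets≤ (bad-rare (N d) d))) ⟩
        2 * g * (3 * atyp * d)                                 ≡⟨ cong (2 * g *_) (*-assoc 3 atyp d) ⟩
        2 * g * (3 * (atyp * d))                               ≤⟨ *-monoʳ-≤ (2 * g) (*-monoʳ-≤ 3 (atypical-rare (N d) d D
                                                                   (subst (λ R → R * N d * D + d ≤ d * D) (sym R≡) (N-small d)) {{>-nonZero 1≤d}})) ⟩
        2 * g * (3 * (suc R′ * (D * D * R′) * suc R′ ^ d))     ≡⟨ cong₂ (λ a b → 2 * g * (3 * (a * (D * D * R′) * b))) R≡ (trans (cong (_^ d) R≡) exchange) ⟩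
        2 * g * (3 * (R * (D * D * R′) * (2 ^ d) ^ r))         ≤⟨ *-monoʳ-≤ (2 * g) (*-monoʳ-≤ 3 (*-monoʳ-≤ (R * (D * D * R′)) (C-lower r (2 ^ d) (≤-trans (m≤m+n r m) n≤)))) ⟩
        2 * g * (3 * (R * (D * D * R′) * (r ^ r * X)))         ≡⟨ lem g (R * (D * D * R′)) (r ^ r) X ⟩
        2 * g * atypicality * X                                ≤⟨ *-monoˡ-≤ X rare ⟩
        d * X                                                  ≡⟨ *-comm d X ⟩
        X * d                                                  ∎)
        where
        open ≤-Reasoning
        atyp = count (λ X → ¬? (typical? (N d) X)) (matrices (N d) d)
        exchange : (2 ^ r) ^ d ≡ (2 ^ d) ^ r
        exchange = trans (^-*-assoc 2 r d) (trans (cong (2 ^_) (*-comm r d)) (sym (^-*-assoc 2 d r)))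
        lem : ∀ g a b X → 2 * g * (3 * (a * (b * X))) ≡ 2 * g * (3 * a * b) * X
        lem = solve-∀

      combine : ∀ Y → 2 * g * Y ≤ M C m → g * (badSets * (M C m) + X * Y) ≤ Π
      combine Y gY = *-cancelˡ-≤ 2 (begin
        2 * (g * (badSets * (M C m) + X * Y))                  ≡⟨ lem g badSets (M C m) X Y ⟩
        2 * g * badSets * (M C m) + X * (2 * g * Y)            ≤⟨ +-mono-≤ (*-monoˡ-≤ (M C m) few-bad) (*-monoʳ-≤ X gY) ⟩
        Π + Π                                                  ≡⟨ cong (Π +_) (+-identityʳ Π) ⟨
        2 * Π                                                  ∎)
        where
        open ≤-Reasoning
        lem : ∀ g b c X Y → 2 * (g * (b * c + X * Y)) ≡ 2 * g * b * c + X * (2 * g * Y)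
        lem = solve-∀

    low : n ^ E * r ^ (E * d) * 2 ^ d ≤ 2 ^ E * 2 ^ (E * d) * Λ ^ (e * d) → g * Π ≤ g * ∑ (Ws F? m M 2^d≡) f + Π
    low key = ≤-trans (*-monoʳ-≤ g (∑-kfaces≥ F? m M 2^d≡ Y Y-bound)) (≤-trans (≤-reflexive (*-distribˡ-+ g (∑ (Ws F? m M 2^d≡) f) _))
        (+-monoʳ-≤ (g * ∑ (Ws F? m M 2^d≡) f) (combine Y Y-small)))
      where
      open ≤-Reasoning
      -- suc (2 * g ∸ 1) is 2g, or 1 if g = 0.
      Y = (M C m) / suc (2 * g ∸ 1)
      Y-small : 2 * g * Y ≤ M C m
      Y-small = ≤-trans (*-monoˡ-≤ Y (m≤n+m∸n (2 * g) 1)) (≤-trans (≤-reflexive (*-comm (suc (2 * g ∸ 1)) Y)) (m/n*n≤m (M C m) (suc (2 * g ∸ 1))))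
      Y-bound : ∀ T → GoodSet T → count (λ W → (T ⊆? W ×-dec card W ≟ n) ×-dec ¬? (face? convex T W)) S ≤ Y
      Y-bound T good = bound (count-nonfaces≤ F? m M 2^d≡ T good)
        where
        c = count (λ W → (T ⊆? W ×-dec card W ≟ n) ×-dec ¬? (face? convex T W)) S
        bound : (∃ λ h → h * Λ ^ N d ≤ r ^ (N d * R) * 2 ^ (d ∸ N d * R) × M * c ≤ h * (m * (M C m))) → c ≤ Y
        bound (h , hΛ , Mc) = ≤-trans (≤-reflexive (sym (m*n/n≡m c (suc (2 * g ∸ 1))))) (/-monoˡ-≤ (suc (2 * g ∸ 1)) (c-small (2 * g) refl))
          where
          blocking : 2 * g * h * n ≤ 2 ^ d
          blocking = few-blocking d (N d) (L d) n g h (split d) hΛ Λ≤r^R (subcritical-room g d room) key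
          c*2g : M * (c * (2 * g)) ≤ M * (M C m)
          c*2g = begin
            M * (c * (2 * g))                 ≡⟨ lem M c (2 * g) ⟩
            2 * g * (M * c)                   ≤⟨ *-monoʳ-≤ (2 * g) Mc ⟩
            2 * g * (h * (m * (M C m)))       ≡⟨ lem₂ (2 * g) h m (M C m) ⟩
            2 * g * h * m * (M C m)           ≤⟨ *-monoˡ-≤ (M C m) (drop (2 * g * h) (≤-trans blocking (≤-reflexive 2^d≡))) ⟩
            M * (M C m)                       ∎
            where
            lem : ∀ M c g → M * (c * g) ≡ g * (M * c)
            lem = solve-∀
            lem₂ : ∀ g h m c → g * (h * (m * c)) ≡ g * h * m * c
            lem₂ = solve-∀
            drop : ∀ x → x * (r + m) ≤ r + M → x * m ≤ M
            drop zero    _  = z≤n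
            drop (suc x) le = +-cancelˡ-≤ r _ _ (≤-trans (+-monoˡ-≤ (suc x * m) (m≤n*m r (suc x))) (≤-trans (≤-reflexive (sym (*-distribˡ-+ (suc x) r m))) le))
          c≤ : c ≤ M C m
          c≤ = ≤-trans (count-mono _ (λ W → T ⊆? W ×-dec card W ≟ card T + m) S λ W ((a , b) , _) → (λ {i} → a {i}) , trans b (cong (_+ m) (sym (proj₁ good))))
            (≤-reflexive (count-supersets T M m (trans 2^d≡ (cong (_+ M) (sym (proj₁ good))))))
          c-small : ∀ x → x ≡ 2 * g → c * suc (x ∸ 1) ≤ M C m
          c-small zero    eq = ≤-trans (≤-reflexive (*-identityʳ c)) c≤
          c-small (suc x) eq = *-cancelˡ-≤ M {{M≢0}} (≤-trans (≤-reflexive (cong (λ z → M * (c * z)) eq)) c*2g)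

    high : 2 ^ (E * d) * Λ ^ (e * d) * 2 ^ d ≤ (2 * n) ^ E * r ^ (E * d) → g * ∑ (Ws F? m M 2^d≡) f ≤ Π
    high key = decide (r ^ d ≤? V * 2 ^ d)
      where
      open ≤-Reasoning
      V = 2 * r * (Λ ^ N d * r ^ L d)
      instance
        V≢0 : NonZero V
        V≢0 = m*n≢0 (2 * r) (Λ ^ N d * r ^ L d) {{_}} {{m*n≢0 (Λ ^ N d) (r ^ L d) {{m^n≢0 Λ (N d)}} {{m^n≢0 r (L d)}}}}
      halfspace≥ : ∀ T → GoodSet T → ∀ b c → (∀ i → i ∈ T → slack v b c i ≡ 0ℚ) → r ^ d ≤ card (halfspace b c) * V
      halfspace≥ T (card≡ , good) b c tight = ≤-trans (halfspace-large k (N d) T card≡ good b c tight)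
        (≤-reflexive (lem r (card (halfspace b c)) (Λ ^ N d * r ^ L d)))
        where
        lem : ∀ r c x → 2 * (r * (c * x)) ≡ c * (2 * r * x)
        lem = solve-∀
      decide : Dec (r ^ d ≤ V * 2 ^ d) → g * ∑ (Ws F? m M 2^d≡) f ≤ Π
      decide (no ≰) = ≤-trans (*-monoʳ-≤ g (∑-kfaces≤ F? m M 2^d≡ 0 λ T good → ≤-reflexive (count-none _ S λ W (face , _) → impossible T good face)))
          (combine 0 (≤-trans (≤-reflexive (*-zeroʳ (2 * g))) z≤n))
        where
        impossible : ∀ T → GoodSet T → ∀ {W} → ¬ Face T W
        impossible T good (T⊆W , face) = ≰ (≤-trans (halfspace≥ T good b c tight) (≤-trans (*-monoˡ-≤ V (∣p∣≤n (halfspace b c))) (≤-reflexive (*-comm (2 ^ d) V))))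
          where open Exposing (isFace⇒exposing v convex T⊆W face)
      decide (yes le) = ≤-trans (*-monoʳ-≤ g (∑-kfaces≤ F? m M 2^d≡ Y λ T good → count-faces≤ convex T m (2 ^ d ∸ a₀) λ b c tight →
            ≤-trans (≤-reflexive (∣∁p∣≡n∸∣p∣ (halfspace b c))) (∸-monoʳ-≤ (2 ^ d)
              (≤-trans (/-monoˡ-≤ V (halfspace≥ T good b c tight)) (≤-reflexive (m*n/n≡m (card (halfspace b c)) V))))))
          (combine Y (avoidance n≤ le (many-in-halfspace d (N d) (L d) n Z (split d) Z-bound
            (supercritical-room d (≤-trans (m≤n+m (4 * r * E * R) (16 * r * g * E)) room)) key)))
        where
        open Avoidance r d m M g V (r ^ d) 2^d≡ {{M≢0}}
        Y = suc (2 ^ d) ^ suc d * ((2 ^ d ∸ a₀) C m)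

C-positive : ∀ {r M} → r ≤ M → NonZero (M C r)
C-positive {zero}  {M} _   = _
C-positive {suc r} {M} r≤M = ≢-nonZero λ eq → ≢-nonZero⁻¹ (M ^ suc r) {{m^n≢0 M (suc r) {{>-nonZero (≤-trans (s≤s z≤n) r≤M)}}}}
  (n≤0⇒n≡0 (≤-trans (C-lower (suc r) M r≤M) (≤-reflexive (trans (cong (suc r ^ suc r *_) eq) (*-zeroʳ (suc r ^ suc r))))))

-- Expected densities as quotients of natural numbers

module _ {d : ℕ} (k n : ℕ) (c≢0 : NonZero (n C suc k)) where

  private
    c = fromℕℚ (n C suc k)
    total : List ℚ → ℚ
    total = foldr ℚ._+_ 0ℚ

    ratio-* : ∀ m n → NonZero n → ratio m n ℚ.* fromℕℚ n ≡ fromℕℚ m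
    ratio-* m (suc n) _ = /-* (ℤ.+ m) (suc n)

    density-sum : ∀ Ws → All (λ W → card W ≡ n) Ws → total (map (faceDensity {d} k) Ws) ℚ.* c ≡ fromℕℚ (∑ Ws (faceNumber {d} k))
    density-sum []       []         = ℚ.*-zeroˡ c
    density-sum (W ∷ Ws) (eq ∷ eqs) = trans (ℚ.*-distribʳ-+ c (faceDensity {d} k W) (total (map (faceDensity {d} k) Ws)))
      (trans (cong₂ ℚ._+_ (trans (cong (λ m → ratio (faceNumber {d} k W) (m C suc k) ℚ.* c) eq) (ratio-* (faceNumber {d} k W) (n C suc k) c≢0))
        (density-sum Ws eqs)) (sym (fromℕℚ-+ (faceNumber {d} k W) (∑ Ws (faceNumber {d} k)))))

    mean-* : ∀ qs → NonZero (length qs) → mean qs ℚ.* fromℕℚ (length qs) ≡ total qs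
    mean-* qs@(_ ∷ qs′) _ = trans (ℚ.*-assoc (total qs) _ _) (trans (cong (total qs ℚ.*_) (1/suc-* (length qs′))) (ℚ.*-identityʳ (total qs)))

  expected-* : n ≤ 2 ^ d → expectedFaceDensity d n k ℚ.* fromℕℚ (((2 ^ d) C n) * (n C suc k)) ≡
    fromℕℚ (∑ (filter (λ W → card W ≟ n) (subsets (2 ^ d))) (faceNumber {d} k))
  expected-* n≤ = trans (cong (μ ℚ.*_) (trans (fromℕℚ-* ((2 ^ d) C n) (n C suc k)) (cong (λ l → fromℕℚ l ℚ.* c) (sym len))))
      (trans (sym (ℚ.*-assoc μ (fromℕℚ (length qs)) c)) (trans (cong (ℚ._* c) (mean-* qs (subst NonZero (sym len) (C-positive n≤))))
        (density-sum Ws (All.all-filter (λ W → card W ≟ n) (subsets (2 ^ d))))))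
    where
    Ws = filter (λ W → card W ≟ n) (subsets (2 ^ d))
    qs = map (faceDensity {d} k) Ws
    μ = mean qs
    len : length qs ≡ (2 ^ d) C n
    len = trans (length-map (faceDensity {d} k) Ws) (trans (length-filter-count (λ W → card W ≟ n) (subsets (2 ^ d))) (count-card (2 ^ d) n))

quotient-bounds : ∀ {x} F Ω t .{{_ : NonZero Ω}} → x ℚ.* fromℕℚ Ω ≡ fromℕℚ F →
  (0ℚ ℚ.≤ x) × (F ≤ Ω → x ℚ.≤ 1ℚ) × (suc t * F ≤ Ω → x ℚ.≤ 1/suc t) × (suc t * Ω ≤ suc t * F + Ω → 1ℚ - x ℚ.≤ 1/suc t)
quotient-bounds {x} F Ω t eq =
    *-cancel-≤ 0<Ω (subst₂ ℚ._≤_ (sym (ℚ.*-zeroˡ ω)) (sym eq) (fromℕℚ-nonNeg F))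
  , (λ h → *-cancel-≤ 0<Ω (subst₂ ℚ._≤_ (sym eq) (sym (ℚ.*-identityˡ ω)) (fromℕℚ-mono-≤ h)))
  , (λ h → *-cancel-≤ 0<Ω (*-cancel-≤ (0<fromℕℚ (suc t)) (subst₂ ℚ._≤_
      (trans (fromℕℚ-* (suc t) F) (trans (cong (T ℚ.*_) (sym eq)) (ℚ.*-comm T (x ℚ.* ω))))
      (trans (sym (ℚ.*-identityˡ ω)) (trans (cong (ℚ._* ω) (sym (1/suc-* t))) (solve 3 (λ i T ω → i :* T :* ω := i :* ω :* T) refl (1/suc t) T ω)))
      (fromℕℚ-mono-≤ h))))
  , (λ h → *-cancel-≤ 0<Ω (*-cancel-≤ (0<fromℕℚ (suc t)) (ℚ.≤-trans
      (≤-by (≤⇒0≤- (subst₂ ℚ._≤_ (fromℕℚ-* (suc t) Ω) (trans (fromℕℚ-+ (suc t * F) Ω) (cong (ℚ._+ ω) (trans (fromℕℚ-* (suc t) F) (cong (T ℚ.*_) (sym eq))))) (fromℕℚ-mono-≤ h)))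
        (solve 3 (λ x T ω → (con 1ℚ :- x) :* ω :* T :+ ((T :* (x :* ω) :+ ω) :- T :* ω) := ω) refl x T ω))
      (ℚ.≤-reflexive (trans (sym (ℚ.*-identityˡ ω)) (trans (cong (ℚ._* ω) (sym (1/suc-* t))) (solve 3 (λ i T ω → i :* T :* ω := i :* ω :* T) refl (1/suc t) T ω)))))))
  where
  ω = fromℕℚ Ω
  T = fromℕℚ (suc t)
  0<Ω : 0ℚ ℚ.< ω
  0<Ω = 0<fromℕℚ Ω

module Densities (k′ e t d n : ℕ) .{{_ : NonZero e}} (large : Constants.threshold (suc k′) e (suc t) ≤ d)
  (r≤n : suc (suc k′) ≤ n) (n≤2^d : n ≤ 2 ^ d)
  (v : Fin (2 ^ d) → Fin d → ℚ) (v≡bit : ∀ i j → v i j ≡ bitℚ (lookup (bits {d} i) j)) (convex : ConvexPosition v)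
  (face? : ∀ W T → Dec (KFace {d} v (suc k′) W T))
  (faceNumber≡ : ∀ W → faceNumber {d} (suc k′) W ≡ count (face? W) (subsets (2 ^ d))) where

  private
    k = suc k′
    m = n ∸ suc k
    M = 2 ^ d ∸ suc k
    n≡ : suc k + m ≡ n
    n≡ = m+[n∸m]≡n r≤n
    2^d≡ : 2 ^ d ≡ suc k + M
    2^d≡ = sym (m+[n∸m]≡n (≤-trans r≤n n≤2^d))
    F : ℕ → ℕ
    F n = ∑ (filter (λ W → card W ≟ n) (subsets (2 ^ d))) (faceNumber {d} k)
    Ω : ℕ → ℕ
    Ω n = ((2 ^ d) C n) * (n C suc k)
    x = expectedFaceDensity d n k

    Ω≢0 : NonZero (Ω n)
    Ω≢0 = m*n≢0 ((2 ^ d) C n) (n C suc k) {{C-positive n≤2^d}} {{C-positive r≤n}}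

    bounds = quotient-bounds {x} (F n) (Ω n) t {{Ω≢0}} (expected-* {d} k n (C-positive r≤n) n≤2^d)

    open Constants k e
    open Large (suc t) d large
    module FD = FixedDimension {d} v v≡bit convex k (N d) {{N≢0}}
    module B = Bounds k e (suc t) d large v v≡bit convex

    F≡ : F (suc k + m) ≡ ∑ (FD.Ws face? m M 2^d≡) (λ W → count (face? W) (subsets (2 ^ d)))
    F≡ = ∑-cong (FD.Ws face? m M 2^d≡) faceNumber≡

    Ω≡ : Ω (suc k + m) ≡ ((2 ^ d) C suc k) * (M C m)
    Ω≡ = FD.pairs face? m M 2^d≡

  0≤x : 0ℚ ℚ.≤ x
  0≤x = proj₁ bounds

  x≤1 : x ℚ.≤ 1ℚ
  x≤1 = proj₁ (proj₂ bounds) (subst (λ n → F n ≤ Ω n) n≡ (≤-trans (≤-reflexive F≡) (FD.∑-kfaces≤C face? m M 2^d≡)))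

  x-large : n ^ E * r ^ (E * d) * 2 ^ d ≤ 2 ^ E * 2 ^ (E * d) * Λ ^ (e * d) → 1ℚ - x ℚ.≤ 1/suc t
  x-large key = proj₂ (proj₂ (proj₂ bounds)) (subst (λ n → suc t * Ω n ≤ suc t * F n + Ω n) n≡
    (subst₂ (λ f ω → suc t * ω ≤ suc t * f + ω) (sym F≡) (sym Ω≡)
      (B.low face? m M 2^d≡ (≤-trans (≤-reflexive n≡) n≤2^d) (subst (λ n → n ^ E * r ^ (E * d) * 2 ^ d ≤ 2 ^ E * 2 ^ (E * d) * Λ ^ (e * d)) (sym n≡) key))))

  x-small : 2 ^ (E * d) * Λ ^ (e * d) * 2 ^ d ≤ (2 * n) ^ E * r ^ (E * d) → x ℚ.≤ 1/suc t
  x-small key = proj₁ (proj₂ (proj₂ bounds)) (subst (λ n → suc t * F n ≤ Ω n) n≡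
    (subst₂ (λ f ω → suc t * f ≤ ω) (sym F≡) (sym Ω≡)
      (B.high face? m M 2^d≡ (≤-trans (≤-reflexive n≡) n≤2^d) (subst (λ n → 2 ^ (E * d) * Λ ^ (e * d) * 2 ^ d ≤ (2 * n) ^ E * r ^ (E * d)) (sym n≡) key))))

kFace? : ∀ d k W T → Dec (KFace {d} (cubeℚ d) k W T)
kFace? d k W T = isKFace? {d} k W T

faceNumber-count : ∀ d k W → faceNumber {d} k W ≡ count (kFace? d k W) (subsets (2 ^ d))
faceNumber-count d k W = length-filter-count (isKFace? {d} k W) (subsets (2 ^ d))

module _ (k′ e t d n : ℕ) .{{_ : NonZero e}} (large : Constants.threshold (suc k′) e (suc t) ≤ d)
  (r≤n : suc (suc k′) ≤ n) (n≤2^d : n ≤ 2 ^ d) where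

  private
    open Constants (suc k′) e
    module Cubes = Densities k′ e t d n large r≤n n≤2^d (cubeℚ d) (cubeℚ-bits d) (cube-convexPosition d)
      (kFace? d (suc k′)) (faceNumber-count d (suc k′))

  nearly-all-faces : n ^ E * r ^ (E * d) * 2 ^ d ≤ 2 ^ E * 2 ^ (E * d) * Λ ^ (e * d) → ℚ.∣ 1ℚ - expectedFaceDensity d n (suc k′) ∣ ℚ.≤ 1/suc t
  nearly-all-faces key = ∣-∣≤ (Cubes.x-large key) (ℚ.≤-trans
    (≤-by (≤⇒0≤- Cubes.x≤1) (solve 1 (λ x → :- (con 1ℚ :- x) :+ (con 1ℚ :- x) := con 0ℚ) refl (expectedFaceDensity d n (suc k′))))
    (ℚ.<⇒≤ (0<1/suc t)))

  nearly-no-faces : 2 ^ (E * d) * Λ ^ (e * d) * 2 ^ d ≤ (2 * n) ^ E * r ^ (E * d) → ℚ.∣ expectedFaceDensity d n (suc k′) ∣ ℚ.≤ 1/suc t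
  nearly-no-faces key = ∣-∣≤ (Cubes.x-small key) (ℚ.≤-trans (≤-by Cubes.0≤x (ℚ.+-inverseˡ (expectedFaceDensity d n (suc k′)))) (ℚ.<⇒≤ (0<1/suc t)))

theorem2 : (k : ℕ) .{{_ : NonZero k}} →
    (ε : ℝ) → 0ℝ <ℝ ε →
    (n : ℕ → ℕ) →
    (∀ d → 1 ≤ n d × n d ≤ 2 ^ d) →
    (∃ λ D → ∀ d → D ≤ d → suc k ≤ n d) →
    ((∀ d → fromℕ (n d) ≤ℝ 2^ℝ ((τ k -ℝ ε) *ℝ fromℕ d)) →
    TendsToZero (λ d → 1ℚ - expectedFaceDensity d (n d) k)) ×
    ((∀ d → 2^ℝ ((τ k +ℝ ε) *ℝ fromℕ d) ≤ℝ fromℕ (n d)) →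
    TendsToZero (λ d → expectedFaceDensity d (n d) k))
theorem2 k@(suc k′) ε 0<ε n n-range (D , r≤n) = below , above
  where
  open Columns k using (Λ)
  below : (∀ d → fromℕ (n d) ≤ℝ 2^ℝ ((τ k -ℝ ε) *ℝ fromℕ d)) → TendsToZero (λ d → 1ℚ - expectedFaceDensity d (n d) k)
  below n≤ δ 0<δ = D ⊔ Constants.threshold k e {{e≢0}} (suc t) , λ d D≤d → ℚ.≤-trans
      (nearly-all-faces k′ e t d (n d) {{e≢0}} (m⊔n≤o⇒n≤o D _ D≤d) (r≤n d (m⊔n≤o⇒m≤o D _ D≤d)) (proj₂ (n-range d))
        (key d (n d) (proj₁ (n-range d)) (n≤ d)))
      (proj₂ (archimedean δ 0<δ) t ≤-refl)
    where
    exponent = Entropies.subcritical k′ Λ (Λ^r k′) (r^rR k′) ε 0<ε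
    e = proj₁ exponent
    e≢0 = proj₁ (proj₂ exponent)
    key = proj₂ (proj₂ exponent)
    t = proj₁ (archimedean δ 0<δ)
  above : (∀ d → 2^ℝ ((τ k +ℝ ε) *ℝ fromℕ d) ≤ℝ fromℕ (n d)) → TendsToZero (λ d → expectedFaceDensity d (n d) k)
  above ≤n δ 0<δ = D ⊔ Constants.threshold k e {{e≢0}} (suc t) , λ d D≤d → ℚ.≤-trans
      (nearly-no-faces k′ e t d (n d) {{e≢0}} (m⊔n≤o⇒n≤o D _ D≤d) (r≤n d (m⊔n≤o⇒m≤o D _ D≤d)) (proj₂ (n-range d))
        (key d (n d) (proj₁ (n-range d)) (≤n d)))
      (proj₂ (archimedean δ 0<δ) t ≤-refl)
    where
    exponent = Entropies.supercritical k′ Λ (Λ^r k′) (r^rR k′) ε 0<ε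
    e = proj₁ exponent
    e≢0 = proj₁ (proj₂ exponent)
    key = proj₂ (proj₂ exponent)
    t = proj₁ (archimedean δ 0<δ)
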